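{- Let $X$ be a finite nonempty set and let $\mathcal T$ and $\mathcal T'$ be phylogenetic trees on $X$. Then $$d_{TBR}(\mathcal T,\mathcal T') = \min\{ w(\sigma) \,:\, \sigma \text{ is a cherry picking sequence for } \mathcal T \text{ and } \mathcal T'\}.$$
   Context: All graphs are finite multigraphs without loops. A leaf is a vertex of degree at most one. Suppressing a degree-two vertex $v$ with incident edges $\{u,v\},\{v,w\}$, $u\neq w$, means deleting $v$ and these edges and adding $\{u,w\}$. A phylogenetic tree on a finite nonempty set $X$ is a tree whose set of leaves is exactly $X$ and in which every non-leaf vertex has degree three (for $X=\{x\}$ the single vertex $x$). A forest on $X$ is a set of phylogenetic trees whose leaf sets are pairwise disjoint with union $X$; a tree is identified with the one-element forest containing it. $d_{TBR}(\mathcal T,\mathcal T')$ is the tree bisection and reconnection distance: the minimum number of TBR moves needed to transform $\mathcal T$ into $\mathcal T'$, where a TBR move deletes an edge of the tree, suppresses resulting degree-two vertices to obtain two phylogenetic trees, and reconnects them by a new edge joining a point of one tree to a point of the other (a point being a new vertex subdividing an edge, or the vertex itself if that tree is a single vertex). Forest notions: a cherry of a phylogenetic tree $\mathcal T$ is a pair $(x,y)$ of distinct leaves such that either $\mathcal T$ is the single edge $\{x,y\}$ or $x,y$ are adjacent to a common vertex; a cherry of a forest is a cherry of one of its trees. For a leaf $x$, $e_x$ denotes the edge containing $x$. A phylogenetic tree $\mathcal S$ is a proper pendant subtree of a tree $\mathcal T$ if there is a cut-edge $e$ of $\mathcal T$ such that $\mathcal S$ equals one of the two components obtained by deleting $e$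 and suppressing degree-two vertices; this edge is denoted $e_{\mathcal S}$ (for $\mathcal S$ a single leaf $p$, $e_{\mathcal S}=e_p$). $((x,y),p)$ denotes a proper pendant subtree with leaf set $\{x,y,p\}$ in which $(x,y)$ is a cherry, and $((x,y),(p,q))$ one with leaf set $\{x,y,p,q\}$ in which $(x,y)$ and $(p,q)$ are cherries; $(p,q)$ also denotes the two-leaf pendant subtree on $\{p,q\}$. For an edge $e$ of a tree $\mathcal T_e$ in a forest $\mathcal F$, $\mathcal F-e$ is obtained by replacing $\mathcal T_e$ by the trees obtained from $\mathcal T_e$ by deleting $e$ and suppressing degree-two vertices. For $x\in X$, $|X|\ge2$, with $\mathcal T_x$ the tree containing $x$, $\mathcal F-x$ removes $\mathcal T_x$ if it is the single vertex $x$ and otherwise replaces $\mathcal T_x$ by the tree obtained by deleting $x$ and $e_x$ and suppressing the resulting degree-two vertex. Cherry picking sequence: for forests $\mathcal F,\mathcal F'$ on $X$, a sequence $\sigma=(x_1,\dots,x_m)$ of elements of $X$, $m\ge|X|\ge1$, is a cherry picking sequence for $\mathcal F$ and $\mathcal F'$ if there are forests $\mathcal F[i],\mathcal F'[i]$, $1\le i\le m$, with $\mathcal F[1]=\mathcal F$, $\mathcal F'[1]=\mathcal F'$, $\mathcal F[m]=\mathcal F'[m]=\{x_m\}$, and for each $1\le i\le m-1$ precisely one of: (C1) $(x_i,y)$ is a cherry in both $\mathcal F[i]$ and $\mathcal F'[i]$ for some $y$, and $\mathcal F[i+1]=\mathcal F[i]-x_i$, $\mathcal F'[i+1]=\mathcal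 F'[i]-x_i$; (C2) $(x_i,y)$ is a cherry in $\mathcal F[i]$ for some $y$ and one of: (a) $(x_i,z)$ is a cherry in $\mathcal F'[i]$ with $z\ne y$, $\mathcal F'[i+1]=\mathcal F'[i]$, and either (i) $\mathcal F[i+1]$ is $\mathcal F[i]-e_{x_i}$ or $\mathcal F[i]-e_y$, or (ii) $((x_i,y),p)$ is a proper pendant subtree of a tree in $\mathcal F[i]$, $p\in X$, and $\mathcal F[i+1]=\mathcal F[i]-e_{\mathcal S}$ for some $\mathcal S\in\{p,((x_i,y),p)\}$, or (iii) $((x_i,y),(p,q))$ is a proper pendant subtree of a tree in $\mathcal F[i]$, $p\ne q\in X$, and $\mathcal F[i+1]=\mathcal F[i]-e_{\mathcal S}$ for some $\mathcal S\in\{p,q,(p,q)\}$; (b) $x_i,y$ are leaves of one tree $\mathcal T'\in\mathcal F'[i]$, neither in a cherry of $\mathcal T'$, and either (i) $\mathcal F'[i+1]=\mathcal F'[i]$ and $\mathcal F[i+1]$ is $\mathcal F[i]-e_{x_i}$ or $\mathcal F[i]-e_y$, or (ii) for $e$ the edge of $\mathcal T'$ containing the vertex adjacent to $x_i$ and not on the path between $x_i$ and $y$, $\mathcal F'[i+1]=\mathcal F'[i]-e$ and $\mathcal F[i+1]=\mathcal F[i]$; (c) $x_i,y$ lie in different trees of $\mathcal F'[i]$, neither is an isolated vertex or in a cherry of $\mathcal F'[i]$, $\mathcal F'[i+1]=\mathcal F'[i]$, and $\mathcal F[i+1]$ is $\mathcal F[i]-e_{x_i}$ or $\mathcal F[i]-e_y$;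 or the same with the roles of $\mathcal F$ and $\mathcal F'$ reversed; (C3) $x_i$ is a single-vertex component of $\mathcal F[i]$, $\mathcal F[i+1]=\mathcal F[i]-x_i$ and $\mathcal F'[i+1]=\mathcal F'[i]-x_i$, or the same with the roles of $\mathcal F$ and $\mathcal F'$ reversed. Weight: if $m\ge2$, $c(x_i)=0$ if (C1) or (C3) applies at step $i$ and $c(x_i)=1$ otherwise, and $w(\sigma)=\sum_{i=1}^{m-1}c(x_i)$; if $m=1$, $w(\sigma)=0$. -}

module Defs where

open import Data.Nat using (ℕ; zero; suc; _+_; _≤_)
open import Data.List using (List; []; _∷_; _++_; map; length)
open import Data.List.Membership.Propositional using (_∈_; _∉_)
open import Data.List.Relation.Unary.All using (All)
open import Data.List.Relation.Unary.Unique.Propositional using (Unique)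
open import Data.List.Relation.Binary.Permutation.Propositional using (_↭_)
open import Data.List.Relation.Binary.Pointwise using (Pointwise)
open import Data.Product using (Σ; ∃; _×_; _,_; proj₁; proj₂; swap)
open import Data.Sum using (_⊎_; inj₁; inj₂)
open import Relation.Nullary using (¬_)
open import Relation.Binary.PropositionalEquality using (_≡_; _≢_)
open import Relation.Binary.Construct.Closure.ReflexiveTransitive using (Star)

-- Finite multigraphs without loops, with labelled vertices.
-- A vertex is either an element  inj₁ a  of the label set (these are the
-- elements of X that are vertices of the graph) or an unlabelled vertex
-- inj₂ n.  Edges form a list (so parallel edges are allowed); an edge is
-- an ordered pair read as an unordered pair.
-- A *forest* (set of trees with disjoint leaf sets) is represented as the
-- single graph that is the disjoint union of its trees; its trees are the
-- connected components.

Vx : Set → Set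
Vx A = A ⊎ ℕ

Edge : Set → Set
Edge A = Vx A × Vx A

record Graph (A : Set) : Set where
  constructor mkG
  field
    verts : List (Vx A)
    edges : List (Edge A)
open Graph public

module _ {A : Set} where

  Inc : Vx A → Edge A → Set
  Inc v e = proj₁ e ≡ v ⊎ proj₂ e ≡ v

  Joins : Edge A → Vx A → Vx A → Set
  Joins e u v = e ≡ (u , v) ⊎ e ≡ (v , u)

  WF : Graph A → Set
  WF G = Unique (verts G)
       × All (λ e → proj₁ e ∈ verts G × proj₂ e ∈ verts G × proj₁ e ≢ proj₂ e) (edges G)

  Deg : Graph A → Vx A → ℕ → Set
  Deg G v n = Σ (List (Edge A)) λ I → Σ (List (Edge A)) λ R →
      (edges G ↭ (I ++ R)) × length I ≡ n × All (Inc v) I × All (λ e → ¬ Inc v e) R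

  Adj : Graph A → Vx A → Vx A → Set
  Adj G u v = Σ (Edge A) λ e → e ∈ edges G × Joins e u v

  Conn : Graph A → Vx A → Vx A → Set
  Conn G u v = u ∈ verts G × Star (Adj G) u v

  Acyclic : Graph A → Set
  Acyclic G = ∀ E₁ e E₂ → edges G ≡ E₁ ++ e ∷ E₂ →
    ¬ Star (Adj (mkG (verts G) (E₁ ++ E₂))) (proj₁ e) (proj₂ e)

  IsLeaf : Graph A → Vx A → Set
  IsLeaf G v = Deg G v 0 ⊎ Deg G v 1

  Labelled : Vx A → Set
  Labelled v = Σ A λ a → v ≡ inj₁ a

  PhyloForest : Graph A → Set
  PhyloForest G = WF G × Acyclic G ×
    (∀ v → v ∈ verts G →
       (IsLeaf G v → Labelled v) × (Labelled v → IsLeaf G v) × (¬ IsLeaf G v → Deg G v 3))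

  ForestOn : List A → Graph A → Set
  ForestOn X G = PhyloForest G × (∀ a → (inj₁ a ∈ verts G → a ∈ X) × (a ∈ X → inj₁ a ∈ verts G))

  PhyloTreeOn : List A → Graph A → Set
  PhyloTreeOn X G = ForestOn X G × (∀ u v → u ∈ verts G → v ∈ verts G → Conn G u v)

  SameE : Edge A → Edge A → Set
  SameE e e' = e ≡ e' ⊎ e ≡ swap e'

  EdgesEq : List (Edge A) → List (Edge A) → Set
  EdgesEq E E' = Σ (List (Edge A)) λ E'' → Pointwise SameE E E'' × (E'' ↭ E')

  Iso : Graph A → Graph A → Set
  Iso G H = Σ (Vx A → Vx A) λ f →
      (∀ a → f (inj₁ a) ≡ inj₁ a) × Unique (verts H) × (map f (verts G) ↭ verts H)
    × EdgesEq (map (λ e → f (proj₁ e) , f (proj₂ e)) (edges G)) (edges H)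

  Supp : Graph A → Vx A → Graph A → Set
  Supp G v H = Σ (List (Vx A)) λ V₁ → Σ (List (Vx A)) λ V₂ →
    Σ (Vx A) λ u → Σ (Vx A) λ w → Σ (Edge A) λ a → Σ (Edge A) λ b → Σ (List (Edge A)) λ R →
      verts G ≡ V₁ ++ v ∷ V₂ × (edges G ↭ (a ∷ b ∷ R)) × Joins a u v × Joins b v w
    × All (λ e → ¬ Inc v e) R × u ≢ w × H ≡ mkG (V₁ ++ V₂) ((u , w) ∷ R)

  SuppSet : List (Vx A) → Graph A → Graph A → Set
  SuppSet S G H = Star (λ G₁ G₂ → Σ (Vx A) λ v → v ∈ S × Supp G₁ v G₂) G H
                × (∀ v → v ∈ S → v ∈ verts H → ¬ Deg H v 2)

  Cut : Graph A → List (Edge A) → Edge A → List (Edge A) → Graph A → Set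
  Cut G E₁ e E₂ K = (edges G ≡ E₁ ++ e ∷ E₂)
    × SuppSet (proj₁ e ∷ proj₂ e ∷ []) (mkG (verts G) (E₁ ++ E₂)) K

  EdgeProp : Set₁
  EdgeProp = List (Edge A) → Edge A → List (Edge A) → Graph A → Set

  MinusEdge : Graph A → EdgeProp → Graph A → Set
  MinusEdge G P H = Σ (List (Edge A)) λ E₁ → Σ (Edge A) λ e → Σ (List (Edge A)) λ E₂ →
    Σ (Graph A) λ K → Cut G E₁ e E₂ K × P E₁ e E₂ K × Iso K H

  IsEdgeOf : A → EdgeProp
  IsEdgeOf x _ e _ _ = Inc (inj₁ x) e

  RemoveV : Graph A → Vx A → Graph A → Set
  RemoveV G v K = Σ (List (Vx A)) λ V₁ → Σ (List (Vx A)) λ V₂ →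
    verts G ≡ V₁ ++ v ∷ V₂ × K ≡ mkG (V₁ ++ V₂) (edges G)

  MinusLeaf : Graph A → A → Graph A → Set
  MinusLeaf G x H =
      (Deg G (inj₁ x) 0 × Σ (Graph A) λ K → RemoveV G (inj₁ x) K × Iso K H)
    ⊎ (Σ (List (Edge A)) λ E₁ → Σ (Edge A) λ e → Σ (List (Edge A)) λ E₂ → Σ (Vx A) λ u →
       Σ (Graph A) λ K₁ → Σ (Graph A) λ K₂ →
         edges G ≡ E₁ ++ e ∷ E₂ × Joins e (inj₁ x) u
       × RemoveV (mkG (verts G) (E₁ ++ E₂)) (inj₁ x) K₁ × SuppSet (u ∷ []) K₁ K₂ × Iso K₂ H)

  Cherry : Graph A → A → A → Set
  Cherry G x y = x ≢ y × inj₁ x ∈ verts G × inj₁ y ∈ verts G ×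
    ( (Adj G (inj₁ x) (inj₁ y) × (∀ v → Conn G (inj₁ x) v → v ≡ inj₁ x ⊎ v ≡ inj₁ y))
    ⊎ (Σ (Vx A) λ w → Adj G (inj₁ x) w × Adj G (inj₁ y) w))

  InCherry : Graph A → A → Set
  InCherry G x = Σ A λ y → Cherry G x y

  Isolated : Graph A → A → Set
  Isolated G x = inj₁ x ∈ verts G × Deg G (inj₁ x) 0

  -- the cut edge e (in the tree containing r) of a proper pendant subtree
  -- whose leaf set is (the set of elements of) L and which contains r;
  -- K is the result of cutting e
  PendantCut : Graph A → A → List A → EdgeProp
  PendantCut G r L E₁ e E₂ K = Conn G (inj₁ r) (proj₁ e)
    × (∀ a → (Conn K (inj₁ r) (inj₁ a) → a ∈ L) × (a ∈ L → Conn K (inj₁ r) (inj₁ a)))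

  -- e = e_S for S = ((x,y),p)
  Pend3 : Graph A → A → A → A → EdgeProp
  Pend3 G x y p E₁ e E₂ K = PendantCut G x (x ∷ y ∷ p ∷ []) E₁ e E₂ K × Cherry K x y

  -- e = e_S for S = ((x,y),(p,q))
  Pend4 : Graph A → A → A → A → A → EdgeProp
  Pend4 G x y p q E₁ e E₂ K =
    PendantCut G x (x ∷ y ∷ p ∷ q ∷ []) E₁ e E₂ K × Cherry K x y × Cherry K p q

  -- e = e_S for S = (p,q)
  Pend2 : Graph A → A → A → EdgeProp
  Pend2 G p q E₁ e E₂ K = PendantCut G p (p ∷ q ∷ []) E₁ e E₂ K × Cherry K p q

  HasPendant : Graph A → EdgeProp → Set
  HasPendant G P = Σ (List (Edge A)) λ E₁ → Σ (Edge A) λ e → Σ (List (Edge A)) λ E₂ →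
    Σ (Graph A) λ K → Cut G E₁ e E₂ K × P E₁ e E₂ K

  data Walk (G : Graph A) : Vx A → Vx A → List (Vx A) → Set where
    stop : ∀ {u} → u ∈ verts G → Walk G u u (u ∷ [])
    next : ∀ {u w v ps} → Adj G u w → Walk G w v ps → Walk G u v (u ∷ ps)

  data Consec (a b : Vx A) : List (Vx A) → Set where
    here  : ∀ {ps} → Consec a b (a ∷ b ∷ ps)
    there : ∀ {c ps} → Consec a b ps → Consec a b (c ∷ ps)

  OffPath : Graph A → Vx A → Vx A → Edge A → Set
  OffPath G u v e = Σ (List (Vx A)) λ ps → Walk G u v ps × Unique ps ×
    ¬ (Σ (Vx A) λ a → Σ (Vx A) λ b → Consec a b ps × Joins e a b)

  ThirdEdge : Graph A → A → A → EdgeProp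
  ThirdEdge G x y _ e _ _ = Σ (Vx A) λ w → Adj G (inj₁ x) w × Inc w e
    × OffPath G (inj₁ x) (inj₁ y) e

  C1 : Graph A → Graph A → A → Graph A → Graph A → Set
  C1 F F' x F₂ F₂' = Σ A λ y → Cherry F x y × Cherry F' x y
    × MinusLeaf F x F₂ × MinusLeaf F' x F₂'

  C3 : Graph A → Graph A → A → Graph A → Graph A → Set
  C3 F F' x F₂ F₂' = Isolated F x × MinusLeaf F x F₂ × MinusLeaf F' x F₂'

  C2 : Graph A → Graph A → A → Graph A → Graph A → Set
  C2 F F' x F₂ F₂' = Σ A λ y → Cherry F x y ×
    (
      ( (Σ A λ z → Cherry F' x z × z ≢ y) × F₂' ≡ F' ×
        ( MinusEdge F (λ E₁ e E₂ K → IsEdgeOf x E₁ e E₂ K ⊎ IsEdgeOf y E₁ e E₂ K) F₂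
        ⊎ (Σ A λ p → p ≢ x × p ≢ y × HasPendant F (Pend3 F x y p) ×
             (MinusEdge F (IsEdgeOf p) F₂ ⊎ MinusEdge F (Pend3 F x y p) F₂))
        ⊎ (Σ A λ p → Σ A λ q → p ≢ q × p ≢ x × p ≢ y × q ≢ x × q ≢ y
             × HasPendant F (Pend4 F x y p q) ×
             (MinusEdge F (IsEdgeOf p) F₂ ⊎ MinusEdge F (IsEdgeOf q) F₂
               ⊎ MinusEdge F (Pend2 F p q) F₂))))
    ⊎
      ( Conn F' (inj₁ x) (inj₁ y) × ¬ InCherry F' x × ¬ InCherry F' y ×
        ( (F₂' ≡ F' × MinusEdge F (λ E₁ e E₂ K → IsEdgeOf x E₁ e E₂ K ⊎ IsEdgeOf y E₁ e E₂ K) F₂)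
        ⊎ (F₂ ≡ F × MinusEdge F' (ThirdEdge F' x y) F₂')))
    ⊎
      ( inj₁ x ∈ verts F' × inj₁ y ∈ verts F' × ¬ Conn F' (inj₁ x) (inj₁ y)
        × ¬ Isolated F' x × ¬ Isolated F' y × ¬ InCherry F' x × ¬ InCherry F' y
        × F₂' ≡ F'
        × MinusEdge F (λ E₁ e E₂ K → IsEdgeOf x E₁ e E₂ K ⊎ IsEdgeOf y E₁ e E₂ K) F₂))

  data Step (F F' : Graph A) (x : A) (F₂ F₂' : Graph A) : ℕ → Set where
    c1  : C1 F F' x F₂ F₂' → Step F F' x F₂ F₂' 0
    c2  : C2 F F' x F₂ F₂' → Step F F' x F₂ F₂' 1
    c2ʳ : C2 F' F x F₂' F₂ → Step F F' x F₂ F₂' 1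
    c3  : C3 F F' x F₂ F₂' → Step F F' x F₂ F₂' 0
    c3ʳ : C3 F' F x F₂' F₂ → Step F F' x F₂ F₂' 0

  single : A → Graph A
  single x = mkG (inj₁ x ∷ []) []

  data CPS : Graph A → Graph A → List A → ℕ → Set where
    last : ∀ x → CPS (single x) (single x) (x ∷ []) 0
    step : ∀ {F F' F₂ F₂' x σ c w} → PhyloForest F → PhyloForest F' →
           Step F F' x F₂ F₂' c → CPS F₂ F₂' σ w → CPS F F' (x ∷ σ) (c + w)

  CherryPickingSeq : List A → Graph A → Graph A → List A → ℕ → Set
  CherryPickingSeq X T T' σ w = CPS T T' σ w × length X ≤ length σ

  -- TBR
  -- a point of the tree containing p: the vertex itself if it is a single
  -- vertex, otherwise a new vertex subdividing an edge
  Point : Graph A → Vx A → Graph A → Set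
  Point G p G₁ = (p ∈ verts G × Deg G p 0 × G₁ ≡ G)
    ⊎ (Σ ℕ λ n → Σ (List (Edge A)) λ E₁ → Σ (Edge A) λ e → Σ (List (Edge A)) λ E₂ →
        inj₂ n ∉ verts G × edges G ≡ E₁ ++ e ∷ E₂ × p ≡ inj₂ n
      × G₁ ≡ mkG (p ∷ verts G) ((proj₁ e , p) ∷ (p , proj₂ e) ∷ E₁ ++ E₂))

  TBRMove : Graph A → Graph A → Set
  TBRMove T H = Σ (List (Edge A)) λ E₁ → Σ (Edge A) λ e → Σ (List (Edge A)) λ E₂ →
    Σ (Graph A) λ K → Σ (Vx A) λ p → Σ (Vx A) λ q → Σ (Graph A) λ K₁ → Σ (Graph A) λ K₂ →
      Cut T E₁ e E₂ K × Point K p K₁ × Point K₁ q K₂ × ¬ Conn K₂ p q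
    × H ≡ mkG (verts K₂) ((p , q) ∷ edges K₂)

  data TBRSeq : Graph A → Graph A → ℕ → Set where
    done : ∀ {T T'} → Iso T T' → TBRSeq T T' 0
    move : ∀ {T H T' k} → TBRMove T H → TBRSeq H T' k → TBRSeq T T' (suc k)

  IsTBRDist : Graph A → Graph A → ℕ → Set
  IsTBRDist T T' d = TBRSeq T T' d × (∀ k → TBRSeq T T' k → d ≤ k)

  IsMinCPSWeight : List A → Graph A → Graph A → ℕ → Set
  IsMinCPSWeight X T T' d = (Σ (List A) λ σ → CherryPickingSeq X T T' σ d)
    × (∀ σ w → CherryPickingSeq X T T' σ w → d ≤ w)

{-# OPTIONS --safe #-}
module Submission where

-- An agreement forest of two forests on X is a partition of X whose blocks span disjoint subtrees of either
-- forest and induce the same tree, i.e. the same quartets, in both. Both sides of the equality are one less than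
-- the least number of blocks of an agreement forest of T and T'.
--
-- Distance ≤ blocks − 1: cut T into its blocks and reattach them one at a time in the positions they have in T';
-- every reattachment is one move. Blocks − 1 ≤ distance: undoing a move cuts the edge it inserted, and at most
-- one block uses that edge, so splitting this block suffices.
--
-- Blocks − 1 ≤ weight: read a cherry picking sequence backwards. A step (C3) creates one new block, a step (C1)
-- enlarges a block, and a step of weight one merges two trees of F or of F'. The number of blocks stays at most
-- the weight plus the length of a list of leaves each of which is separated, in F or in F', from all later ones;
-- a (C3) step extends this list, a merger loses at most one entry, and for two trees only one entry is left.
--
-- Weight ≤ blocks − 1: keep F a single tree and branch at a cherry (x,y) of F of maximal depth. Whatever the
-- agreement forest, it has a singleton block at a leaf that some case of (C2) allows to cut off (which is
-- then removed by (C3)), or a block {x,y,z} or {p,q} which some case allows to cut off as a pendant subtree, or it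
-- does not use an edge of F' which case (b)(ii) allows to cut.

open import Defs
open import Data.Empty using (⊥; ⊥-elim)
import Data.Fin as Fin
import Data.Fin.Properties as Fin
open import Data.List using (List; []; _∷_; _++_; map; length; lookup; allFin)
import Data.List.Properties as List
open import Data.List.Membership.Propositional using (_∈_; _∉_; find; lose)
open import Data.List.Membership.Propositional.Properties using (∈-++⁺ˡ; ∈-++⁺ʳ; ∈-++⁻; ∈-∃++; ∈-map⁺; ∈-map⁻; ∈-allFin; ∈-lookup)
open import Data.List.Relation.Binary.Pointwise using (Pointwise; []; _∷_)
import Data.List.Relation.Binary.Pointwise as Pointwise
import Data.List.Relation.Binary.Permutation.Homogeneous as Homogeneous
open import Data.List.Relation.Binary.Permutation.Propositional using (_↭_; ↭-refl; ↭-sym; ↭-trans; ↭-reflexive; ↭⇒↭ₛ; prep; swap; refl; trans)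
open import Data.List.Relation.Binary.Permutation.Propositional.Properties using (∈-resp-↭; Any-resp-↭; All-resp-↭; ++⁺ˡ; ++⁺ʳ; ++⁺; ++-comm; ↭-length; shifts; shift; drop-∷; ++-commutativeMonoid; ↭-singleton-inv; ↭-empty-inv; map⁺)
import Data.List.Relation.Binary.Permutation.Setoid as SetoidPermutation
import Data.List.Relation.Binary.Permutation.Setoid.Properties as SetoidPermutationProperties
open import Data.List.Relation.Unary.All as All using (All; []; _∷_)
import Data.List.Relation.Unary.All.Properties as All
open import Data.List.Relation.Unary.AllPairs using ([]; _∷_)
open import Data.List.Relation.Unary.Any using (Any; here; there; any?)
import Data.List.Relation.Unary.Any as Any
open import Data.List.Relation.Unary.Any.Properties using (lookup-index)
open import Data.List.Relation.Unary.Unique.Propositional using (Unique)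
import Data.List.Relation.Unary.Unique.Propositional.Properties as Unique
open import Data.Nat using (ℕ; zero; suc; _+_; _≤_; z≤n; s≤s; s≤s⁻¹)
import Data.Nat as ℕ
open import Data.Nat.ListAction using (sum)
open import Data.Nat.Properties using (+-suc; +-assoc; +-comm; +-identityʳ; +-mono-≤; +-monoʳ-≤; +-monoˡ-≤; suc-injective; ≤-refl; ≤-trans; ≤-reflexive; ≤-antisym; ≤-total; n≤1+n; m≤m+n; m≤n+m; n≮n)
open import Data.Product using (Σ; ∃; _×_; _,_; proj₁; proj₂)
import Data.Product as Product
open import Data.Sum using (_⊎_; inj₁; inj₂)
import Data.Sum as Sum
open import Data.Sum.Properties using (inj₁-injective)
open import Data.Unit using (⊤; tt)
open import Function using (_∘_; id; case_of_)
open import Relation.Binary.Bundles using (Setoid)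
open import Relation.Binary.Construct.Closure.ReflexiveTransitive using (Star; ε; _◅_; _◅◅_)
open import Relation.Binary.Definitions using (DecidableEquality)
open import Relation.Binary.PropositionalEquality using (_≡_; _≢_; refl; cong; cong₂; sym; subst; setoid)
import Relation.Binary.PropositionalEquality as Eq
open import Relation.Nullary using (¬_; Dec; yes; no)
open import Relation.Nullary.Decidable using (_×-dec_; ¬?)
import Algebra.Solver.CommutativeMonoid as MonoidSolver

unique-↭ : {A : Set} {xs ys : List A} → xs ↭ ys → Unique xs → Unique ys
unique-↭ p = SetoidPermutationProperties.Unique-resp-↭ (setoid _) (↭⇒↭ₛ p)

unique-++ʳ : {A : Set} (xs : List A) {ys : List A} → Unique (xs ++ ys) → Unique ys
unique-++ʳ []       u       = u
unique-++ʳ (x ∷ xs) (_ ∷ u) = unique-++ʳ xs u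

unique-++ˡ : {A : Set} (xs : List A) {ys : List A} → Unique (xs ++ ys) → Unique xs
unique-++ˡ xs {ys} u = unique-++ʳ ys (unique-↭ (++-comm xs ys) u)

unique-disjoint : {A : Set} (xs : List A) {ys : List A} {x : A} → Unique (xs ++ ys) → x ∈ xs → x ∈ ys → ⊥
unique-disjoint (x ∷ xs) (q ∷ _) (here refl) j = All.lookup q (∈-++⁺ʳ xs j) refl
unique-disjoint (x ∷ xs) (_ ∷ u) (there i)   j = unique-disjoint xs u i j

unique-head : {A : Set} {x : A} {xs : List A} → Unique (x ∷ xs) → x ∉ xs
unique-head (q ∷ _) j = All.lookup q j refl

∈-↭ : {A : Set} {x : A} {xs : List A} → x ∈ xs → ∃ λ ys → xs ↭ x ∷ ys
∈-↭ i with ∈-∃++ i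
... | ys , zs , refl = ys ++ zs , shift _ ys zs

pick : {A : Set} {u : A} {r : List A} (xs : List A) {ys : List A} → xs ++ ys ↭ u ∷ r →
       (∃ λ xs' → xs ↭ u ∷ xs' × r ↭ xs' ++ ys) ⊎ (∃ λ ys' → ys ↭ u ∷ ys' × r ↭ xs ++ ys')
pick xs {ys} p with ∈-++⁻ xs (∈-resp-↭ (↭-sym p) (here refl))
... | inj₁ i = let xs' , q = ∈-↭ i in
      inj₁ (xs' , q , drop-∷ (↭-trans (↭-sym p) (++⁺ʳ ys q)))
... | inj₂ j = let ys' , q = ∈-↭ j in
      inj₂ (ys' , q , drop-∷ (↭-trans (↭-sym p) (↭-trans (++⁺ˡ xs q) (shift _ xs ys'))))

pointwise-↭ : {A : Set} {R : A → A → Set} {xs ys zs : List A} → xs ↭ ys → Pointwise R ys zs →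
              ∃ λ ws → Pointwise R xs ws × ws ↭ zs
pointwise-↭ refl         q           = _ , q , ↭-refl
pointwise-↭ (prep x p)   (e ∷ q)     = let _ , r , p' = pointwise-↭ p q in _ , e ∷ r , prep _ p'
pointwise-↭ (swap x y p) (e ∷ f ∷ q) = let _ , r , p' = pointwise-↭ p q in _ , f ∷ e ∷ r , swap _ _ p'
pointwise-↭ (trans p p') q           =
  let _ , r , s = pointwise-↭ p' q ; _ , r' , s' = pointwise-↭ p r in _ , r' , ↭-trans s' s

∈-strip : {A : Set} {x y : A} {ys : List A} → x ∈ y ∷ ys → x ≢ y → x ∈ ys
∈-strip (here e)  n = ⊥-elim (n e)
∈-strip (there i) n = i

pointwise-++⁻ : {A : Set} {R : A → A → Set} (xs : List A) {ys zs : List A} → Pointwise R (xs ++ ys) zs →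
  ∃ λ zs₁ → ∃ λ zs₂ → zs ≡ zs₁ ++ zs₂ × Pointwise R xs zs₁ × Pointwise R ys zs₂
pointwise-++⁻ []       p       = [] , _ , refl , [] , p
pointwise-++⁻ (x ∷ xs) (r ∷ p) = let zs₁ , zs₂ , e , q , q' = pointwise-++⁻ xs p in
  _ ∷ zs₁ , zs₂ , Eq.cong (_ ∷_) e , r ∷ q , q'

unique-set : {A : Set} {xs ys : List A} → Unique xs → Unique ys → (∀ {z} → z ∈ xs → z ∈ ys) → (∀ {z} → z ∈ ys → z ∈ xs) → xs ↭ ys
unique-set {xs = []} {[]} u v f g = ↭-refl
unique-set {xs = []} {y ∷ ys} u v f g with () ← g (here refl)
unique-set {xs = x ∷ xs} {ys} u@(_ ∷ u') v f g =
  let zs , p = ∈-↭ (f (here refl)) ; v' = unique-↭ p v in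
  ↭-trans (prep x (unique-set u' (unique-++ʳ (x ∷ []) v')
    (λ i → ∈-strip (∈-resp-↭ p (f (there i))) (λ { refl → unique-head u i }))
    (λ i → ∈-strip (g (∈-resp-↭ (↭-sym p) (there i))) (λ { refl → unique-head v' i })))) (↭-sym p)

module Forests {L : Set} (_≟_ : DecidableEquality L) where

  open import Data.List.Membership.DecPropositional _≟_ using (_∈?_) public

  data Tr : Set where
    lf : L → Tr
    nd : Tr → Tr → Tr

  -- An unrooted binary tree, presented as two rooted trees joined by one of its edges. The steps _⟶_ move to an
  -- adjacent edge or exchange subtrees, so _~_ is isomorphism and T ~ edge s t selects an edge of T.
  data Ut : Set where
    one  : L → Ut
    edge : Tr → Tr → Ut

  unr : Tr → Ut
  unr (lf x)   = one x
  unr (nd a b) = edge a b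

  infix 4 _⟶_ _~_

  data _⟶_ : Ut → Ut → Set where
    rot  : ∀ {a b c} → edge (nd a b) c ⟶ edge a (nd b c)
    swp  : ∀ {s t} → edge s t ⟶ edge t s
    flip : ∀ {a b c} → edge (nd a b) c ⟶ edge (nd b a) c

  _~_ : Ut → Ut → Set
  _~_ = Star _⟶_

  ~rot : ∀ {a b c} → edge (nd a b) c ~ edge a (nd b c)
  ~rot = rot ◅ ε

  ~swp : ∀ {s t} → edge s t ~ edge t s
  ~swp = swp ◅ ε

  ~flip : ∀ {a b c} → edge (nd a b) c ~ edge (nd b a) c
  ~flip = flip ◅ ε

  ~rot⁻ : ∀ {a b c} → edge a (nd b c) ~ edge (nd a b) c
  ~rot⁻ = swp ◅ flip ◅ rot ◅ swp ◅ flip ◅ ε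

  ~sym : ∀ {U V} → U ~ V → V ~ U
  ~sym ε          = ε
  ~sym (rot ◅ p)  = ~sym p ◅◅ ~rot⁻
  ~sym (swp ◅ p)  = ~sym p ◅◅ ~swp
  ~sym (flip ◅ p) = ~sym p ◅◅ ~flip

  ~exch : ∀ {s b r} → edge (nd s b) r ~ edge (nd s r) b
  ~exch = flip ◅ rot ◅ swp ◅ ε

  one-~ : ∀ {x U} → one x ~ U → U ≡ one x
  one-~ ε = refl
  one-~ (() ◅ _)

  lf-unr : ∀ {x} p → one x ~ unr p → p ≡ lf x
  lf-unr (lf y)   q with refl ← one-~ q = refl
  lf-unr (nd _ _) q with () ← one-~ q

  edge≁one : ∀ {a b x} → ¬ (edge a b ~ one x)
  edge≁one q with () ← one-~ (~sym q)

  data InsR (b : Tr) : Tr → Tr → Set where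
    top : ∀ {s} → InsR b s (nd s b)
    inl : ∀ {p p' q} → InsR b p p' → InsR b (nd p q) (nd p' q)
    inr : ∀ {p q q'} → InsR b q q' → InsR b (nd p q) (nd p q')

  data InsE (b : Tr) : Ut → Ut → Set where
    inl : ∀ {s s' t} → InsR b s s' → InsE b (edge s t) (edge s' t)
    inr : ∀ {s t t'} → InsR b t t' → InsE b (edge s t) (edge s t')

  ins-step : ∀ {b U U' V} → U ⟶ V → InsE b U U' → ∃ λ V' → InsE b V V' × U' ~ V'
  ins-step rot  (inl top)     = _ , inr (inr top) , (flip ◅ swp ◅ ε) ◅◅ ~rot⁻ ◅◅ (swp ◅ rot ◅ ε)
  ins-step rot  (inl (inl i)) = _ , inl i , ~rot
  ins-step rot  (inl (inr i)) = _ , inr (inl i) , ~rot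
  ins-step rot  (inr i)       = _ , inr (inr i) , ~rot
  ins-step swp  (inl i)       = _ , inr i , ~swp
  ins-step swp  (inr i)       = _ , inl i , ~swp
  ins-step flip (inl top)     = _ , inl top , (rot ◅ flip ◅ ε) ◅◅ ~rot⁻
  ins-step flip (inl (inl i)) = _ , inl (inr i) , ~flip
  ins-step flip (inl (inr i)) = _ , inl (inl i) , ~flip
  ins-step flip (inr i)       = _ , inr i , ~flip

  ins-~ : ∀ {b U U' V} → U ~ V → InsE b U U' → ∃ λ V' → InsE b V V' × U' ~ V'
  ins-~ ε       i = _ , i , ε
  ins-~ (r ◅ p) i = case ins-step r i of λ { (_ , j , q) →
    case ins-~ p j of λ { (_ , k , q') →
    _ , k , q ◅◅ q' }}

  ins-detach : ∀ {b s s'} → InsR b s s' → ∀ r → ∃ λ c → edge s' r ~ edge c b × unr c ~ edge s r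
  ins-detach top     r = _ , ~exch , ε
  ins-detach (inl i) r = case ins-detach i _ of λ { (c , p , q) →
    c , ~rot ◅◅ p , q ◅◅ ~rot⁻ }
  ins-detach (inr i) r = case ins-detach i _ of λ { (c , p , q) →
    c , ~flip ◅◅ ~rot ◅◅ p , q ◅◅ ~rot⁻ ◅◅ ~flip }

  insE-unr : ∀ {b p q V} → InsE b (edge p q) V → ∃ λ p' → V ≡ unr p' × InsR b (nd p q) p'
  insE-unr (inl i) = _ , refl , inl i
  insE-unr (inr i) = _ , refl , inr i

  insR-unr : ∀ {b p q c'} → InsR b (nd p q) c' → ∃ λ W → InsE b (edge p q) W × W ~ unr c'
  insR-unr top     = _ , inl top , ~exch
  insR-unr (inl i) = _ , inl i , ε
  insR-unr (inr i) = _ , inr i , ε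

  ins-transport : ∀ {b c c'} → InsR b c c' → ∀ p → unr c ~ unr p →
    ∃ λ p' → unr p' ~ unr c' × (∀ t → ∃ λ e → edge p' t ~ edge e b × unr e ~ edge p t)
  ins-transport {c = lf x} top p q with refl ← lf-unr p q = _ , ε , ins-detach top
  ins-transport {c = nd _ _} i (lf x) q = ⊥-elim (edge≁one q)
  ins-transport {c = nd _ _} i (nd p₁ p₂) q
    with W , j , w ← insR-unr i
    with V , k , v ← ins-~ q j
    with p' , refl , l ← insE-unr k = p' , ~sym v ◅◅ w , ins-detach l

  data Decomp : Ut → List Ut → Set where
    done : ∀ {T U} → T ~ U → Decomp T (U ∷ [])
    cut  : ∀ {T s t G G'} → T ~ edge s t → Decomp (unr s) G → Decomp (unr t) G' → Decomp T (G ++ G')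
    perm : ∀ {T G G'} → Decomp T G → G ↭ G' → Decomp T G'

  dec-~ : ∀ {T T' G} → T ~ T' → Decomp T' G → Decomp T G
  dec-~ p (done q)    = done (p ◅◅ q)
  dec-~ p (cut q d e) = cut (p ◅◅ q) d e
  dec-~ p (perm d q)  = perm (dec-~ p d) q

  dec-nonempty : ∀ {T G} → Decomp T G → ∃ λ n → length G ≡ suc n
  dec-nonempty (done _) = _ , refl
  dec-nonempty (cut {G = G} {G'} _ d e) with dec-nonempty d | dec-nonempty e
  ... | m , p | n , q = _ , Eq.trans (List.length-++ G) (Eq.cong₂ _+_ p q)
  dec-nonempty (perm d p) with dec-nonempty d
  ... | n , q = n , Eq.trans (sym (↭-length p)) q

  dec-one : ∀ {T U G} → Decomp T G → G ≡ U ∷ [] → T ~ U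
  dec-one (done p) refl = p
  dec-one (cut {G = G} {G'} _ d e) eq with dec-nonempty d | dec-nonempty e
  ... | m , p | n , q with () ← Eq.trans (sym (+-suc m n)) (suc-injective (Eq.trans (sym (Eq.cong₂ _+_ p q)) (Eq.trans (sym (List.length-++ G)) (cong length eq))))
  dec-one (perm d p) refl with refl ← ↭-singleton-inv p = dec-one d refl

  dec-pointwise : ∀ {T G G'} → Decomp T G → Pointwise _~_ G G' → Decomp T G'
  dec-pointwise (done p)    (q ∷ []) = done (p ◅◅ q)
  dec-pointwise (cut {G = G} p d e) q with H₁ , H₂ , refl , q₁ , q₂ ← pointwise-++⁻ G q =
    cut p (dec-pointwise d q₁) (dec-pointwise e q₂)
  dec-pointwise (perm d p)  q = case pointwise-↭ p q of λ { (_ , q' , p') →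
    perm (dec-pointwise d q') p' }

  dec-attach : ∀ {P G U R} s → Decomp P G → G ↭ U ∷ R → U ~ unr s →
    ∃ λ s̄ → unr s̄ ~ P × (∀ t → Decomp (edge s̄ t) (edge s t ∷ R))
  dec-attach-cut : ∀ {s' t' G G' R₁ U R} s → Decomp (unr s') G → Decomp (unr t') G' → G ↭ U ∷ R₁ → R ↭ R₁ ++ G' →
    U ~ unr s → ∃ λ s̄ → unr s̄ ~ edge s' t' × (∀ t → Decomp (edge s̄ t) (edge s t ∷ R))
  dec-attach s (done p) q r with refl ← ↭-singleton-inv (↭-sym q) = s , ~sym (p ◅◅ r) , λ t → done ε
  dec-attach s (perm d p) q r = dec-attach s d (↭-trans p q) r
  dec-attach s (cut {G = G} p d e) q r with pick G q
  ... | inj₁ (_ , g , h) = case dec-attach-cut s d e g h r of λ { (s̄ , a , b) →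
    s̄ , a ◅◅ ~sym p , b }
  ... | inj₂ (_ , g , h) = case dec-attach-cut s e d g (↭-trans h (++-comm G _)) r of λ { (s̄ , a , b) →
    s̄ , a ◅◅ ~swp ◅◅ ~sym p , b }
  dec-attach-cut {G' = G'} {R₁} s d e g h r =
    case dec-attach s d g r of λ { (s₁ , a , f) →
    case ins-transport top s₁ (~sym a) of λ { (p' , a' , f') →
    p' , a' , λ t → case f' t of λ { (c , u , v) →
      perm (cut u (dec-~ v (f t)) e) (prep _ (↭-sym h)) }}}

  TBR₁ : Ut → Ut → Set
  TBR₁ T H = ∃ λ a → ∃ λ b → ∃ λ p → ∃ λ q → T ~ edge a b × unr a ~ unr p × unr b ~ unr q × H ~ edge p q

  tbr-~ : ∀ {T T' H} → T ~ T' → TBR₁ T' H → TBR₁ T H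
  tbr-~ p (a , b , c , d , q , r) = a , b , c , d , p ◅◅ q , r

  tbr-insert : ∀ a b {H₁} → TBR₁ (unr a) H₁ → ∃ λ H → TBR₁ (edge a b) H × ∃ λ e → H ~ edge e b × unr e ~ H₁
  tbr-insert (lf x) b (_ , _ , _ , _ , p , _) with () ← one-~ p
  tbr-insert (nd a₁ a₂) b (c , d , p , q , r , u , v , w) with ins-~ {b = b} r (inl top)
  ... | _ , inl i , z = case ins-transport i p u of λ { (p' , k , f) →
    case f q of λ { (e , g , h) →
    edge p' q , (_ , d , p' , q , ~exch ◅◅ z , ~sym k , v , ε) , e , g , h ◅◅ ~sym w }}
  ... | _ , inr i , z = case ins-transport i q v of λ { (q' , k , f) →
    case f p of λ { (e , g , h) →
    edge p q' , (c , _ , p , q' , ~exch ◅◅ z , u , ~sym k , ε) , e , ~swp ◅◅ g , h ◅◅ ~swp ◅◅ ~sym w }}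

  dec-tbr : ∀ {T G U W R} s t → Decomp T G → G ↭ U ∷ W ∷ R → U ~ unr s → W ~ unr t →
    ∃ λ H → TBR₁ T H × Decomp H (edge s t ∷ R)
  dec-tbr-cut : ∀ {s' t' G G' R₁ U W R} s t → Decomp (unr s') G → Decomp (unr t') G' → G ↭ U ∷ R₁ → W ∷ R ↭ R₁ ++ G' →
    U ~ unr s → W ~ unr t → ∃ λ H → TBR₁ (edge s' t') H × Decomp H (edge s t ∷ R)
  dec-tbr s t (done _) q _ _ with () ← ↭-length q
  dec-tbr s t (perm d p) q r r' = dec-tbr s t d (↭-trans p q) r r'
  dec-tbr s t (cut {G = G} p d e) q r r' with pick G q
  ... | inj₁ (_ , g , h) = case dec-tbr-cut s t d e g h r r' of λ { (H , a , b) →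
    H , tbr-~ p a , b }
  ... | inj₂ (_ , g , h) = case dec-tbr-cut s t e d g (↭-trans h (++-comm G _)) r r' of λ { (H , a , b) →
    H , tbr-~ (p ◅◅ ~swp) a , b }
  dec-tbr-cut {s'} {t'} {R₁ = R₁} s t d e g h r r' with pick R₁ (↭-sym h)
  ... | inj₁ (R₂ , k , l) =
        case dec-tbr s t d (↭-trans g (prep _ k)) r r' of λ { (H₁ , a , b) →
        case tbr-insert s' t' a of λ { (H , a' , _ , u , v) →
        H , a' , perm (cut u (dec-~ v b) e) (prep _ (↭-sym l)) }}
  ... | inj₂ (R₂ , k , l) =
        case dec-attach s d g r of λ { (s̄ , a , f) →
        case dec-attach t e k r' of λ { (t̄ , b , f') →
        let D : Decomp (edge s̄ t̄) ((edge t s ∷ R₂) ++ R₁)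
            D = dec-join (f t̄) (dec-~ ~swp (f' s))
        in edge s̄ t̄ , (_ , _ , s̄ , t̄ , ε , ~sym a , ~sym b , ε) ,
           dec-pointwise (perm D (prep _ (↭-trans (++-comm R₂ R₁) (↭-sym l)))) (~swp ∷ refl-pw _) }}
    where
    refl-pw : ∀ G → Pointwise _~_ G G
    refl-pw []      = []
    refl-pw (_ ∷ G) = ε ∷ refl-pw G
    dec-join : ∀ {T Z R G} → Decomp T (Z ∷ R) → Decomp Z G → Decomp T (G ++ R)
    dec-join D E = go D ↭-refl E
      where
      go : ∀ {T Z R G G'} → Decomp T G' → G' ↭ Z ∷ R → Decomp Z G → Decomp T (G ++ R)
      go {R = R} {G} (done p) q E with refl ← ↭-singleton-inv (↭-sym q) = perm (dec-~ p E) (↭-reflexive (sym (List.++-identityʳ G)))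
      go (perm D p) q E = go D (↭-trans p q) E
      go {G = G₀} (cut {G = G} {G'} p D D') q E with pick G q
      ... | inj₁ (G₁ , g , h) = perm (cut p (go D g E) D')
              (↭-trans (↭-reflexive (List.++-assoc G₀ G₁ G')) (++⁺ˡ G₀ (↭-sym h)))
      ... | inj₂ (G₁ , g , h) = perm (cut p D (go D' g E))
              (↭-trans (shifts G G₀) (++⁺ˡ G₀ (↭-sym h)))

  data TBRs : Ut → Ut → ℕ → Set where
    nil  : ∀ {T H} → T ~ H → TBRs T H 0
    cons : ∀ {T H H' k} → TBR₁ T H → TBRs H H' k → TBRs T H' (suc k)

  tbrs-~ : ∀ {T T' H k} → T ~ T' → TBRs T' H k → TBRs T H k
  tbrs-~ p (nil q)    = nil (p ◅◅ q)
  tbrs-~ p (cons q r) = cons (tbr-~ p q) r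

  tbrs-trans : ∀ {T H K k l} → TBRs T H k → TBRs H K l → TBRs T K (k + l)
  tbrs-trans (nil p)    q = tbrs-~ p q
  tbrs-trans (cons p r) q = cons p (tbrs-trans r q)

  dec-assemble : ∀ {T T' G R} → Decomp T' G → Decomp T (G ++ R) →
    ∃ λ H → ∃ λ k → ∃ λ U → TBRs T H k × suc k ≡ length G × U ~ T' × Decomp H (U ∷ R)
  dec-assemble (done p) d = _ , 0 , _ , nil ε , refl , ~sym p , d
  dec-assemble {R = R} (perm e p) d =
    case dec-assemble e (perm d (++⁺ʳ R (↭-sym p))) of λ { (H , k , U , a , b , c , f) →
    H , k , U , a , Eq.trans b (↭-length p) , c , f }
  dec-assemble {R = R} (cut {s = s} {t} {G} {G'} p e e') d =
    case dec-assemble e (perm d (↭-reflexive (List.++-assoc G G' R))) of λ { (H₁ , k₁ , U₁ , a₁ , b₁ , c₁ , f₁) →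
    case dec-assemble e' (perm f₁ (↭-sym (shift U₁ G' R))) of λ { (H₂ , k₂ , U₂ , a₂ , b₂ , c₂ , f₂) →
    case dec-tbr s t f₂ (swap _ _ ↭-refl) c₁ c₂ of λ { (H₃ , x , f₃) →
    H₃ , k₁ + suc (k₂ + 0) , edge s t , tbrs-trans a₁ (Eq.subst (TBRs _ _) (+-suc k₂ 0) (tbrs-trans a₂ (cons x (nil ε)))) ,
       Eq.trans (Eq.cong₂ _+_ b₁ (Eq.trans (cong suc (+-identityʳ k₂)) b₂)) (sym (List.length-++ G)) , ~sym p , f₃ }}}

  dec-tbrs : ∀ {T T' G G'} → Decomp T G → Decomp T' G' → Pointwise _~_ G G' → ∃ λ k → TBRs T T' k × suc k ≡ length G'
  dec-tbrs {G' = G'} d e p =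
    case dec-assemble {R = []} e (perm (dec-pointwise d p) (↭-reflexive (sym (List.++-identityʳ G')))) of λ { (H , k , U , a , b , c , f) →
    let a' = tbrs-trans a (nil (dec-one f refl ◅◅ c))
    in k , Eq.subst (TBRs _ _) (+-identityʳ k) a' , b }

  Forest : Set
  Forest = List Ut

  lv : Tr → List L
  lv (lf x)   = x ∷ []
  lv (nd a b) = lv a ++ lv b

  lvU : Ut → List L
  lvU (one x)    = x ∷ []
  lvU (edge s t) = lv s ++ lv t

  lvF : Forest → List L
  lvF []      = []
  lvF (U ∷ F) = lvU U ++ lvF F

  lv-unr : ∀ s → lvU (unr s) ≡ lv s
  lv-unr (lf x)   = refl
  lv-unr (nd a b) = refl

  infix 4 _⟿_ _≈_

  data _⟿_ : Forest → Forest → Set where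
    tree : ∀ {U V F} → U ⟶ V → (U ∷ F) ⟿ (V ∷ F)
    perm : ∀ {F F'} → F ↭ F' → F ⟿ F'

  _≈_ : Forest → Forest → Set
  _≈_ = Star _⟿_

  ≈perm : ∀ {F F'} → F ↭ F' → F ≈ F'
  ≈perm p = perm p ◅ ε

  ≈head : ∀ {U V F} → U ~ V → (U ∷ F) ≈ (V ∷ F)
  ≈head ε       = ε
  ≈head (r ◅ p) = tree r ◅ ≈head p

  ≈sym : ∀ {F F'} → F ≈ F' → F' ≈ F
  ≈sym ε            = ε
  ≈sym (tree r ◅ p) = ≈sym p ◅◅ ≈head (~sym (r ◅ ε))
  ≈sym (perm r ◅ p) = ≈sym p ◅◅ ≈perm (↭-sym r)

  ≈cons : ∀ {U F F'} → F ≈ F' → (U ∷ F) ≈ (U ∷ F')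
  ≈cons ε = ε
  ≈cons (tree r ◅ p) = perm (swap _ _ ↭-refl) ◅ tree r ◅ perm (swap _ _ ↭-refl) ◅ ≈cons p
  ≈cons (perm r ◅ p) = perm (prep _ r) ◅ ≈cons p

  lv-⟶ : ∀ {U V} → U ⟶ V → lvU U ↭ lvU V
  lv-⟶ (rot {a} {b} {c})  = ↭-reflexive (List.++-assoc (lv a) (lv b) (lv c))
  lv-⟶ (swp {s} {t})      = ++-comm (lv s) (lv t)
  lv-⟶ (flip {a} {b} {c}) = ++⁺ʳ (lv c) (++-comm (lv a) (lv b))

  lvF-↭ : ∀ {F F'} → F ↭ F' → lvF F ↭ lvF F'
  lvF-↭ refl         = ↭-refl
  lvF-↭ (prep U p)   = ++⁺ˡ (lvU U) (lvF-↭ p)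
  lvF-↭ (swap U V p) = ↭-trans (shifts (lvU U) (lvU V)) (++⁺ˡ (lvU V) (++⁺ˡ (lvU U) (lvF-↭ p)))
  lvF-↭ (trans p q)  = ↭-trans (lvF-↭ p) (lvF-↭ q)

  lv-~ : ∀ {U V} → U ~ V → lvU U ↭ lvU V
  lv-~ ε       = ↭-refl
  lv-~ (r ◅ p) = ↭-trans (lv-⟶ r) (lv-~ p)

  lvF-⟿ : ∀ {F F'} → F ⟿ F' → lvF F ↭ lvF F'
  lvF-⟿ (tree {F = F} r) = ++⁺ʳ (lvF F) (lv-⟶ r)
  lvF-⟿ (perm p)         = lvF-↭ p

  lvF-≈ : ∀ {F F'} → F ≈ F' → lvF F ↭ lvF F'
  lvF-≈ ε       = ↭-refl
  lvF-≈ (r ◅ p) = ↭-trans (lvF-⟿ r) (lvF-≈ p)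

  length-≈ : ∀ {F F'} → F ≈ F' → length F ≡ length F'
  length-≈ ε            = refl
  length-≈ (tree r ◅ p) = length-≈ p
  length-≈ (perm r ◅ p) = Eq.trans (↭-length r) (length-≈ p)

  sz : Tr → ℕ
  sz (lf x)   = 0
  sz (nd a b) = suc (suc (sz a + sz b))

  szU : Ut → ℕ
  szU (one x)    = 0
  szU (edge s t) = suc (sz s + sz t)

  szF : Forest → ℕ
  szF []      = 0
  szF (U ∷ F) = szU U + szF F

  sz-unr : ∀ s → szU (unr s) ≤ sz s
  sz-unr (lf x)   = ≤-refl
  sz-unr (nd a b) = n≤1+n _

  sz-⟶ : ∀ {U V} → U ⟶ V → szU U ≡ szU V
  sz-⟶ (rot {a} {b} {c})  = cong suc (Eq.trans (cong (λ z → suc (suc z)) (+-assoc (sz a) (sz b) (sz c)))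
    (Eq.sym (Eq.trans (+-suc (sz a) _) (cong suc (+-suc (sz a) _)))))
  sz-⟶ (swp {s} {t})      = cong suc (+-comm (sz s) (sz t))
  sz-⟶ (flip {a} {b} {c}) = cong (λ z → suc (suc (suc (z + sz c)))) (+-comm (sz a) (sz b))

  sz-~ : ∀ {U V} → U ~ V → szU U ≡ szU V
  sz-~ ε       = refl
  sz-~ (r ◅ p) = Eq.trans (sz-⟶ r) (sz-~ p)

  szF-↭ : ∀ {F F'} → F ↭ F' → szF F ≡ szF F'
  szF-↭ refl                 = refl
  szF-↭ (prep U p)           = cong (szU U +_) (szF-↭ p)
  szF-↭ (swap {F} U V p)     = Eq.trans (sym (+-assoc (szU U) (szU V) _))
    (Eq.trans (cong₂ _+_ (+-comm (szU U) (szU V)) (szF-↭ p)) (+-assoc (szU V) (szU U) _))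
  szF-↭ (trans p q)          = Eq.trans (szF-↭ p) (szF-↭ q)

  szF-≈ : ∀ {F F'} → F ≈ F' → szF F ≡ szF F'
  szF-≈ ε                    = refl
  szF-≈ (tree {F = F} r ◅ p) = Eq.trans (cong (_+ szF F) (sz-⟶ r)) (szF-≈ p)
  szF-≈ (perm r ◅ p)         = Eq.trans (szF-↭ r) (szF-≈ p)

  lv-nonempty : ∀ s → ∃ λ x → x ∈ lv s
  lv-nonempty (lf x)   = x , here refl
  lv-nonempty (nd a b) = let x , i = lv-nonempty a in x , ∈-++⁺ˡ i

  lvU-nonempty : ∀ U → ∃ λ x → x ∈ lvU U
  lvU-nonempty (one x)    = x , here refl
  lvU-nonempty (edge s t) = let x , i = lv-nonempty s in x , ∈-++⁺ˡ i

  locate : ∀ {x} s t → x ∈ lv s → ∃ λ t' → edge s t ~ edge (lf x) t'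
  locate (lf _)   t (here refl) = t , ε
  locate (nd a b) t i with ∈-++⁻ (lv a) i
  ... | inj₁ j = let t' , p = locate a (nd b t) j in t' , ~rot ◅◅ p
  ... | inj₂ j = let t' , p = locate b (nd a t) j in t' , ~flip ◅◅ ~rot ◅◅ p

  locateU : ∀ {x} s t → x ∈ lv s ++ lv t → ∃ λ t' → edge s t ~ edge (lf x) t'
  locateU s t i with ∈-++⁻ (lv s) i
  ... | inj₁ j = locate s t j
  ... | inj₂ j = let t' , p = locate t s j in t' , ~swp ◅◅ p

  locateF : ∀ {x} F → x ∈ lvF F → (∃ λ R → F ≈ one x ∷ R) ⊎ (∃ λ t → ∃ λ R → F ≈ edge (lf x) t ∷ R)
  locateF (U ∷ F) i with ∈-++⁻ (lvU U) i
  locateF (one _ ∷ F) i    | inj₁ (here refl) = inj₁ (F , ε)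
  locateF (edge s t ∷ F) i | inj₁ j = let t' , p = locateU s t j in inj₂ (t' , F , ≈head p)
  locateF (U ∷ F) i | inj₂ j with locateF F j
  ... | inj₁ (R , p)     = inj₁ (U ∷ R , ≈cons p ◅◅ ≈perm (swap _ _ ↭-refl))
  ... | inj₂ (t , R , p) = inj₂ (t , U ∷ R , ≈cons p ◅◅ ≈perm (swap _ _ ↭-refl))

  locate-pendant : ∀ {y} p q r → y ∈ lv (nd p q) →
    ∃ λ u → ∃ λ w → edge (nd p q) r ~ edge (nd (lf y) u) w × (∀ {z} → z ∈ lv u → z ∈ lv (nd p q)) × (∀ {z} → z ∈ lv r → z ∈ lv w)
  locate-pendantˡ : ∀ {y} p q r → y ∈ lv p →
    ∃ λ u → ∃ λ w → edge (nd p q) r ~ edge (nd (lf y) u) w × (∀ {z} → z ∈ lv u → z ∈ lv p ++ lv q) × (∀ {z} → z ∈ lv r → z ∈ lv w)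
  locate-pendantˡ (lf y) q r (here refl) = q , r , ε , there , id
  locate-pendantˡ (nd a b) q r i =
    let u , w , e , f , g = locate-pendant a b (nd q r) i
    in u , w , ~rot ◅◅ e , ∈-++⁺ˡ ∘ f , g ∘ ∈-++⁺ʳ (lv q)
  locate-pendant p q r i with ∈-++⁻ (lv p) i
  ... | inj₁ j = locate-pendantˡ p q r j
  ... | inj₂ j = let u , w , e , f , g = locate-pendantˡ q p r j in
        u , w , ~flip ◅◅ e , ∈-resp-↭ (++-comm (lv q) (lv p)) ∘ f , g

  infix 4 _⊑_

  data _⊑_ (u : Tr) : Tr → Set where
    top : u ⊑ u
    inl : ∀ {a b} → u ⊑ a → u ⊑ nd a b
    inr : ∀ {a b} → u ⊑ b → u ⊑ nd a b

  ⊑-lv : ∀ {u s x} → u ⊑ s → x ∈ lv u → x ∈ lv s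
  ⊑-lv top     i = i
  ⊑-lv (inl p) i = ∈-++⁺ˡ (⊑-lv p i)
  ⊑-lv (inr {a} p) i = ∈-++⁺ʳ (lv a) (⊑-lv p i)

  leaf-⊑ : ∀ {x} s → x ∈ lv s → lf x ⊑ s
  leaf-⊑ (lf _)   (here refl) = top
  leaf-⊑ (nd a b) i with ∈-++⁻ (lv a) i
  ... | inj₁ j = inl (leaf-⊑ a j)
  ... | inj₂ j = inr (leaf-⊑ b j)

  Splits : Tr → L → L → L → L → Set
  Splits u a b c d = (a ∈ lv u × b ∈ lv u) × (c ∉ lv u × d ∉ lv u)

  SepBy : Tr → L → L → L → L → Set
  SepBy u a b c d = Splits u a b c d ⊎ Splits u c d a b

  -- The quartet ab|cd. Coincidences such as a ≡ b are allowed.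
  Sep : Ut → L → L → L → L → Set
  Sep (one _)    a b c d = ⊥
  Sep (edge s t) a b c d = ∃ λ u → (u ⊑ s ⊎ u ⊑ t) × SepBy u a b c d

  In₄ : Ut → L → L → L → L → Set
  In₄ T a b c d = (a ∈ lvU T × b ∈ lvU T) × (c ∈ lvU T × d ∈ lvU T)

  Same : Forest → L → L → Set
  Same F a b = Any (λ T → a ∈ lvU T × b ∈ lvU T) F

  SepF : Forest → L → L → L → L → Set
  SepF F a b c d = Any (λ T → In₄ T a b c d × Sep T a b c d) F

  sep-swap : ∀ T {a b c d} → Sep T a b c d → Sep T c d a b
  sep-swap (edge s t) (u , p , q) = u , p , Sum.swap q

  sep-flip : ∀ T {a b c d} → Sep T a b c d → Sep T b a c d
  sep-flip (edge s t) (u , p , inj₁ ((i , j) , k)) = u , p , inj₁ ((j , i) , k)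
  sep-flip (edge s t) (u , p , inj₂ (k , (i , j))) = u , p , inj₂ (k , (j , i))

  sepF-swap : ∀ {F a b c d} → SepF F a b c d → SepF F c d a b
  sepF-swap = Any.map (λ { {T} ((i , j) , s) → (j , i) , sep-swap T s })

  sepF-flipˡ : ∀ {F a b c d} → SepF F a b c d → SepF F b a c d
  sepF-flipˡ = Any.map (λ { {T} (((i , i') , j) , s) → ((i' , i) , j) , sep-flip T s })

  sepF-flipʳ : ∀ {F a b c d} → SepF F a b c d → SepF F a b d c
  sepF-flipʳ = sepF-swap ∘ sepF-flipˡ ∘ sepF-swap

  not-in : ∀ {x} {xs ys : List L} → x ∈ xs ++ ys → x ∉ xs → x ∈ ys
  not-in {xs = xs} i n with ∈-++⁻ xs i
  ... | inj₁ j = ⊥-elim (n j)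
  ... | inj₂ j = j

  sep-⟶ : ∀ {U V a b c d} → U ⟶ V → Unique (lvU U) → In₄ U a b c d → Sep U a b c d → Sep V a b c d
  sep-⟶ (rot {a} {b} {c}) u ((i , j) , (k , l)) (._ , inj₁ top , inj₁ ((p , q) , (m , n))) =
    c , inj₂ (inr top) , inj₂ ((not-in k m , not-in l n) , (unique-disjoint (lv (nd a b)) u p , unique-disjoint (lv (nd a b)) u q))
  sep-⟶ (rot {a} {b} {c}) u ((i , j) , (k , l)) (._ , inj₁ top , inj₂ ((p , q) , (m , n))) =
    c , inj₂ (inr top) , inj₁ ((not-in i m , not-in j n) , (unique-disjoint (lv (nd a b)) u p , unique-disjoint (lv (nd a b)) u q))
  sep-⟶ rot u _ (w , inj₁ (inl p) , s) = w , inj₁ p , s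
  sep-⟶ rot u _ (w , inj₁ (inr p) , s) = w , inj₂ (inl p) , s
  sep-⟶ rot u _ (w , inj₂ p , s)       = w , inj₂ (inr p) , s
  sep-⟶ swp u _ (w , p , s)            = w , Sum.swap p , s
  sep-⟶ (flip {a} {b}) u _ (._ , inj₁ top , s) = nd b a , inj₁ top ,
    Sum.map (λ { ((i , j) , (k , l)) → (to i , to j) , (k ∘ from , l ∘ from) })
            (λ { ((i , j) , (k , l)) → (to i , to j) , (k ∘ from , l ∘ from) }) s
    where
    to : ∀ {x} → x ∈ lv a ++ lv b → x ∈ lv b ++ lv a
    to = ∈-resp-↭ (++-comm (lv a) (lv b))
    from : ∀ {x} → x ∈ lv b ++ lv a → x ∈ lv a ++ lv b
    from = ∈-resp-↭ (++-comm (lv b) (lv a))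
  sep-⟶ flip u _ (w , inj₁ (inl p) , s) = w , inj₁ (inr p) , s
  sep-⟶ flip u _ (w , inj₁ (inr p) , s) = w , inj₁ (inl p) , s
  sep-⟶ flip u _ (w , inj₂ p , s)       = w , inj₂ p , s

  same-⟿ : ∀ {F F' a b} → F ⟿ F' → Same F a b → Same F' a b
  same-⟿ (tree r) (here (i , j)) = here (∈-resp-↭ (lv-⟶ r) i , ∈-resp-↭ (lv-⟶ r) j)
  same-⟿ (tree r) (there k)      = there k
  same-⟿ (perm p) k              = Any-resp-↭ p k

  sepF-⟿ : ∀ {F F' a b c d} → F ⟿ F' → Unique (lvF F) → SepF F a b c d → SepF F' a b c d
  sepF-⟿ (tree {U} {V} r) u (here (q@((i , j) , (k , l)) , s)) =
    here (((f i , f j) , (f k , f l)) , sep-⟶ r (unique-++ˡ (lvU U) u) q s)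
    where
    f : ∀ {x} → x ∈ lvU U → x ∈ lvU V
    f = ∈-resp-↭ (lv-⟶ r)
  sepF-⟿ (tree r) u (there k) = there k
  sepF-⟿ (perm p) u k         = Any-resp-↭ p k

  same-≈ : ∀ {F F' a b} → F ≈ F' → Same F a b → Same F' a b
  same-≈ ε       k = k
  same-≈ (r ◅ p) k = same-≈ p (same-⟿ r k)

  sepF-≈ : ∀ {F F' a b c d} → F ≈ F' → Unique (lvF F) → SepF F a b c d → SepF F' a b c d
  sepF-≈ ε       u k = k
  sepF-≈ (r ◅ p) u k = sepF-≈ p (unique-↭ (lvF-⟿ r) u) (sepF-⟿ r u k)

  any-lvF : ∀ {F x} → Any (λ T → x ∈ lvU T) F → x ∈ lvF F
  any-lvF (here i)            = ∈-++⁺ˡ i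
  any-lvF {T ∷ _} (there k)   = ∈-++⁺ʳ (lvU T) (any-lvF k)

  lvF-any : ∀ F {x} → x ∈ lvF F → Any (λ T → x ∈ lvU T) F
  lvF-any (T ∷ F) i with ∈-++⁻ (lvU T) i
  ... | inj₁ j = here j
  ... | inj₂ j = there (lvF-any F j)

  same-refl : ∀ F {x} → x ∈ lvF F → Same F x x
  same-refl F i = Any.map (λ j → j , j) (lvF-any F i)

  comp-unique : ∀ {F x} {P Q : Ut → Set} → Unique (lvF F) → Any (λ T → x ∈ lvU T × P T) F →
    Any (λ T → x ∈ lvU T × Q T) F → Any (λ T → P T × Q T) F
  comp-unique u (here (_ , p)) (here (_ , q)) = here (p , q)
  comp-unique {T ∷ _} u (here (i , p)) (there k) =
    ⊥-elim (unique-disjoint (lvU T) u i (any-lvF (Any.map proj₁ k)))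
  comp-unique {T ∷ _} u (there k) (here (i , p)) =
    ⊥-elim (unique-disjoint (lvU T) u i (any-lvF (Any.map proj₁ k)))
  comp-unique {T ∷ _} u (there k) (there l) = there (comp-unique (unique-++ʳ (lvU T) u) k l)

  same-sym : ∀ {F a b} → Same F a b → Same F b a
  same-sym = Any.map (λ { (i , j) → j , i })

  same-trans : ∀ {F a b c} → Unique (lvF F) → Same F a b → Same F b c → Same F a c
  same-trans u p q = comp-unique u (same-sym p) q

  same-∈ : ∀ {F a b} → Same F a b → a ∈ lvF F
  same-∈ = any-lvF ∘ Any.map proj₁

  sepF-same : ∀ {F a b c d} → SepF F a b c d → Same F a b × Same F a c × Same F a d
  sepF-same s = Any.map (λ { (((i , j) , (k , l)) , _) → i , j }) s ,
                Any.map (λ { (((i , j) , (k , l)) , _) → i , k }) s ,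
                Any.map (λ { (((i , j) , (k , l)) , _) → i , l }) s

  laminar : ∀ {u v} s → Unique (lv s) → u ⊑ s → v ⊑ s → u ⊑ v ⊎ v ⊑ u ⊎ (∀ {x} → x ∈ lv u → x ∈ lv v → ⊥)
  laminar s u p top = inj₁ p
  laminar s u top q = inj₂ (inj₁ q)
  laminar (nd a b) u (inl p) (inl q) = laminar a (unique-++ˡ (lv a) u) p q
  laminar (nd a b) u (inr p) (inr q) = laminar b (unique-++ʳ (lv a) u) p q
  laminar (nd a b) u (inl p) (inr q) = inj₂ (inj₂ (λ i j → unique-disjoint (lv a) u (⊑-lv p i) (⊑-lv q j)))
  laminar (nd a b) u (inr p) (inl q) = inj₂ (inj₂ (λ i j → unique-disjoint (lv a) u (⊑-lv q j) (⊑-lv p i)))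

  nested : ∀ {u v} s t → Unique (lv s ++ lv t) → u ⊑ s ⊎ u ⊑ t → v ⊑ s ⊎ v ⊑ t →
    u ⊑ v ⊎ v ⊑ u ⊎ (∀ {x} → x ∈ lv u → x ∈ lv v → ⊥)
  nested s t uq (inj₁ p) (inj₁ q) = laminar s (unique-++ˡ (lv s) uq) p q
  nested s t uq (inj₂ p) (inj₂ q) = laminar t (unique-++ʳ (lv s) uq) p q
  nested s t uq (inj₁ p) (inj₂ q) = inj₂ (inj₂ λ i j → unique-disjoint (lv s) uq (⊑-lv p i) (⊑-lv q j))
  nested s t uq (inj₂ p) (inj₁ q) = inj₂ (inj₂ λ i j → unique-disjoint (lv s) uq (⊑-lv q j) (⊑-lv p i))

  laminarU : ∀ {u v} s t → Unique (lv s ++ lv t) → u ⊑ s ⊎ u ⊑ t → v ⊑ s ⊎ v ⊑ t →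
    ∀ {x y z} → x ∈ lv u → x ∈ lv v → y ∈ lv u → y ∉ lv v → z ∉ lv u → z ∈ lv v → ⊥
  laminarU s t uq p q i j k l m n with nested s t uq p q
  ... | inj₁ w        = l (⊑-lv w k)
  ... | inj₂ (inj₁ w) = m (⊑-lv w n)
  ... | inj₂ (inj₂ w) = w i j

  sep-compat : ∀ T {a b c d} → Unique (lvU T) → Sep T a b c d → Sep T a c b d → ⊥
  sep-compat (edge s t) uq (u , p , inj₁ ((a , b) , (c , d))) (v , q , inj₁ ((a' , c') , (b' , d'))) =
    laminarU s t uq p q a a' b b' c c'
  sep-compat (edge s t) uq (u , p , inj₁ ((a , b) , (c , d))) (v , q , inj₂ ((b' , d') , (a' , c'))) =
    laminarU s t uq p q b b' a a' d d'
  sep-compat (edge s t) uq (u , p , inj₂ ((c , d) , (a , b))) (v , q , inj₁ ((a' , c') , (b' , d'))) =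
    laminarU s t uq p q c c' d d' a a'
  sep-compat (edge s t) uq (u , p , inj₂ ((c , d) , (a , b))) (v , q , inj₂ ((b' , d') , (a' , c'))) =
    laminarU s t uq p q d d' c c' b b'

  sepF-compat : ∀ {F a b c d} → Unique (lvF F) → SepF F a b c d → SepF F a c b d → ⊥
  sepF-compat {T ∷ F} u (here (_ , s)) (here (_ , s')) = sep-compat T (unique-++ˡ (lvU T) u) s s'
  sepF-compat {T ∷ F} u (here (((i , _) , _) , s)) (there k) =
    unique-disjoint (lvU T) u i (same-∈ (proj₁ (sepF-same k)))
  sepF-compat {T ∷ F} u (there k) (here (((i , _) , _) , s)) =
    unique-disjoint (lvU T) u i (same-∈ (proj₁ (sepF-same k)))
  sepF-compat {T ∷ F} u (there k) (there l) = sepF-compat (unique-++ʳ (lvU T) u) k l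

  sep-root : ∀ {s t R a b c d} → Unique (lvF (edge s t ∷ R)) → a ∈ lv s → b ∈ lv s → c ∈ lv t → d ∈ lv t →
    SepF (edge s t ∷ R) a b c d
  sep-root {s} {t} {R} u i j k l = here (((∈-++⁺ˡ i , ∈-++⁺ˡ j) , (∈-++⁺ʳ (lv s) k , ∈-++⁺ʳ (lv s) l)) ,
    (s , inj₁ top , inj₁ ((i , j) , ((λ m → unique-disjoint (lv s) u' m k) , (λ m → unique-disjoint (lv s) u' m l)))))
    where
    u' : Unique (lv s ++ lv t)
    u' = unique-++ˡ (lv s ++ lv t) u

  sep-leaf : ∀ {F z c d} → Unique (lvF F) → Same F z c → Same F z d → z ≢ c → z ≢ d → SepF F z z c d
  sep-leaf {z = z} {c} {d} u p q n m = Any.map f (comp-unique u (Any.map (λ { (i , j) → i , (i , j) }) p) q)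
    where
    f : ∀ {T} → (z ∈ lvU T × c ∈ lvU T) × d ∈ lvU T → In₄ T z z c d × Sep T z z c d
    f {one _} ((here refl , here refl) , _) = ⊥-elim (n refl)
    f {edge s t} ((i , j) , k) = ((i , i) , (j , k)) , (lf z , g , inj₁ ((here refl , here refl) , ((λ { (here e) → n (sym e) }) , (λ { (here e) → m (sym e) }))))
      where
      g : lf z ⊑ s ⊎ lf z ⊑ t
      g with ∈-++⁻ (lv s) i
      ... | inj₁ i' = inj₁ (leaf-⊑ s i')
      ... | inj₂ i' = inj₂ (leaf-⊑ t i')

  cutF : Tr → Tr → Forest → Forest
  cutF s t R = unr s ∷ unr t ∷ R

  lvF-cut : ∀ s t R → lvF (cutF s t R) ≡ lvF (edge s t ∷ R)
  lvF-cut s t R = Eq.trans (cong₂ (λ p q → p ++ q ++ lvF R) (lv-unr s) (lv-unr t)) (sym (List.++-assoc (lv s) (lv t) (lvF R)))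

  ∈-unr : ∀ s {x} → x ∈ lvU (unr s) → x ∈ lv s
  ∈-unr s = subst (_ ∈_) (lv-unr s)

  ∈-unr⁻ : ∀ s {x} → x ∈ lv s → x ∈ lvU (unr s)
  ∈-unr⁻ s = subst (_ ∈_) (sym (lv-unr s))

  same-cut : ∀ s t R {a b} → Same (cutF s t R) a b → Same (edge s t ∷ R) a b
  same-cut s t R (here (i , j))         = here (∈-++⁺ˡ (∈-unr s i) , ∈-++⁺ˡ (∈-unr s j))
  same-cut s t R (there (here (i , j))) = here (∈-++⁺ʳ (lv s) (∈-unr t i) , ∈-++⁺ʳ (lv s) (∈-unr t j))
  same-cut s t R (there (there k))      = there k

  sep-unr : ∀ s {a b c d} → Sep (unr s) a b c d → ∃ λ u → u ⊑ s × SepBy u a b c d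
  sep-unr (nd p q) (u , inj₁ w , k) = u , inl w , k
  sep-unr (nd p q) (u , inj₂ w , k) = u , inr w , k

  sep-cut : ∀ s t R {a b c d} → SepF (cutF s t R) a b c d → SepF (edge s t ∷ R) a b c d
  sep-cut s t R (here (((i , j) , (k , l)) , p)) with sep-unr s p
  ... | u , w , q = here (((f i , f j) , (f k , f l)) , (u , inj₁ w , q))
    where
    f : ∀ {x} → x ∈ lvU (unr s) → x ∈ lv s ++ lv t
    f = ∈-++⁺ˡ ∘ ∈-unr s
  sep-cut s t R (there (here (((i , j) , (k , l)) , p))) with sep-unr t p
  ... | u , w , q = here (((f i , f j) , (f k , f l)) , (u , inj₂ w , q))
    where
    f : ∀ {x} → x ∈ lvU (unr t) → x ∈ lv s ++ lv t
    f = ∈-++⁺ʳ (lv s) ∘ ∈-unr t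
  sep-cut s t R (there (there k)) = there k

  same-head : ∀ {U F a b} → Unique (lvF (U ∷ F)) → a ∈ lvU U → Same (U ∷ F) a b → b ∈ lvU U
  same-head u i (here (_ , j)) = j
  same-head {U} u i (there k)  = ⊥-elim (unique-disjoint (lvU U) u i (same-∈ k))

  -- Inside one side of the cut edge, neither that side itself nor a subtree of the other side separates anything.
  sep-side : ∀ s t {u a b c d} → Unique (lv s ++ lv t) → a ∈ lv s → b ∈ lv s → c ∈ lv s → d ∈ lv s →
    u ⊑ s ⊎ u ⊑ t → SepBy u a b c d → Sep (unr s) a b c d
  sep-side s t uq a b c d (inj₂ w) (inj₁ ((i , _) , _)) = ⊥-elim (unique-disjoint (lv s) uq a (⊑-lv w i))
  sep-side s t uq a b c d (inj₂ w) (inj₂ ((i , _) , _)) = ⊥-elim (unique-disjoint (lv s) uq c (⊑-lv w i))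
  sep-side s t uq a b c d (inj₁ top) (inj₁ (_ , (i , _))) = ⊥-elim (i c)
  sep-side s t uq a b c d (inj₁ top) (inj₂ (_ , (i , _))) = ⊥-elim (i a)
  sep-side (nd p q) t uq a b c d (inj₁ (inl w)) k = _ , inj₁ w , k
  sep-side (nd p q) t uq a b c d (inj₁ (inr w)) k = _ , inj₂ w , k

  sep-cut⁻ : ∀ s t R {a b c d} → Unique (lvF (edge s t ∷ R)) → SepF (edge s t ∷ R) a b c d →
    Same (cutF s t R) a b → Same (cutF s t R) a c → Same (cutF s t R) a d → SepF (cutF s t R) a b c d
  sep-cut⁻ s t R uq (there k) _ _ _ = there (there k)
  sep-cut⁻ s t R uq (here (((i , _) , _) , (u , w , q))) p₁ p₂ p₃ with ∈-++⁻ (lv s) i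
  ... | inj₁ i₀ = here (((i' , f p₁) , (f p₂ , f p₃)) ,
          sep-side s t (unique-++ˡ (lv s ++ lv t) uq) i₀ (∈-unr s (f p₁)) (∈-unr s (f p₂)) (∈-unr s (f p₃)) w q)
    where
    i' = ∈-unr⁻ s i₀
    f : ∀ {x} → Same (cutF s t R) _ x → x ∈ lvU (unr s)
    f = same-head (subst Unique (sym (lvF-cut s t R)) uq) i'
  ... | inj₂ i₀ = there (here (((i' , f p₁) , (f p₂ , f p₃)) ,
          sep-side t s (unique-↭ (++-comm (lv s) (lv t)) (unique-++ˡ (lv s ++ lv t) uq)) i₀ (∈-unr t (f p₁)) (∈-unr t (f p₂)) (∈-unr t (f p₃)) (Sum.swap w) q))
    where
    i' = ∈-unr⁻ t i₀
    f : ∀ {x} → Same (cutF s t R) _ x → x ∈ lvU (unr t)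
    f p = same-head (unique-↭ (lvF-↭ (swap (unr s) (unr t) (↭-refl {x = R}))) (subst Unique (sym (lvF-cut s t R)) uq)) i'
            (same-≈ (≈perm (swap (unr s) (unr t) (↭-refl {x = R}))) p)

  Colouring : Set
  Colouring = L → ℕ

  -- The colour classes are the blocks of an agreement forest; they span disjoint subtrees of F
  -- because blocks of different colours in one tree are separated by an edge (dis).
  record Ok (F : Forest) (col : Colouring) : Set where
    field
      blk : ∀ {a b} → a ∈ lvF F → b ∈ lvF F → col a ≡ col b → Same F a b
      dis : ∀ {a b c d} → Same F a b → Same F c d → Same F a c → col a ≡ col b → col c ≡ col d → col a ≢ col c →
            SepF F a b c d
  open Ok public

  Agr : Forest → Forest → Colouring → Set
  Agr F F' col = ∀ {a b c d} → col a ≡ col b → col a ≡ col c → col a ≡ col d → SepF F a b c d → SepF F' a b c d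

  record AF (F F' : Forest) (col : Colouring) : Set where
    field
      okˡ  : Ok F col
      okʳ  : Ok F' col
      agr  : Agr F F' col
      agr' : Agr F' F col
  open AF public

  af-sym : ∀ {F F' col} → AF F F' col → AF F' F col
  af-sym x = record { okˡ = okʳ x ; okʳ = okˡ x ; agr = agr' x ; agr' = agr x }

  Cover : Forest → Colouring → List ℕ → Set
  Cover F col R = ∀ {a} → a ∈ lvF F → col a ∈ R

  ok-≈ : ∀ {F F' col} → Unique (lvF F) → F ≈ F' → Ok F col → Ok F' col
  ok-≈ {F} {F'} u p o = record
    { blk = λ i j e → same-≈ p (blk o (back i) (back j) e)
    ; dis = λ x y z e f g → sepF-≈ p u (dis o (same-≈ q x) (same-≈ q y) (same-≈ q z) e f g) }
    where
    q = ≈sym p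
    back : ∀ {x} → x ∈ lvF F' → x ∈ lvF F
    back = ∈-resp-↭ (↭-sym (lvF-≈ p))

  af-≈ : ∀ {F F₂ F' col} → Unique (lvF F) → F ≈ F₂ → AF F F' col → AF F₂ F' col
  af-≈ u p x = record
    { okˡ = ok-≈ u p (okˡ x) ; okʳ = okʳ x
    ; agr = λ e f g s → agr x e f g (sepF-≈ (≈sym p) (unique-↭ (lvF-≈ p) u) s)
    ; agr' = λ e f g s → sepF-≈ p u (agr' x e f g s) }

  af-≈ʳ : ∀ {F F' F₂' col} → Unique (lvF F') → F' ≈ F₂' → AF F F' col → AF F F₂' col
  af-≈ʳ u p x = af-sym (af-≈ u p (af-sym x))

  module _ (s t : Tr) (R : Forest) (u : Unique (lvF (edge s t ∷ R))) where
    private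
      F₁ = edge s t ∷ R
      F₂ = cutF s t R
      u₂ : Unique (lvF F₂)
      u₂ = subst Unique (sym (lvF-cut s t R)) u
      to : ∀ {x} → x ∈ lvF F₁ → x ∈ lvF F₂
      to = subst (_ ∈_) (sym (lvF-cut s t R))
      from : ∀ {x} → x ∈ lvF F₂ → x ∈ lvF F₁
      from = subst (_ ∈_) (lvF-cut s t R)

    same-cases : ∀ {a c} → Same F₁ a c → Same F₂ a c ⊎ (a ∈ lv s × c ∈ lv t) ⊎ (a ∈ lv t × c ∈ lv s)
    same-cases (there k) = inj₁ (there (there k))
    same-cases (here (i , j)) with ∈-++⁻ (lv s) i | ∈-++⁻ (lv s) j
    ... | inj₁ i' | inj₁ j' = inj₁ (here (∈-unr⁻ s i' , ∈-unr⁻ s j'))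
    ... | inj₂ i' | inj₂ j' = inj₁ (there (here (∈-unr⁻ t i' , ∈-unr⁻ t j')))
    ... | inj₁ i' | inj₂ j' = inj₂ (inj₁ (i' , j'))
    ... | inj₂ i' | inj₁ j' = inj₂ (inj₂ (i' , j'))

    same-s : ∀ {a b} → a ∈ lv s → Same F₂ a b → b ∈ lv s
    same-s i k = ∈-unr s (same-head u₂ (∈-unr⁻ s i) k)

    same-t : ∀ {a b} → a ∈ lv t → Same F₂ a b → b ∈ lv t
    same-t i k = ∈-unr t (same-head (unique-↭ (lvF-↭ p) u₂) (∈-unr⁻ t i) (same-≈ (≈perm p) k))
      where
      p : cutF s t R ↭ cutF t s R
      p = swap (unr s) (unr t) ↭-refl

    af-cut↑ : ∀ {F' col} → AF F₂ F' col → AF F₁ F' col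
    af-cut↑ {F'} {col} x = record { okˡ = record { blk = b ; dis = d } ; okʳ = okʳ x ; agr = g ; agr' = λ e f h z → sep-cut s t R (agr' x e f h z) }
      where
      o = okˡ x
      b : ∀ {a b} → a ∈ lvF F₁ → b ∈ lvF F₁ → col a ≡ col b → Same F₁ a b
      b i j e = same-cut s t R (blk o (to i) (to j) e)
      same₂ : ∀ {a b} → Same F₁ a b → col a ≡ col b → Same F₂ a b
      same₂ k e = blk o (to (same-∈ k)) (to (same-∈ (same-sym k))) e
      d : ∀ {a b c d} → Same F₁ a b → Same F₁ c d → Same F₁ a c → col a ≡ col b → col c ≡ col d → col a ≢ col c → SepF F₁ a b c d
      d k l m e f n with same-cases m
      ... | inj₁ m' = sep-cut s t R (dis o (same₂ k e) (same₂ l f) m' e f n)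
      ... | inj₂ (inj₁ (i , j)) = sep-root u i (same-s i (same₂ k e)) j (same-t j (same₂ l f))
      ... | inj₂ (inj₂ (i , j)) = sepF-swap (sep-root u j (same-s j (same₂ l f)) i (same-t i (same₂ k e)))
      g : Agr F₁ F' col
      g e f h z = let p , q , r = sepF-same z in agr x e f h (sep-cut⁻ s t R u z (same₂ p e) (same₂ q f) (same₂ r h))

    Unused : Colouring → Set
    Unused col = ∀ {a b} → a ∈ lv s → b ∈ lv t → col a ≢ col b

    af-cut↓ : ∀ {F' col} → Unused col → AF F₁ F' col → AF F₂ F' col
    af-cut↓ {F'} {col} un x = record { okˡ = record { blk = b ; dis = d } ; okʳ = okʳ x ; agr = λ e f h z → agr x e f h (sep-cut s t R z) ; agr' = g }
      where
      o = okˡ x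
      same₂ : ∀ {a b} → Same F₁ a b → col a ≡ col b → Same F₂ a b
      same₂ k e with same-cases k
      ... | inj₁ k' = k'
      ... | inj₂ (inj₁ (i , j)) = ⊥-elim (un i j e)
      ... | inj₂ (inj₂ (i , j)) = ⊥-elim (un j i (sym e))
      b : ∀ {a b} → a ∈ lvF F₂ → b ∈ lvF F₂ → col a ≡ col b → Same F₂ a b
      b i j e = same₂ (blk o (from i) (from j) e) e
      d : ∀ {a b c d} → Same F₂ a b → Same F₂ c d → Same F₂ a c → col a ≡ col b → col c ≡ col d → col a ≢ col c → SepF F₂ a b c d
      d k l m e f n = sep-cut⁻ s t R u (dis o (same-cut s t R k) (same-cut s t R l) (same-cut s t R m) e f n) k m (same-trans u₂ m l)
      g : Agr F' F₂ col
      g e f h z = let z' = agr' x e f h z ; p , q , r = sepF-same z' in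
        sep-cut⁻ s t R u z' (same₂ p e) (same₂ q f) (same₂ r h)

  record Restr (F F₂ : Forest) : Set where
    field
      lv⊆   : ∀ {x} → x ∈ lvF F₂ → x ∈ lvF F
      same↑ : ∀ {a b} → Same F₂ a b → Same F a b
      same↓ : ∀ {a b} → a ∈ lvF F₂ → b ∈ lvF F₂ → Same F a b → Same F₂ a b
      sep↑  : ∀ {a b c d} → SepF F₂ a b c d → SepF F a b c d
      sep↓  : ∀ {a b c d} → a ∈ lvF F₂ → b ∈ lvF F₂ → c ∈ lvF F₂ → d ∈ lvF F₂ → SepF F a b c d → SepF F₂ a b c d
  open Restr public

  sepF-∈ : ∀ {F a b c d} → SepF F a b c d → (a ∈ lvF F × b ∈ lvF F) × (c ∈ lvF F × d ∈ lvF F)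
  sepF-∈ z = let p , q , r = sepF-same z in (same-∈ p , same-∈ (same-sym p)) , (same-∈ (same-sym q) , same-∈ (same-sym r))

  ok-restr : ∀ {F F₂ col} → Restr F F₂ → Ok F col → Ok F₂ col
  ok-restr r o = record
    { blk = λ i j e → same↓ r i j (blk o (lv⊆ r i) (lv⊆ r j) e)
    ; dis = λ k l m e f n → sep↓ r (same-∈ k) (same-∈ (same-sym k)) (same-∈ l) (same-∈ (same-sym l))
        (dis o (same↑ r k) (same↑ r l) (same↑ r m) e f n) }

  agr-restr : ∀ {F F₂ F' F₂' col} → Restr F F₂ → Restr F' F₂' → (∀ {x} → x ∈ lvF F₂ → x ∈ lvF F₂') → Agr F F' col → Agr F₂ F₂' col
  agr-restr r r' k g e f h z = let (a , b) , (c , d) = sepF-∈ z in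
    sep↓ r' (k a) (k b) (k c) (k d) (g e f h (sep↑ r z))

  af-restr : ∀ {F F₂ F' F₂' col} → Restr F F₂ → Restr F' F₂' → lvF F₂ ↭ lvF F₂' → AF F F' col → AF F₂ F₂' col
  af-restr r r' p x = record
    { okˡ = ok-restr r (okˡ x) ; okʳ = ok-restr r' (okʳ x)
    ; agr = agr-restr r r' (∈-resp-↭ p) (agr x) ; agr' = agr-restr r' r (∈-resp-↭ (↭-sym p)) (agr' x) }

  restr-≈ : ∀ {F F' F₂} → Unique (lvF F) → F ≈ F' → Restr F' F₂ → Restr F F₂
  restr-≈ u p r = record
    { lv⊆ = ∈-resp-↭ (lvF-≈ q) ∘ lv⊆ r ; same↑ = same-≈ q ∘ same↑ r ; same↓ = λ i j k → same↓ r i j (same-≈ p k)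
    ; sep↑ = sepF-≈ q (unique-↭ (lvF-≈ p) u) ∘ sep↑ r ; sep↓ = λ i j k l z → sep↓ r i j k l (sepF-≈ p u z) }
    where q = ≈sym p

  restr-tail : ∀ {U R} → Unique (lvF (U ∷ R)) → Restr (U ∷ R) R
  restr-tail {U} u = record
    { lv⊆ = ∈-++⁺ʳ (lvU U) ; same↑ = there
    ; same↓ = λ { i j (here (k , _)) → ⊥-elim (unique-disjoint (lvU U) u k i) ; i j (there k) → k }
    ; sep↑ = there
    ; sep↓ = λ { i j k l (here (((m , _) , _) , _)) → ⊥-elim (unique-disjoint (lvU U) u m i) ; i j k l (there z) → z } }

  restr-leaf : ∀ {x t R} → Unique (lvF (edge (lf x) t ∷ R)) → Restr (edge (lf x) t ∷ R) (unr t ∷ R)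
  restr-leaf {x} {t} {R} u = record
    { lv⊆ = there ∘ sub ; same↑ = same-cut (lf x) t R ∘ there ; same↓ = s↓
    ; sep↑ = sep-cut (lf x) t R ∘ there
    ; sep↓ = λ i j k l z → let p , q , r = sepF-same z in
        tail (sep-cut⁻ (lf x) t R u z (there (s↓ i j p)) (there (s↓ i k q)) (there (s↓ i l r))) }
    where
    sub : ∀ {y} → y ∈ lvF (unr t ∷ R) → y ∈ lv t ++ lvF R
    sub = subst (_ ∈_) (cong (_++ lvF R) (lv-unr t))
    s↓ : ∀ {a b} → a ∈ lvF (unr t ∷ R) → b ∈ lvF (unr t ∷ R) → Same (edge (lf x) t ∷ R) a b → Same (unr t ∷ R) a b
    s↓ i j (here (here refl , _)) = ⊥-elim (unique-head u (sub i))
    s↓ i j (here (there _ , here refl)) = ⊥-elim (unique-head u (sub j))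
    s↓ i j (here (there k , there l)) = here (∈-unr⁻ t k , ∈-unr⁻ t l)
    s↓ i j (there k) = there k
    tail : ∀ {a b c d} → SepF (one x ∷ unr t ∷ R) a b c d → SepF (unr t ∷ R) a b c d
    tail (there z) = z

  data Rem (x : L) (F : Forest) : Forest → Set where
    isol : ∀ {R} → F ≈ one x ∷ R → Rem x F R
    pend : ∀ {t R} → F ≈ edge (lf x) t ∷ R → Rem x F (unr t ∷ R)

  rem-lv : ∀ {x F F₂} → Rem x F F₂ → lvF F ↭ x ∷ lvF F₂
  rem-lv (isol p) = lvF-≈ p
  rem-lv (pend {t} {R} p) = ↭-trans (lvF-≈ p) (↭-reflexive (sym (lvF-cut (lf _) t R)))

  rem-restr : ∀ {x F F₂} → Unique (lvF F) → Rem x F F₂ → Restr F F₂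
  rem-restr u (isol p) = restr-≈ u p (restr-tail (unique-↭ (lvF-≈ p) u))
  rem-restr u (pend p) = restr-≈ u p (restr-leaf (unique-↭ (lvF-≈ p) u))

  af-rem : ∀ {x F F' F₂ F₂' col} → Unique (lvF F) → lvF F ↭ lvF F' → Rem x F F₂ → Rem x F' F₂' → AF F F' col → AF F₂ F₂' col
  af-rem u p r r' = af-restr (rem-restr u r) (rem-restr (unique-↭ p u) r')
    (drop-∷ (↭-trans (↭-sym (rem-lv r)) (↭-trans p (rem-lv r'))))

  upd : Colouring → L → ℕ → Colouring
  upd col x c a with a ≟ x
  ... | yes _ = c
  ... | no _  = col a

  upd-≡ : ∀ col x c → upd col x c x ≡ c
  upd-≡ col x c with x ≟ x
  ... | yes _ = refl
  ... | no n  = ⊥-elim (n refl)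

  upd-≢ : ∀ col {x c a} → a ≢ x → upd col x c a ≡ col a
  upd-≢ col {x} {a = a} n with a ≟ x
  ... | yes e = ⊥-elim (n e)
  ... | no _  = refl

  fresh : ∀ (R : List ℕ) → ∃ λ c → c ∉ R
  fresh R = suc (sum R) , λ i → n≮n _ (≤-trans (s≤s (bound R i)) ≤-refl)
    where
    bound : ∀ {n} R → n ∈ R → n ≤ sum R
    bound (x ∷ R) (here refl) = m≤m+n x (sum R)
    bound (x ∷ R) (there i)   = ≤-trans (bound R i) (m≤n+m (sum R) x)

  ok-one : ∀ {x F col col'} → Unique (lvF (one x ∷ F)) → (∀ {a} → a ∈ lvF F → col' a ≡ col a) →
    (∀ {a} → a ∈ lvF F → col' a ≢ col' x) → Ok F col → Ok (one x ∷ F) col'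
  ok-one {x} {F} {col} {col'} u eq ne o = record { blk = b ; dis = d }
    where
    conv : ∀ {a b} → a ∈ lvF F → b ∈ lvF F → col' a ≡ col' b → col a ≡ col b
    conv i j e = Eq.trans (sym (eq i)) (Eq.trans e (eq j))
    b : ∀ {a b} → a ∈ lvF (one x ∷ F) → b ∈ lvF (one x ∷ F) → col' a ≡ col' b → Same (one x ∷ F) a b
    b (here refl) (here refl) e = here (here refl , here refl)
    b (here refl) (there j)   e = ⊥-elim (ne j (sym e))
    b (there i)   (here refl) e = ⊥-elim (ne i e)
    b (there i)   (there j)   e = there (blk o i j (conv i j e))
    d : ∀ {a b c d} → Same (one x ∷ F) a b → Same (one x ∷ F) c d → Same (one x ∷ F) a c → col' a ≡ col' b → col' c ≡ col' d → col' a ≢ col' c → SepF (one x ∷ F) a b c d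
    d k l (here (here refl , here refl)) e f n = ⊥-elim (n refl)
    d (here (here refl , _)) l (there m) e f n = ⊥-elim (unique-head u (same-∈ m))
    d (there k) (here (here refl , _)) (there m) e f n = ⊥-elim (unique-head u (same-∈ (same-sym m)))
    d (there k) (there l) (there m) e f n =
      let k₁ = same-∈ k ; k₂ = same-∈ (same-sym k) ; l₁ = same-∈ l ; l₂ = same-∈ (same-sym l) in
      there (dis o k l m (conv k₁ k₂ e) (conv l₁ l₂ f) (λ h → n (Eq.trans (eq k₁) (Eq.trans h (sym (eq l₁))))))

  af-one : ∀ {x F F' col c} → Unique (lvF (one x ∷ F)) → lvF F ↭ lvF F' → (∀ {a} → a ∈ lvF F → col a ≢ c) →
    AF F F' col → AF (one x ∷ F) (one x ∷ F') (upd col x c)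
  af-one {x} {F} {F'} {col} {c} u p ne w = record
    { okˡ = ok-one u eq n (okˡ w)
    ; okʳ = ok-one (unique-↭ (prep x p) u) (eq ∘ ∈-resp-↭ q) (n ∘ ∈-resp-↭ q) (okʳ w)
    ; agr = g (agr w) (λ i → i) ; agr' = g (agr' w) (∈-resp-↭ q) }
    where
    q = ↭-sym p
    eq : ∀ {a} → a ∈ lvF F → upd col x c a ≡ col a
    eq i = upd-≢ col (λ { refl → unique-head u i })
    n : ∀ {a} → a ∈ lvF F → upd col x c a ≢ upd col x c x
    n i e = ne i (Eq.trans (sym (eq i)) (Eq.trans e (upd-≡ col x c)))
    g : ∀ {F₁ F₂} → Agr F₁ F₂ col → (∀ {a} → a ∈ lvF F₁ → a ∈ lvF F) → Agr (one x ∷ F₁) (one x ∷ F₂) (upd col x c)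
    g {F₁} h k e f r (there z) = let (i , j) , (l , m) = sepF-∈ z in there (h (cv i j e) (cv i l f) (cv i m r) z)
      where
      cv : ∀ {a b} → a ∈ lvF F₁ → b ∈ lvF F₁ → upd col x c a ≡ upd col x c b → col a ≡ col b
      cv i j e = Eq.trans (sym (eq (k i))) (Eq.trans e (eq (k j)))

  data ChTop (y : L) : Tr → Set where
    two  : ChTop y (lf y)
    more : ∀ {r} → ChTop y (nd (lf y) r)

  chtop-∈ : ∀ {y t} → ChTop y t → y ∈ lv t
  chtop-∈ two  = here refl
  chtop-∈ more = here refl

  LeafSplit : L → L → L → L → L → Set
  LeafSplit z a b c d = (a ≡ z × b ≡ z × c ≢ z × d ≢ z) ⊎ (c ≡ z × d ≡ z × a ≢ z × b ≢ z)

  leafSplit-sep : ∀ {F z a b c d} → Unique (lvF F) → Same F a b → Same F a c → Same F a d → LeafSplit z a b c d → SepF F a b c d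
  leafSplit-sep u p q r (inj₁ (refl , refl , n , m)) = sep-leaf u q r (n ∘ sym) (m ∘ sym)
  leafSplit-sep u p q r (inj₂ (refl , refl , n , m)) = sepF-swap (sep-leaf u (same-sym q) (same-trans u (same-sym q) p) (n ∘ sym) (m ∘ sym))

  module CherryExt (x y : L) where

    ρ : L → L
    ρ a with a ≟ x
    ... | yes _ = y
    ... | no _  = a

    ρ-cases : ∀ a → (a ≡ x × ρ a ≡ y) ⊎ (a ≢ x × ρ a ≡ a)
    ρ-cases a with a ≟ x
    ... | yes e = inj₁ (e , refl)
    ... | no n  = inj₂ (n , refl)

    upd-ρ : ∀ col a → upd col x (col y) a ≡ col (ρ a)
    upd-ρ col a with a ≟ x
    ... | yes _ = refl
    ... | no _  = refl

    module _ (r : Tr) (x∉r : x ∉ lv r) (y∉r : y ∉ lv r) {w} (p : w ⊑ r) where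
      sub-ρ : ∀ {a} → ρ a ∈ lv w → a ∈ lv w
      sub-ρ {a} i with ρ-cases a
      ... | inj₁ (_ , e) = ⊥-elim (y∉r (⊑-lv p (subst (_∈ lv w) e i)))
      ... | inj₂ (_ , e) = subst (_∈ lv w) e i

      sub-ρ⁻ : ∀ {a} → a ∈ lv w → ρ a ∈ lv w
      sub-ρ⁻ {a} i with ρ-cases a
      ... | inj₁ (refl , _) = ⊥-elim (x∉r (⊑-lv p i))
      ... | inj₂ (_ , e) = subst (_∈ lv w) (sym e) i

      split-ρ : ∀ {a b c d} → Splits w (ρ a) (ρ b) (ρ c) (ρ d) → Splits w a b c d
      split-ρ ((i , j) , (k , l)) = (sub-ρ i , sub-ρ j) , (k ∘ sub-ρ⁻ , l ∘ sub-ρ⁻)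

      split-ρ⁻ : ∀ {a b c d} → Splits w a b c d → Splits w (ρ a) (ρ b) (ρ c) (ρ d)
      split-ρ⁻ ((i , j) , (k , l)) = (sub-ρ⁻ i , sub-ρ⁻ j) , (k ∘ sub-ρ , l ∘ sub-ρ)

    module _ {t R} (ch : ChTop y t) (u : Unique (lvF (edge (lf x) t ∷ R))) where
      private
        F₁ = edge (lf x) t ∷ R
        F₂ = unr t ∷ R
        rs = restr-leaf {x} {t} {R} u
        x∉ : x ∉ lv t ++ lvF R
        x∉ = unique-head u
        y∈ : y ∈ lv t
        y∈ = chtop-∈ ch
        y∉R : y ∉ lvF R
        y∉R i = unique-disjoint (lv t) (unique-++ʳ (x ∷ []) u) y∈ i

      ρ-in : ∀ {a} → a ∈ x ∷ lv t → ρ a ∈ lv t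
      ρ-in {a} i with ρ-cases a
      ρ-in {a} i | inj₁ (_ , e) rewrite e = y∈
      ρ-in {a} (here e) | inj₂ (n , _) = ⊥-elim (n e)
      ρ-in {a} (there i) | inj₂ (_ , e) rewrite e = i

      ρ-out : ∀ {a} → ρ a ∈ lv t → a ∈ x ∷ lv t
      ρ-out {a} i with ρ-cases a
      ... | inj₁ (refl , _) = here refl
      ... | inj₂ (_ , e) rewrite e = there i

      ρ-R : ∀ {a} → ρ a ∈ lvF R → ρ a ≡ a
      ρ-R {a} i with ρ-cases a
      ... | inj₁ (_ , e) = ⊥-elim (y∉R (subst (_∈ lvF R) e i))
      ... | inj₂ (_ , e) = e

      ρ-R⁻ : ∀ {a} → a ∈ lvF R → ρ a ≡ a
      ρ-R⁻ {a} i with ρ-cases a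
      ... | inj₁ (refl , _) = ⊥-elim (x∉ (∈-++⁺ʳ (lv t) i))
      ... | inj₂ (_ , e) = e

      ρ-lv : ∀ {a} → a ∈ lvF F₁ → ρ a ∈ lvF F₂
      ρ-lv {a} i with ∈-++⁻ (x ∷ lv t) i
      ... | inj₁ j = ∈-++⁺ˡ (∈-unr⁻ t (ρ-in j))
      ... | inj₂ j = ∈-++⁺ʳ (lvU (unr t)) (subst (_∈ lvF R) (sym (ρ-R⁻ j)) j)

      same-ρ : ∀ {a b} → Same F₂ (ρ a) (ρ b) → Same F₁ a b
      same-ρ (here (i , j)) = here (ρ-out (∈-unr t i) , ρ-out (∈-unr t j))
      same-ρ (there k) = there (Eq.subst₂ (Same R) (ρ-R (same-∈ k)) (ρ-R (same-∈ (same-sym k))) k)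

      same-ρ⁻ : ∀ {a b} → Same F₁ a b → Same F₂ (ρ a) (ρ b)
      same-ρ⁻ (here (i , j)) = here (∈-unr⁻ t (ρ-in i) , ∈-unr⁻ t (ρ-in j))
      same-ρ⁻ (there k) = there (Eq.subst₂ (Same R) (sym (ρ-R⁻ (same-∈ k))) (sym (ρ-R⁻ (same-∈ (same-sym k)))) k)

      tail-ρ : ∀ {a b c d} → ρ a ≡ a → ρ b ≡ b → ρ c ≡ c → ρ d ≡ d → SepF R (ρ a) (ρ b) (ρ c) (ρ d) → SepF R a b c d
      tail-ρ p q r s z rewrite p | q | r | s = z

      tail-ρ⁻ : ∀ {a b c d} → ρ a ≡ a → ρ b ≡ b → ρ c ≡ c → ρ d ≡ d → SepF R a b c d → SepF R (ρ a) (ρ b) (ρ c) (ρ d)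
      tail-ρ⁻ p q r s z rewrite p | q | r | s = z

      sepT-ρ : ∀ {t} → ChTop y t → Unique (x ∷ lv t) → ∀ {a b c d} → In₄ (unr t) (ρ a) (ρ b) (ρ c) (ρ d) →
        Sep (unr t) (ρ a) (ρ b) (ρ c) (ρ d) → Sep (edge (lf x) t) a b c d
      sepT-ρ (more {r}) v {a} {b} {c} {d} ((i , j) , (k , l)) (w , q , s) = go q s
        where
        x∉r : x ∉ lv r
        x∉r i = unique-head v (there i)
        y∉r : y ∉ lv r
        y∉r i = unique-head (unique-++ʳ (x ∷ []) v) i
        out : ∀ {a} → ρ a ∈ y ∷ [] → a ∉ lv r
        out {a} (here e) i with ρ-cases a
        ... | inj₁ (refl , _) = x∉r i
        ... | inj₂ (_ , e') = y∉r (subst (_∈ lv r) (Eq.trans (sym e') e) i)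
        inn : ∀ {a} → ρ a ∈ y ∷ lv r → ρ a ∉ y ∷ [] → a ∈ lv r
        inn {a} (here e) n = ⊥-elim (n (here e))
        inn {a} (there i) n = sub-ρ r x∉r y∉r top i
        go : w ⊑ lf y ⊎ w ⊑ r → SepBy w (ρ a) (ρ b) (ρ c) (ρ d) → Sep (edge (lf x) (nd (lf y) r)) a b c d
        go (inj₁ top) (inj₁ ((i' , j') , (k' , l'))) = r , inj₂ (inr top) , inj₂ ((inn k k' , inn l l') , (out i' , out j'))
        go (inj₁ top) (inj₂ ((k' , l') , (i' , j'))) = r , inj₂ (inr top) , inj₁ ((inn i i' , inn j j') , (out k' , out l'))
        go (inj₂ p) s = w , inj₂ (inr p) , Sum.map (split-ρ r x∉r y∉r p) (split-ρ r x∉r y∉r p) s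

      sepT-ρ⁻ : ∀ {t} → ChTop y t → Unique (x ∷ lv t) → ∀ {a b c d} → In₄ (edge (lf x) t) a b c d → Sep (edge (lf x) t) a b c d →
        (∃ λ z → LeafSplit z a b c d) ⊎ Sep (unr t) (ρ a) (ρ b) (ρ c) (ρ d)
      sepT-ρ⁻ ct v _ (._ , inj₁ top , inj₁ ((here e , here f) , (n , m))) = inj₁ (x , inj₁ (e , f , n ∘ here , m ∘ here))
      sepT-ρ⁻ ct v _ (._ , inj₁ top , inj₂ ((here e , here f) , (n , m))) = inj₁ (x , inj₂ (e , f , n ∘ here , m ∘ here))
      sepT-ρ⁻ two v _ (._ , inj₂ top , inj₁ ((here e , here f) , (n , m))) = inj₁ (y , inj₁ (e , f , n ∘ here , m ∘ here))
      sepT-ρ⁻ two v _ (._ , inj₂ top , inj₂ ((here e , here f) , (n , m))) = inj₁ (y , inj₂ (e , f , n ∘ here , m ∘ here))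
      sepT-ρ⁻ more v (_ , (here e , here f)) (._ , inj₂ top , inj₁ ((i , j) , _)) =
        inj₁ (x , inj₂ (e , f , (λ { refl → unique-head v i }) , (λ { refl → unique-head v j })))
      sepT-ρ⁻ more v (_ , (there k , _)) (._ , inj₂ top , inj₁ (_ , (n , m))) = ⊥-elim (n k)
      sepT-ρ⁻ more v (_ , (here _ , there k)) (._ , inj₂ top , inj₁ (_ , (n , m))) = ⊥-elim (m k)
      sepT-ρ⁻ more v ((here e , here f) , _) (._ , inj₂ top , inj₂ ((i , j) , _)) =
        inj₁ (x , inj₁ (e , f , (λ { refl → unique-head v i }) , (λ { refl → unique-head v j })))
      sepT-ρ⁻ more v ((there k , _) , _) (._ , inj₂ top , inj₂ (_ , (n , m))) = ⊥-elim (n k)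
      sepT-ρ⁻ more v ((here _ , there k) , _) (._ , inj₂ top , inj₂ (_ , (n , m))) = ⊥-elim (m k)
      sepT-ρ⁻ more v _ (._ , inj₂ (inl top) , inj₁ ((here e , here f) , (n , m))) = inj₁ (y , inj₁ (e , f , n ∘ here , m ∘ here))
      sepT-ρ⁻ more v _ (._ , inj₂ (inl top) , inj₂ ((here e , here f) , (n , m))) = inj₁ (y , inj₂ (e , f , n ∘ here , m ∘ here))
      sepT-ρ⁻ (more {r}) v _ (w , inj₂ (inr p) , s) = inj₂ (w , inj₂ p , Sum.map (split-ρ⁻ r x∉r y∉r p) (split-ρ⁻ r x∉r y∉r p) s)
        where
        x∉r : x ∉ lv r
        x∉r i = unique-head v (there i)
        y∉r : y ∉ lv r
        y∉r i = unique-head (unique-++ʳ (x ∷ []) v) i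

      sep-ρ : ∀ {a b c d} → SepF F₂ (ρ a) (ρ b) (ρ c) (ρ d) → SepF F₁ a b c d
      sep-ρ (here (q@((i , j) , (k , l)) , s)) = here (((f i , f j) , (f k , f l)) , sepT-ρ ch (unique-++ˡ (x ∷ lv t) u) q s)
        where
        f : ∀ {a} → ρ a ∈ lvU (unr t) → a ∈ x ∷ lv t
        f i = ρ-out (∈-unr t i)
      sep-ρ (there z) = let (i , j) , (k , l) = sepF-∈ z in
        there (tail-ρ (ρ-R i) (ρ-R j) (ρ-R k) (ρ-R l) z)

      sep-ρ⁻ : ∀ {a b c d} → SepF F₁ a b c d → (∃ λ z → LeafSplit z a b c d) ⊎ SepF F₂ (ρ a) (ρ b) (ρ c) (ρ d)
      sep-ρ⁻ (here (q@((i , j) , (k , l)) , s)) = Sum.map id (λ z → here (((f i , f j) , (f k , f l)) , z)) (sepT-ρ⁻ ch (unique-++ˡ (x ∷ lv t) u) q s)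
        where
        f : ∀ {a} → a ∈ x ∷ lv t → ρ a ∈ lvU (unr t)
        f i = ∈-unr⁻ t (ρ-in i)
      sep-ρ⁻ (there z) = let (i , j) , (k , l) = sepF-∈ z in
        inj₂ (there (tail-ρ⁻ (ρ-R⁻ i) (ρ-R⁻ j) (ρ-R⁻ k) (ρ-R⁻ l) z))

      ok-cherry : ∀ {col} → Ok F₂ col → Ok F₁ (upd col x (col y))
      ok-cherry {col} o = record
        { blk = λ {a} {b} i j e → same-ρ {a} {b} (blk o (ρ-lv i) (ρ-lv j) (cv a b e))
        ; dis = λ {a} {b} {c} {d} k l m e f n → sep-ρ {a} {b} {c} {d} (dis o (same-ρ⁻ k) (same-ρ⁻ l) (same-ρ⁻ m) (cv a b e) (cv c d f)
            (λ h → n (Eq.trans (upd-ρ col a) (Eq.trans h (sym (upd-ρ col c)))))) }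
        where
        cv : ∀ a b → upd col x (col y) a ≡ upd col x (col y) b → col (ρ a) ≡ col (ρ b)
        cv a b e = Eq.trans (sym (upd-ρ col a)) (Eq.trans e (upd-ρ col b))

    agr-cherry : ∀ {t R t' R' col} (ch : ChTop y t) (u : Unique (lvF (edge (lf x) t ∷ R)))
      (ch' : ChTop y t') (u' : Unique (lvF (edge (lf x) t' ∷ R'))) → lvF (edge (lf x) t ∷ R) ↭ lvF (edge (lf x) t' ∷ R') →
      Ok (unr t' ∷ R') col → Agr (unr t ∷ R) (unr t' ∷ R') col → Agr (edge (lf x) t ∷ R) (edge (lf x) t' ∷ R') (upd col x (col y))
    agr-cherry {t} {R} {t'} {R'} {col} ch u ch' u' p o g {a} {b} {c} {d} e f h z with sep-ρ⁻ ch u z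
    ... | inj₂ z' = sep-ρ ch' u' {a} {b} {c} {d} (g (cv b e) (cv c f) (cv d h) z')
      where
      cv : ∀ b → upd col x (col y) a ≡ upd col x (col y) b → col (ρ a) ≡ col (ρ b)
      cv b e = Eq.trans (sym (upd-ρ col a)) (Eq.trans e (upd-ρ col b))
    ... | inj₁ (w , ls) = let (i , j) , (k , l) = sepF-∈ z ; o' = ok-cherry ch' u' o in
      leafSplit-sep u' (blk o' (to i) (to j) e) (blk o' (to i) (to k) f) (blk o' (to i) (to l) h) ls
      where
      to : ∀ {a} → a ∈ lvF (edge (lf x) t ∷ R) → a ∈ lvF (edge (lf x) t' ∷ R')
      to = ∈-resp-↭ p

  af-cherry : ∀ {x y t R t' R' col} → ChTop y t → ChTop y t' → Unique (lvF (edge (lf x) t ∷ R)) →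
    lvF (edge (lf x) t ∷ R) ↭ lvF (edge (lf x) t' ∷ R') → AF (unr t ∷ R) (unr t' ∷ R') col →
    AF (edge (lf x) t ∷ R) (edge (lf x) t' ∷ R') (upd col x (col y))
  af-cherry {x} {y} ch ch' u p w = record
    { okˡ = ok-cherry ch u (okˡ w) ; okʳ = ok-cherry ch' u' (okʳ w)
    ; agr = agr-cherry ch u ch' u' p (okʳ w) (agr w) ; agr' = agr-cherry ch' u' ch u (↭-sym p) (okˡ w) (agr' w) }
    where
    open CherryExt x y
    u' = unique-↭ p u

  Crossing : Tr → Tr → Colouring → Set
  Crossing s t col = ∃ λ a → ∃ λ b → a ∈ lv s × b ∈ lv t × col a ≡ col b

  crossing? : ∀ s t col → Crossing s t col ⊎ (∀ {a b} → a ∈ lv s → b ∈ lv t → col a ≢ col b)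
  crossing? s t col with any? (λ a → any? (λ b → col a ℕ.≟ col b) (lv t)) (lv s)
  ... | yes p = let a , i , q = find p ; b , j , e = find q in inj₁ (a , b , i , j , e)
  ... | no n  = inj₂ (λ i j e → n (lose i (lose j e)))

  -- Blocks are disjoint subtrees, so at most one block uses a given edge; splitting that block makes the edge cuttable.
  af-split : ∀ {s t R F' col C} → Unique (lvF (edge s t ∷ R)) → AF (edge s t ∷ R) F' col → Cover (edge s t ∷ R) col C →
    lvF F' ↭ lvF (edge s t ∷ R) →
    ∃ λ col' → ∃ λ C' → AF (cutF s t R) F' col' × Cover (cutF s t R) col' C' × length C' ≤ suc (length C)
  af-split {s} {t} {R} {F'} {col} {C} u x cov lv≡ with crossing? s t col
  ... | inj₂ un = col , C , af-cut↓ s t R u un x , (λ i → cov (subst (_ ∈_) (lvF-cut s t R) i)) , n≤1+n _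
  ... | inj₁ (a₀ , b₀ , a₀∈ , b₀∈ , e₀) = col' , c ∷ C , af-cut↓ s t R u unused x' , cov' , ≤-refl
    where
    F = edge s t ∷ R
    c : ℕ
    c = proj₁ (fresh C)
    c∉ : c ∉ C
    c∉ = proj₂ (fresh C)
    P : L → Set
    P a = col a ≡ col a₀ × a ∈ lv s
    P? : ∀ a → Dec (P a)
    P? a = (col a ℕ.≟ col a₀) ×-dec (a ∈? lv s)
    col' : Colouring
    col' a with P? a
    ... | yes _ = c
    ... | no _  = col a
    spec : ∀ a → (P a × col' a ≡ c) ⊎ (¬ P a × col' a ≡ col a)
    spec a with P? a
    ... | yes p = inj₁ (p , refl)
    ... | no n  = inj₂ (n , refl)
    eq' : ∀ {a b} → a ∈ lvF F → b ∈ lvF F → col' a ≡ col' b → (P a × P b) ⊎ (¬ P a × ¬ P b × col a ≡ col b)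
    eq' {a} {b} i j e with spec a | spec b
    ... | inj₁ (p , _) | inj₁ (q , _) = inj₁ (p , q)
    ... | inj₂ (p , f) | inj₂ (q , g) = inj₂ (p , q , Eq.trans (sym f) (Eq.trans e g))
    ... | inj₁ (p , f) | inj₂ (q , g) = ⊥-elim (c∉ (subst (_∈ C) (Eq.trans (sym g) (Eq.trans (sym e) f)) (cov j)))
    ... | inj₂ (p , f) | inj₁ (q , g) = ⊥-elim (c∉ (subst (_∈ C) (Eq.trans (sym f) (Eq.trans e g)) (cov i)))
    eq : ∀ {a b} → a ∈ lvF F → b ∈ lvF F → col' a ≡ col' b → col a ≡ col b
    eq i j e with eq' i j e
    ... | inj₁ ((p , _) , (q , _)) = Eq.trans p (sym q)
    ... | inj₂ (_ , _ , g) = g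
    inT : ∀ {a} → a ∈ lvF F → col a ≡ col a₀ → ¬ P a → a ∈ lv t
    inT i e n = not-in (same-head u (∈-++⁺ˡ a₀∈) (blk (okˡ x) (∈-++⁺ˡ (∈-++⁺ˡ a₀∈)) i (sym e))) (λ j → n (e , j))
    ne : ∀ {a c} → col' a ≢ col' c → P a → ¬ P c
    ne {a} {c} n p q with spec a | spec c
    ... | inj₁ (_ , f) | inj₁ (_ , g) = n (Eq.trans f (sym g))
    ... | inj₂ (p' , _) | _ = p' p
    ... | inj₁ _ | inj₂ (q' , _) = q' q
    both : ∀ {a c} → col' a ≢ col' c → col a ≡ col c → ¬ P a → P c
    both {a} {c} n e p with spec a | spec c
    ... | inj₁ (p' , _) | _ = ⊥-elim (p p')
    ... | inj₂ _ | inj₁ (q , _) = q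
    ... | inj₂ (_ , f) | inj₂ (_ , g) = ⊥-elim (n (Eq.trans f (Eq.trans e (sym g))))
    sepF : ∀ {a b c d} → a ∈ lvF F → b ∈ lvF F → c ∈ lvF F → d ∈ lvF F → col' a ≡ col' b → col' c ≡ col' d → col' a ≢ col' c →
      col a ≡ col c → SepF F a b c d
    sepF {a} i j k l e f n g with eq' i j e | eq' k l f
    ... | inj₁ (p , q) | inj₁ (r , _) = ⊥-elim (ne n p r)
    ... | inj₁ (p , q) | inj₂ (r , r' , h) = sep-root u (proj₂ p) (proj₂ q) (inT k (Eq.trans (sym g) (proj₁ p)) r)
            (inT l (Eq.trans (sym h) (Eq.trans (sym g) (proj₁ p))) r')
    ... | inj₂ (p , q , h) | inj₁ (r , r') = sepF-swap (sep-root u (proj₂ r) (proj₂ r') (inT i (Eq.trans g (proj₁ r)) p)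
            (inT j (Eq.trans (sym h) (Eq.trans g (proj₁ r))) q))
    ... | inj₂ (p , q , h) | inj₂ (r , r' , h') = ⊥-elim (r (both n g p))
    to : ∀ {a} → a ∈ lvF F' → a ∈ lvF F
    to = ∈-resp-↭ lv≡
    x' : AF F F' col'
    x' = record
      { okˡ = record { blk = λ i j e → blk (okˡ x) i j (eq i j e) ; dis = d }
      ; okʳ = record { blk = λ i j e → blk (okʳ x) i j (eq (to i) (to j) e) ; dis = d' }
      ; agr = λ e f g z → let (i , j) , (k , l) = sepF-∈ z in agr x (eq i j e) (eq i k f) (eq i l g) z
      ; agr' = λ e f g z → let (i , j) , (k , l) = sepF-∈ z in agr' x (eq (to i) (to j) e) (eq (to i) (to k) f) (eq (to i) (to l) g) z }
      where
      d : ∀ {a b c d} → Same F a b → Same F c d → Same F a c → col' a ≡ col' b → col' c ≡ col' d → col' a ≢ col' c → SepF F a b c d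
      d {a} {b} {c} {d} k l m e f n with col a ℕ.≟ col c
      ... | yes g = sepF (same-∈ k) (same-∈ (same-sym k)) (same-∈ l) (same-∈ (same-sym l)) e f n g
      ... | no g  = dis (okˡ x) k l m (eq (same-∈ k) (same-∈ (same-sym k)) e) (eq (same-∈ l) (same-∈ (same-sym l)) f) g
      d' : ∀ {a b c d} → Same F' a b → Same F' c d → Same F' a c → col' a ≡ col' b → col' c ≡ col' d → col' a ≢ col' c → SepF F' a b c d
      d' {a} {b} {c} {d} k l m e f n with col a ℕ.≟ col c
      ... | no g  = dis (okʳ x) k l m (eq (to (same-∈ k)) (to (same-∈ (same-sym k))) e) (eq (to (same-∈ l)) (to (same-∈ (same-sym l))) f) g
      ... | yes g = let i = to (same-∈ k) ; j = to (same-∈ (same-sym k)) ; p = to (same-∈ l) ; q = to (same-∈ (same-sym l)) in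
        agr x (eq i j e) g (Eq.trans g (eq p q f)) (sepF i j p q e f n g)
    unused : ∀ {a b} → a ∈ lv s → b ∈ lv t → col' a ≢ col' b
    unused {a} {b} i j e with eq' (∈-++⁺ˡ (∈-++⁺ˡ i)) (∈-++⁺ˡ (∈-++⁺ʳ (lv s) j)) e
    ... | inj₁ (_ , (_ , k)) = unique-disjoint (lv s) (unique-++ˡ (lv s ++ lv t) u) k j
    ... | inj₂ (p , _ , g) = sepF-compat u (sep-root u i a₀∈ j b₀∈)
            (dis (okˡ x) (here (∈-++⁺ˡ i , ∈-++⁺ʳ (lv s) j)) (here (∈-++⁺ˡ a₀∈ , ∈-++⁺ʳ (lv s) b₀∈)) (here (∈-++⁺ˡ i , ∈-++⁺ˡ a₀∈))
              g e₀ (λ h → p (h , i)))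
    cov' : Cover (cutF s t R) col' (c ∷ C)
    cov' {a} i with spec a
    ... | inj₁ (_ , e) = here e
    ... | inj₂ (_ , e) = there (subst (_∈ C) (sym e) (cov (subst (_ ∈_) (lvF-cut s t R) i)))

  Mono : Colouring → Ut → Set
  Mono col T = ∀ {a b} → a ∈ lvU T → b ∈ lvU T → col a ≡ col b

  Cuttable : Colouring → Ut → Set
  Cuttable col T = ∃ λ s → ∃ λ t → T ~ edge s t × (∀ {a b} → a ∈ lv s → b ∈ lv t → col a ≢ col b)

  cuttable-~ : ∀ {col T T'} → T ~ T' → Cuttable col T' → Cuttable col T
  cuttable-~ p (s , t , q , n) = s , t , p ◅◅ q , n

  search : ∀ {R col} s t → Unique (lvF (edge s t ∷ R)) → Ok (edge s t ∷ R) col → (w : Crossing s t col) →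
    Cuttable col (edge s t) ⊎ (∀ {z} → z ∈ lv s → col z ≡ col (proj₁ w))
  search (lf x) t u o (_ , _ , here refl , _) = inj₂ (λ { (here refl) → refl })
  search {R} {col} (nd p q) t u o (a , b , i , j , e) with crossing? p (nd q t) col | crossing? q (nd p t) col
  ... | inj₂ n | _ = inj₁ (p , nd q t , ~rot , n)
  ... | inj₁ _ | inj₂ n = inj₁ (q , nd p t , ~flip ◅◅ ~rot , n)
  ... | inj₁ w₁@(a₁ , b₁ , i₁ , j₁ , e₁) | inj₁ w₂@(a₂ , b₂ , i₂ , j₂ , e₂)
    with search p (nd q t) (unique-↭ (lvF-≈ r₁) u) (ok-≈ u r₁ o) w₁ | search q (nd p t) (unique-↭ (lvF-≈ r₂) u) (ok-≈ u r₂ o) w₂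
    where
    r₁ : edge (nd p q) t ∷ R ≈ edge p (nd q t) ∷ R
    r₁ = ≈head ~rot
    r₂ : edge (nd p q) t ∷ R ≈ edge q (nd p t) ∷ R
    r₂ = ≈head (~flip ◅◅ ~rot)
  ... | inj₁ k | _ = inj₁ (cuttable-~ ~rot k)
  ... | inj₂ _ | inj₁ k = inj₁ (cuttable-~ (~flip ◅◅ ~rot) k)
  ... | inj₂ m₁ | inj₂ m₂ = inj₂ mono
    where
    same : col a₁ ≡ col a₂
    same with ∈-++⁻ (lv q) j₁ | ∈-++⁻ (lv p) j₂
    ... | inj₁ k | _ = Eq.trans e₁ (m₂ k)
    ... | inj₂ _ | inj₁ k = sym (Eq.trans e₂ (m₁ k))
    ... | inj₂ k₁ | inj₂ k₂ with col a₁ ℕ.≟ col a₂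
    ...   | yes f = f
    ...   | no n  = ⊥-elim (sepF-compat u (sep-root u (∈-++⁺ˡ i₁) (∈-++⁺ʳ (lv p) i₂) k₁ k₂)
              (dis o (here (∈-++⁺ˡ (∈-++⁺ˡ i₁) , ∈-++⁺ʳ (lv (nd p q)) k₁)) (here (∈-++⁺ˡ (∈-++⁺ʳ (lv p) i₂) , ∈-++⁺ʳ (lv (nd p q)) k₂))
                (here (∈-++⁺ˡ (∈-++⁺ˡ i₁) , ∈-++⁺ˡ (∈-++⁺ʳ (lv p) i₂))) e₁ e₂ n))
    to₁ : ∀ {z} → z ∈ lv p ++ lv q → col z ≡ col a₁
    to₁ k with ∈-++⁻ (lv p) k
    ... | inj₁ l = m₁ l
    ... | inj₂ l = Eq.trans (m₂ l) (sym same)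
    mono : ∀ {z} → z ∈ lv p ++ lv q → col z ≡ col a
    mono k = Eq.trans (to₁ k) (sym (to₁ i))

  mono-or-cuttable : ∀ {R col} T → Unique (lvF (T ∷ R)) → Ok (T ∷ R) col → Mono col T ⊎ Cuttable col T
  mono-or-cuttable (one x) u o = inj₁ (λ { (here refl) (here refl) → refl })
  mono-or-cuttable {R} {col} (edge s t) u o with crossing? s t col
  ... | inj₂ n = inj₂ (s , t , ε , n)
  ... | inj₁ w@(a , b , i , j , e) with search s t u o w | search t s (unique-↭ (lvF-≈ r) u) (ok-≈ u r o) (b , a , j , i , sym e)
    where
    r : edge s t ∷ R ≈ edge t s ∷ R
    r = ≈head ~swp
  ... | inj₁ k | _ = inj₂ k
  ... | inj₂ _ | inj₁ k = inj₂ (cuttable-~ ~swp k)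
  ... | inj₂ m | inj₂ n = inj₁ (λ p q → Eq.trans (f p) (sym (f q)))
    where
    f : ∀ {z} → z ∈ lv s ++ lv t → col z ≡ col a
    f p with ∈-++⁻ (lv s) p
    ... | inj₁ q = m q
    ... | inj₂ q = Eq.trans (n q) (sym e)

  Decomposed : Ut → Forest → Forest → Colouring → Set
  Decomposed T R F' col = ∃ λ G → Decomp T G × All (Mono col) G × AF (G ++ R) F' col × lvF (G ++ R) ↭ lvF (T ∷ R)

  decompose-merge : ∀ {T s t R F' col} G → T ~ edge s t → Unique (lvF (T ∷ R)) → Decomp (unr s) G → All (Mono col) G →
    lvF (G ++ unr t ∷ R) ↭ lvF (T ∷ R) → Decomposed (unr t) (G ++ R) F' col → Decomposed T R F' col
  decompose-merge {T} {t = t} {R} G p u D M q (G' , D' , M' , y , q') = G ++ G' , cut p D D' , All.++⁺ M M' , af-≈ (unique-↭ (↭-sym lv') u) (≈perm r) y , ↭-trans (lvF-↭ (↭-sym r)) lv'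
    where
    r : G' ++ G ++ R ↭ (G ++ G') ++ R
    r = ↭-trans (shifts G' G) (↭-reflexive (sym (List.++-assoc G G' R)))
    lv' : lvF (G' ++ G ++ R) ↭ lvF (T ∷ R)
    lv' = ↭-trans q' (↭-trans (lvF-↭ (↭-sym (shift (unr t) G R))) q)

  decompose       : ∀ n {T R F' col} → szU T ≤ n → Unique (lvF (T ∷ R)) → AF (T ∷ R) F' col → Decomposed T R F' col
  decompose-cut   : ∀ n {T R F' col} → szU T ≤ n → Unique (lvF (T ∷ R)) → AF (T ∷ R) F' col → Cuttable col T → Decomposed T R F' col
  decompose-right : ∀ n {T s t R F' col} → T ~ edge s t → szU (unr t) ≤ n → Unique (lvF (T ∷ R)) → Decomposed (unr s) (unr t ∷ R) F' col → Decomposed T R F' col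
  decompose n {T} le u x with mono-or-cuttable T u (okˡ x)
  ... | inj₁ m = T ∷ [] , done ε , m ∷ [] , x , ↭-refl
  ... | inj₂ c = decompose-cut n le u x c
  decompose-cut zero le u x (s , t , p , _) with () ← ≤-trans (≤-reflexive (sym (sz-~ p))) le
  decompose-cut (suc n) {T} {R} le u x (s , t , p , un) =
    decompose-right n p (≤-trans (sz-unr t) (≤-trans (m≤n+m (sz t) (sz s)) le')) u
      (decompose n (≤-trans (sz-unr s) (≤-trans (m≤m+n (sz s) (sz t)) le')) (subst Unique (sym (lvF-cut s t R)) u₁) (af-cut↓ s t R u₁ un (af-≈ u p' x)))
    where
    p' : T ∷ R ≈ edge s t ∷ R
    p' = ≈head p
    u₁ : Unique (lvF (edge s t ∷ R))
    u₁ = unique-↭ (lvF-≈ p') u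
    le' : sz s + sz t ≤ n
    le' = s≤s⁻¹ (≤-trans (≤-reflexive (sym (sz-~ p))) le)
  decompose-right n {T} {s} {t} {R} p le u (G , D , M , y , q) =
    decompose-merge G p u D M lv' (decompose n le (unique-↭ (lvF-↭ r) u₁) (af-≈ u₁ (≈perm r) y))
    where
    r : G ++ unr t ∷ R ↭ unr t ∷ G ++ R
    r = shift (unr t) G R
    lv' : lvF (G ++ unr t ∷ R) ↭ lvF (T ∷ R)
    lv' = ↭-trans q (↭-trans (↭-reflexive (lvF-cut s t R)) (lvF-≈ (≈head {F = R} (~sym p))))
    u₁ : Unique (lvF (G ++ unr t ∷ R))
    u₁ = unique-↭ (↭-sym lv') u

  cherryT : ∀ a b r → ∃ λ x → ∃ λ y → ∃ λ w → edge (nd a b) r ~ edge (nd (lf x) (lf y)) w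
  cherryT (lf x) (lf y) r = x , y , r , ε
  cherryT (nd p q) b r = let x , y , w , e = cherryT p q (nd b r) in x , y , w , ~rot ◅◅ e
  cherryT (lf x) (nd p q) r = let x , y , w , e = cherryT p q (nd (lf x) r) in x , y , w , ~flip ◅◅ ~rot ◅◅ e

  cherryU : ∀ s t → ∃ λ x → ∃ λ y → ∃ λ t' → edge s t ~ edge (lf x) t' × ChTop y t'
  cherryU (lf x) (lf y) = x , y , _ , ε , two
  cherryU (nd a b) t = let x , y , w , e = cherryT a b t in x , y , _ , e ◅◅ ~rot , more
  cherryU (lf x) (nd a b) = let x' , y , w , e = cherryT a b (lf x) in x' , y , _ , ~swp ◅◅ e ◅◅ ~rot , more

  module Subst (x y : L) where
    σ : Tr → Tr
    σ (lf z) with z ≟ y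
    ... | yes _ = nd (lf x) (lf y)
    ... | no _  = lf z
    σ (nd a b) = nd (σ a) (σ b)

    σ-y : σ (lf y) ≡ nd (lf x) (lf y)
    σ-y with y ≟ y
    ... | yes _ = refl
    ... | no n  = ⊥-elim (n refl)

    σ-∉ : ∀ s → y ∉ lv s → σ s ≡ s
    σ-∉ (lf z) n with z ≟ y
    ... | yes e = ⊥-elim (n (here (sym e)))
    ... | no _  = refl
    σ-∉ (nd a b) n = cong₂ nd (σ-∉ a (n ∘ ∈-++⁺ˡ)) (σ-∉ b (n ∘ ∈-++⁺ʳ (lv a)))

    σ-~ : ∀ {s t s' t'} → edge s t ~ edge s' t' → edge (σ s) (σ t) ~ edge (σ s') (σ t')
    σ-~ ε          = ε
    σ-~ (rot ◅ p)  = rot ◅ σ-~ p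
    σ-~ (swp ◅ p)  = swp ◅ σ-~ p
    σ-~ (flip ◅ p) = flip ◅ σ-~ p

  cherry-ext : ∀ {x y t t'} → ChTop y t → ChTop y t' → Unique (lv t) → Unique (lv t') → unr t ~ unr t' → edge (lf x) t ~ edge (lf x) t'
  cherry-ext two two u u' p = ε
  cherry-ext two more u u' p with () ← one-~ p
  cherry-ext more two u u' p = ⊥-elim (edge≁one p)
  cherry-ext {x} {y} (more {r}) (more {r'}) u u' p = ~rot⁻ ◅◅ Eq.subst₂ _~_ (f r u) (f r' u') (σ-~ p) ◅◅ ~rot
    where
    open Subst x y
    f : ∀ r → Unique (y ∷ lv r) → edge (σ (lf y)) (σ r) ≡ edge (nd (lf x) (lf y)) r
    f r u = cong₂ edge σ-y (σ-∉ r (unique-head u))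

  SepSub : Ut → Ut → Set
  SepSub U V = ∀ {a b c d} → SepF (U ∷ []) a b c d → SepF (V ∷ []) a b c d

  uniqueU : ∀ {U} → Unique (lvU U) → Unique (lvF (U ∷ []))
  uniqueU {U} u = subst Unique (sym (List.++-identityʳ (lvU U))) u

  lvF-single : ∀ U → lvF (U ∷ []) ≡ lvU U
  lvF-single U = List.++-identityʳ (lvU U)

  chtop-second : ∀ {x y t} p q → Unique (x ∷ lv t) → ChTop y t → Unique (x ∷ lv (nd p q)) → y ∈ lv p → lv t ↭ lv (nd p q) →
    SepSub (edge (lf x) t) (edge (lf x) (nd p q)) → p ≡ lf y
  chtop-second (lf z) q u ch u' (here refl) e sub = refl
  chtop-second {x} {y} {t} (nd p₁ p₂) q u ch u' i e sub = ⊥-elim absurd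
    where
    p = nd p₁ p₂
    other : ∃ λ w → w ∈ lv p × w ≢ y
    other with ∈-++⁻ (lv p₁) i
    ... | inj₁ k = let w , l = lv-nonempty p₂ in w , ∈-++⁺ʳ (lv p₁) l , λ { refl → unique-disjoint (lv p₁) (unique-++ˡ (lv p) (unique-++ʳ (x ∷ []) u')) k l }
    ... | inj₂ k = let w , l = lv-nonempty p₁ in w , ∈-++⁺ˡ l , λ { refl → unique-disjoint (lv p₁) (unique-++ˡ (lv p) (unique-++ʳ (x ∷ []) u')) l k }
    w = proj₁ other
    z = proj₁ (lv-nonempty q)
    w∈ : w ∈ lv p
    w∈ = proj₁ (proj₂ other)
    z∈ : z ∈ lv q
    z∈ = proj₂ (lv-nonempty q)
    z≢y : z ≢ y
    z≢y f = unique-disjoint (lv p) (unique-++ʳ (x ∷ []) u') i (subst (_∈ lv q) f z∈)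
    V = edge (lf x) (nd p q)
    uV : Unique (lvF (V ∷ []))
    uV = uniqueU {V} u'
    s₁ : SepF (V ∷ []) x z y w
    s₁ = sepF-≈ r (unique-↭ (lvF-≈ (≈sym r)) uV) (sepF-swap (sep-root (unique-↭ (lvF-≈ (≈sym r)) uV) i w∈ (here refl) (there z∈)))
      where
      r : edge p (nd (lf x) q) ∷ [] ≈ V ∷ []
      r = ≈head (~rot⁻ ◅◅ ~flip ◅◅ ~rot)
    rest : ∀ {v} → ChTop y t → v ∈ lv t → v ≢ y → ∃ λ r → t ≡ nd (lf y) r × v ∈ lv r
    rest two (here e) n = ⊥-elim (n e)
    rest more (here e) n = ⊥-elim (n e)
    rest more (there k) n = _ , refl , k
    s₂ : SepF (V ∷ []) x y z w
    s₂ with rest ch (∈-resp-↭ (↭-sym e) (∈-++⁺ʳ (lv p) z∈)) z≢y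
    ... | r , refl , k with rest ch (∈-resp-↭ (↭-sym e) (∈-++⁺ˡ w∈)) (proj₂ (proj₂ other))
    ... | _ , refl , l = sub (sepF-≈ g (unique-↭ (lvF-≈ (≈sym g)) uU) (sep-root (unique-↭ (lvF-≈ (≈sym g)) uU) (here refl) (there (here refl)) k l))
      where
      g : edge (nd (lf x) (lf y)) r ∷ [] ≈ edge (lf x) t ∷ []
      g = ≈head ~rot
      uU : Unique (lvF (edge (lf x) t ∷ []))
      uU = uniqueU {edge (lf x) t} u
    absurd : ⊥
    absurd = sepF-compat uV s₂ s₁

  two-leaves : ∀ {s t z} → ¬ (lv s ++ lv t ↭ z ∷ [])
  two-leaves {s} {t} p with lv s | lv-nonempty s | lv t | lv-nonempty t
  ... | _ ∷ [] | _ | _ ∷ _ | _ with () ← ↭-length p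
  ... | _ ∷ _ ∷ _ | _ | _ ∷ _ | _ with () ← ↭-length p

  quartets-determine : ∀ n {U V} → szU U ≤ n → Unique (lvU U) → lvU U ↭ lvU V → SepSub U V → U ~ V
  quartets-determine n {one x} {one y} le u p sub with refl ← ↭-singleton-inv p = ε
  quartets-determine n {one x} {edge s t} le u p sub = ⊥-elim (two-leaves {s} {t} (↭-sym p))
  quartets-determine n {edge s t} {one x} le u p sub = ⊥-elim (two-leaves {s} {t} p)
  quartets-determine zero {edge s t} {edge s' t'} () u p sub
  quartets-determine (suc n) {edge s t} {edge s' t'} le u p sub with cherryU s t
  ... | x , y , t₁ , e , ch with locateU {x} s' t' (∈-resp-↭ (↭-trans (↭-sym (lv-~ e)) p) (here refl))
  ... | t₂ , e' = e ◅◅ main t₂ e' ◅◅ ~sym e'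
    where
    u₁ : Unique (x ∷ lv t₁)
    u₁ = unique-↭ (lv-~ e) u
    module _ (t₃ : Tr) (e' : edge s' t' ~ edge (lf x) t₃) where
      q : x ∷ lv t₁ ↭ x ∷ lv t₃
      q = ↭-trans (↭-sym (lv-~ e)) (↭-trans p (lv-~ e'))
      u₃ : Unique (x ∷ lv t₃)
      u₃ = unique-↭ q u₁
      sub₁ : SepSub (edge (lf x) t₁) (edge (lf x) t₃)
      sub₁ z = sepF-≈ (≈head e') (uniqueU {edge s' t'} (unique-↭ p u)) (sub (sepF-≈ (≈head (~sym e)) (uniqueU {edge (lf x) t₁} u₁) z))
      finish : ChTop y t₃ → edge (lf x) t₁ ~ edge (lf x) t₃
      finish ch₃ = cherry-ext ch ch₃ (unique-++ʳ (x ∷ []) u₁) (unique-++ʳ (x ∷ []) u₃)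
        (quartets-determine n (le' le) (subst Unique (sym (lv-unr t₁)) (unique-++ʳ (x ∷ []) u₁))
          (Eq.subst₂ _↭_ (sym (lv-unr t₁)) (sym (lv-unr t₃)) (drop-∷ q)) sub₂)
        where
        le' : szU (edge s t) ≤ suc n → szU (unr t₁) ≤ n
        le' (s≤s k) = ≤-trans (sz-unr t₁) (≤-trans (≤-reflexive (Eq.sym (suc-injective (sz-~ e)))) k)
        r₁ = restr-leaf {x} {t₁} {[]} (uniqueU {edge (lf x) t₁} u₁)
        r₃ = restr-leaf {x} {t₃} {[]} (uniqueU {edge (lf x) t₃} u₃)
        mv : ∀ {a} → a ∈ lvF (unr t₁ ∷ []) → a ∈ lvF (unr t₃ ∷ [])
        mv i = subst (_ ∈_) (sym (lvF-single (unr t₃))) (∈-unr⁻ t₃ (∈-resp-↭ (drop-∷ q) (∈-unr t₁ (subst (_ ∈_) (lvF-single (unr t₁)) i))))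
        sub₂ : SepSub (unr t₁) (unr t₃)
        sub₂ z = let (a , b) , (c , d) = sepF-∈ z in sep↓ r₃ (mv a) (mv b) (mv c) (mv d) (sub₁ (sep↑ r₁ z))
      y∈ : y ∈ lv t₃
      y∈ = ∈-resp-↭ (drop-∷ q) (chtop-∈ ch)
    main-nd : ∀ a b → edge s' t' ~ edge (lf x) (nd a b) → y ∈ lv a → edge (lf x) t₁ ~ edge (lf x) (nd a b)
    main-nd a b f i with refl ← chtop-second a b u₁ ch (u₃ (nd a b) f) i (drop-∷ (q (nd a b) f)) (sub₁ (nd a b) f) = finish (nd a b) f more
    flipʳ : ∀ {x a b} → edge (lf x) (nd a b) ~ edge (lf x) (nd b a)
    flipʳ = swp ◅ flip ◅ swp ◅ ε
    main : ∀ t₃ → edge s' t' ~ edge (lf x) t₃ → edge (lf x) t₁ ~ edge (lf x) t₃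
    main (lf z) f with y∈ (lf z) f
    ... | here refl = finish (lf z) f two
    main (nd a b) f with ∈-++⁻ (lv a) (y∈ (nd a b) f)
    ... | inj₁ i = main-nd a b f i
    ... | inj₂ i = main-nd b a (f ◅◅ flipʳ) i ◅◅ flipʳ

  match : ∀ {col} G G' → AF G G' col → All (Mono col) G → All (Mono col) G' → Unique (lvF G) → lvF G ↭ lvF G' →
    ∃ λ G'' → Pointwise _~_ G G'' × G'' ↭ G'
  match [] [] x m m' u p = [] , [] , ↭-refl
  match [] (U ∷ G') x m m' u p = ⊥-elim (empty U (subst (_ ∈_) (↭-empty-inv (↭-sym p)) (∈-++⁺ˡ (proj₂ (lvU-nonempty U)))))
    where
    empty : ∀ U {x : L} → x ∈ [] → ⊥
    empty U ()
  match {col} (U ∷ G) G' x (m ∷ ms) m' u p = pick-component (find (lvF-any G' (∈-resp-↭ p (∈-++⁺ˡ i))))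
    where
    a : L
    a = proj₁ (lvU-nonempty U)
    i : a ∈ lvU U
    i = proj₂ (lvU-nonempty U)
    u' : Unique (lvF G')
    u' = unique-↭ p u
    drop-++ : ∀ (xs : List L) {ys zs} → xs ++ ys ↭ xs ++ zs → ys ↭ zs
    drop-++ []       p = p
    drop-++ (x ∷ xs) p = drop-++ xs (drop-∷ p)
    agr-here : ∀ {V G₁ a b c d} → Unique (lvF (V ∷ G₁)) → a ∈ lvU V → SepF (V ∷ G₁) a b c d → SepF (V ∷ []) a b c d
    agr-here u i (here z) = here z
    agr-here {V} u i (there z) = ⊥-elim (unique-disjoint (lvU V) u i (same-∈ (proj₁ (sepF-same z))))
    module Component (U' : Ut) (k : U' ∈ G') (j : a ∈ lvU U') (G₁ : List Ut) (q : G' ↭ U' ∷ G₁) where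
      y : AF (U ∷ G) (U' ∷ G₁) col
      y = af-≈ʳ u' (≈perm q) x
      u₁ : Unique (lvF (U' ∷ G₁))
      u₁ = unique-↭ (lvF-↭ q) u'
      p₁ : lvF (U ∷ G) ↭ lvF (U' ∷ G₁)
      p₁ = ↭-trans p (lvF-↭ q)
      to : ∀ {b} → b ∈ lvU U → b ∈ lvU U'
      to l = same-head u₁ j (blk (okʳ y) (∈-++⁺ˡ j) (∈-resp-↭ p₁ (∈-++⁺ˡ l)) (m i l))
      from : ∀ {b} → b ∈ lvU U' → b ∈ lvU U
      from l = same-head u i (blk (okˡ y) (∈-++⁺ˡ i) (∈-resp-↭ (↭-sym p₁) (∈-++⁺ˡ l)) (All.lookup m' k j l))
      p₂ : lvU U ↭ lvU U'
      p₂ = unique-set (unique-++ˡ (lvU U) u) (unique-++ˡ (lvU U') u₁) to from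
      p₃ : lvF G ↭ lvF G₁
      p₃ = drop-++ (lvU U) (↭-trans p₁ (++⁺ʳ (lvF G₁) (↭-sym p₂)))
      sub : SepSub U U'
      sub (here (((a , b) , (c , d)) , s)) = agr-here u₁ (to a) (agr y (m a b) (m a c) (m a d) (here (((a , b) , (c , d)) , s)))
      extend : (∃ λ E → Pointwise _~_ G E × E ↭ G₁) → ∃ λ G'' → Pointwise _~_ (U ∷ G) G'' × G'' ↭ G'
      extend (E , pw , r) = U' ∷ E , quartets-determine (szU U) ≤-refl (unique-++ˡ (lvU U) u) p₂ sub ∷ pw , ↭-trans (prep U' r) (↭-sym q)
      result : ∃ λ G'' → Pointwise _~_ (U ∷ G) G'' × G'' ↭ G'
      result = extend (match G G₁ (af-restr (restr-tail u) (restr-tail u₁) p₃ y) ms (All.tail (All-resp-↭ q m')) (unique-++ʳ (lvU U) u) p₃)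
    pick-component : (∃ λ U' → U' ∈ G' × a ∈ lvU U') → ∃ λ G'' → Pointwise _~_ (U ∷ G) G'' × G'' ↭ G'
    pick-component (U' , k , j) = Component.result U' k j (proj₁ (∈-↭ k)) (proj₂ (∈-↭ k))

  length≤cover : ∀ {col} G {C} → Unique (lvF G) → Ok G col → Cover G col C → length G ≤ length C
  length≤cover [] u o cov = z≤n
  length≤cover {col} (U ∷ G) {C} u o cov = count (∈-↭ (cov (∈-++⁺ˡ i)))
    where
    i = proj₂ (lvU-nonempty U)
    count : (∃ λ C' → C ↭ col (proj₁ (lvU-nonempty U)) ∷ C') → suc (length G) ≤ length C
    count (C' , p) = ≤-trans (s≤s (length≤cover G (unique-++ʳ (lvU U) u) (ok-restr (restr-tail u) o)
         (λ j → ∈-strip (∈-resp-↭ p (cov (∈-++⁺ʳ (lvU U) j)))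
           (λ e → unique-disjoint (lvU U) u (same-head u i (blk o (∈-++⁺ˡ i) (∈-++⁺ʳ (lvU U) j) (sym e))) j))))
       (≤-reflexive (sym (↭-length p)))

  Split : Ut → Forest → Colouring → Set
  Split T F' col = ∃ λ G → Decomp T G × All (Mono col) G × AF G F' col × lvF G ↭ lvF (T ∷ [])

  split : ∀ {T F' col} → Unique (lvF (T ∷ [])) → AF (T ∷ []) F' col → Split T F' col
  split {T} {F'} {col} u x = tidy (decompose (szU T) ≤-refl u x)
    where
    tidy : Decomposed T [] F' col → Split T F' col
    tidy (G , D , M , y , q) = G , D , M , subst (λ H → AF H F' col) (List.++-identityʳ G) y , subst (λ H → lvF H ↭ lvF (T ∷ [])) (List.++-identityʳ G) q

  af-tbrs : ∀ {T T' col C} → Unique (lvF (T ∷ [])) → lvF (T ∷ []) ↭ lvF (T' ∷ []) → AF (T ∷ []) (T' ∷ []) col → Cover (T' ∷ []) col C →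
    ∃ λ k → TBRs T T' k × suc k ≤ length C
  af-tbrs {T} {T'} {col} {C} u p x cov = second (split u x)
    where
    module _ {G G' : Forest} (D : Decomp T G) (D' : Decomp T' G') (z : AF G G' col) (q₂ : lvF G' ↭ lvF (T' ∷ [])) where
      count : (∃ λ k → TBRs T T' k × suc k ≡ length G') → ∃ λ k → TBRs T T' k × suc k ≤ length C
      count (k , tb , l) = k , tb , ≤-trans (≤-reflexive l) (length≤cover G' (unique-↭ (↭-sym q₂) (unique-↭ p u)) (okʳ z) (λ i → cov (∈-resp-↭ q₂ i)))
      assemble : (∃ λ G'' → Pointwise _~_ G G'' × G'' ↭ G') → ∃ λ k → TBRs T T' k × suc k ≡ length G'
      assemble (G'' , pw , r) = Product.map₂ (Product.map₂ (λ l → Eq.trans l (↭-length r))) (dec-tbrs D (perm D' (↭-sym r)) pw)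
    second : Split T (T' ∷ []) col → ∃ λ k → TBRs T T' k × suc k ≤ length C
    third  : ∀ {G} → Decomp T G → All (Mono col) G → lvF G ↭ lvF (T ∷ []) → Split T' G col → ∃ λ k → TBRs T T' k × suc k ≤ length C
    second (G , D , M , y , q) = third D M q (split (unique-↭ p u) (af-sym y))
    third {G} D M q (G' , D' , M' , y , q') =
      count D D' (af-sym y) q' (assemble D D' (af-sym y) q' (match G G' (af-sym y) M M' (unique-↭ (↭-sym q) u) (↭-trans q (↭-trans p (↭-sym q')))))

  module Realise {A : Set} (ι : L → A) (ι-injective : ∀ {i j} → ι i ≡ ι j → i ≡ j) where

    sameE-refl : ∀ {e : Edge A} → SameE e e
    sameE-refl = inj₁ refl

    sameE-sym : ∀ {e e' : Edge A} → SameE e e' → SameE e' e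
    sameE-sym (inj₁ refl) = inj₁ refl
    sameE-sym (inj₂ refl) = inj₂ refl

    sameE-trans : ∀ {e e' e'' : Edge A} → SameE e e' → SameE e' e'' → SameE e e''
    sameE-trans (inj₁ refl) q           = q
    sameE-trans (inj₂ refl) (inj₁ refl) = inj₂ refl
    sameE-trans (inj₂ refl) (inj₂ refl) = inj₁ refl

    edgeSetoid : Setoid _ _
    edgeSetoid = record { Carrier = Edge A ; _≈_ = SameE ; isEquivalence = record { refl = sameE-refl ; sym = sameE-sym ; trans = sameE-trans } }

    open SetoidPermutation edgeSetoid public using () renaming (_↭_ to _≋_; ↭-refl to ≋-refl; ↭-sym to ≋-sym; ↭-trans to ≋-trans; ↭-prep to ≋-prep; ↭-reflexive to ≋-reflexive)
    open SetoidPermutationProperties edgeSetoid public using () renaming (++⁺ to ≋-++; drop-∷ to ≋-drop; ++-commutativeMonoid to ≋-monoid)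

    ↭⇒≋ : ∀ {E E' : List (Edge A)} → E ↭ E' → E ≋ E'
    ↭⇒≋ refl         = ≋-refl
    ↭⇒≋ (prep x p)   = ≋-prep x (↭⇒≋ p)
    ↭⇒≋ (swap x y p) = Homogeneous.swap sameE-refl sameE-refl (↭⇒≋ p)
    ↭⇒≋ (trans p q)  = ≋-trans (↭⇒≋ p) (↭⇒≋ q)

    pw⇒≋ : ∀ {E E' : List (Edge A)} → Pointwise SameE E E' → E ≋ E'
    pw⇒≋ = Homogeneous.refl

    edgesEq⇒≋ : ∀ {E E' : List (Edge A)} → EdgesEq E E' → E ≋ E'
    edgesEq⇒≋ (_ , p , q) = ≋-trans (pw⇒≋ p) (↭⇒≋ q)

    ≋⇒edgesEq : ∀ {E E' : List (Edge A)} → E ≋ E' → EdgesEq E E'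
    ≋⇒edgesEq (Homogeneous.refl p) = _ , p , ↭-refl
    ≋⇒edgesEq (Homogeneous.prep e p) = let _ , q , r = ≋⇒edgesEq p in _ , e ∷ q , prep _ r
    ≋⇒edgesEq (Homogeneous.swap e f p) = let _ , q , r = ≋⇒edgesEq p in _ , e ∷ f ∷ q , swap _ _ r
    ≋⇒edgesEq (Homogeneous.trans p p') =
      let _ , q , r = ≋⇒edgesEq p ; _ , q' , r' = ≋⇒edgesEq p' ; _ , q₁ , r₁ = pointwise-↭ r q' in
      _ , Pointwise.transitive sameE-trans q q₁ , ↭-trans r₁ r'

    ≋-head : ∀ {x : Edge A} {xs ys} → x ∷ xs ≋ ys → ∃ λ y → ∃ λ ys₁ → ∃ λ ys₂ → ys ≡ ys₁ ++ y ∷ ys₂ × SameE x y × xs ≋ ys₁ ++ ys₂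
    ≋-head p with ≋⇒edgesEq p
    ... | y ∷ _ , e ∷ q , r with ys₁ , ys₂ , refl ← ∈-∃++ (∈-resp-↭ r (here refl)) =
      y , ys₁ , ys₂ , refl , e , ≋-trans (pw⇒≋ q) (↭⇒≋ (drop-∷ (↭-trans r (shift y ys₁ ys₂))))

    ≋-∈ : ∀ {x : Edge A} {xs ys} → xs ≋ ys → x ∈ xs → ∃ λ y → y ∈ ys × SameE x y
    ≋-∈ p i with zs , q ← ∈-↭ i with y , ys₁ , ys₂ , refl , e , _ ← ≋-head (≋-trans (≋-sym (↭⇒≋ q)) p) =
      y , ∈-++⁺ʳ ys₁ (here refl) , e

    inc-resp : ∀ {v : Vx A} {e e'} → SameE e e' → Inc v e → Inc v e'
    inc-resp (inj₁ refl) i = i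
    inc-resp (inj₂ refl) i = Sum.swap i

    inc-pw : ∀ {v : Vx A} {E E'} → Pointwise SameE E E' → All (Inc v) E → All (Inc v) E'
    inc-pw []      []      = []
    inc-pw (e ∷ p) (i ∷ q) = inc-resp e i ∷ inc-pw p q

    ¬inc-pw : ∀ {v : Vx A} {E E'} → Pointwise SameE E E' → All (λ e → ¬ Inc v e) E → All (λ e → ¬ Inc v e) E'
    ¬inc-pw []      []      = []
    ¬inc-pw (e ∷ p) (i ∷ q) = (i ∘ inc-resp (sameE-sym e)) ∷ ¬inc-pw p q

    deg-from : ∀ {G : Graph A} {v} I {E} → I ++ E ≋ edges G → All (Inc v) I → All (λ e → ¬ Inc v e) E → Deg G v (length I)
    deg-from I p i n with _ , q , r ← ≋⇒edgesEq p with I' , E' , refl , q₁ , q₂ ← pointwise-++⁻ I q =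
      I' , E' , ↭-sym r , sym (Pointwise.Pointwise-length q₁) , inc-pw q₁ i , ¬inc-pw q₂ n

    count-unique : ∀ {v : Vx A} I {R I' R'} → I ++ R ↭ I' ++ R' → All (Inc v) I → All (λ e → ¬ Inc v e) R →
      All (Inc v) I' → All (λ e → ¬ Inc v e) R' → length I ≡ length I'
    count-unique [] {I' = []} p _ _ _ _ = refl
    count-unique [] {I' = e ∷ I'} p _ n (i ∷ _) _ = ⊥-elim (All.lookup n (∈-resp-↭ (↭-sym p) (here refl)) i)
    count-unique (e ∷ I) {R} {I'} {R'} p (i ∷ is) n is' n' with ∈-++⁻ I' (∈-resp-↭ p (here refl))
    ... | inj₂ k = ⊥-elim (All.lookup n' k i)
    ... | inj₁ k = let I'' , q = ∈-↭ k in
      Eq.trans (cong suc (count-unique I (drop-∷ (↭-trans p (++⁺ʳ R' q))) is n (All.tail (All-resp-↭ q is')) n')) (sym (↭-length q))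

    deg-unique : ∀ {G : Graph A} {v m n} → Deg G v m → Deg G v n → m ≡ n
    deg-unique (I , R , p , refl , i , n) (I' , R' , p' , refl , i' , n') = count-unique I (↭-trans (↭-sym p) p') i n i' n'

    Cont : Set
    Cont = List (Vx A) × List (Edge A)

    infixr 5 _⊹_
    infix 4 _≃_

    _⊹_ : Cont → Cont → Cont
    (V , E) ⊹ (V' , E') = V ++ V' , E ++ E'

    _≃_ : Cont → Cont → Set
    (V , E) ≃ (V' , E') = V ↭ V' × E ≋ E'

    ≃-refl : ∀ {C} → C ≃ C
    ≃-refl = ↭-refl , ≋-refl

    ≃-sym : ∀ {C C'} → C ≃ C' → C' ≃ C
    ≃-sym (p , q) = ↭-sym p , ≋-sym q

    ≃-trans : ∀ {C C' C''} → C ≃ C' → C' ≃ C'' → C ≃ C''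
    ≃-trans (p , q) (p' , q') = ↭-trans p p' , ≋-trans q q'

    ⊹-cong : ∀ {C C' D D'} → C ≃ C' → D ≃ D' → C ⊹ D ≃ C' ⊹ D'
    ⊹-cong (p , q) (p' , q') = ++⁺ p p' , ≋-++ q q'

    module V-Solver = MonoidSolver (++-commutativeMonoid {A = Vx A})
    module E-Solver = MonoidSolver ≋-monoid

    ⊹-assoc : ∀ C D E → (C ⊹ D) ⊹ E ≃ C ⊹ D ⊹ E
    ⊹-assoc (V , E) (V' , E') (V'' , E'') = ↭-reflexive (List.++-assoc V V' V'') , ≋-reflexive (List.++-assoc E E' E'')

    ⊹-comm : ∀ C D → C ⊹ D ≃ D ⊹ C
    ⊹-comm (V , E) (V' , E') = ++-comm V V' , E-Solver.solve 2 (λ a b → a E-Solver.⊕ b E-Solver.⊜ b E-Solver.⊕ a) ≋-refl E E'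

    ⊹-shifts : ∀ C D E → C ⊹ D ⊹ E ≃ D ⊹ C ⊹ E
    ⊹-shifts C D E = ≃-trans (≃-sym (⊹-assoc C D E)) (≃-trans (⊹-cong (⊹-comm C D) ≃-refl) (⊹-assoc D C E))

    record Holds (G : Graph A) (C : Cont) : Set where
      constructor holds
      field
        uniqueV : Unique (proj₁ C)
        cont    : C ≃ (verts G , edges G)
    open Holds public

    holds-≃ : ∀ {G C C'} → C ≃ C' → Holds G C → Holds G C'
    holds-≃ p h = holds (unique-↭ (proj₁ p) (uniqueV h)) (≃-trans (≃-sym p) (cont h))

    Ends : Cont → Set
    Ends (V , E) = All (λ e → proj₁ e ∈ V × proj₂ e ∈ V) E

    ends-⊹ : ∀ {C D} → Ends C → Ends D → Ends (C ⊹ D)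
    ends-⊹ {V , _} p q = All.++⁺ (All.map (λ { (i , j) → ∈-++⁺ˡ i , ∈-++⁺ˡ j }) p) (All.map (λ { (i , j) → ∈-++⁺ʳ V i , ∈-++⁺ʳ V j }) q)

    ¬inc-ends : ∀ {v : Vx A} {V E} → Ends (V , E) → v ∉ V → All (λ e → ¬ Inc v e) E
    ¬inc-ends p n = All.map (λ { (i , j) → λ { (inj₁ refl) → n i ; (inj₂ refl) → n j } }) p

    adj-closed : ∀ {G : Graph A} {C D u w} → Holds G (C ⊹ D) → Ends C → Ends D → u ∈ proj₁ C → Adj G u w → w ∈ proj₁ C
    adj-closed {C = V , E} {V' , E'} h p q i (e , k , j) with ≋-∈ (≋-sym (proj₂ (cont h))) k
    ... | e' , k' , s with ∈-++⁻ E k'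
    ... | inj₂ k₂ = ⊥-elim (unique-disjoint V (uniqueV h) i (u∈ s j (All.lookup q k₂)))
      where
      u∈ : ∀ {u w : Vx A} {e e'} → SameE e e' → Joins e u w → proj₁ e' ∈ V' × proj₂ e' ∈ V' → u ∈ V'
      u∈ (inj₁ refl) (inj₁ refl) (a , b) = a
      u∈ (inj₁ refl) (inj₂ refl) (a , b) = b
      u∈ (inj₂ refl) (inj₁ refl) (a , b) = b
      u∈ (inj₂ refl) (inj₂ refl) (a , b) = a
    ... | inj₁ k₁ = w∈ s j (All.lookup p k₁)
      where
      w∈ : ∀ {u w : Vx A} {e e'} → SameE e e' → Joins e u w → proj₁ e' ∈ V × proj₂ e' ∈ V → w ∈ V
      w∈ (inj₁ refl) (inj₁ refl) (a , b) = b
      w∈ (inj₁ refl) (inj₂ refl) (a , b) = a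
      w∈ (inj₂ refl) (inj₁ refl) (a , b) = a
      w∈ (inj₂ refl) (inj₂ refl) (a , b) = b

    star-closed : ∀ {G : Graph A} {C D u w} → Holds G (C ⊹ D) → Ends C → Ends D → u ∈ proj₁ C → Star (Adj G) u w → w ∈ proj₁ C
    star-closed h p q i ε       = i
    star-closed h p q i (a ◅ s) = star-closed h p q (adj-closed h p q i a) s

    holds-edge : ∀ {G C e} → Holds G C → e ∈ proj₂ C → ∃ λ e' → e' ∈ edges G × SameE e e'
    holds-edge h i = ≋-∈ (proj₂ (cont h)) i

    holds-adj : ∀ {G C u v} → Holds G C → (u , v) ∈ proj₂ C → Adj G u v
    holds-adj h i with holds-edge h i
    ... | e , k , inj₁ refl = e , k , inj₁ refl
    ... | e , k , inj₂ refl = e , k , inj₂ refl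

    adj-sym : ∀ {G : Graph A} {u v} → Adj G u v → Adj G v u
    adj-sym (e , k , j) = e , k , Sum.swap j

    star-sym : ∀ {G : Graph A} {u v} → Star (Adj G) u v → Star (Adj G) v u
    star-sym     ε       = ε
    star-sym {G} (a ◅ s) = star-sym {G} s ◅◅ (adj-sym {G} a ◅ ε)

    holds-deg : ∀ {G V v} I {E} → Holds G (V , I ++ E) → All (Inc v) I → All (λ e → ¬ Inc v e) E → Deg G v (length I)
    holds-deg {G} I h = deg-from {G} I (proj₂ (cont h))

    remove-vertex : ∀ {v : Vx A} {V W} → v ∷ V ↭ W → ∃ λ V₁ → ∃ λ V₂ → W ≡ V₁ ++ v ∷ V₂ × V ↭ V₁ ++ V₂
    remove-vertex {v} p with V₁ , V₂ , refl ← ∈-∃++ (∈-resp-↭ p (here refl)) = V₁ , V₂ , refl , drop-∷ (↭-trans p (shift v V₁ V₂))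

    supp-make : ∀ {G n u w V E} → Holds G (n ∷ V , (n , u) ∷ (n , w) ∷ E) → All (λ e → ¬ Inc n e) E → u ≢ w →
      ∃ λ H → Supp G n H × Holds H (V , (u , w) ∷ E)
    supp-make {G} {n} {u} {w} h ni u≢w with V₁ , V₂ , eqV , pV ← remove-vertex (proj₁ (cont h)) with ≋⇒edgesEq (proj₂ (cont h))
    ... | a ∷ b ∷ R , ea ∷ eb ∷ pw , r =
      mkG (V₁ ++ V₂) ((u , w) ∷ R) ,
      (V₁ , V₂ , u , w , a , b , R , eqV , ↭-sym r , ja ea , jb eb , ¬inc-pw pw ni , u≢w , refl) ,
      holds (unique-++ʳ (n ∷ []) (uniqueV h)) (pV , ≋-prep _ (pw⇒≋ pw))
      where
      ja : ∀ {u a} → SameE (n , u) a → Joins a u n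
      ja (inj₁ refl) = inj₂ refl
      ja (inj₂ refl) = inj₁ refl
      jb : ∀ {w b} → SameE (n , w) b → Joins b n w
      jb (inj₁ refl) = inj₁ refl
      jb (inj₂ refl) = inj₂ refl

    supp-view : ∀ {G H n u w V E} → Holds G (n ∷ V , (n , u) ∷ (n , w) ∷ E) → All (λ e → ¬ Inc n e) E → Supp G n H →
      Holds H (V , (u , w) ∷ E)
    supp-view {G} {H} {n} {u} {w} {V} {E} h ni (V₁ , V₂ , u' , w' , a , b , R , eqV , r , ja , jb , nR , _ , refl)
      with ≋⇒edgesEq (≋-trans (proj₂ (cont h)) (↭⇒≋ r))
    ... | y ∷ z ∷ E' , ey ∷ ez ∷ pw , q =
      holds (unique-++ʳ (n ∷ []) (uniqueV h)) (pV , pE)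
      where
      pV : V ↭ V₁ ++ V₂
      pV = drop-∷ (↭-trans (proj₁ (cont h)) (↭-trans (↭-reflexive eqV) (shift n V₁ V₂)))
      iy : Inc n y
      iy = inc-resp ey (inj₁ refl)
      iz : Inc n z
      iz = inc-resp ez (inj₁ refl)
      fin : ∀ {x c} → Inc n x → x ∷ E' ↭ c ∷ R → x ≡ c × E' ↭ R
      fin i p with ∈-resp-↭ p (here refl)
      ... | here refl = refl , drop-∷ p
      ... | there k = ⊥-elim (All.lookup nR k i)
      end : ∀ {u u' a} → SameE (n , u) a → Joins a u' n → u ≡ u'
      end (inj₁ refl) (inj₁ refl) = refl
      end (inj₁ refl) (inj₂ refl) = refl
      end (inj₂ refl) (inj₁ refl) = refl
      end (inj₂ refl) (inj₂ refl) = refl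
      pE : (u , w) ∷ E ≋ (u' , w') ∷ R
      pE with ∈-resp-↭ q (here refl)
      ... | there (there k) = ⊥-elim (All.lookup nR k iy)
      ... | here refl with refl , p ← fin iz (drop-∷ q)
                      with refl ← end ey ja | refl ← end ez (Sum.swap jb) = ≋-prep _ (≋-trans (pw⇒≋ pw) (↭⇒≋ p))
      ... | there (here refl) with refl , p ← fin iz (drop-∷ (↭-trans q (swap a b ↭-refl)))
                      with refl ← end ey (Sum.swap jb) | refl ← end ez ja = Homogeneous.prep (inj₂ refl) (≋-trans (pw⇒≋ pw) (↭⇒≋ p))

    cut-edge : ∀ {G V e E} → Holds G (V , e ∷ E) → ∃ λ E₁ → ∃ λ e' → ∃ λ E₂ → edges G ≡ E₁ ++ e' ∷ E₂ × SameE e e' ×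
      Holds (mkG (verts G) (E₁ ++ E₂)) (V , E)
    cut-edge h with y , E₁ , E₂ , eq , s , p ← ≋-head (proj₂ (cont h)) = E₁ , y , E₂ , eq , s , holds (uniqueV h) (proj₁ (cont h) , p)

    cut-edge⁻ : ∀ {G V e e' E E₁ E₂} → Holds G (V , e ∷ E) → edges G ≡ E₁ ++ e' ∷ E₂ → SameE e e' → Holds (mkG (verts G) (E₁ ++ E₂)) (V , E)
    cut-edge⁻ {e = e} {e'} {E} {E₁} {E₂} h eq s = holds (uniqueV h) (proj₁ (cont h) , ≋-drop
      (≋-trans (proj₂ (cont h)) (≋-trans (≋-reflexive eq) (≋-trans (↭⇒≋ (shift e' E₁ E₂)) (Homogeneous.prep (sameE-sym s) ≋-refl)))))

    ¬two-incident-leaf : ∀ {G : Graph A} {v e e' E} → e ∷ e' ∷ E ≋ edges G → Inc v e → Inc v e' → ¬ IsLeaf G v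
    ¬two-incident-leaf {G} {v} p i i' l with ≋⇒edgesEq p
    ... | a ∷ b ∷ R , ea ∷ eb ∷ _ , r = go l
      where
      bad : ∀ I {R'} → edges G ↭ I ++ R' → length I ≤ 1 → All (λ e → ¬ Inc v e) R' → ⊥
      bad [] q _ n = All.lookup n (∈-resp-↭ (↭-trans r q) (here refl)) (inc-resp ea i)
      bad (c ∷ []) q _ n with ∈-resp-↭ (↭-trans r q) (here refl)
      ... | there k = All.lookup n k (inc-resp ea i)
      ... | here refl = All.lookup n (∈-resp-↭ (drop-∷ (↭-trans r q)) (here refl)) (inc-resp eb i')
      bad (c ∷ d ∷ I) q (s≤s ()) n
      go : IsLeaf G v → ⊥
      go (inj₁ (I , R , q , e , _ , n)) = bad I q (≤-trans (≤-reflexive e) z≤n) n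
      go (inj₂ (I , R , q , e , _ , n)) = bad I q (≤-reflexive e) n

    leaf : L → Vx A
    leaf x = inj₁ (ι x)

    leaf-injective : ∀ {x y} → leaf x ≡ leaf y → x ≡ y
    leaf-injective = ι-injective ∘ inj₁-injective

    -- A choice of names for the inner vertices; the leaf x is the vertex ι x.
    data Named : Tr → Set where
      lf : ∀ x → Named (lf x)
      nd : ∀ {s t} → ℕ → Named s → Named t → Named (nd s t)

    data NamedU : Ut → Set where
      one  : ∀ x → NamedU (one x)
      edge : ∀ {s t} → Named s → Named t → NamedU (edge s t)

    rt : ∀ {s} → Named s → Vx A
    rt (lf x)     = leaf x
    rt (nd n _ _) = inj₂ n

    vs : ∀ {s} → Named s → List (Vx A)
    vs (lf x)     = leaf x ∷ []
    vs (nd n α β) = inj₂ n ∷ vs α ++ vs β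

    es : ∀ {s} → Named s → List (Edge A)
    es (lf x)     = []
    es (nd n α β) = (inj₂ n , rt α) ∷ (inj₂ n , rt β) ∷ es α ++ es β

    cT : ∀ {s} → Named s → Cont
    cT α = vs α , es α

    cU : ∀ {U} → NamedU U → Cont
    cU (one x)    = leaf x ∷ [] , []
    cU (edge α β) = vs α ++ vs β , (rt α , rt β) ∷ es α ++ es β

    cP : ∀ {ps} → All Named ps → Cont
    cP []      = [] , []
    cP (α ∷ π) = cT α ⊹ cP π

    cF : ∀ {F} → All NamedU F → Cont
    cF []      = [] , []
    cF (ν ∷ φ) = cU ν ⊹ cF φ

    rt∈ : ∀ {s} (α : Named s) → rt α ∈ vs α
    rt∈ (lf x)     = here refl
    rt∈ (nd n α β) = here refl

    ends-T : ∀ {s} (α : Named s) → Ends (cT α)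
    ends-T (lf x)     = []
    ends-T (nd n α β) = (here refl , there (∈-++⁺ˡ (rt∈ α))) ∷ (here refl , there (∈-++⁺ʳ (vs α) (rt∈ β))) ∷
      All.map (λ { (i , j) → there i , there j }) (ends-⊹ {cT α} {cT β} (ends-T α) (ends-T β))

    ends-U : ∀ {U} (ν : NamedU U) → Ends (cU ν)
    ends-U (one x)    = []
    ends-U (edge α β) = (∈-++⁺ˡ (rt∈ α) , ∈-++⁺ʳ (vs α) (rt∈ β)) ∷ ends-⊹ {cT α} {cT β} (ends-T α) (ends-T β)

    ends-P : ∀ {ps} (π : All Named ps) → Ends (cP π)
    ends-P []      = []
    ends-P (α ∷ π) = ends-⊹ {cT α} {cP π} (ends-T α) (ends-P π)

    ends-F : ∀ {F} (φ : All NamedU F) → Ends (cF φ)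
    ends-F []      = []
    ends-F (ν ∷ φ) = ends-⊹ {cU ν} {cF φ} (ends-U ν) (ends-F φ)

    mv : ∀ {U V} → U ⟶ V → NamedU U → NamedU V
    mv rot  (edge (nd n α β) γ) = edge α (nd n β γ)
    mv swp  (edge α β)          = edge β α
    mv flip (edge (nd n α β) γ) = edge (nd n β α) γ

    mv-≃ : ∀ {U V} (r : U ⟶ V) (ν : NamedU U) → cU ν ≃ cU (mv r ν)
    mv-≃ rot (edge (nd n α β) γ) =
      V-Solver.solve 4 (λ n a b c → let _∙_ = V-Solver._⊕_ in (n ∙ (a ∙ b)) ∙ c V-Solver.⊜ a ∙ (n ∙ (b ∙ c))) ↭-refl (inj₂ n ∷ []) (vs α) (vs β) (vs γ) ,
      ≋-trans
        (E-Solver.solve 6 (λ x y z a b c → let _∙_ = E-Solver._⊕_ in x ∙ ((y ∙ (z ∙ (a ∙ b))) ∙ c) E-Solver.⊜ y ∙ (a ∙ (z ∙ (x ∙ (b ∙ c))))) ≋-refl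
          ((inj₂ n , rt γ) ∷ []) ((inj₂ n , rt α) ∷ []) ((inj₂ n , rt β) ∷ []) (es α) (es β) (es γ))
        (Homogeneous.prep (inj₂ refl) ≋-refl)
    mv-≃ swp (edge α β) = ++-comm (vs α) (vs β) , Homogeneous.prep (inj₂ refl) (proj₂ (⊹-comm (cT α) (cT β)))
    mv-≃ flip (edge (nd n α β) γ) =
      prep (inj₂ n) (++⁺ʳ (vs γ) (++-comm (vs α) (vs β))) ,
      ≋-prep _ (E-Solver.solve 5 (λ y z a b c → let _∙_ = E-Solver._⊕_ in (y ∙ (z ∙ (a ∙ b))) ∙ c E-Solver.⊜ (z ∙ (y ∙ (b ∙ a))) ∙ c) ≋-refl
          ((inj₂ n , rt α) ∷ []) ((inj₂ n , rt β) ∷ []) (es α) (es β) (es γ))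

    mv* : ∀ {U V} → U ~ V → NamedU U → NamedU V
    mv* ε       ν = ν
    mv* (r ◅ p) ν = mv* p (mv r ν)

    mv*-≃ : ∀ {U V} (p : U ~ V) (ν : NamedU U) → cU ν ≃ cU (mv* p ν)
    mv*-≃ ε       ν = ≃-refl
    mv*-≃ (r ◅ p) ν = ≃-trans (mv-≃ r ν) (mv*-≃ p (mv r ν))

    mvF-↭ : ∀ {F F'} → F ↭ F' → (φ : All NamedU F) → ∃ λ (φ' : All NamedU F') → cF φ ≃ cF φ'
    mvF-↭ refl         φ           = φ , ≃-refl
    mvF-↭ (prep U p)   (ν ∷ φ)     = case mvF-↭ p φ of λ { (φ' , q) →
      ν ∷ φ' , ⊹-cong (≃-refl {cU ν}) q }
    mvF-↭ (swap U V p) (ν ∷ μ ∷ φ) = case mvF-↭ p φ of λ { (φ' , q) →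
      μ ∷ ν ∷ φ' ,
      ≃-trans (⊹-cong (≃-refl {cU ν}) (⊹-cong (≃-refl {cU μ}) q)) (⊹-shifts (cU ν) (cU μ) (cF φ')) }
    mvF-↭ (trans p q)  φ           = case mvF-↭ p φ of λ { (φ' , r) →
      case mvF-↭ q φ' of λ { (φ'' , r') →
      φ'' , ≃-trans r r' }}

    mvF : ∀ {F F'} → F ≈ F' → (φ : All NamedU F) → ∃ λ (φ' : All NamedU F') → cF φ ≃ cF φ'
    mvF ε            φ       = φ , ≃-refl
    mvF (tree r ◅ p) (ν ∷ φ) = case mvF p (mv r ν ∷ φ) of λ { (φ' , q) →
      φ' , ≃-trans (⊹-cong (mv-≃ r ν) (≃-refl {cF φ})) q }
    mvF (perm r ◅ p) φ       = case mvF-↭ r φ of λ { (φ₁ , q) →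
      case mvF p φ₁ of λ { (φ' , q') →
      φ' , ≃-trans q q' }}

    Rep : Forest → Graph A → Set
    Rep F G = Σ (All NamedU F) λ φ → Holds G (cF φ)

    rep-≈ : ∀ {F F' G} → F ≈ F' → Rep F G → Rep F' G
    rep-≈ p (φ , h) = case mvF p φ of λ { (φ' , q) →
      φ' , holds-≃ q h }

    locateV : ∀ {s t v} (α : Named s) (β : Named t) → v ∈ vs α →
      ∃ λ s' → ∃ λ t' → Σ (edge s t ~ edge s' t') λ p → Σ (Named s') λ α' → Σ (Named t') λ β' → mv* p (edge α β) ≡ edge α' β' × rt α' ≡ v
    locateV (lf x) β (here refl) = _ , _ , ε , _ , _ , refl , refl
    locateV (nd n α₁ α₂) β (here refl) = _ , _ , ε , _ , _ , refl , refl
    locateV (nd n α₁ α₂) β (there i) with ∈-++⁻ (vs α₁) i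
    ... | inj₁ j = case locateV α₁ (nd n α₂ β) j of λ { (_ , _ , p , α' , β' , e , f) →
      _ , _ , rot ◅ p , α' , β' , e , f }
    ... | inj₂ j = case locateV α₂ (nd n α₁ β) j of λ { (_ , _ , p , α' , β' , e , f) →
      _ , _ , flip ◅ rot ◅ p , α' , β' , e , f }

    locateE : ∀ {s t e} (α : Named s) (β : Named t) → e ∈ es α →
      ∃ λ s' → ∃ λ t' → Σ (edge s t ~ edge s' t') λ p → Σ (Named s') λ α' → Σ (Named t') λ β' → mv* p (edge α β) ≡ edge α' β' × SameE (rt α' , rt β') e
    locateE (nd n α₁ α₂) β (here refl) = _ , _ , rot ◅ ε , _ , _ , refl , inj₂ refl
    locateE (nd n α₁ α₂) β (there (here refl)) = _ , _ , flip ◅ rot ◅ ε , _ , _ , refl , inj₂ refl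
    locateE (nd n α₁ α₂) β (there (there i)) with ∈-++⁻ (es α₁) i
    ... | inj₁ j = case locateE α₁ (nd n α₂ β) j of λ { (_ , _ , p , α' , β' , e , f) →
      _ , _ , rot ◅ p , α' , β' , e , f }
    ... | inj₂ j = case locateE α₂ (nd n α₁ β) j of λ { (_ , _ , p , α' , β' , e , f) →
      _ , _ , flip ◅ rot ◅ p , α' , β' , e , f }

    data LocV (v : Vx A) (F : Forest) (C : Cont) : Set where
      isol : ∀ {x R} (ρ : All NamedU R) → F ≈ one x ∷ R → v ≡ leaf x → C ≃ cU (one x) ⊹ cF ρ → LocV v F C
      conn : ∀ {s t R} (α : Named s) (β : Named t) (ρ : All NamedU R) → F ≈ edge s t ∷ R → v ≡ rt α → C ≃ cU (edge α β) ⊹ cF ρ → LocV v F C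

    data LocE (e : Edge A) (F : Forest) (C : Cont) : Set where
      loc : ∀ {s t R} (α : Named s) (β : Named t) (ρ : All NamedU R) → F ≈ edge s t ∷ R → SameE (rt α , rt β) e → C ≃ cU (edge α β) ⊹ cF ρ → LocE e F C

    rotate : ∀ {U V R} (ν : NamedU U) (μ : NamedU V) (ρ : All NamedU R) → cU ν ⊹ cU μ ⊹ cF ρ ≃ cU μ ⊹ cF (ν ∷ ρ)
    rotate ν μ ρ = ⊹-shifts (cU ν) (cU μ) (cF ρ)

    locateVF : ∀ {v F} (φ : All NamedU F) → v ∈ proj₁ (cF φ) → LocV v F (cF φ)
    locateVF (ν ∷ φ) i with ∈-++⁻ (proj₁ (cU ν)) i
    locateVF (one x ∷ φ) i | inj₁ (here refl) = isol φ ε refl ≃-refl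
    locateVF (edge α β ∷ φ) i | inj₁ j with ∈-++⁻ (vs α) j
    ... | inj₁ k = case locateV α β k of λ { (_ , _ , p , α' , β' , e , f) →
      conn α' β' φ (≈head p) (sym f) (⊹-cong (subst (cU (edge α β) ≃_) (cong cU e) (mv*-≃ p (edge α β))) (≃-refl {cF φ})) }
    ... | inj₂ k = case locateV β α k of λ { (_ , _ , p , α' , β' , e , f) →
      conn α' β' φ (≈head (swp ◅ p)) (sym f) (⊹-cong (subst (cU (edge α β) ≃_) (cong cU e) (mv*-≃ (swp ◅ p) (edge α β))) (≃-refl {cF φ})) }
    locateVF (ν ∷ φ) i | inj₂ j with locateVF φ j
    ... | isol {x} ρ p e q = isol (ν ∷ ρ) (≈cons p ◅◅ ≈perm (swap _ _ ↭-refl)) e (≃-trans (⊹-cong (≃-refl {cU ν}) q) (rotate ν (one x) ρ))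
    ... | conn α β ρ p e q = conn α β (ν ∷ ρ) (≈cons p ◅◅ ≈perm (swap _ _ ↭-refl)) e (≃-trans (⊹-cong (≃-refl {cU ν}) q) (rotate ν (edge α β) ρ))

    locateEF : ∀ {e F} (φ : All NamedU F) → e ∈ proj₂ (cF φ) → LocE e F (cF φ)
    locateEF (ν ∷ φ) i with ∈-++⁻ (proj₂ (cU ν)) i
    locateEF (edge α β ∷ φ) i | inj₁ (here refl) = loc α β φ ε sameE-refl ≃-refl
    locateEF (edge α β ∷ φ) i | inj₁ (there j) with ∈-++⁻ (es α) j
    ... | inj₁ k = case locateE α β k of λ { (_ , _ , p , α' , β' , e , f) →
      loc α' β' φ (≈head p) f (⊹-cong (subst (cU (edge α β) ≃_) (cong cU e) (mv*-≃ p (edge α β))) (≃-refl {cF φ})) }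
    ... | inj₂ k = case locateE β α k of λ { (_ , _ , p , α' , β' , e , f) →
      loc α' β' φ (≈head (swp ◅ p)) f (⊹-cong (subst (cU (edge α β) ≃_) (cong cU e) (mv*-≃ (swp ◅ p) (edge α β))) (≃-refl {cF φ})) }
    locateEF (ν ∷ φ) i | inj₂ j with locateEF φ j
    ... | loc α β ρ p e q = loc α β (ν ∷ ρ) (≈cons p ◅◅ ≈perm (swap _ _ ↭-refl)) e (≃-trans (⊹-cong (≃-refl {cU ν}) q) (rotate ν (edge α β) ρ))

    loc-resp : ∀ {e e' F C} → SameE e e' → LocE e F C → LocE e' F C
    loc-resp s (loc α β ρ p q r) = loc α β ρ p (sameE-trans q s) r

    repV : ∀ {F G v} → ((φ , h) : Rep F G) → v ∈ verts G → LocV v F (cF φ)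
    repV (φ , h) i = locateVF φ (∈-resp-↭ (↭-sym (proj₁ (cont h))) i)

    repE : ∀ {F G e} → ((φ , h) : Rep F G) → e ∈ edges G → LocE e F (cF φ)
    repE (φ , h) i with ≋-∈ (≋-sym (proj₂ (cont h))) i
    ... | e' , k , s = loc-resp (sameE-sym s) (locateEF φ k)

    data VertexKind (G : Graph A) (v : Vx A) : Set where
      leaf0 : ∀ {x} → v ≡ leaf x → Deg G v 0 → VertexKind G v
      leaf1 : ∀ {x} → v ≡ leaf x → Deg G v 1 → VertexKind G v
      inner : ∀ {n} → v ≡ inj₂ n → Deg G v 3 → VertexKind G v

    deg-isol : ∀ {G x R} (ρ : All NamedU R) → Holds G (cU (one x) ⊹ cF ρ) → Deg G (leaf x) 0
    deg-isol ρ h = holds-deg [] h [] (¬inc-ends (ends-F ρ) (unique-head (uniqueV h)))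

    ¬inc-leaf : ∀ {G x t R} (β : Named t) (ρ : All NamedU R) → Holds G (cU (edge (lf x) β) ⊹ cF ρ) → All (λ e → ¬ Inc (leaf x) e) (es β ++ proj₂ (cF ρ))
    ¬inc-leaf β ρ h = ¬inc-ends (ends-⊹ {cT β} {cF ρ} (ends-T β) (ends-F ρ)) (unique-head (uniqueV h))

    deg-leaf : ∀ {G x t R} (β : Named t) (ρ : All NamedU R) → Holds G (cU (edge (lf x) β) ⊹ cF ρ) → Deg G (leaf x) 1
    deg-leaf {x = x} β ρ h = holds-deg ((leaf x , rt β) ∷ []) h (inj₁ refl ∷ []) (¬inc-leaf β ρ h)

    ¬inc-node : ∀ {G n s₁ s₂ t R} (α₁ : Named s₁) (α₂ : Named s₂) (β : Named t) (ρ : All NamedU R) → Holds G (cU (edge (nd n α₁ α₂) β) ⊹ cF ρ) →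
      All (λ e → ¬ Inc (inj₂ n) e) (((es α₁ ++ es α₂) ++ es β) ++ proj₂ (cF ρ))
    ¬inc-node α₁ α₂ β ρ h = ¬inc-ends (ends-⊹ {(cT α₁ ⊹ cT α₂) ⊹ cT β} {cF ρ} (ends-⊹ {cT α₁ ⊹ cT α₂} {cT β} (ends-⊹ {cT α₁} {cT α₂} (ends-T α₁) (ends-T α₂)) (ends-T β)) (ends-F ρ)) (unique-head (uniqueV h))

    deg-node : ∀ {G n s₁ s₂ t R} (α₁ : Named s₁) (α₂ : Named s₂) (β : Named t) (ρ : All NamedU R) → Holds G (cU (edge (nd n α₁ α₂) β) ⊹ cF ρ) → Deg G (inj₂ n) 3
    deg-node {n = n} α₁ α₂ β ρ h =
      holds-deg ((inj₂ n , rt β) ∷ (inj₂ n , rt α₁) ∷ (inj₂ n , rt α₂) ∷ []) h (inj₁ refl ∷ inj₁ refl ∷ inj₁ refl ∷ []) (¬inc-node α₁ α₂ β ρ h)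

    kind-at : ∀ {F G C v} → Holds G C → LocV v F C → VertexKind G v
    kind-at h (isol ρ p refl q) = leaf0 refl (deg-isol ρ (holds-≃ q h))
    kind-at h (conn (lf x) β ρ p refl q) = leaf1 refl (deg-leaf β ρ (holds-≃ q h))
    kind-at h (conn (nd n α₁ α₂) β ρ p refl q) = inner refl (deg-node α₁ α₂ β ρ (holds-≃ q h))

    kind : ∀ {F G v} → Rep F G → v ∈ verts G → VertexKind G v
    kind r i = kind-at (proj₂ r) (repV r i)

    ¬deg2 : ∀ {F G v} → Rep F G → v ∈ verts G → ¬ Deg G v 2
    ¬deg2 {G = G} r i d with kind r i
    ... | leaf0 _ d' with () ← deg-unique {G} d d'
    ... | leaf1 _ d' with () ← deg-unique {G} d d'
    ... | inner _ d' with () ← deg-unique {G} d d'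

    edge-ends : ∀ {s t R G e} (α : Named s) (β : Named t) (ρ : All NamedU R) → Holds G (cU (edge α β) ⊹ cF ρ) → SameE (rt α , rt β) e →
      proj₁ e ∈ verts G × proj₂ e ∈ verts G × proj₁ e ≢ proj₂ e
    edge-ends {G = G} α β ρ h = fin
      where
      a : rt α ∈ verts G
      a = ∈-resp-↭ (proj₁ (cont h)) (∈-++⁺ˡ (∈-++⁺ˡ (rt∈ α)))
      b : rt β ∈ verts G
      b = ∈-resp-↭ (proj₁ (cont h)) (∈-++⁺ˡ (∈-++⁺ʳ (vs α) (rt∈ β)))
      n : rt α ≢ rt β
      n f = unique-disjoint (vs α) (unique-++ˡ (vs α ++ vs β) (uniqueV h)) (rt∈ α) (subst (_∈ vs β) (sym f) (rt∈ β))
      fin : ∀ {e} → SameE (rt α , rt β) e → proj₁ e ∈ verts G × proj₂ e ∈ verts G × proj₁ e ≢ proj₂ e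
      fin (inj₁ refl) = a , b , n
      fin (inj₂ refl) = b , a , n ∘ sym

    cut-disconnects : ∀ {s t R K e} (α : Named s) (β : Named t) (ρ : All NamedU R) → Holds K (cT α ⊹ cT β ⊹ cF ρ) → SameE (rt α , rt β) e →
      ¬ Star (Adj K) (proj₁ e) (proj₂ e)
    cut-disconnects {K = K} α β ρ h = fin
      where
      ab : Star (Adj K) (rt α) (rt β) → ⊥
      ab st = unique-disjoint (vs α) (uniqueV h) (star-closed {C = cT α} {cT β ⊹ cF ρ} h (ends-T α) (ends-⊹ {cT β} {cF ρ} (ends-T β) (ends-F ρ)) (rt∈ α) st) (∈-++⁺ˡ (rt∈ β))
      fin : ∀ {e} → SameE (rt α , rt β) e → ¬ Star (Adj K) (proj₁ e) (proj₂ e)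
      fin (inj₁ refl) st = ab st
      fin (inj₂ refl) st = ab (star-sym {K} st)

    kind-phylo : ∀ {G v} → VertexKind G v → (IsLeaf G v → Labelled v) × (Labelled v → IsLeaf G v) × (¬ IsLeaf G v → Deg G v 3)
    kind-phylo (leaf0 e d) = (λ _ → _ , e) , (λ _ → inj₁ d) , λ n → ⊥-elim (n (inj₁ d))
    kind-phylo (leaf1 e d) = (λ _ → _ , e) , (λ _ → inj₂ d) , λ n → ⊥-elim (n (inj₂ d))
    kind-phylo {G} {v} (inner {m} refl d) = (λ l → ⊥-elim (notLeaf l)) , (λ { (_ , ()) }) , λ _ → d
      where
      notLeaf : ¬ IsLeaf G (inj₂ m)
      notLeaf (inj₁ d') with () ← deg-unique {G} d d'
      notLeaf (inj₂ d') with () ← deg-unique {G} d d'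

    rep-phylo : ∀ {F G} → Rep F G → PhyloForest G
    rep-phylo {F} {G} r@(φ , h) = (unique-↭ (proj₁ (cont h)) (uniqueV h) , All.tabulate (λ i → wf (repE r i))) , acyclic , λ v i → kind-phylo (kind r i)
      where
      wf : ∀ {e} → LocE e F (cF φ) → proj₁ e ∈ verts G × proj₂ e ∈ verts G × proj₁ e ≢ proj₂ e
      wf (loc α β ρ p s q) = edge-ends α β ρ (holds-≃ q h) s
      no-cycle : ∀ {E₁ e E₂} → edges G ≡ E₁ ++ e ∷ E₂ → LocE e F (cF φ) → ¬ Star (Adj (mkG (verts G) (E₁ ++ E₂))) (proj₁ e) (proj₂ e)
      no-cycle eq (loc α β ρ p s q) = cut-disconnects α β ρ (holds-≃ (⊹-assoc (cT α) (cT β) (cF ρ)) (cut-edge⁻ (holds-≃ q h) eq s)) s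
      acyclic : Acyclic G
      acyclic E₁ e E₂ eq = no-cycle eq (repE r (subst (e ∈_) (sym eq) (∈-++⁺ʳ E₁ (here refl))))

    rts : ∀ {ps} → All Named ps → List (Vx A)
    rts []      = []
    rts (α ∷ π) = rt α ∷ rts π

    SuppStep : List (Vx A) → Graph A → Graph A → Set
    SuppStep S G₁ G₂ = Σ (Vx A) λ v → v ∈ S × Supp G₁ v G₂

    leaf-to-F : ∀ {ps F} x (π : All Named ps) (φ : All NamedU F) → cP (lf x ∷ π) ⊹ cF φ ≃ cP π ⊹ cF (one x ∷ φ)
    leaf-to-F x π φ = ⊹-shifts (cU (one x)) (cP π) (cF φ)

    node-cont : ∀ {ps F s t} (α : Named s) (β : Named t) (π : All Named ps) (φ : All NamedU F) →
      (proj₁ (cT α ⊹ cT β ⊹ cP π ⊹ cF φ) , (rt α , rt β) ∷ proj₂ (cT α ⊹ cT β ⊹ cP π ⊹ cF φ)) ≃ cP π ⊹ cF (edge α β ∷ φ)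
    node-cont α β π φ =
      V-Solver.solve 4 (λ a b c d → let _∙_ = V-Solver._⊕_ in a ∙ (b ∙ (c ∙ d)) V-Solver.⊜ c ∙ ((a ∙ b) ∙ d)) ↭-refl (vs α) (vs β) (proj₁ (cP π)) (proj₁ (cF φ)) ,
      E-Solver.solve 5 (λ x a b c d → let _∙_ = E-Solver._⊕_ in x ∙ (a ∙ (b ∙ (c ∙ d))) E-Solver.⊜ c ∙ ((x ∙ (a ∙ b)) ∙ d)) ≋-refl ((rt α , rt β) ∷ []) (es α) (es β) (proj₂ (cP π)) (proj₂ (cF φ))

    node-holds : ∀ {ps F s t G} n (α : Named s) (β : Named t) (π : All Named ps) (φ : All NamedU F) → Holds G (cP (nd n α β ∷ π) ⊹ cF φ) →
      Holds G (inj₂ n ∷ proj₁ (cT α ⊹ cT β ⊹ cP π ⊹ cF φ) , (inj₂ n , rt α) ∷ (inj₂ n , rt β) ∷ proj₂ (cT α ⊹ cT β ⊹ cP π ⊹ cF φ))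
      × All (λ e → ¬ Inc (inj₂ n) e) (proj₂ (cT α ⊹ cT β ⊹ cP π ⊹ cF φ)) × rt α ≢ rt β
    node-holds {G = G} n α β π φ h = h' , ¬inc-ends ends (unique-head (uniqueV h')) ,
      λ e → unique-disjoint (vs α) (unique-++ʳ (inj₂ n ∷ []) (uniqueV h')) (rt∈ α) (subst (_∈ proj₁ (cT β ⊹ cP π ⊹ cF φ)) (sym e) (∈-++⁺ˡ (rt∈ β)))
      where
      C = cT α ⊹ cT β ⊹ cP π ⊹ cF φ
      ends : Ends C
      ends = ends-⊹ {cT α} {cT β ⊹ cP π ⊹ cF φ} (ends-T α) (ends-⊹ {cT β} {cP π ⊹ cF φ} (ends-T β) (ends-⊹ {cP π} {cF φ} (ends-P π) (ends-F φ)))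
      p : ((cT α ⊹ cT β) ⊹ cP π) ⊹ cF φ ≃ C
      p = ≃-trans (⊹-cong (⊹-assoc (cT α) (cT β) (cP π)) (≃-refl {cF φ})) (≃-trans (⊹-assoc (cT α) (cT β ⊹ cP π) (cF φ)) (⊹-cong (≃-refl {cT α}) (⊹-assoc (cT β) (cP π) (cF φ))))
      h' : Holds G (inj₂ n ∷ proj₁ C , (inj₂ n , rt α) ∷ (inj₂ n , rt β) ∷ proj₂ C)
      h' = holds-≃ (prep _ (proj₁ p) , ≋-prep _ (≋-prep _ (proj₂ p))) h

    supp-star : ∀ {ps F G S} (π : All Named ps) (φ : All NamedU F) → Holds G (cP π ⊹ cF φ) → (∀ {v} → v ∈ rts π → v ∈ S) →
      ∃ λ K → Star (SuppStep S) G K × Rep (map unr ps ++ F) K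
    supp-star [] φ h sub = _ , ε , φ , h
    supp-star {ps = _ ∷ ps} {F} (lf x ∷ π) φ h sub =
      case supp-star π (one x ∷ φ) (holds-≃ (leaf-to-F x π φ) h) (sub ∘ there) of λ { (K , st , r) →
      K , st , rep-≈ (≈perm (shift (one x) (map unr ps) F)) r }
    supp-star {ps = nd s t ∷ ps} {F} (nd n α β ∷ π) φ h sub =
      case node-holds n α β π φ h of λ { (h' , ni , ne) →
      case supp-make h' ni ne of λ { (H , sp , h'') →
      case supp-star π (edge α β ∷ φ) (holds-≃ (node-cont α β π φ) h'') (sub ∘ there) of λ { (K , st , r) →
      K , (inj₂ n , sub (here refl) , sp) ◅ st , rep-≈ (≈perm (shift (edge s t) (map unr ps) F)) r }}}

    supp-set : ∀ {ps F G} (π : All Named ps) (φ : All NamedU F) → Holds G (cP π ⊹ cF φ) → ∀ {S} → (∀ {v} → v ∈ rts π → v ∈ S) →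
      ∃ λ K → SuppSet S G K × Rep (map unr ps ++ F) K
    supp-set π φ h sub = case supp-star π φ h sub of λ { (K , st , r) →
      K , (st , λ v _ i → ¬deg2 r i) , r }

    pickP : ∀ {ps v} (π : All Named ps) → v ∈ rts π →
      ∃ λ s → ∃ λ ps' → Σ (Named s) λ α → Σ (All Named ps') λ π' → ps ↭ s ∷ ps' × v ≡ rt α × cP π ≃ cT α ⊹ cP π' × (∀ {w} → w ∈ rts π → w ≡ v ⊎ w ∈ rts π') × (∀ {w} → w ∈ rts π' → w ∈ rts π)
    pickP (α ∷ π) (here refl) = _ , _ , α , π , ↭-refl , refl , ≃-refl , (λ { (here e) → inj₁ e ; (there i) → inj₂ i }) , there
    pickP (α ∷ π) (there i) with pickP π i
    ... | s , ps' , α' , π' , p , e , q , f , g = s , _ , α' , α ∷ π' , ↭-trans (prep _ p) (swap _ _ ↭-refl) , e ,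
          ≃-trans (⊹-cong (≃-refl {cT α}) q) (⊹-shifts (cT α) (cT α') (cP π')) ,
          (λ { (here e) → inj₂ (here e) ; (there i) → Sum.map id there (f i) }) , λ { (here e) → here e ; (there i) → there (g i) }

    supp-done : ∀ {ps F K S} (π : All Named ps) (φ : All NamedU F) → Holds K (cP π ⊹ cF φ) → (∀ {v} → v ∈ rts π → v ∈ S) →
      (∀ v → v ∈ S → v ∈ verts K → ¬ Deg K v 2) → Rep (map unr ps ++ F) K
    supp-done [] φ h sub no2 = φ , h
    supp-done {ps = _ ∷ ps} {F} (lf x ∷ π) φ h sub no2 =
      rep-≈ (≈perm (shift (one x) (map unr ps) F)) (supp-done π (one x ∷ φ) (holds-≃ (leaf-to-F x π φ) h) (sub ∘ there) no2)
    supp-done (nd n α β ∷ π) φ h sub no2 =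
      case node-holds n α β π φ h of λ { (h' , ni , ne) →
      ⊥-elim (no2 (inj₂ n) (sub (here refl)) (∈-resp-↭ (proj₁ (cont h')) (here refl))
        (holds-deg ((inj₂ n , rt α) ∷ (inj₂ n , rt β) ∷ []) h' (inj₁ refl ∷ inj₁ refl ∷ []) ni)) }

    joins-incʳ : ∀ {u w} {e : Edge A} → Joins e u w → Inc w e
    joins-incʳ (inj₁ refl) = inj₂ refl
    joins-incʳ (inj₂ refl) = inj₁ refl

    supp-leaf : ∀ {ps F G H x} (π : All Named ps) (φ : All NamedU F) → Holds G (cT (lf x) ⊹ cP π ⊹ cF φ) → ¬ Supp G (leaf x) H
    supp-leaf π φ h (_ , _ , _ , _ , a , _ , _ , _ , pE , ja , _) = bad (≋-∈ (≋-sym (proj₂ (cont h))) (∈-resp-↭ (↭-sym pE) (here refl)))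
      where
      bad : (∃ λ e → e ∈ proj₂ (cP π ⊹ cF φ) × SameE a e) → ⊥
      bad (e , k , s) = All.lookup (¬inc-ends (ends-⊹ {cP π} {cF φ} (ends-P π) (ends-F φ)) (unique-head (uniqueV h))) k (inc-resp s (joins-incʳ ja))

    supp-node : ∀ {ps F s t G H} n (α : Named s) (β : Named t) (π : All Named ps) (φ : All NamedU F) → Holds G (cP (nd n α β ∷ π) ⊹ cF φ) → Supp G (inj₂ n) H →
      Holds H (cP π ⊹ cF (edge α β ∷ φ)) × (∀ {v} → v ∈ verts H → v ∈ verts G × v ≢ inj₂ n)
    supp-node {G = G} {H} n α β π φ h sp = exposed (node-holds n α β π φ h)
      where
      C = cT α ⊹ cT β ⊹ cP π ⊹ cF φ
      exposed : Holds G (inj₂ n ∷ proj₁ C , (inj₂ n , rt α) ∷ (inj₂ n , rt β) ∷ proj₂ C) × All (λ e → ¬ Inc (inj₂ n) e) (proj₂ C) × rt α ≢ rt β →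
        Holds H (cP π ⊹ cF (edge α β ∷ φ)) × (∀ {v} → v ∈ verts H → v ∈ verts G × v ≢ inj₂ n)
      exposed (h' , ni , _) = holds-≃ (node-cont α β π φ) hH ,
        λ j → ∈-resp-↭ (proj₁ (cont h')) (there (∈-resp-↭ (↭-sym (proj₁ (cont hH))) j)) ,
              λ { refl → unique-head (uniqueV h') (∈-resp-↭ (↭-sym (proj₁ (cont hH))) j) }
        where
        hH : Holds H (proj₁ C , (rt α , rt β) ∷ proj₂ C)
        hH = supp-view h' ni sp

    supp-vertex : ∀ {G H : Graph A} {v} → Supp G v H → v ∈ verts G
    supp-vertex {v = v} (V₁ , _ , _ , _ , _ , _ , _ , eqV , _) = subst (v ∈_) (sym eqV) (∈-++⁺ʳ V₁ (here refl))

    supp-analyse : ∀ {ps F G K S} (π : All Named ps) (φ : All NamedU F) → Holds G (cP π ⊹ cF φ) →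
      (∀ {v} → v ∈ S → v ∈ verts G → v ∈ rts π) → (∀ {v} → v ∈ rts π → v ∈ S) → Star (SuppStep S) G K →
      (∀ v → v ∈ S → v ∈ verts K → ¬ Deg K v 2) → Rep (map unr ps ++ F) K
    supp-first : ∀ {ps ps' F G H K S s v} (π' : All Named ps') (φ : All NamedU F) (α : Named s) → ps ↭ s ∷ ps' → v ≡ rt α → Holds G (cP (α ∷ π') ⊹ cF φ) →
      (∀ {w} → w ∈ S → w ∈ verts G → w ≡ v ⊎ w ∈ rts π') → (∀ {w} → w ∈ rts π' → w ∈ S) → Supp G v H → Star (SuppStep S) H K →
      (∀ v → v ∈ S → v ∈ verts K → ¬ Deg K v 2) → Rep (map unr ps ++ F) K
    supp-analyse π φ h sub' sub ε no2 = supp-done π φ h sub no2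
    supp-analyse {ps} {F} {K = K} π φ h sub' sub ((v , v∈S , sp) ◅ st) no2 = pending (pickP π (sub' v∈S (supp-vertex sp)))
      where
      pending : (∃ λ s → ∃ λ ps' → Σ (Named s) λ α → Σ (All Named ps') λ π' → ps ↭ s ∷ ps' × v ≡ rt α × cP π ≃ cT α ⊹ cP π' × (∀ {w} → w ∈ rts π → w ≡ v ⊎ w ∈ rts π') × (∀ {w} → w ∈ rts π' → w ∈ rts π)) →
        Rep (map unr ps ++ F) K
      pending (_ , _ , α , π' , p , e , q , f , g) = supp-first π' φ α p e (holds-≃ (⊹-cong q (≃-refl {cF φ})) h) (λ i j → f (sub' i j)) (sub ∘ g) sp st no2
    supp-first π' φ (lf x) p refl h f sub sp st no2 = ⊥-elim (supp-leaf π' φ (holds-≃ (⊹-assoc (cT (lf x)) (cP π') (cF φ)) h) sp)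
    supp-first {ps} {ps'} {F} {G} {H} {K} {S} π' φ (nd {s} {t} n α β) p refl h f sub sp st no2 = rest (supp-node n α β π' φ h sp)
      where
      rest : Holds H (cP π' ⊹ cF (edge α β ∷ φ)) × (∀ {v} → v ∈ verts H → v ∈ verts G × v ≢ inj₂ n) → Rep (map unr ps ++ F) K
      rest (hH , out) = rep-≈ (≈perm (↭-trans (shift (edge s t) (map unr ps') F) (++⁺ʳ F (map⁺ unr (↭-sym p)))))
        (supp-analyse π' (edge α β ∷ φ) hH (λ i j → left (proj₂ (out j)) (f i (proj₁ (out j)))) sub st no2)
        where
        left : ∀ {w} → w ≢ inj₂ n → w ≡ inj₂ n ⊎ w ∈ rts π' → w ∈ rts π'
        left n (inj₁ e) = ⊥-elim (n e)
        left n (inj₂ i) = i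

    pend-two : ∀ {s t R} (α : Named s) (β : Named t) (ρ : All NamedU R) → (vs α ++ vs β , es α ++ es β) ⊹ cF ρ ≃ cP (α ∷ β ∷ []) ⊹ cF ρ
    pend-two α β ρ = ⊹-cong (⊹-cong (≃-refl {cT α}) (↭-reflexive (sym (List.++-identityʳ (vs β))) , ≋-reflexive (sym (List.++-identityʳ (es β))))) (≃-refl {cF ρ})

    pend-one : ∀ {t R} (β : Named t) (ρ : All NamedU R) → cT β ⊹ cF ρ ≃ cP (β ∷ []) ⊹ cF ρ
    pend-one β ρ = ⊹-cong (↭-reflexive (sym (List.++-identityʳ (vs β))) , ≋-reflexive (sym (List.++-identityʳ (es β)))) (≃-refl {cF ρ})

    sameE-ends : ∀ {u w v} {e : Edge A} → SameE (u , w) e → v ∈ u ∷ w ∷ [] → v ∈ proj₁ e ∷ proj₂ e ∷ []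
    sameE-ends (inj₁ refl) i = i
    sameE-ends (inj₂ refl) (here e) = there (here e)
    sameE-ends (inj₂ refl) (there (here e)) = here e

    cut-make : ∀ {s t R G} (α : Named s) (β : Named t) (ρ : All NamedU R) → Holds G (cU (edge α β) ⊹ cF ρ) →
      ∃ λ E₁ → ∃ λ e → ∃ λ E₂ → ∃ λ K → Cut G E₁ e E₂ K × SameE (rt α , rt β) e × Rep (cutF s t R) K
    cut-make α β ρ h =
      case cut-edge h of λ { (E₁ , e , E₂ , eq , s , h') →
      case supp-set (α ∷ β ∷ []) ρ (holds-≃ (pend-two α β ρ) h') (sameE-ends s) of λ { (K , ss , r) →
      E₁ , e , E₂ , K , (eq , ss) , s , r }}

    sameE-ends⁻ : ∀ {u w v} {e : Edge A} → SameE (u , w) e → v ∈ proj₁ e ∷ proj₂ e ∷ [] → v ∈ u ∷ w ∷ []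
    sameE-ends⁻ (inj₁ refl) i = i
    sameE-ends⁻ (inj₂ refl) (here e) = there (here e)
    sameE-ends⁻ (inj₂ refl) (there (here e)) = here e

    cut-view : ∀ {F G E₁ e E₂ K} → Rep F G → Cut G E₁ e E₂ K → ∃ λ s → ∃ λ t → ∃ λ R → F ≈ edge s t ∷ R × Rep (cutF s t R) K
    cut-view {F} {E₁ = E₁} {e} {K = K} r@(φ , h) (eq , st , no2) = at (repE r (subst (e ∈_) (sym eq) (∈-++⁺ʳ E₁ (here refl))))
      where
      at : LocE e F (cF φ) → ∃ λ s → ∃ λ t → ∃ λ R → F ≈ edge s t ∷ R × Rep (cutF s t R) K
      at (loc α β ρ p s q) = _ , _ , _ , p ,
        supp-analyse (α ∷ β ∷ []) ρ (holds-≃ (pend-two α β ρ) (cut-edge⁻ (holds-≃ q h) eq s)) (λ i _ → sameE-ends⁻ s i) (sameE-ends s) st no2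

    iso-refl : ∀ {F G} → Rep F G → Iso G G
    iso-refl {G = G} (φ , h) = id , (λ _ → refl) , unique-↭ (proj₁ (cont h)) (uniqueV h) , ↭-reflexive (List.map-id (verts G)) ,
      ≋⇒edgesEq (≋-reflexive (List.map-id (edges G)))

    sameE-joins : ∀ {u w} {e : Edge A} → SameE (u , w) e → Joins e u w
    sameE-joins (inj₁ refl) = inj₁ refl
    sameE-joins (inj₂ refl) = inj₂ refl

    minus-make : ∀ {x F F₂ G} → Rem x F F₂ → Rep F G → ∃ λ K → MinusLeaf G (ι x) K × Rep F₂ K
    minus-make {x} {G = G} (isol p) r with rep-≈ p r
    ... | one .x ∷ ρ , h with V₁ , V₂ , eq , pV ← remove-vertex (proj₁ (cont h)) =
      let K = mkG (V₁ ++ V₂) (edges G) ; r' = ρ , holds (unique-++ʳ (leaf x ∷ []) (uniqueV h)) (pV , proj₂ (cont h)) in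
      K , inj₁ (deg-isol ρ h , K , (V₁ , V₂ , eq , refl) , iso-refl r') , r'
    minus-make {x} {G = G} (pend p) r with rep-≈ p r
    ... | edge (lf .x) β ∷ ρ , h with E₁ , e , E₂ , eqE , s , h₁ ← cut-edge h
                                with V₁ , V₂ , eqV , pV ← remove-vertex (proj₁ (cont h₁)) =
      let h₂ = holds {mkG (V₁ ++ V₂) (E₁ ++ E₂)} (unique-++ʳ (leaf x ∷ []) (uniqueV h₁)) (pV , proj₂ (cont h₁))
      in case supp-set (β ∷ []) ρ (holds-≃ (pend-one β ρ) h₂) id of λ { (K , ss , r') →
      K , inj₂ (E₁ , e , E₂ , rt β , _ , K , eqE , sameE-joins s , (V₁ , V₂ , eqV , refl) , ss , iso-refl r') , r' }

    rename : (f : Vx A → Vx A) → (∀ a → f (inj₁ a) ≡ inj₁ a) → ∀ {s} (α : Named s) → (∀ n → inj₂ n ∈ vs α → ∃ λ m → f (inj₂ n) ≡ inj₂ m) →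
      Σ (Named s) λ α' → rt α' ≡ f (rt α) × vs α' ≡ map f (vs α) × es α' ≡ map (λ e → f (proj₁ e) , f (proj₂ e)) (es α)
    rename f fl (lf x) ok = lf x , sym (fl _) , cong (_∷ []) (sym (fl _)) , refl
    rename f fl (nd n α β) ok =
      case ok n (here refl) of λ { (m , e) →
      case rename f fl α (λ k i → ok k (there (∈-++⁺ˡ i))) of λ { (α' , a , b , c) →
      case rename f fl β (λ k i → ok k (there (∈-++⁺ʳ (vs α) i))) of λ { (β' , a' , b' , c') →
      nd m α' β' , sym e , cong₂ _∷_ (sym e) (Eq.trans (cong₂ _++_ b b') (sym (List.map-++ f (vs α) (vs β)))) ,
         cong₂ _∷_ (cong₂ _,_ (sym e) a) (cong₂ _∷_ (cong₂ _,_ (sym e) a') (Eq.trans (cong₂ _++_ c c') (sym (List.map-++ _ (es α) (es β))))) }}}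

    mapC : (Vx A → Vx A) → Cont → Cont
    mapC f (V , E) = map f V , map (λ e → f (proj₁ e) , f (proj₂ e)) E

    renameU : (f : Vx A → Vx A) → (∀ a → f (inj₁ a) ≡ inj₁ a) → ∀ {U} (ν : NamedU U) → (∀ n → inj₂ n ∈ proj₁ (cU ν) → ∃ λ m → f (inj₂ n) ≡ inj₂ m) →
      Σ (NamedU U) λ ν' → cU ν' ≡ mapC f (cU ν)
    renameU f fl (one x) ok = one x , cong (λ v → v ∷ [] , []) (sym (fl _))
    renameU f fl (edge α β) ok =
      case rename f fl α (λ k i → ok k (∈-++⁺ˡ i)) of λ { (α' , a , b , c) →
      case rename f fl β (λ k i → ok k (∈-++⁺ʳ (vs α) i)) of λ { (β' , a' , b' , c') →
      edge α' β' , cong₂ _,_ (Eq.trans (cong₂ _++_ b b') (sym (List.map-++ f (vs α) (vs β))))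
           (cong₂ _∷_ (cong₂ _,_ a a') (Eq.trans (cong₂ _++_ c c') (sym (List.map-++ _ (es α) (es β))))) }}

    renameF : (f : Vx A → Vx A) → (∀ a → f (inj₁ a) ≡ inj₁ a) → ∀ {F} (φ : All NamedU F) → (∀ n → inj₂ n ∈ proj₁ (cF φ) → ∃ λ m → f (inj₂ n) ≡ inj₂ m) →
      Σ (All NamedU F) λ φ' → cF φ' ≡ mapC f (cF φ)
    renameF f fl [] ok = [] , refl
    renameF f fl (ν ∷ φ) ok =
      case renameU f fl ν (λ k i → ok k (∈-++⁺ˡ i)) of λ { (ν' , a) →
      case renameF f fl φ (λ k i → ok k (∈-++⁺ʳ (proj₁ (cU ν)) i)) of λ { (φ' , b) →
      ν' ∷ φ' , Eq.trans (cong₂ _⊹_ a b) (cong₂ _,_ (sym (List.map-++ f (proj₁ (cU ν)) (proj₁ (cF φ)))) (sym (List.map-++ _ (proj₂ (cU ν)) (proj₂ (cF φ))))) }}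

    map-≋ : (f : Vx A → Vx A) → ∀ {E E'} → E ≋ E' → map (λ e → f (proj₁ e) , f (proj₂ e)) E ≋ map (λ e → f (proj₁ e) , f (proj₂ e)) E'
    map-≋ f (Homogeneous.refl p) = Homogeneous.refl (mp p)
      where
      mp : ∀ {E E'} → Pointwise SameE E E' → Pointwise SameE (map (λ e → f (proj₁ e) , f (proj₂ e)) E) (map (λ e → f (proj₁ e) , f (proj₂ e)) E')
      mp [] = []
      mp (inj₁ refl ∷ p) = inj₁ refl ∷ mp p
      mp (inj₂ refl ∷ p) = inj₂ refl ∷ mp p
    map-≋ f (Homogeneous.prep (inj₁ refl) p) = Homogeneous.prep (inj₁ refl) (map-≋ f p)
    map-≋ f (Homogeneous.prep (inj₂ refl) p) = Homogeneous.prep (inj₂ refl) (map-≋ f p)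
    map-≋ f (Homogeneous.swap e e' p) = Homogeneous.swap (r e) (r e') (map-≋ f p)
      where
      r : ∀ {e e' : Edge A} → SameE e e' → SameE (f (proj₁ e) , f (proj₂ e)) (f (proj₁ e') , f (proj₂ e'))
      r (inj₁ refl) = inj₁ refl
      r (inj₂ refl) = inj₂ refl
    map-≋ f (Homogeneous.trans p q) = Homogeneous.trans (map-≋ f p) (map-≋ f q)

    rep-iso : ∀ {F K H} → Rep F K → Iso K H → PhyloForest H → Rep F H
    rep-iso {F} {K} {H} r@(φ , h) (f , fl , uH , pV , pE) (_ , _ , vert) =
      case renameF f fl φ ok of λ { (φ' , e) →
      let q : mapC f (cF φ) ≃ (verts H , edges H)
          q = ↭-trans (map⁺ f (proj₁ (cont h))) pV , ≋-trans (map-≋ f (proj₂ (cont h))) (edgesEq⇒≋ pE)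
          q' = subst (_≃ (verts H , edges H)) (sym e) q
      in φ' , holds (unique-↭ (↭-sym (proj₁ q')) uH) q' }
      where
      ok : ∀ n → inj₂ n ∈ proj₁ (cF φ) → ∃ λ m → f (inj₂ n) ≡ inj₂ m
      ok n i with f (inj₂ n) in eq
      ... | inj₂ m = m , refl
      ... | inj₁ a with locateVF φ i
      ...   | isol ρ p () q
      ...   | conn (lf x) β ρ p () q
      ...   | conn (nd _ α₁ α₂) β ρ p refl q = ⊥-elim (¬two-incident-leaf {H} two' (inj₁ eq) (inj₁ eq) (proj₁ (proj₂ (vert (inj₁ a) a∈)) (a , refl)))
        where
        two' = ≋-trans (map-≋ f (≋-trans (≋-sym (proj₂ q)) (proj₂ (cont h)))) (edgesEq⇒≋ pE)
        a∈ : inj₁ a ∈ verts H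
        a∈ = ∈-resp-↭ pV (subst (_∈ map f (verts K)) eq (∈-map⁺ f (∈-resp-↭ (proj₁ (cont h)) i)))

    joins-end : ∀ {u v w} {e : Edge A} → SameE e (u , v) → Joins e u w → w ≡ v
    joins-end (inj₁ refl) (inj₁ refl) = refl
    joins-end (inj₁ refl) (inj₂ refl) = refl
    joins-end (inj₂ refl) (inj₁ refl) = refl
    joins-end (inj₂ refl) (inj₂ refl) = refl

    joins-inc : ∀ {u w} {e : Edge A} → Joins e u w → Inc u e
    joins-inc (inj₁ refl) = inj₁ refl
    joins-inc (inj₂ refl) = inj₂ refl

    isolated-edge : ∀ {G x R u e} (ρ : All NamedU R) → Holds G (cU (one x) ⊹ cF ρ) → e ∈ edges G → ¬ Joins e (leaf x) u
    isolated-edge {x = x} {e = e} ρ h i j = bad (≋-∈ (≋-sym (proj₂ (cont h))) i)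
      where
      bad : (∃ λ e' → e' ∈ proj₂ (cF ρ) × SameE e e') → ⊥
      bad (e' , k , s) = All.lookup (¬inc-ends (ends-F ρ) (unique-head (uniqueV h))) k (inc-resp s (joins-inc j))

    leaf-edge : ∀ {G x t R u e} (β : Named t) (ρ : All NamedU R) → Holds G (cU (edge (lf x) β) ⊹ cF ρ) → e ∈ edges G → Joins e (leaf x) u → SameE (leaf x , rt β) e × u ≡ rt β
    leaf-edge {x = x} {u = u} {e} β ρ h i j = which (≋-∈ (≋-sym (proj₂ (cont h))) i)
      where
      which : (∃ λ e' → e' ∈ (leaf x , rt β) ∷ es β ++ proj₂ (cF ρ) × SameE e e') → SameE (leaf x , rt β) e × u ≡ rt β
      which (_ , here refl , s) = sameE-sym s , joins-end s j
      which (_ , there k , s) = ⊥-elim (All.lookup (¬inc-leaf β ρ h) k (inc-resp s (joins-inc j)))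

    drop-vertex : ∀ {v : Vx A} {V W V₁ V₂} → v ∷ V ↭ W → W ≡ V₁ ++ v ∷ V₂ → V ↭ V₁ ++ V₂
    drop-vertex {v} {V₁ = V₁} {V₂} p eq = drop-∷ (↭-trans p (↭-trans (↭-reflexive eq) (shift v V₁ V₂)))

    MinusView : A → Forest → Graph A → Set
    MinusView a F H = ∃ λ x → ∃ λ F₂ → ι x ≡ a × Rem x F F₂ × Rep F₂ H

    minus-isolated : ∀ {a F C G H K} → Holds G C → LocV (inj₁ a) F C → Deg G (inj₁ a) 0 → RemoveV G (inj₁ a) K → Iso K H → PhyloForest H → MinusView a F H
    minus-isolated {G = G} h (isol {x} ρ p refl q) d (V₁ , V₂ , eq , refl) iso ph = x , _ , refl , isol p , rep-iso (ρ , drop (holds-≃ q h)) iso ph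
      where
      drop : Holds G (cU (one x) ⊹ cF ρ) → Holds (mkG (V₁ ++ V₂) (edges G)) (cF ρ)
      drop h' = holds (unique-++ʳ (leaf x ∷ []) (uniqueV h')) (drop-vertex (proj₁ (cont h')) eq , proj₂ (cont h'))
    minus-isolated {G = G} h (conn (lf x) β ρ p refl q) d _ iso ph with () ← deg-unique {G} d (deg-leaf β ρ (holds-≃ q h))

    minus-pendant : ∀ {a F C G H K₁ K₂ E₁ e E₂ u} → Holds G C → LocV (inj₁ a) F C → edges G ≡ E₁ ++ e ∷ E₂ → Joins e (inj₁ a) u →
      RemoveV (mkG (verts G) (E₁ ++ E₂)) (inj₁ a) K₁ → SuppSet (u ∷ []) K₁ K₂ → Iso K₂ H → PhyloForest H → MinusView a F H
    minus-pendant {E₁ = E₁} {e} h (isol ρ p refl q) eqE j _ _ _ _ = ⊥-elim (isolated-edge ρ (holds-≃ q h) (subst (e ∈_) (sym eqE) (∈-++⁺ʳ E₁ (here refl))) j)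
    minus-pendant {F = F} {H = H} {E₁ = E₁} {e} {E₂} {u} h (conn {t = t} {R} (lf x) β ρ p refl q) eqE j (V₁ , V₂ , eqV , refl) (st , no2) iso ph =
      x , _ , refl , pend p , detach (leaf-edge β ρ h' (subst (e ∈_) (sym eqE) (∈-++⁺ʳ E₁ (here refl))) j)
      where
      h' = holds-≃ q h
      detach : SameE (leaf x , rt β) e × u ≡ rt β → Rep (unr t ∷ R) H
      detach (s , refl) = rep-iso (supp-analyse (β ∷ []) ρ (holds-≃ (pend-one β ρ) h₂) (λ i _ → i) id st no2) iso ph
        where
        h₁ = cut-edge⁻ h' eqE s
        h₂ : Holds (mkG (V₁ ++ V₂) (E₁ ++ E₂)) (cT β ⊹ cF ρ)
        h₂ = holds (unique-++ʳ (leaf x ∷ []) (uniqueV h₁)) (drop-vertex (proj₁ (cont h₁)) eqV , proj₂ (cont h₁))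

    removed-vertex : ∀ {G K : Graph A} {v} → RemoveV G v K → v ∈ verts G
    removed-vertex {v = v} (V₁ , _ , eq , _) = subst (v ∈_) (sym eq) (∈-++⁺ʳ V₁ (here refl))

    minus-view : ∀ {a F G H} → Rep F G → MinusLeaf G a H → PhyloForest H → MinusView a F H
    minus-view r (inj₁ (d , K , rm , iso)) ph = minus-isolated (proj₂ r) (repV r (removed-vertex rm)) d rm iso ph
    minus-view r (inj₂ (E₁ , e , E₂ , u , K₁ , K₂ , eqE , j , rm , ss , iso)) ph = minus-pendant (proj₂ r) (repV r (removed-vertex rm)) eqE j rm ss iso ph

    minusEdge-view : ∀ {F G P H} → Rep F G → MinusEdge G P H → PhyloForest H → ∃ λ s → ∃ λ t → ∃ λ R → F ≈ edge s t ∷ R × Rep (cutF s t R) H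
    minusEdge-view r (E₁ , e , E₂ , K , c , _ , iso) ph =
      case cut-view r c of λ { (s , t , R , p , r') →
      s , t , R , p , rep-iso r' iso ph }

    -- The components of an acyclic graph, before the degree conditions make them binary.
    data Rose : Set where
      node : Vx A → List Rose → Rose

    rtR : Rose → Vx A
    rtR (node v _) = v

    vsR  : Rose → List (Vx A)
    vsRs : List Rose → List (Vx A)
    vsR (node v ts) = v ∷ vsRs ts
    vsRs []       = []
    vsRs (t ∷ ts) = vsR t ++ vsRs ts

    esR  : Rose → List (Edge A)
    esRs : Vx A → List Rose → List (Edge A)
    esR (node v ts) = esRs v ts
    esRs v []       = []
    esRs v (t ∷ ts) = (v , rtR t) ∷ esR t ++ esRs v ts

    cR : Rose → Cont
    cR t = vsR t , esR t

    cRs : Vx A → List Rose → Cont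
    cRs v ts = vsRs ts , esRs v ts

    hang : Vx A → Rose → Cont
    hang v t = vsR t , (v , rtR t) ∷ esR t

    cRF : List Rose → Cont
    cRF []       = [] , []
    cRF (t ∷ ts) = cR t ⊹ cRF ts

    cRs-++ : ∀ v ts us → cRs v (ts ++ us) ≡ cRs v ts ⊹ cRs v us
    cRs-++ v [] us = refl
    cRs-++ v (t ∷ ts) us = cong₂ _,_
      (Eq.trans (cong (vsR t ++_) (cong proj₁ (cRs-++ v ts us))) (sym (List.++-assoc (vsR t) (vsRs ts) (vsRs us))))
      (cong ((v , rtR t) ∷_) (Eq.trans (cong (esR t ++_) (cong proj₂ (cRs-++ v ts us))) (sym (List.++-assoc (esR t) (esRs v ts) (esRs v us)))))

    hereC : Vx A → Cont
    hereC v = v ∷ [] , []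

    reroot  : ∀ t {v} ups → v ∈ vsR t → ∃ λ cs → hereC v ⊹ cRs v cs ≃ cR t ⊹ cRs (rtR t) ups
    rerootL : ∀ r {v} acc ts → v ∈ vsRs ts → ∃ λ cs → hereC v ⊹ cRs v cs ≃ hereC r ⊹ cRs r acc ⊹ cRs r ts
    reroot (node r cs) ups (here refl) = cs ++ ups , subst (λ C → hereC r ⊹ C ≃ cR (node r cs) ⊹ cRs r ups) (sym (cRs-++ r cs ups)) ≃-refl
    reroot (node r cs) ups (there i) = case rerootL r ups cs i of λ { (cs' , p) →
      cs' , ≃-trans p (⊹-cong (≃-refl {hereC r}) (⊹-comm (cRs r ups) (cRs r cs))) }
    rerootL r {v} acc (t ∷ ts) i with ∈-++⁻ (vsR t) i
    ... | inj₂ j = case rerootL r (t ∷ acc) ts j of λ { (cs , p) →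
      cs , ≃-trans p
          ( V-Solver.solve 4 (λ r t a u → let _∙_ = V-Solver._⊕_ in r ∙ ((t ∙ a) ∙ u) V-Solver.⊜ r ∙ (a ∙ (t ∙ u))) ↭-refl (r ∷ []) (vsR t) (vsRs acc) (vsRs ts)
          , E-Solver.solve 4 (λ x t a u → let _∙_ = E-Solver._⊕_ in (x ∙ (t ∙ a)) ∙ u E-Solver.⊜ a ∙ (x ∙ (t ∙ u))) ≋-refl ((r , rtR t) ∷ []) (esR t) (esRs r acc) (esRs r ts)) }
    ... | inj₁ j = case reroot t (node r (acc ++ ts) ∷ []) j of λ { (cs , p) →
      cs , ≃-trans p (≃-trans
          (Eq.subst₂ (λ V E → cR t ⊹ (r ∷ vsRs (acc ++ ts) ++ [] , (rtR t , r) ∷ esRs r (acc ++ ts) ++ []) ≃ (vsR t ++ r ∷ V ++ [] , esR t ++ (rtR t , r) ∷ E ++ []))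
            (cong proj₁ (cRs-++ r acc ts)) (cong proj₂ (cRs-++ r acc ts)) ≃-refl)
          ( V-Solver.solve 4 (λ r t a u → let _∙_ = V-Solver._⊕_ in t ∙ (r ∙ ((a ∙ u) ∙ V-Solver.id)) V-Solver.⊜ r ∙ (a ∙ (t ∙ u))) ↭-refl (r ∷ []) (vsR t) (vsRs acc) (vsRs ts)
          , ≋-trans (E-Solver.solve 4 (λ x t a u → let _∙_ = E-Solver._⊕_ in t ∙ (x ∙ ((a ∙ u) ∙ E-Solver.id)) E-Solver.⊜ x ∙ (a ∙ (t ∙ u))) ≋-refl ((rtR t , r) ∷ []) (esR t) (esRs r acc) (esRs r ts))
             (≋-trans (Homogeneous.prep (inj₂ refl) ≋-refl)
               (E-Solver.solve 4 (λ x t a u → let _∙_ = E-Solver._⊕_ in x ∙ (a ∙ (t ∙ u)) E-Solver.⊜ a ∙ (x ∙ (t ∙ u))) ≋-refl ((r , rtR t) ∷ []) (esR t) (esRs r acc) (esRs r ts))))) }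

    star-rose  : ∀ {G : Graph A} t {v} → (∀ {a b} → (a , b) ∈ esR t → Adj G a b) → v ∈ vsR t → Star (Adj G) (rtR t) v
    star-roseL : ∀ {G : Graph A} r ts {v} → (∀ {a b} → (a , b) ∈ esRs r ts → Adj G a b) → v ∈ vsRs ts → Star (Adj G) r v
    star-rose (node r ts) sub (here refl) = ε
    star-rose {G} (node r ts) sub (there i) = star-roseL {G} r ts sub i
    star-roseL {G} r (t ∷ ts) sub i with ∈-++⁻ (vsR t) i
    ... | inj₁ j = sub (here refl) ◅ star-rose {G} t (λ k → sub (there (∈-++⁺ˡ k))) j
    ... | inj₂ j = star-roseL {G} r ts (λ k → sub (there (∈-++⁺ʳ (esR t) k))) j

    cRF-↭ : ∀ {ts us} → ts ↭ us → cRF ts ≃ cRF us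
    cRF-↭ refl         = ≃-refl
    cRF-↭ (prep t p)   = ⊹-cong (≃-refl {cR t}) (cRF-↭ p)
    cRF-↭ {_ ∷ _ ∷ ts} (swap t u p) = ≃-trans (⊹-shifts (cR t) (cR u) (cRF ts)) (⊹-cong (≃-refl {cR u}) (⊹-cong (≃-refl {cR t}) (cRF-↭ p)))
    cRF-↭ (trans p q)  = ≃-trans (cRF-↭ p) (cRF-↭ q)

    find-rose : ∀ {v} ts → v ∈ proj₁ (cRF ts) → ∃ λ t → ∃ λ us → v ∈ vsR t × ts ↭ t ∷ us
    find-rose (t ∷ ts) i with ∈-++⁻ (vsR t) i
    ... | inj₁ j = t , ts , j , ↭-refl
    ... | inj₂ j = case find-rose ts j of λ { (u , us , k , p) →
      u , t ∷ us , k , ↭-trans (prep t p) (swap t u ↭-refl) }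

    AcyclicE : List (Vx A) → List (Edge A) → Set
    AcyclicE V E = Acyclic (mkG V E)

    star-mono : ∀ {G H : Graph A} → (∀ {e} → e ∈ edges G → e ∈ edges H) → ∀ {u v} → Star (Adj G) u v → Star (Adj H) u v
    star-mono f ε = ε
    star-mono {G} {H} f ((e , i , j) ◅ s) = (e , f i , j) ◅ star-mono {G} {H} f s

    roses : ∀ V E → All (λ e → proj₁ e ∈ V × proj₂ e ∈ V) E → AcyclicE V E → ∃ λ ts → cRF ts ≃ (V , E)
    roses V [] en ac = map (λ v → node v []) V , start V
      where
      start : ∀ V → cRF (map (λ v → node v []) V) ≃ (V , [])
      start []      = ≃-refl
      start (v ∷ V) = case start V of λ { (p , q) →
        prep v p , q }
    roses V ((u , v) ∷ E) ((u∈ , v∈) ∷ en) ac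
      with roses V E en (λ E₁ e E₂ eq s → ac ((u , v) ∷ E₁) e E₂ (cong ((u , v) ∷_) eq) (star-mono {mkG V (E₁ ++ E₂)} {mkG V (_ ∷ E₁ ++ E₂)} there s))
    ... | ts , p with find-rose ts (∈-resp-↭ (↭-sym (proj₁ p)) u∈)
    ... | t , us , i , q with ∈-++⁻ (vsR t) (∈-resp-↭ (↭-trans (↭-sym (proj₁ p)) (proj₁ (cRF-↭ q))) v∈)
    ... | inj₁ j = ⊥-elim (ac [] (u , v) E refl (star-sym {mkG V E} (star-rose {mkG V E} t adj i) ◅◅ star-rose {mkG V E} t adj j))
      where
      adj : ∀ {a b} → (a , b) ∈ esR t → Adj (mkG V E) a b
      adj k with ≋-∈ (≋-trans (≋-sym (proj₂ (cRF-↭ q))) (proj₂ p)) (∈-++⁺ˡ k)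
      ... | e , l , inj₁ refl = e , l , inj₁ refl
      ... | e , l , inj₂ refl = e , l , inj₂ refl
    ... | inj₂ j with find-rose us j
    ... | t' , us' , k , q' with reroot t [] i | reroot t' [] k
    ... | cs , r | cs' , r' = node u (node v cs' ∷ cs) ∷ us' ,
          ≃-trans ( V-Solver.solve 5 (λ u v a b c → let _∙_ = V-Solver._⊕_ in (u ∙ ((v ∙ b) ∙ a)) ∙ c V-Solver.⊜ (u ∙ a) ∙ ((v ∙ b) ∙ c)) ↭-refl (u ∷ []) (v ∷ []) (vsRs cs) (vsRs cs') (proj₁ (cRF us'))
                  , E-Solver.solve 4 (λ x a b c → let _∙_ = E-Solver._⊕_ in (x ∙ (b ∙ a)) ∙ c E-Solver.⊜ x ∙ (a ∙ (b ∙ c))) ≋-refl ((u , v) ∷ []) (esRs u cs) (esRs v cs') (proj₂ (cRF us')))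
            (proj₁ total , ≋-prep (u , v) (proj₂ total))
      where
      strip : ∀ {C} t → C ≃ cR t ⊹ cRs (rtR t) [] → C ≃ cR t
      strip t p = ≃-trans p (↭-reflexive (List.++-identityʳ (vsR t)) , ≋-reflexive (List.++-identityʳ (esR t)))
      total : cR (node u cs) ⊹ cR (node v cs') ⊹ cRF us' ≃ (V , E)
      total = ≃-trans (⊹-cong (strip t r) (⊹-cong (strip t' r') (≃-refl {cRF us'})))
                (≃-trans (⊹-cong (≃-refl {cR t}) (≃-sym (cRF-↭ q'))) (≃-trans (≃-sym (cRF-↭ q)) p))

    ends-R  : ∀ t → Ends (cR t)
    ends-Rs : ∀ v ts → All (λ e → proj₁ e ∈ v ∷ vsRs ts × proj₂ e ∈ v ∷ vsRs ts) (esRs v ts)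
    rtR∈ : ∀ t → rtR t ∈ vsR t
    rtR∈ (node v ts) = here refl
    ends-R (node v ts) = ends-Rs v ts
    ends-Rs v [] = []
    ends-Rs v (t ∷ ts) = (here refl , there (∈-++⁺ˡ (rtR∈ t))) ∷
      All.++⁺ (All.map (λ { (i , j) → there (∈-++⁺ˡ i) , there (∈-++⁺ˡ j) }) (ends-R t))
              (All.map (λ { (i , j) → w i , w j }) (ends-Rs v ts))
      where
      w : ∀ {x} → x ∈ v ∷ vsRs ts → x ∈ v ∷ vsR t ++ vsRs ts
      w (here e)  = here e
      w (there i) = there (∈-++⁺ʳ (vsR t) i)

    stems : Vx A → List Rose → List (Edge A)
    stems v = map (λ t → v , rtR t)

    stems-≋ : ∀ v ts → esRs v ts ≋ stems v ts ++ proj₂ (cRF ts)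
    stems-≋ v [] = ≋-refl
    stems-≋ v (t ∷ ts) = ≋-prep _ (≋-trans (≋-++ (≋-refl {esR t}) (stems-≋ v ts))
      (E-Solver.solve 3 (λ a b c → let _∙_ = E-Solver._⊕_ in a ∙ (b ∙ c) E-Solver.⊜ b ∙ (a ∙ c)) ≋-refl (esR t) (stems v ts) (proj₂ (cRF ts))))

    vsRs-cRF : ∀ ts → proj₁ (cRF ts) ≡ vsRs ts
    vsRs-cRF [] = refl
    vsRs-cRF (t ∷ ts) = cong (vsR t ++_) (vsRs-cRF ts)

    ends-RF : ∀ ts → Ends (cRF ts)
    ends-RF []       = []
    ends-RF (t ∷ ts) = ends-⊹ {cR t} {cRF ts} (ends-R t) (ends-RF ts)

    module _ {G : Graph A} (ph : PhyloForest G) (labels : ∀ a → inj₁ a ∈ verts G → ∃ λ x → ι x ≡ a) where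

      data DegKind (v : Vx A) : ℕ → Set where
        d0 : ∀ x → v ≡ leaf x → DegKind v 0
        d1 : ∀ x → v ≡ leaf x → DegKind v 1
        d3 : ∀ n → v ≡ inj₂ n → DegKind v 3

      deg-kind : ∀ {v k} → v ∈ verts G → Deg G v k → DegKind v k
      deg-kind {v} {0} i d with proj₁ (proj₂ (proj₂ ph) v i) (inj₁ d)
      ... | a , refl with x , refl ← labels a i = d0 x refl
      deg-kind {v} {1} i d with proj₁ (proj₂ (proj₂ ph) v i) (inj₂ d)
      ... | a , refl with x , refl ← labels a i = d1 x refl
      deg-kind {v} {suc (suc k)} i d with not-leaf
        where
        not-leaf : ¬ IsLeaf G v
        not-leaf (inj₁ d') with () ← deg-unique {G} d d'
        not-leaf (inj₂ d') with () ← deg-unique {G} d d'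
      ... | nl with refl ← deg-unique {G} d (proj₂ (proj₂ (proj₂ (proj₂ ph) v i)) nl) = node3 v i nl
        where
        node3 : ∀ v → v ∈ verts G → ¬ IsLeaf G v → DegKind v 3
        node3 (inj₂ n) _ _ = d3 n refl
        node3 (inj₁ a) i nl = ⊥-elim (nl (proj₁ (proj₂ (proj₂ (proj₂ ph) (inj₁ a) i)) (a , refl)))

      all-inc-stems : ∀ v ts → All (Inc v) (stems v ts)
      all-inc-stems v [] = []
      all-inc-stems v (t ∷ ts) = inj₁ refl ∷ all-inc-stems v ts

      node-deg : ∀ {v ts C} I → All (Inc v) I → Holds G ((v ∷ vsRs ts , I ++ esRs v ts) ⊹ C) → Ends C → Deg G v (length I + length ts)
      node-deg {v} {ts} {C} I incI h en = subst (Deg G v) (Eq.trans (List.length-++ I) (cong (length I +_) (List.length-map _ ts)))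
        (holds-deg (I ++ stems v ts) h' (All.++⁺ incI (all-inc-stems v ts))
          (¬inc-ends (ends-⊹ {cRF ts} {C} (ends-RF ts) en) (unique-head (uniqueV h'))))
        where
        h' : Holds G (v ∷ proj₁ (cRF ts) ++ proj₁ C , (I ++ stems v ts) ++ proj₂ (cRF ts) ++ proj₂ C)
        h' = holds-≃ ( ↭-reflexive (cong (λ V → v ∷ V ++ proj₁ C) (sym (vsRs-cRF ts)))
                     , ≋-trans (≋-++ (≋-++ (≋-refl {I}) (stems-≋ v ts)) (≋-refl {proj₂ C}))
                       (E-Solver.solve 4 (λ i a b c → let _∙_ = E-Solver._⊕_ in (i ∙ (a ∙ b)) ∙ c E-Solver.⊜ (i ∙ a) ∙ (b ∙ c)) ≋-refl I (stems v ts) (proj₂ (cRF ts)) (proj₂ C)) ) h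

      Conv : Rose → Set
      Conv t = ∃ λ s → Σ (Named s) λ α → rt α ≡ rtR t × cT α ≃ cR t

      conv : ∀ t {p C} → Holds G (hang p t ⊹ C) → p ∈ proj₁ C → Ends C → Conv t
      conv₂ : ∀ v c d {C} → Holds G (cRs v (c ∷ d ∷ []) ⊹ C) → v ∈ proj₁ C → Ends C → Conv c × Conv d
      convN : ∀ v ts {p C} → Holds G (hang p (node v ts) ⊹ C) → p ∈ proj₁ C → Ends C → DegKind v (suc (length ts)) → Conv (node v ts)
      conv (node v ts) {p} {C} h p∈ en =
        convN v ts h p∈ en (deg-kind (∈-resp-↭ (proj₁ (cont h)) (here refl)) (node-deg {v} {ts} {C} ((p , v) ∷ []) (inj₂ refl ∷ []) h en))
      convN v [] h p∈ en (d1 x refl) = lf x , lf x , refl , ≃-refl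
      convN v (c ∷ []) h p∈ en ()
      convN v (c ∷ d ∷ _ ∷ _) h p∈ en ()
      convN v (c ∷ d ∷ []) {p} {C} h p∈ en (d3 n refl) =
        case conv₂ v c d
              (holds-≃ {C' = cRs v (c ∷ d ∷ []) ⊹ ((v ∷ [] , (p , v) ∷ []) ⊹ C)}
              ( V-Solver.solve 3 (λ v a c → let _∙_ = V-Solver._⊕_ in v ∙ (a ∙ c) V-Solver.⊜ a ∙ (v ∙ c)) ↭-refl (v ∷ []) (vsRs (c ∷ d ∷ [])) (proj₁ C)
              , E-Solver.solve 3 (λ v a c → let _∙_ = E-Solver._⊕_ in v ∙ (a ∙ c) E-Solver.⊜ a ∙ (v ∙ c)) ≋-refl ((p , v) ∷ []) (esRs v (c ∷ d ∷ [])) (proj₂ C)) h)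
              (here refl) ((there p∈ , here refl) ∷ All.map (λ { (i , j) → there i , there j }) en) of λ { ((s , α , ra , a) , (t , β , rb , b)) →
        nd s t , nd n α β , refl ,
           ( prep _ (↭-trans (++⁺ (proj₁ a) (proj₁ b)) (↭-reflexive (cong (vsR c ++_) (sym (List.++-identityʳ (vsR d))))))
           , ≋-trans (Homogeneous.prep (inj₁ (cong (v ,_) ra)) (Homogeneous.prep (inj₁ (cong (v ,_) rb)) (≋-++ (proj₂ a) (proj₂ b))))
               (E-Solver.solve 4 (λ x y a b → let _∙_ = E-Solver._⊕_ in x ∙ (y ∙ (a ∙ b)) E-Solver.⊜ x ∙ (a ∙ (y ∙ (b ∙ E-Solver.id)))) ≋-refl ((v , rtR c) ∷ []) ((v , rtR d) ∷ []) (esR c) (esR d)) ) }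
      conv₂ v c d {C} h v∈ en =
        conv c {v} {hang v d ⊹ C} (holds-≃
          ( V-Solver.solve 3 (λ c d r → let _∙_ = V-Solver._⊕_ in (c ∙ (d ∙ V-Solver.id)) ∙ r V-Solver.⊜ c ∙ (d ∙ r)) ↭-refl (vsR c) (vsR d) (proj₁ C)
          , E-Solver.solve 5 (λ x y c d r → let _∙_ = E-Solver._⊕_ in (x ∙ (c ∙ (y ∙ (d ∙ E-Solver.id)))) ∙ r E-Solver.⊜ (x ∙ c) ∙ ((y ∙ d) ∙ r)) ≋-refl ((v , rtR c) ∷ []) ((v , rtR d) ∷ []) (esR c) (esR d) (proj₂ C)) h)
          (∈-++⁺ʳ (vsR d) v∈) (ends-hang d) ,
        conv d {v} {hang v c ⊹ C} (holds-≃
          ( V-Solver.solve 3 (λ c d r → let _∙_ = V-Solver._⊕_ in (c ∙ (d ∙ V-Solver.id)) ∙ r V-Solver.⊜ d ∙ (c ∙ r)) ↭-refl (vsR c) (vsR d) (proj₁ C)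
          , E-Solver.solve 5 (λ x y c d r → let _∙_ = E-Solver._⊕_ in (x ∙ (c ∙ (y ∙ (d ∙ E-Solver.id)))) ∙ r E-Solver.⊜ (y ∙ d) ∙ ((x ∙ c) ∙ r)) ≋-refl ((v , rtR c) ∷ []) ((v , rtR d) ∷ []) (esR c) (esR d) (proj₂ C)) h)
          (∈-++⁺ʳ (vsR c) v∈) (ends-hang c)
        where
        ends-hang : ∀ t → Ends (hang v t ⊹ C)
        ends-hang t = (∈-++⁺ʳ (vsR t) v∈ , ∈-++⁺ˡ (rtR∈ t)) ∷ ends-⊹ {cR t} {C} (ends-R t) en

      convU : ∀ t {C} → Holds G (cR t ⊹ C) → Ends C → ∃ λ U → Σ (NamedU U) λ ν → cU ν ≃ cR t
      convUN : ∀ v ts {C} → Holds G (cR (node v ts) ⊹ C) → Ends C → DegKind v (length ts) → ∃ λ U → Σ (NamedU U) λ ν → cU ν ≃ cR (node v ts)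
      convU (node v ts) {C} h en = convUN v ts h en (deg-kind (∈-resp-↭ (proj₁ (cont h)) (here refl)) (node-deg {v} {ts} {C} [] [] h en))
      convUN v [] h en (d0 x refl) = one x , one x , ≃-refl
      convUN v (c ∷ d ∷ []) h en ()
      convUN v (c ∷ d ∷ _ ∷ _ ∷ _) h en ()
      convUN v (c ∷ []) {C} h en (d1 x refl) =
        case conv c {v} {hereC v ⊹ C} (holds-≃
              ( V-Solver.solve 3 (λ v a c → let _∙_ = V-Solver._⊕_ in v ∙ ((a ∙ V-Solver.id) ∙ c) V-Solver.⊜ a ∙ (v ∙ c)) ↭-refl (v ∷ []) (vsR c) (proj₁ C)
              , E-Solver.solve 3 (λ x a c → let _∙_ = E-Solver._⊕_ in (x ∙ (a ∙ E-Solver.id)) ∙ c E-Solver.⊜ (x ∙ a) ∙ c) ≋-refl ((v , rtR c) ∷ []) (esR c) (proj₂ C)) h)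
              (here refl) (All.map (λ { (i , j) → there i , there j }) en) of λ { (s , α , r , a) →
        edge (lf x) s , edge (lf x) α ,
           ( prep v (↭-trans (proj₁ a) (↭-reflexive (sym (List.++-identityʳ (vsR c)))))
           , Homogeneous.prep (inj₁ (cong (v ,_) r)) (≋-trans (proj₂ a) (≋-reflexive (sym (List.++-identityʳ (esR c))))) ) }
      convUN v (c ∷ d ∷ e ∷ []) {C} h en (d3 n refl) =
        case conv₂ v c d {(v ∷ vsR e , (v , rtR e) ∷ esR e) ⊹ C} (holds-≃
              ( V-Solver.solve 5 (λ v c d e r → let _∙_ = V-Solver._⊕_ in (v ∙ (c ∙ (d ∙ (e ∙ V-Solver.id)))) ∙ r V-Solver.⊜ (c ∙ (d ∙ V-Solver.id)) ∙ ((v ∙ e) ∙ r)) ↭-refl (v ∷ []) (vsR c) (vsR d) (vsR e) (proj₁ C)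
              , E-Solver.solve 7 (λ x y z c d e r → let _∙_ = E-Solver._⊕_ in (x ∙ (c ∙ (y ∙ (d ∙ (z ∙ (e ∙ E-Solver.id)))))) ∙ r E-Solver.⊜ (x ∙ (c ∙ (y ∙ (d ∙ E-Solver.id)))) ∙ ((z ∙ e) ∙ r)) ≋-refl
              ((v , rtR c) ∷ []) ((v , rtR d) ∷ []) ((v , rtR e) ∷ []) (esR c) (esR d) (esR e) (proj₂ C)) h)
              (here refl) (ends-⊹ {v ∷ vsR e , (v , rtR e) ∷ esR e} {C} (ends-st e) en) of λ { ((s , α , ra , a) , (t , β , rb , b)) →
        case conv e {v} {(v ∷ vsRs (c ∷ d ∷ []) , esRs v (c ∷ d ∷ [])) ⊹ C} (holds-≃
              ( V-Solver.solve 5 (λ v c d e r → let _∙_ = V-Solver._⊕_ in (v ∙ (c ∙ (d ∙ (e ∙ V-Solver.id)))) ∙ r V-Solver.⊜ e ∙ ((v ∙ (c ∙ (d ∙ V-Solver.id))) ∙ r)) ↭-refl (v ∷ []) (vsR c) (vsR d) (vsR e) (proj₁ C)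
              , E-Solver.solve 7 (λ x y z c d e r → let _∙_ = E-Solver._⊕_ in (x ∙ (c ∙ (y ∙ (d ∙ (z ∙ (e ∙ E-Solver.id)))))) ∙ r E-Solver.⊜ (z ∙ e) ∙ ((x ∙ (c ∙ (y ∙ (d ∙ E-Solver.id)))) ∙ r)) ≋-refl
              ((v , rtR c) ∷ []) ((v , rtR d) ∷ []) ((v , rtR e) ∷ []) (esR c) (esR d) (esR e) (proj₂ C)) h)
              (here refl) (ends-⊹ {v ∷ vsRs (c ∷ d ∷ []) , esRs v (c ∷ d ∷ [])} {C} (ends-R (node v (c ∷ d ∷ []))) en) of λ { ((u , γ , rc , g)) →
        edge (nd s t) u , edge (nd n α β) γ ,
           ( prep v (↭-trans (++⁺ (++⁺ (proj₁ a) (proj₁ b)) (proj₁ g))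
               (V-Solver.solve 3 (λ c d e → let _∙_ = V-Solver._⊕_ in (c ∙ d) ∙ e V-Solver.⊜ c ∙ (d ∙ (e ∙ V-Solver.id))) ↭-refl (vsR c) (vsR d) (vsR e)))
           , ≋-trans (Homogeneous.prep (inj₁ (cong (v ,_) rc)) (Homogeneous.prep (inj₁ (cong (v ,_) ra)) (Homogeneous.prep (inj₁ (cong (v ,_) rb)) (≋-++ (≋-++ (proj₂ a) (proj₂ b)) (proj₂ g)))))
               (E-Solver.solve 6 (λ x y z c d e → let _∙_ = E-Solver._⊕_ in z ∙ (x ∙ (y ∙ ((c ∙ d) ∙ e))) E-Solver.⊜ x ∙ (c ∙ (y ∙ (d ∙ (z ∙ (e ∙ E-Solver.id)))))) ≋-refl
                  ((v , rtR c) ∷ []) ((v , rtR d) ∷ []) ((v , rtR e) ∷ []) (esR c) (esR d) (esR e)) ) }}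
        where
        ends-st : ∀ t → Ends (v ∷ vsR t , (v , rtR t) ∷ esR t)
        ends-st t = (here refl , there (rtR∈ t)) ∷ All.map (λ { (i , j) → there i , there j }) (ends-R t)

      convF : ∀ ts {C} → Holds G (cRF ts ⊹ C) → Ends C → ∃ λ F → Σ (All NamedU F) λ φ → cF φ ≃ cRF ts
      convF [] h en = [] , [] , ≃-refl
      convF (t ∷ ts) {C} h en =
        case convU t (holds-≃ (⊹-assoc (cR t) (cRF ts) C) h) (ends-⊹ {cRF ts} {C} (ends-RF ts) en) of λ { (U , ν , p) →
        case convF ts {cR t ⊹ C} (holds-≃ (≃-trans (⊹-assoc (cR t) (cRF ts) C) (⊹-shifts (cR t) (cRF ts) C)) h) (ends-⊹ {cR t} {C} (ends-R t) en) of λ { (F , φ , q) →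
        U ∷ F , ν ∷ φ , ⊹-cong p q }}

      rep-exists : ∃ λ F → Rep F G
      rep-exists =
        case roses (verts G) (edges G) (All.map (λ { (i , j , _) → i , j }) (proj₂ (proj₁ ph))) (proj₁ (proj₂ ph)) of λ { (ts , p) →
        let h = holds {G} (unique-↭ (↭-sym (proj₁ p)) (proj₁ (proj₁ ph))) p
        in case convF ts {[] , []} (holds-≃ (↭-reflexive (sym (List.++-identityʳ _)) , ≋-reflexive (sym (List.++-identityʳ _))) h) [] of λ { (F , φ , q) →
        F , φ , holds-≃ (≃-sym q) h }}

    lv-vs : ∀ {s x} (α : Named s) → x ∈ lv s → leaf x ∈ vs α
    lv-vs (lf x) (here refl) = here refl
    lv-vs {nd s t} (nd n α β) i with ∈-++⁻ (lv s) i
    ... | inj₁ j = there (∈-++⁺ˡ (lv-vs α j))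
    ... | inj₂ j = there (∈-++⁺ʳ (vs α) (lv-vs β j))

    vs-lv : ∀ {s x} (α : Named s) → leaf x ∈ vs α → x ∈ lv s
    vs-lv (lf y) (here e) = here (leaf-injective e)
    vs-lv {nd s t} (nd n α β) (there i) with ∈-++⁻ (vs α) i
    ... | inj₁ j = ∈-++⁺ˡ (vs-lv α j)
    ... | inj₂ j = ∈-++⁺ʳ (lv s) (vs-lv β j)

    lv-vsU : ∀ {U x} (ν : NamedU U) → x ∈ lvU U → leaf x ∈ proj₁ (cU ν)
    lv-vsU (one x) (here refl) = here refl
    lv-vsU {edge s t} (edge α β) i with ∈-++⁻ (lv s) i
    ... | inj₁ j = ∈-++⁺ˡ (lv-vs α j)
    ... | inj₂ j = ∈-++⁺ʳ (vs α) (lv-vs β j)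

    vs-lvU : ∀ {U x} (ν : NamedU U) → leaf x ∈ proj₁ (cU ν) → x ∈ lvU U
    vs-lvU (one y) (here e) = here (leaf-injective e)
    vs-lvU {edge s t} (edge α β) i with ∈-++⁻ (vs α) i
    ... | inj₁ j = ∈-++⁺ˡ (vs-lv α j)
    ... | inj₂ j = ∈-++⁺ʳ (lv s) (vs-lv β j)

    lv-vsF : ∀ {F x} (φ : All NamedU F) → x ∈ lvF F → leaf x ∈ proj₁ (cF φ)
    lv-vsF {U ∷ F} (ν ∷ φ) i with ∈-++⁻ (lvU U) i
    ... | inj₁ j = ∈-++⁺ˡ (lv-vsU ν j)
    ... | inj₂ j = ∈-++⁺ʳ (proj₁ (cU ν)) (lv-vsF φ j)

    vs-lvF : ∀ {F x} (φ : All NamedU F) → leaf x ∈ proj₁ (cF φ) → x ∈ lvF F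
    vs-lvF {U ∷ F} (ν ∷ φ) i with ∈-++⁻ (proj₁ (cU ν)) i
    ... | inj₁ j = ∈-++⁺ˡ (vs-lvU ν j)
    ... | inj₂ j = ∈-++⁺ʳ (lvU U) (vs-lvF φ j)

    lv-verts : ∀ {F G x} → Rep F G → x ∈ lvF F → leaf x ∈ verts G
    lv-verts (φ , h) i = ∈-resp-↭ (proj₁ (cont h)) (lv-vsF φ i)

    verts-lv : ∀ {F G x} → Rep F G → leaf x ∈ verts G → x ∈ lvF F
    verts-lv (φ , h) i = vs-lvF φ (∈-resp-↭ (↭-sym (proj₁ (cont h))) i)

    label-∈ : ∀ {F a} (φ : All NamedU F) → inj₁ a ∈ proj₁ (cF φ) → ∃ λ x → ι x ≡ a × x ∈ lvF F
    label-∈ φ i with locateVF φ i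
    ... | isol {x} ρ p refl q = x , refl , vs-lvF φ i
    ... | conn (lf x) β ρ p refl q = x , refl , vs-lvF φ i

    label-verts : ∀ {F G a} → Rep F G → inj₁ a ∈ verts G → ∃ λ x → ι x ≡ a × x ∈ lvF F
    label-verts (φ , h) i = label-∈ φ (∈-resp-↭ (↭-sym (proj₁ (cont h))) i)

    unique-lvT : ∀ {s} (α : Named s) → Unique (vs α) → Unique (lv s)
    unique-lvT (lf x) u = [] ∷ []
    unique-lvT (nd n α β) (_ ∷ u) = Unique.++⁺ (unique-lvT α (unique-++ˡ (vs α) u)) (unique-lvT β (unique-++ʳ (vs α) u))
      (λ { (i , j) → unique-disjoint (vs α) u (lv-vs α i) (lv-vs β j) })

    unique-lvU : ∀ {U} (ν : NamedU U) → Unique (proj₁ (cU ν)) → Unique (lvU U)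
    unique-lvU (one x) u = [] ∷ []
    unique-lvU (edge α β) u = Unique.++⁺ (unique-lvT α (unique-++ˡ (vs α) u)) (unique-lvT β (unique-++ʳ (vs α) u))
      (λ { (i , j) → unique-disjoint (vs α) u (lv-vs α i) (lv-vs β j) })

    unique-lvF : ∀ {F} (φ : All NamedU F) → Unique (proj₁ (cF φ)) → Unique (lvF F)
    unique-lvF [] u = []
    unique-lvF (ν ∷ φ) u = Unique.++⁺ (unique-lvU ν (unique-++ˡ (proj₁ (cU ν)) u)) (unique-lvF φ (unique-++ʳ (proj₁ (cU ν)) u))
      (λ { (i , j) → unique-disjoint (proj₁ (cU ν)) u (lv-vsU ν i) (lv-vsF φ j) })

    rep-unique : ∀ {F G} → Rep F G → Unique (lvF F)
    rep-unique (φ , h) = unique-lvF φ (uniqueV h)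

    star-T : ∀ {s v} (G : Graph A) (α : Named s) → (∀ {a b} → (a , b) ∈ es α → Adj G a b) → v ∈ vs α → Star (Adj G) (rt α) v
    star-T G (lf x) sub (here refl) = ε
    star-T G (nd n α β) sub (here refl) = ε
    star-T G (nd n α β) sub (there i) with ∈-++⁻ (vs α) i
    ... | inj₁ j = sub (here refl) ◅ star-T G α (λ k → sub (there (there (∈-++⁺ˡ k)))) j
    ... | inj₂ j = sub (there (here refl)) ◅ star-T G β (λ k → sub (there (there (∈-++⁺ʳ (es α) k)))) j

    star-TT : ∀ {s v w} (G : Graph A) (α : Named s) → (∀ {a b} → (a , b) ∈ es α → Adj G a b) → v ∈ vs α → w ∈ vs α → Star (Adj G) v w
    star-TT G α sub i j = star-sym {G} (star-T G α sub i) ◅◅ star-T G α sub j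

    star-U : ∀ {U v w} (G : Graph A) (ν : NamedU U) → (∀ {a b} → (a , b) ∈ proj₂ (cU ν) → Adj G a b) → v ∈ proj₁ (cU ν) → w ∈ proj₁ (cU ν) → Star (Adj G) v w
    star-U G (one x) sub (here refl) (here refl) = ε
    star-U G (edge α β) sub i j = star-sym {G} (from i) ◅◅ from j
      where
      from : ∀ {v} → v ∈ vs α ++ vs β → Star (Adj G) (rt α) v
      from i with ∈-++⁻ (vs α) i
      ... | inj₁ k = star-T G α (λ l → sub (there (∈-++⁺ˡ l))) k
      ... | inj₂ k = sub (here refl) ◅ star-T G β (λ l → sub (there (∈-++⁺ʳ (es α) l))) k

    star-same : ∀ {F x y} (G : Graph A) (φ : All NamedU F) → (∀ {a b} → (a , b) ∈ proj₂ (cF φ) → Adj G a b) → Same F x y → Star (Adj G) (leaf x) (leaf y)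
    star-same G (ν ∷ φ) sub (here (i , j)) = star-U G ν (λ k → sub (∈-++⁺ˡ k)) (lv-vsU ν i) (lv-vsU ν j)
    star-same G (ν ∷ φ) sub (there k) = star-same G φ (λ l → sub (∈-++⁺ʳ (proj₂ (cU ν)) l)) k

    conn-make : ∀ {F G x y} → Rep F G → Same F x y → Conn G (leaf x) (leaf y)
    conn-make {G = G} r@(φ , h) k = lv-verts r (same-∈ k) , star-same G φ (holds-adj h) k

    comp-of : ∀ F {x} → x ∈ lvF F → ∃ λ T → ∃ λ R → F ≈ T ∷ R × x ∈ lvU T
    comp-of F i = case find (lvF-any F i) of λ { (T , k , j) →
      case ∈-↭ k of λ { (R , p) →
      T , R , ≈perm p , j }}

    comp-closed : ∀ {T R G x v} → Rep (T ∷ R) G → x ∈ lvU T → Star (Adj G) (leaf x) v → Σ (NamedU T) λ ν → v ∈ proj₁ (cU ν)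
    comp-closed ((ν ∷ ρ) , h) i st = ν , star-closed {C = cU ν} {cF ρ} h (ends-U ν) (ends-F ρ) (lv-vsU ν i) st

    conn-view : ∀ {F G x y} → Rep F G → Conn G (leaf x) (leaf y) → Same F x y
    conn-view {F} r (i , st) = case comp-of F (verts-lv r i) of λ { (T , R , p , j) →
      case comp-closed (rep-≈ p r) j st of λ { (ν , k) →
      same-≈ (≈sym p) (here (j , vs-lvU ν k)) }}

    isolated-make : ∀ {F G x R} → Rep F G → F ≈ one x ∷ R → Isolated G (ι x)
    isolated-make r p with rep-≈ p r
    ... | one x ∷ ρ , h = ∈-resp-↭ (proj₁ (cont h)) (here refl) , deg-isol ρ h

    isolated-view : ∀ {F G a} → Rep F G → Isolated G a → ∃ λ x → ∃ λ R → ι x ≡ a × F ≈ one x ∷ R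
    isolated-view {G = G} r (i , d) with repV r i
    ... | isol ρ p refl q = _ , _ , refl , p
    ... | conn (lf x) β ρ p refl q with () ← deg-unique {G} d (deg-leaf β ρ (holds-≃ q (proj₂ r)))

    Ch : Forest → L → L → Set
    Ch F x y = ∃ λ t → ∃ λ R → F ≈ edge (lf x) t ∷ R × ChTop y t

    cherry-make : ∀ {F G x y} → Rep F G → Ch F x y → Cherry G (ι x) (ι y)
    cherry-make {G = G} {x} {y} r (t , R , p , ct) with rep-≈ p r
    ... | r'@(edge (lf .x) β ∷ ρ , h) = (λ e → ne (ι-injective e)) , lv-verts r' (here refl) , lv-verts r' (there (∈-++⁺ˡ (chtop-∈ ct))) , go ct β h
      where
      ne : x ≢ y
      ne refl = unique-head (rep-unique r') (∈-++⁺ˡ (chtop-∈ ct))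
      go : ∀ {t} → ChTop y t → (β : Named t) → Holds G (cU (edge (lf x) β) ⊹ cF ρ) →
        (Adj G (leaf x) (leaf y) × (∀ v → Conn G (leaf x) v → v ≡ leaf x ⊎ v ≡ leaf y)) ⊎ (Σ (Vx A) λ w → Adj G (leaf x) w × Adj G (leaf y) w)
      go two (lf .y) h = inj₁ (holds-adj h (here refl) , λ v c → which (star-closed {C = cU (edge (lf x) (lf y))} {cF ρ} h (ends-U (edge (lf x) (lf y))) (ends-F ρ) (here refl) (proj₂ c)))
        where
        which : ∀ {v} → v ∈ leaf x ∷ leaf y ∷ [] → v ≡ leaf x ⊎ v ≡ leaf y
        which (here e) = inj₁ e
        which (there (here e)) = inj₂ e
      go more (nd n (lf .y) β) h = inj₂ (inj₂ n , holds-adj h (here refl) , adj-sym {G} (holds-adj h (there (here refl))))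

    leaf-adj : ∀ {G x t R w} (β : Named t) (ρ : All NamedU R) → Holds G (cU (edge (lf x) β) ⊹ cF ρ) → Adj G (leaf x) w → w ≡ rt β
    leaf-adj {x = x} β ρ h (e , i , j) with ≋-∈ (≋-sym (proj₂ (cont h))) i
    ... | e' , there k , s = ⊥-elim (All.lookup (¬inc-leaf β ρ h) k (inc-resp s (joins-inc j)))
    ... | ._ , here refl , s = joins-end s j

    node-adj : ∀ {G n s₁ s₂ t R w} (α₁ : Named s₁) (α₂ : Named s₂) (β : Named t) (ρ : All NamedU R) → Holds G (cU (edge (nd n α₁ α₂) β) ⊹ cF ρ) →
      Adj G (inj₂ n) w → w ≡ rt β ⊎ w ≡ rt α₁ ⊎ w ≡ rt α₂
    node-adj {n = n} α₁ α₂ β ρ h (e , i , j) with ≋-∈ (≋-sym (proj₂ (cont h))) i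
    ... | ._ , here refl , s = inj₁ (joins-end s j)
    ... | ._ , there (here refl) , s = inj₂ (inj₁ (joins-end s j))
    ... | ._ , there (there (here refl)) , s = inj₂ (inj₂ (joins-end s j))
    ... | e' , there (there (there k)) , s = ⊥-elim (All.lookup (¬inc-node α₁ α₂ β ρ h) k (inc-resp s (joins-inc j)))

    deg0-adj : ∀ {G : Graph A} {v w} → Deg G v 0 → ¬ Adj G v w
    deg0-adj ([] , R , p , _ , _ , n) (e , i , j) = All.lookup n (∈-resp-↭ p i) (joins-inc j)

    rt-leaf : ∀ {s y} (α : Named s) → leaf y ≡ rt α → s ≡ lf y
    rt-leaf (lf x) e with refl ← leaf-injective e = refl

    CherryAlt : Graph A → Vx A → Vx A → Set
    CherryAlt G u v = (Adj G u v × (∀ w → Conn G u w → w ≡ u ⊎ w ≡ v)) ⊎ (Σ (Vx A) λ w → Adj G u w × Adj G v w)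

    cherry-at : ∀ {F G x y t R} (β : Named t) (ρ : All NamedU R) → Holds G (cU (edge (lf x) β) ⊹ cF ρ) → F ≈ edge (lf x) t ∷ R →
      x ≢ y → ∀ {w} → w ≡ rt β → Adj G (leaf y) w → Ch F x y
    cherry-at {G = G} {x} (lf z) ρ h p ne refl l = ⊥-elim (ne (leaf-injective (sym e)))
      where
      e : leaf _ ≡ leaf x
      e = leaf-adj (lf x) ρ (holds-≃ (⊹-cong (mv-≃ swp (edge (lf x) (lf z))) (≃-refl {cF ρ})) h) (adj-sym {G} l)
    cherry-at {F} {G} {x} {y} {nd t₁ t₂} {R} (nd n β₁ β₂) ρ h p ne refl l =
      fin (node-adj β₁ β₂ (lf x) ρ (holds-≃ (⊹-cong (mv-≃ swp (edge (lf x) (nd n β₁ β₂))) (≃-refl {cF ρ})) h) (adj-sym {G} l))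
      where
      chˡ : t₁ ≡ lf y → Ch F x y
      chˡ refl = _ , _ , p , more
      chʳ : t₂ ≡ lf y → Ch F x y
      chʳ refl = _ , _ , p ◅◅ ≈head (swp ◅ flip ◅ swp ◅ ε) , more
      fin : leaf y ≡ leaf x ⊎ leaf y ≡ rt β₁ ⊎ leaf y ≡ rt β₂ → Ch F x y
      fin (inj₁ e) = ⊥-elim (ne (leaf-injective (sym e)))
      fin (inj₂ (inj₁ e)) = chˡ (rt-leaf β₁ e)
      fin (inj₂ (inj₂ e)) = chʳ (rt-leaf β₂ e)

    cherry-leaf : ∀ {F G x y t R} (β : Named t) (ρ : All NamedU R) → Holds G (cU (edge (lf x) β) ⊹ cF ρ) → F ≈ edge (lf x) t ∷ R →
      x ≢ y → CherryAlt G (leaf x) (leaf y) → Ch F x y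
    cherry-leaf {F} {x = x} {y} {t} {R} β ρ h p ne (inj₁ (k , _)) = fin (rt-leaf β (leaf-adj β ρ h k))
      where
      fin : t ≡ lf y → Ch F x y
      fin refl = _ , _ , p , two
    cherry-leaf β ρ h p ne (inj₂ (w , k , l)) = cherry-at β ρ h p ne (leaf-adj β ρ h k) l

    cherry-loc : ∀ {F G a y} → ((φ , h) : Rep F G) → LocV (inj₁ a) F (cF φ) → a ≢ ι y → CherryAlt G (inj₁ a) (leaf y) → ∃ λ x → ι x ≡ a × Ch F x y
    cherry-loc {G = G} (φ , h) (isol ρ p refl q) ne (inj₁ (k , _)) = ⊥-elim (deg0-adj {G} (deg-isol ρ (holds-≃ q h)) k)
    cherry-loc {G = G} (φ , h) (isol ρ p refl q) ne (inj₂ (_ , k , _)) = ⊥-elim (deg0-adj {G} (deg-isol ρ (holds-≃ q h)) k)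
    cherry-loc (φ , h) (conn (lf x) β ρ p refl q) ne c = x , refl , cherry-leaf β ρ (holds-≃ q h) p (ne ∘ cong ι) c

    cherry-view : ∀ {F G a b} → Rep F G → Cherry G a b → ∃ λ x → ∃ λ y → ι x ≡ a × ι y ≡ b × Ch F x y
    cherry-view {F} {G} {a} {b} r (ne , i , j , c) = fin (label-verts r j)
      where
      fin : (∃ λ y → ι y ≡ b × y ∈ lvF F) → ∃ λ x → ∃ λ y → ι x ≡ a × ι y ≡ b × Ch F x y
      fin (y , refl , _) = case cherry-loc r (repV r i) ne c of λ { (x , e , ch) →
        x , y , e , refl , ch }

    pairs : ∀ {s} → Named s → Named s → List (ℕ × ℕ)
    pairs (lf x) (lf .x) = []
    pairs (nd n α β) (nd m α' β') = (n , m) ∷ pairs α α' ++ pairs β β'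

    pairsU : ∀ {U} → NamedU U → NamedU U → List (ℕ × ℕ)
    pairsU (one x) (one .x) = []
    pairsU (edge α β) (edge α' β') = pairs α α' ++ pairs β β'

    look : List (ℕ × ℕ) → ℕ → ℕ
    look [] n = n
    look ((k , m) ∷ ps) n with n ℕ.≟ k
    ... | yes _ = m
    ... | no _  = look ps n

    look-∈ : ∀ {ps n m} → Unique (map proj₁ ps) → (n , m) ∈ ps → look ps n ≡ m
    look-∈ {(k , m) ∷ ps} {n} u i with n ℕ.≟ k
    look-∈ u (here refl) | yes _ = refl
    look-∈ u (here refl) | no n = ⊥-elim (n refl)
    look-∈ u (there i) | yes refl = ⊥-elim (unique-head u (∈-map⁺ proj₁ i))
    look-∈ (_ ∷ u) (there i) | no _ = look-∈ u i

    pairs-vs : ∀ {s n} (α α' : Named s) → n ∈ map proj₁ (pairs α α') → inj₂ n ∈ vs α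
    pairs-vs (nd n α β) (nd m α' β') (here refl) = here refl
    pairs-vs (nd n α β) (nd m α' β') (there i) with ∈-++⁻ (map proj₁ (pairs α α')) (subst (_ ∈_) (List.map-++ proj₁ (pairs α α') (pairs β β')) i)
    ... | inj₁ j = there (∈-++⁺ˡ (pairs-vs α α' j))
    ... | inj₂ j = there (∈-++⁺ʳ (vs α) (pairs-vs β β' j))
    pairs-vs (lf x) (lf .x) ()

    pairs-unique : ∀ {s} (α α' : Named s) → Unique (vs α) → Unique (map proj₁ (pairs α α'))
    pairs-unique (lf x) (lf .x) u = []
    pairs-unique (nd n α β) (nd m α' β') u@(_ ∷ u') = All.tabulate (λ i e → unique-head u (fromP (subst (_∈ _) (sym e) i))) ∷ body
      where
      body : Unique (map proj₁ (pairs α α' ++ pairs β β'))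
      body = subst Unique (sym (List.map-++ proj₁ (pairs α α') (pairs β β')))
        (Unique.++⁺ (pairs-unique α α' (unique-++ˡ (vs α) u')) (pairs-unique β β' (unique-++ʳ (vs α) u'))
          (λ { (i , j) → unique-disjoint (vs α) u' (pairs-vs α α' i) (pairs-vs β β' j) }))
      fromP : ∀ {k} → k ∈ map proj₁ (pairs α α' ++ pairs β β') → inj₂ k ∈ vs α ++ vs β
      fromP i with ∈-++⁻ (map proj₁ (pairs α α')) (subst (_ ∈_) (List.map-++ proj₁ (pairs α α') (pairs β β')) i)
      ... | inj₁ j = ∈-++⁺ˡ (pairs-vs α α' j)
      ... | inj₂ j = ∈-++⁺ʳ (vs α) (pairs-vs β β' j)

    module _ (f : Vx A → Vx A) (fl : ∀ a → f (inj₁ a) ≡ inj₁ a) where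
      map-named : ∀ {s} (α α' : Named s) → (∀ {n m} → (n , m) ∈ pairs α α' → f (inj₂ n) ≡ inj₂ m) →
        f (rt α) ≡ rt α' × mapC f (cT α) ≡ cT α'
      map-named (lf x) (lf .x) ok = fl _ , cong (λ v → v ∷ [] , []) (fl _)
      map-named (nd n α β) (nd m α' β') ok =
        let e = ok (here refl)
        in case map-named α α' (λ i → ok (there (∈-++⁺ˡ i))) of λ { (r , c) →
        case map-named β β' (λ i → ok (there (∈-++⁺ʳ (pairs α α') i))) of λ { (r' , c') →
        e , cong₂ _,_ (cong₂ _∷_ e (Eq.trans (List.map-++ f (vs α) (vs β)) (cong₂ _++_ (cong proj₁ c) (cong proj₁ c'))))
             (cong₂ _∷_ (cong₂ _,_ e r) (cong₂ _∷_ (cong₂ _,_ e r') (Eq.trans (List.map-++ _ (es α) (es β)) (cong₂ _++_ (cong proj₂ c) (cong proj₂ c'))))) }}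

      map-namedU : ∀ {U} (ν ν' : NamedU U) → (∀ {n m} → (n , m) ∈ pairsU ν ν' → f (inj₂ n) ≡ inj₂ m) → mapC f (cU ν) ≡ cU ν'
      map-namedU (one x) (one .x) ok = cong (λ v → v ∷ [] , []) (fl _)
      map-namedU (edge α β) (edge α' β') ok =
        case map-named α α' (λ i → ok (∈-++⁺ˡ i)) of λ { (r , c) →
        case map-named β β' (λ i → ok (∈-++⁺ʳ (pairs α α') i)) of λ { (r' , c') →
        cong₂ _,_ (Eq.trans (List.map-++ f (vs α) (vs β)) (cong₂ _++_ (cong proj₁ c) (cong proj₁ c')))
             (cong₂ _∷_ (cong₂ _,_ r r') (Eq.trans (List.map-++ _ (es α) (es β)) (cong₂ _++_ (cong proj₂ c) (cong proj₂ c')))) }}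

    pairsU-unique : ∀ {U} (ν ν' : NamedU U) → Unique (proj₁ (cU ν)) → Unique (map proj₁ (pairsU ν ν'))
    pairsU-unique (one x) (one .x) u = []
    pairsU-unique (edge α β) (edge α' β') u = subst Unique (sym (List.map-++ proj₁ (pairs α α') (pairs β β')))
        (Unique.++⁺ (pairs-unique α α' (unique-++ˡ (vs α) u)) (pairs-unique β β' (unique-++ʳ (vs α) u))
          (λ { (i , j) → unique-disjoint (vs α) u (pairs-vs α α' i) (pairs-vs β β' j) }))

    iso-make : ∀ {U G H} → Rep (U ∷ []) G → Rep (U ∷ []) H → Iso G H
    iso-make {U} {G} {H} (ν ∷ [] , h) (ν' ∷ [] , h') =
      f , (λ _ → refl) , unique-↭ (proj₁ (cont h')) (uniqueV h') , pV , ≋⇒edgesEq pE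
      where
      f : Vx A → Vx A
      f (inj₁ a) = inj₁ a
      f (inj₂ n) = inj₂ (look (pairsU ν ν') n)
      e : mapC f (cU ν) ≡ cU ν'
      e = map-namedU f (λ _ → refl) ν ν' (λ i → cong inj₂ (look-∈ (pairsU-unique ν ν' (unique-++ˡ (proj₁ (cU ν)) (uniqueV h))) i))
      tidy : ∀ {K} (μ : NamedU U) → Holds K (cU μ ⊹ ([] , [])) → cU μ ≃ (verts K , edges K)
      tidy μ k = ≃-trans (↭-reflexive (sym (List.++-identityʳ _)) , ≋-reflexive (sym (List.++-identityʳ _))) (cont k)
      c = tidy {G} ν h
      c' = tidy {H} ν' h'
      pV : map f (verts G) ↭ verts H
      pV = ↭-trans (map⁺ f (↭-sym (proj₁ c))) (↭-trans (↭-reflexive (cong proj₁ e)) (proj₁ c'))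
      pE : map (λ e → f (proj₁ e) , f (proj₂ e)) (edges G) ≋ edges H
      pE = ≋-trans (map-≋ f (≋-sym (proj₂ c))) (≋-trans (≋-reflexive (cong proj₂ e)) (proj₂ c'))

    -- The quartet ab|cd read off the graph, independently of the tree representing it.
    GSep : Graph A → Vx A → Vx A → Vx A → Vx A → Set
    GSep G a b c d = Conn G a c × ∃ λ E₁ → ∃ λ e → ∃ λ E₂ → edges G ≡ E₁ ++ e ∷ E₂ ×
      Star (Adj (mkG (verts G) (E₁ ++ E₂))) a b × Star (Adj (mkG (verts G) (E₁ ++ E₂))) c d × ¬ Star (Adj (mkG (verts G) (E₁ ++ E₂))) a c

    sub-root : ∀ {u} s t → u ⊑ s → ∃ λ v → edge s t ~ edge u v
    sub-root s t top = t , ε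
    sub-root (nd a b) t (inl p) = case sub-root a (nd b t) p of λ { (v , q) →
      v , ~rot ◅◅ q }
    sub-root (nd a b) t (inr p) = case sub-root b (nd a t) p of λ { (v , q) →
      v , ~flip ◅◅ ~rot ◅◅ q }

    sep-edge : ∀ {s t a b c d} → In₄ (edge s t) a b c d → Sep (edge s t) a b c d →
      ∃ λ s' → ∃ λ t' → edge s t ~ edge s' t' × (a ∈ lv s' × b ∈ lv s') × (c ∈ lv t' × d ∈ lv t')
    sep-edge {s} {t} {a} {b} {c} {d} ((i , j) , (k , l)) (u , w , sb) = go (root w) sb
      where
      root : u ⊑ s ⊎ u ⊑ t → ∃ λ v → edge s t ~ edge u v
      root (inj₁ w) = sub-root s t w
      root (inj₂ w) = case sub-root t s w of λ { (v , q) →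
        v , ~swp ◅◅ q }
      go : (∃ λ v → edge s t ~ edge u v) → SepBy u a b c d → ∃ λ s' → ∃ λ t' → edge s t ~ edge s' t' × (a ∈ lv s' × b ∈ lv s') × (c ∈ lv t' × d ∈ lv t')
      go (v , p) (inj₁ ((a∈ , b∈) , (c∉ , d∉))) = u , v , p , (a∈ , b∈) , (not-in (∈-resp-↭ (lv-~ p) k) c∉ , not-in (∈-resp-↭ (lv-~ p) l) d∉)
      go (v , p) (inj₂ ((c∈ , d∈) , (a∉ , b∉))) = v , u , p ◅◅ ~swp , (not-in (∈-resp-↭ (lv-~ p) i) a∉ , not-in (∈-resp-↭ (lv-~ p) j) b∉) , (c∈ , d∈)

    sepF-edge : ∀ {F a b c d} → SepF F a b c d → ∃ λ s → ∃ λ t → ∃ λ R → F ≈ edge s t ∷ R × (a ∈ lv s × b ∈ lv s) × (c ∈ lv t × d ∈ lv t)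
    sepF-edge {F} z with find z
    ... | edge s t , k , (i , sp) with ∈-↭ k | sep-edge {s} {t} i sp
    ... | R , p | s' , t' , q , m , n = s' , t' , R , ≈perm p ◅◅ ≈head q , m , n

    gsep-make : ∀ {F G a b c d} → Rep F G → SepF F a b c d → GSep G (leaf a) (leaf b) (leaf c) (leaf d)
    gsep-make {F} {G} {a} {b} {c} {d} r z with sepF-edge z
    ... | s , t , R , p , (i , j) , (k , l) with rep-≈ p r
    ... | r'@(edge α β ∷ ρ , h) with E₁ , e , E₂ , eq , _ , h₁ ← cut-edge h =
      conn-make r (proj₁ (proj₂ (sepF-same z))) , E₁ , e , E₂ , eq ,
      star-TT K α (λ m → holds-adj h₂ (∈-++⁺ˡ m)) (lv-vs α i) (lv-vs α j) ,
      star-TT K β (λ m → holds-adj h₂ (∈-++⁺ʳ (es α) (∈-++⁺ˡ m))) (lv-vs β k) (lv-vs β l) ,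
      λ st → unique-disjoint (vs α) (uniqueV h₂) (star-closed {C = cT α} {cT β ⊹ cF ρ} h₂ (ends-T α) (ends-⊹ {cT β} {cF ρ} (ends-T β) (ends-F ρ)) (lv-vs α i) st) (∈-++⁺ˡ (lv-vs β k))
      where
      K = mkG (verts G) (E₁ ++ E₂)
      h₂ : Holds K (cT α ⊹ cT β ⊹ cF ρ)
      h₂ = holds-≃ (⊹-assoc (cT α) (cT β) (cF ρ)) h₁

    gsep-view : ∀ {F G a b c d} → Rep F G → GSep G (leaf a) (leaf b) (leaf c) (leaf d) → SepF F a b c d
    gsep-view {F} {G} {a} {b} {c} {d} r@(φ , h) (cn , E₁ , e , E₂ , eq , sab , scd , nac) with repE r (subst (e ∈_) (sym eq) (∈-++⁺ʳ E₁ (here refl)))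
    ... | loc {s} {t} {R} α β ρ p sm q = sepF-≈ (≈sym p) (unique-↭ (lvF-≈ p) (rep-unique r)) (go (same-≈ p (conn-view r cn)))
      where
      K = mkG (verts G) (E₁ ++ E₂)
      h₁ : Holds K (cT α ⊹ cT β ⊹ cF ρ)
      h₁ = holds-≃ (⊹-assoc (cT α) (cT β) (cF ρ)) (cut-edge⁻ (holds-≃ q h) eq sm)
      h₁' : Holds K (cT β ⊹ cT α ⊹ cF ρ)
      h₁' = holds-≃ (⊹-shifts (cT α) (cT β) (cF ρ)) h₁
      u : Unique (lvF (edge s t ∷ R))
      u = unique-↭ (lvF-≈ p) (rep-unique r)
      inα : ∀ {x y} → Star (Adj K) (leaf x) (leaf y) → x ∈ lv s → y ∈ lv s
      inα st i = vs-lv α (star-closed {C = cT α} {cT β ⊹ cF ρ} h₁ (ends-T α) (ends-⊹ {cT β} {cF ρ} (ends-T β) (ends-F ρ)) (lv-vs α i) st)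
      inβ : ∀ {x y} → Star (Adj K) (leaf x) (leaf y) → x ∈ lv t → y ∈ lv t
      inβ st i = vs-lv β (star-closed {C = cT β} {cT α ⊹ cF ρ} h₁' (ends-T β) (ends-⊹ {cT α} {cF ρ} (ends-T α) (ends-F ρ)) (lv-vs β i) st)
      go : Same (edge s t ∷ R) a c → SepF (edge s t ∷ R) a b c d
      go (there k) = ⊥-elim (nac (star-same K ρ (λ m → holds-adj h₁ (∈-++⁺ʳ (es α) (∈-++⁺ʳ (es β) m))) k))
      go (here (i , j)) with ∈-++⁻ (lv s) i | ∈-++⁻ (lv s) j
      ... | inj₁ i' | inj₁ j' = ⊥-elim (nac (star-TT K α (λ m → holds-adj h₁ (∈-++⁺ˡ m)) (lv-vs α i') (lv-vs α j')))
      ... | inj₂ i' | inj₂ j' = ⊥-elim (nac (star-TT K β (λ m → holds-adj h₁ (∈-++⁺ʳ (es α) (∈-++⁺ˡ m))) (lv-vs β i') (lv-vs β j')))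
      ... | inj₁ i' | inj₂ j' = sep-root u i' (inα sab i') j' (inβ scd j')
      ... | inj₂ i' | inj₁ j' = sepF-swap (sep-root u j' (inα scd j') i' (inβ sab i'))

    rep-sep : ∀ {F F' G a b c d} → Rep F G → Rep F' G → SepF F a b c d → SepF F' a b c d
    rep-sep r r' z = gsep-view r' (gsep-make r z)

    fresh-vertex : ∀ (V : List (Vx A)) → ∃ λ n → inj₂ n ∉ V
    fresh-vertex V = case fresh (map name V) of λ { (n , p) →
      n , λ i → p (∈-map⁺ name i) }
      where
      name : Vx A → ℕ
      name (inj₁ _) = 0
      name (inj₂ n) = n

    subdivided : ∀ {G n V e E₁ E₂ u w E} → inj₂ n ∉ verts G → Holds G (V , (u , w) ∷ E) → edges G ≡ E₁ ++ e ∷ E₂ → SameE (u , w) e →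
      Holds (mkG (inj₂ n ∷ verts G) ((proj₁ e , inj₂ n) ∷ (inj₂ n , proj₂ e) ∷ E₁ ++ E₂)) (inj₂ n ∷ V , (inj₂ n , u) ∷ (inj₂ n , w) ∷ E)
    subdivided {G} {n} {V} {e} {E₁} {E₂} {u} {w} {E} n∉ h eq s = holds (All.tabulate (λ i e → n∉ (∈-resp-↭ (proj₁ (cont h)) (subst (_∈ V) (sym e) i))) ∷ uniqueV h)
      (prep _ (proj₁ (cont h)) , ps s)
      where
      h' = cut-edge⁻ h eq s
      ps : ∀ {e} → SameE (u , w) e → (inj₂ n , u) ∷ (inj₂ n , w) ∷ E ≋ (proj₁ e , inj₂ n) ∷ (inj₂ n , proj₂ e) ∷ E₁ ++ E₂
      ps (inj₁ refl) = Homogeneous.prep (inj₂ refl) (≋-prep _ (proj₂ (cont h')))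
      ps (inj₂ refl) = Homogeneous.swap sameE-refl (inj₂ refl) (proj₂ (cont h'))

    node-assoc : ∀ {ps F s t} (α : Named s) (β : Named t) (π : All Named ps) (φ : All NamedU F) → ((cT α ⊹ cT β) ⊹ cP π) ⊹ cF φ ≃ cT α ⊹ cT β ⊹ cP π ⊹ cF φ
    node-assoc α β π φ = ≃-trans {((cT α ⊹ cT β) ⊹ cP π) ⊹ cF φ} {(cT α ⊹ cT β ⊹ cP π) ⊹ cF φ} {cT α ⊹ cT β ⊹ cP π ⊹ cF φ}
      (⊹-cong {(cT α ⊹ cT β) ⊹ cP π} {cT α ⊹ cT β ⊹ cP π} {cF φ} {cF φ} (⊹-assoc (cT α) (cT β) (cP π)) (≃-refl {cF φ}))
      (≃-trans {(cT α ⊹ cT β ⊹ cP π) ⊹ cF φ} {cT α ⊹ (cT β ⊹ cP π) ⊹ cF φ} {cT α ⊹ cT β ⊹ cP π ⊹ cF φ}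
        (⊹-assoc (cT α) (cT β ⊹ cP π) (cF φ)) (⊹-cong {cT α} {cT α} {(cT β ⊹ cP π) ⊹ cF φ} {cT β ⊹ cP π ⊹ cF φ} (≃-refl {cT α}) (⊹-assoc (cT β) (cP π) (cF φ))))

    node-assemble : ∀ {ps F s t G} n (α : Named s) (β : Named t) (π : All Named ps) (φ : All NamedU F) →
      Holds G (inj₂ n ∷ proj₁ (cT α ⊹ cT β ⊹ cP π ⊹ cF φ) , (inj₂ n , rt α) ∷ (inj₂ n , rt β) ∷ proj₂ (cT α ⊹ cT β ⊹ cP π ⊹ cF φ)) →
      Holds G (cP (nd n α β ∷ π) ⊹ cF φ)
    node-assemble n α β π φ h = holds-≃ {C' = cP (nd n α β ∷ π) ⊹ cF φ} (prep (inj₂ n) (proj₁ q) , ≋-prep (inj₂ n , rt α) (≋-prep (inj₂ n , rt β) (proj₂ q))) h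
      where
      q : cT α ⊹ cT β ⊹ cP π ⊹ cF φ ≃ ((cT α ⊹ cT β) ⊹ cP π) ⊹ cF φ
      q = ≃-sym {((cT α ⊹ cT β) ⊹ cP π) ⊹ cF φ} {cT α ⊹ cT β ⊹ cP π ⊹ cF φ} (node-assoc α β π φ)

    edge-expose : ∀ {ps F s t G} (α : Named s) (β : Named t) (π : All Named ps) (φ : All NamedU F) → Holds G (cP π ⊹ cF (edge α β ∷ φ)) →
      Holds G (proj₁ (cT α ⊹ cT β ⊹ cP π ⊹ cF φ) , (rt α , rt β) ∷ proj₂ (cT α ⊹ cT β ⊹ cP π ⊹ cF φ))
    edge-expose α β π φ h = holds-≃ {C = cP π ⊹ cF (edge α β ∷ φ)} (≃-sym {proj₁ (cT α ⊹ cT β ⊹ cP π ⊹ cF φ) , (rt α , rt β) ∷ proj₂ (cT α ⊹ cT β ⊹ cP π ⊹ cF φ)} {cP π ⊹ cF (edge α β ∷ φ)} (node-cont α β π φ)) h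

    point-make : ∀ {ps R G} p (π : All Named ps) (μ : NamedU (unr p)) (ρ : All NamedU R) → Holds G (cP π ⊹ cF (μ ∷ ρ)) →
      ∃ λ v → ∃ λ G' → Point G v G' × Σ (Named p) λ α → rt α ≡ v × Holds G' (cP (α ∷ π) ⊹ cF ρ)
    point-make {G = G} (lf x) π (one .x) ρ h = leaf x , G , inj₁ (∈-resp-↭ (proj₁ (cont h')) (here refl) , holds-deg [] h' [] (¬inc-ends (ends-⊹ {cP π} {cF ρ} (ends-P π) (ends-F ρ)) (unique-head (uniqueV h'))) , refl) ,
      lf x , refl , h'
      where
      h' : Holds G (cP (lf x ∷ π) ⊹ cF ρ)
      h' = holds-≃ (≃-sym (leaf-to-F x π ρ)) h
    point-make {G = G} (nd s t) π (edge α β) ρ h = point-edge (fresh-vertex (verts G)) (cut-edge h₁)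
      where
      h₁ = edge-expose α β π ρ h
      C = cT α ⊹ cT β ⊹ cP π ⊹ cF ρ
      point-edge : (∃ λ n → inj₂ n ∉ verts G) →
        (∃ λ E₁ → ∃ λ e → ∃ λ E₂ → edges G ≡ E₁ ++ e ∷ E₂ × SameE (rt α , rt β) e × Holds (mkG (verts G) (E₁ ++ E₂)) C) →
        ∃ λ v → ∃ λ G' → Point G v G' × Σ (Named (nd s t)) λ α → rt α ≡ v × Holds G' (cP (α ∷ π) ⊹ cF ρ)
      point-edge (n , n∉) (E₁ , e , E₂ , eq , s , _) =
        inj₂ n , _ , inj₂ (n , E₁ , e , E₂ , n∉ , eq , refl , refl) , nd n α β , refl , node-assemble n α β π ρ (subdivided n∉ h₁ eq s)

    point-view : ∀ {ps F G v G'} (π : All Named ps) (φ : All NamedU F) → Holds G (cP π ⊹ cF φ) → Point G v G' →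
      (∀ {w} → w ∈ proj₁ (cP π) → ¬ Star (Adj G') w v) →
      ∃ λ p → ∃ λ R → Σ (Named p) λ α → Σ (All NamedU R) λ ρ → F ≈ unr p ∷ R × rt α ≡ v × Holds G' (cP (α ∷ π) ⊹ cF ρ)
    point-view {G = G} π φ h (inj₁ (i , d , refl)) sep with ∈-++⁻ (proj₁ (cP π)) (∈-resp-↭ (↭-sym (proj₁ (cont h))) i)
    ... | inj₁ j = ⊥-elim (sep j ε)
    ... | inj₂ j with locateVF φ j
    ...   | isol {x} ρ p refl q = lf x , _ , lf x , ρ , p , refl , holds-≃ (≃-trans (⊹-cong (≃-refl {cP π}) q) (≃-sym (leaf-to-F x π ρ))) h
    ...   | conn α β ρ p refl q = ⊥-elim (deg0-adj {G} d (holds-adj (holds-≃ (⊹-cong (≃-refl {cP π}) q) h) (∈-++⁺ʳ (proj₂ (cP π)) (here refl))))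
    point-view {G = G} π φ h (inj₂ (n , E₁ , e , E₂ , n∉ , eq , refl , refl)) sep with ≋-∈ (≋-sym (proj₂ (cont h))) (subst (e ∈_) (sym eq) (∈-++⁺ʳ E₁ (here refl)))
    ... | e' , k , s with ∈-++⁻ (proj₂ (cP π)) k
    ... | inj₁ k' = ⊥-elim (sep (end s (All.lookup (ends-P π) k')) ((_ , here refl , inj₁ refl) ◅ ε))
      where
      end : ∀ {e e' : Edge A} → SameE e e' → proj₁ e' ∈ proj₁ (cP π) × proj₂ e' ∈ proj₁ (cP π) → proj₁ e ∈ proj₁ (cP π)
      end (inj₁ refl) (i , _) = i
      end (inj₂ refl) (_ , j) = j
    ... | inj₂ k' with loc-resp (sameE-sym s) (locateEF φ k')
    ...   | loc {s₁} {t₁} α β ρ p sm q = nd s₁ t₁ , _ , nd n α β , ρ , p , refl ,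
            node-assemble n α β π ρ (subdivided n∉ (edge-expose α β π ρ (holds-≃ {C' = cP π ⊹ cF (edge α β ∷ ρ)} (⊹-cong {cP π} {cP π} {cF φ} {cF (edge α β ∷ ρ)} (≃-refl {cP π}) q) h)) eq sm)

    ≈-single : ∀ {U F} → U ∷ [] ≈ F → ∃ λ V → F ≡ V ∷ [] × U ~ V
    ≈-single ε = _ , refl , ε
    ≈-single (tree r ◅ p) = case ≈-single p of λ { (V , e , q) →
      V , e , r ◅ q }
    ≈-single (perm r ◅ p) with refl ← ↭-singleton-inv (↭-sym r) = ≈-single p

    ≈-pair : ∀ {U V F} → U ∷ V ∷ [] ≈ F → ∃ λ U' → ∃ λ V' → F ≡ U' ∷ V' ∷ [] × ((U ~ U' × V ~ V') ⊎ (U ~ V' × V ~ U'))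
    ≈-pair ε = _ , _ , refl , inj₁ (ε , ε)
    ≈-pair (tree r ◅ p) with ≈-pair p
    ... | U' , V' , e , inj₁ (q , q') = U' , V' , e , inj₁ (r ◅ q , q')
    ... | U' , V' , e , inj₂ (q , q') = U' , V' , e , inj₂ (r ◅ q , q')
    ≈-pair {U} {V} (perm r ◅ p) with two' r
      where
      two' : ∀ {F} → U ∷ V ∷ [] ↭ F → F ≡ U ∷ V ∷ [] ⊎ F ≡ V ∷ U ∷ []
      two' {[]} r with () ← ↭-length r
      two' {W ∷ F} r with ∈-resp-↭ (↭-sym r) (here refl)
      ... | here refl with refl ← ↭-singleton-inv (↭-sym (drop-∷ r)) = inj₁ refl
      ... | there (here refl) with refl ← ↭-singleton-inv (↭-sym (drop-∷ (↭-trans (swap V U ↭-refl) r))) = inj₂ refl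
    ... | inj₁ refl = ≈-pair p
    ... | inj₂ refl with ≈-pair p
    ...   | U' , V' , e , inj₁ (q , q') = U' , V' , e , inj₂ (q' , q)
    ...   | U' , V' , e , inj₂ (q , q') = U' , V' , e , inj₁ (q' , q)

    joined : ∀ {p q} {K : Graph A} (α : Named p) (β : Named q) → Holds K (cP (β ∷ α ∷ []) ⊹ ([] , [])) →
      Holds (mkG (verts K) ((rt α , rt β) ∷ edges K)) (cU (edge α β) ⊹ ([] , []))
    joined α β h = holds (unique-↭ pV (uniqueV h)) (↭-trans (↭-sym pV) (proj₁ (cont h)) , ≋-prep _ (≋-trans (≋-sym pE) (proj₂ (cont h))))
      where
      pV : (vs β ++ (vs α ++ [])) ++ [] ↭ (vs α ++ vs β) ++ []
      pV = V-Solver.solve 2 (λ b a → let _∙_ = V-Solver._⊕_ in (b ∙ (a ∙ V-Solver.id)) ∙ V-Solver.id V-Solver.⊜ (a ∙ b) ∙ V-Solver.id) ↭-refl (vs β) (vs α)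
      pE : (es β ++ (es α ++ [])) ++ [] ≋ (es α ++ es β) ++ []
      pE = E-Solver.solve 2 (λ b a → let _∙_ = E-Solver._⊕_ in (b ∙ (a ∙ E-Solver.id)) ∙ E-Solver.id E-Solver.⊜ (a ∙ b) ∙ E-Solver.id) ≋-refl (es β) (es α)

    pairCont : ∀ {p q} (α : Named p) (β : Named q) → cP (β ∷ α ∷ []) ⊹ ([] , []) ≃ cT α ⊹ cT β
    pairCont α β =
      V-Solver.solve 2 (λ b a → let _∙_ = V-Solver._⊕_ in (b ∙ (a ∙ V-Solver.id)) ∙ V-Solver.id V-Solver.⊜ a ∙ b) ↭-refl (vs β) (vs α) ,
      E-Solver.solve 2 (λ b a → let _∙_ = E-Solver._⊕_ in (b ∙ (a ∙ E-Solver.id)) ∙ E-Solver.id E-Solver.⊜ a ∙ b) ≋-refl (es β) (es α)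

    two-comps : ∀ {U V K} → Rep (U ∷ V ∷ []) K → Σ (NamedU U × NamedU V) λ { (μ , μ') → Holds K (cF (μ ∷ μ' ∷ [])) }
    two-comps (μ ∷ μ' ∷ [] , h) = (μ , μ') , h

    not-connected : ∀ {s t K v w} (α : Named s) (β : Named t) → rt α ≡ v → rt β ≡ w → Holds K (cT α ⊹ cT β) → ¬ Conn K v w
    not-connected α β refl refl h (_ , st) = unique-disjoint (vs α) (uniqueV h) (star-closed {C = cT α} {cT β} h (ends-T α) (ends-T β) (rt∈ α) st) (rt∈ β)

    tbr-make : ∀ {T H G} → TBR₁ T H → Rep (T ∷ []) G → ∃ λ G' → TBRMove G G' × Rep (H ∷ []) G'
    tbr-make {T} {H} {G} (a , b , p , q , T~ , ap , bq , H~) r = start (rep-≈ (≈head T~) r)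
      where
      start : Rep (edge a b ∷ []) G → ∃ λ G' → TBRMove G G' × Rep (H ∷ []) G'
      start (edge α β ∷ [] , h) =
        case cut-make α β [] h of λ { (E₁ , e , E₂ , K , c , _ , rK) →
        case two-comps (rep-≈ (≈head ap ◅◅ ≈cons (≈head bq)) rK) of λ { ((μ , μ') , hK) →
        case point-make p [] μ (μ' ∷ []) hK of λ { (v , K₁ , pt , α' , ev , h₁) →
        case point-make q (α' ∷ []) μ' [] h₁ of λ { (w , K₂ , pt' , β' , ew , h₂) →
        mkG (verts K₂) ((rt α' , rt β') ∷ edges K₂) ,
        (E₁ , e , E₂ , K , v , w , K₁ , K₂ , c , pt , pt' , not-connected α' β' ev ew (holds-≃ (pairCont α' β') h₂) ,
          cong₂ (λ x y → mkG (verts K₂) ((x , y) ∷ edges K₂)) ev ew) ,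
        rep-≈ (≈head (~sym H~)) (edge α' β' ∷ [] , joined α' β' h₂) }}}}

    star-subdivide : ∀ {K K₂ : Graph A} {v} → Point K v K₂ → ∀ {a b} → Star (Adj K) a b → Star (Adj K₂) a b
    star-subdivide pt ε = ε
    star-subdivide (inj₁ (_ , _ , refl)) st = st
    star-subdivide {K} {K₂} pt@(inj₂ (n , E₁ , e , E₂ , _ , eq , refl , refl)) ((e' , i , j) ◅ st) = sub j (∈-++⁻ E₁ (subst (e' ∈_) eq i)) ◅◅ star-subdivide {K} {K₂} pt st
      where
      sub : ∀ {a b} → Joins e' a b → e' ∈ E₁ ⊎ e' ∈ e ∷ E₂ → Star (Adj K₂) a b
      sub j (inj₁ k) = (e' , there (there (∈-++⁺ˡ k)) , j) ◅ ε
      sub j (inj₂ (there k)) = (e' , there (there (∈-++⁺ʳ E₁ k)) , j) ◅ ε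
      sub (inj₁ refl) (inj₂ (here refl)) = (_ , here refl , inj₁ refl) ◅ (_ , there (here refl) , inj₁ refl) ◅ ε
      sub (inj₂ refl) (inj₂ (here refl)) = (_ , there (here refl) , inj₂ refl) ◅ (_ , here refl , inj₂ refl) ◅ ε

    point-vertex : ∀ {K K₂ : Graph A} {v u} → Point K v K₂ → u ∈ verts K → u ∈ verts K₂
    point-vertex (inj₁ (_ , _ , refl)) i = i
    point-vertex (inj₂ (_ , _ , _ , _ , _ , _ , refl , refl)) i = there i

    tbr-pair : ∀ {T s t p q} {F : Forest} → T ~ edge s t → F ≡ unr p ∷ unr q ∷ [] →
      (∃ λ U → ∃ λ V → F ≡ U ∷ V ∷ [] × ((unr s ~ U × unr t ~ V) ⊎ (unr s ~ V × unr t ~ U))) → TBR₁ T (edge p q)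
    tbr-pair T~ refl (_ , _ , refl , inj₁ (x , y)) = _ , _ , _ , _ , T~ , x , y , ε
    tbr-pair T~ refl (_ , _ , refl , inj₂ (x , y)) = _ , _ , _ , _ , T~ ◅◅ ~swp , y , x , ε

    PointView : ∀ {ps} → Graph A → Vx A → All Named ps → Forest → Set
    PointView G' v π F = ∃ λ p → ∃ λ R → Σ (Named p) λ α → Σ (All NamedU R) λ ρ → F ≈ unr p ∷ R × rt α ≡ v × Holds G' (cP (α ∷ π) ⊹ cF ρ)

    tbr-second : ∀ {T s t p R K₂ w} (α : Named p) → T ~ edge s t → unr s ∷ unr t ∷ [] ≈ unr p ∷ R → PointView K₂ w (α ∷ []) R →
      ∃ λ H → TBR₁ T H × Rep (H ∷ []) (mkG (verts K₂) ((rt α , w) ∷ edges K₂))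
    tbr-second {p = p} α T~ e₁ (q , [] , β , [] , e₂ , refl , h₂) =
      edge p q , tbr-pair T~ refl (≈-pair (e₁ ◅◅ ≈cons e₂)) , edge α β ∷ [] , joined α β h₂
    tbr-second α T~ e₁ (q , _ ∷ _ , _ , _ , e₂ , _) with () ← length-≈ (e₁ ◅◅ ≈cons e₂)

    tbr-first : ∀ {T s t K₁ K₂ v w} → T ~ edge s t → Point K₁ w K₂ → ¬ Conn K₂ v w → PointView K₁ v [] (unr s ∷ unr t ∷ []) →
      ∃ λ H → TBR₁ T H × Rep (H ∷ []) (mkG (verts K₂) ((v , w) ∷ edges K₂))
    tbr-first {K₁ = K₁} {K₂} {w = w} T~ pt' nc (p' , R₁ , α , ρ₁ , e₁ , refl , h₁) = tbr-second α T~ e₁ (point-view (α ∷ []) ρ₁ h₁ pt' far)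
      where
      far : ∀ {u} → u ∈ vs α ++ [] → ¬ Star (Adj K₂) u w
      far i st = nc (point-vertex pt' (∈-resp-↭ (proj₁ (cont h₁)) (∈-++⁺ˡ (∈-++⁺ˡ (rt∈ α)))) ,
        star-subdivide {K₁} {K₂} pt' (star-T K₁ α (λ k → holds-adj h₁ (∈-++⁺ˡ (∈-++⁺ˡ k))) (subst (_ ∈_) (List.++-identityʳ (vs α)) i)) ◅◅ st)

    tbr-cut : ∀ {T s t R K K₁ K₂ v w} → (∃ λ V → edge s t ∷ R ≡ V ∷ [] × T ~ V) → Rep (cutF s t R) K → Point K v K₁ → Point K₁ w K₂ → ¬ Conn K₂ v w →
      ∃ λ H → TBR₁ T H × Rep (H ∷ []) (mkG (verts K₂) ((v , w) ∷ edges K₂))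
    tbr-cut (_ , refl , T~) (φ , hK) pt pt' nc = tbr-first T~ pt' nc (point-view [] φ hK pt (λ ()))

    tbr-view : ∀ {T G G'} → Rep (T ∷ []) G → TBRMove G G' → ∃ λ H → TBR₁ T H × Rep (H ∷ []) G'
    tbr-view r (E₁ , e , E₂ , K , v , w , K₁ , K₂ , c , pt , pt' , nc , refl) =
      case cut-view r c of λ { (s , t , R , p , r') →
      tbr-cut (≈-single p) r' pt pt' nc }

    tbrs-make : ∀ {T T' G G' k} → TBRs T T' k → Rep (T ∷ []) G → Rep (T' ∷ []) G' → TBRSeq G G' k
    tbrs-make (nil p) r r' = done (iso-make (rep-≈ (≈head p) r) r')
    tbrs-make (cons x xs) r r' = case tbr-make x r of λ { (H , m , r₁) →
      move m (tbrs-make xs r₁ r') }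

    -- In the bipartite graph whose vertices are the trees of F and of F' and whose edges are the leaves, such a list
    -- is an edge set without cycles.
    data Indep (F F' : Forest) : List L → Set where
      []   : Indep F F' []
      cons : ∀ {x I} → All (λ j → ¬ Same F x j) I ⊎ All (λ j → ¬ Same F' x j) I → Indep F F' I → Indep F F' (x ∷ I)

    indep-sym : ∀ {F F' I} → Indep F F' I → Indep F' F I
    indep-sym []         = []
    indep-sym (cons q d) = cons (Sum.swap q) (indep-sym d)

    indep-map : ∀ {F F' F₂ F₂' I} → (∀ {a b} → a ∈ I → b ∈ I → Same F₂ a b → Same F a b) → (∀ {a b} → a ∈ I → b ∈ I → Same F₂' a b → Same F' a b) →
      Indep F F' I → Indep F₂ F₂' I
    indep-map f g [] = []
    indep-map f g (cons q d) = cons (Sum.map (λ q → All.tabulate (λ i k → All.lookup q i (f (here refl) (there i) k))) (λ q → All.tabulate (λ i k → All.lookup q i (g (here refl) (there i) k))) q)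
      (indep-map (λ i j → f (there i) (there j)) (λ i j → g (there i) (there j)) d)

    module _ (s t : Tr) (R F' : Forest) (u : Unique (lvF (edge s t ∷ R))) where

      -- Merging two components of an acyclic incidence structure closes at most one cycle.
      indep-merge : ∀ {I} → Indep (cutF s t R) F' I → ∃ λ I' → Indep (edge s t ∷ R) F' I' × (∀ {x} → x ∈ I' → x ∈ I) × length I ≤ suc (length I')
      indep-merge [] = [] , [] , id , z≤n
      indep-merge (cons (inj₂ q) d) = case indep-merge d of λ { (I' , d' , sub , le) →
        _ ∷ I' , cons (inj₂ (All.tabulate (λ i → All.lookup q (sub i)))) d' , (λ { (here e) → here e ; (there i) → there (sub i) }) , s≤s le }
      indep-merge {x ∷ I} (cons (inj₁ q) d) with x ∈? lv s | x ∈? lv t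
      ... | yes x∈ | _ = I , indep-map away (λ _ _ k → k) d , there , ≤-refl
        where
        away : ∀ {a b} → a ∈ I → b ∈ I → Same (edge s t ∷ R) a b → Same (cutF s t R) a b
        away i j k with same-cases s t R u k
        ... | inj₁ k' = k'
        ... | inj₂ (inj₁ (a∈ , _)) = ⊥-elim (All.lookup q i (here (∈-unr⁻ s x∈ , ∈-unr⁻ s a∈)))
        ... | inj₂ (inj₂ (_ , b∈)) = ⊥-elim (All.lookup q j (here (∈-unr⁻ s x∈ , ∈-unr⁻ s b∈)))
      ... | no _ | yes x∈ = I , indep-map away (λ _ _ k → k) d , there , ≤-refl
        where
        away : ∀ {a b} → a ∈ I → b ∈ I → Same (edge s t ∷ R) a b → Same (cutF s t R) a b
        away i j k with same-cases s t R u k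
        ... | inj₁ k' = k'
        ... | inj₂ (inj₁ (_ , b∈)) = ⊥-elim (All.lookup q j (there (here (∈-unr⁻ t x∈ , ∈-unr⁻ t b∈))))
        ... | inj₂ (inj₂ (a∈ , _)) = ⊥-elim (All.lookup q i (there (here (∈-unr⁻ t x∈ , ∈-unr⁻ t a∈))))
      ... | no x∉s | no x∉t = case indep-merge d of λ { (I' , d' , sub , le) →
        x ∷ I' , cons (inj₁ (All.tabulate (λ i k → All.lookup q (sub i) (keep k)))) d' , (λ { (here e) → here e ; (there i) → there (sub i) }) , s≤s le }
        where
        keep : ∀ {b} → Same (edge s t ∷ R) x b → Same (cutF s t R) x b
        keep k with same-cases s t R u k
        ... | inj₁ k' = k'
        ... | inj₂ (inj₁ (a∈ , _)) = ⊥-elim (x∉s a∈)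
        ... | inj₂ (inj₂ (a∈ , _)) = ⊥-elim (x∉t a∈)

    record Sound (F F' : Forest) (w n : ℕ) : Set where
      constructor sound
      field
        {col}  : Colouring
        {C}    : List ℕ
        {I}    : List L
        af     : AF F F' col
        cover  : Cover F col C
        indep  : Indep F F' I
        inside : ∀ {x} → x ∈ I → x ∈ lvF F
        bound  : length C ≤ w + length I
        steps  : length (lvF F) ≤ n

    sound-sym : ∀ {F F' w n} → lvF F ↭ lvF F' → Sound F F' w n → Sound F' F w n
    sound-sym p (sound x c d i b s) =
      sound (af-sym x) (λ j → c (∈-resp-↭ (↭-sym p) j)) (indep-sym d) (λ j → ∈-resp-↭ p (i j)) b (≤-trans (≤-reflexive (sym (↭-length p))) s)

    sound-cut : ∀ {F F' s t R w n} → Unique (lvF F) → F ≈ edge s t ∷ R → Sound (cutF s t R) F' w n → Sound F F' (suc w) (suc n)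
    sound-cut {F} {F'} {s} {t} {R} {w} {n} u p (sound {col} {C} {I} x c d i b st) = merged (indep-merge s t R F' u₁ d)
      where
      u₁ : Unique (lvF (edge s t ∷ R))
      u₁ = unique-↭ (lvF-≈ p) u
      leaves : lvF F ↭ lvF (cutF s t R)
      leaves = ↭-trans (lvF-≈ p) (↭-reflexive (sym (lvF-cut s t R)))
      merged : (∃ λ I' → Indep (edge s t ∷ R) F' I' × (∀ {x} → x ∈ I' → x ∈ I) × length I ≤ suc (length I')) → Sound F F' (suc w) (suc n)
      merged (I' , d' , sub , le) =
        sound (af-≈ u₁ (≈sym p) (af-cut↑ s t R u₁ x)) (λ k → c (∈-resp-↭ leaves k))
          (indep-map (λ _ _ → same-≈ p) (λ _ _ k → k) d') (λ k → ∈-resp-↭ (↭-sym leaves) (i (sub k)))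
          (≤-trans b (≤-trans (+-mono-≤ (≤-refl {w}) le) (≤-reflexive (+-suc w (length I')))))
          (≤-trans (≤-reflexive (↭-length leaves)) (≤-trans st (n≤1+n _)))

    restr-compare : ∀ {F F₂ F₃} → Restr F F₂ → Restr F F₃ → lvF F₂ ↭ lvF F₃ → Restr F₂ F₃
    restr-compare {F} {F₂} {F₃} r r' p = record
      { lv⊆ = back
      ; same↑ = λ k → same↓ r (back (same-∈ k)) (back (same-∈ (same-sym k))) (same↑ r' k)
      ; same↓ = λ i j k → same↓ r' i j (same↑ r k)
      ; sep↑ = λ z → case sepF-∈ z of λ { ((a , b) , (c , d)) →
        sep↓ r (back a) (back b) (back c) (back d) (sep↑ r' z) }
      ; sep↓ = λ a b c d z → sep↓ r' a b c d (sep↑ r z) }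
      where
      back : ∀ {x} → x ∈ lvF F₃ → x ∈ lvF F₂
      back = ∈-resp-↭ (↭-sym p)

    ext-rem : ∀ {x F F₂ F' col} → Unique (lvF F) → Rem x F F₂ → AF (one x ∷ F₂) F' col → AF F F' col
    ext-rem u (isol p) a = af-≈ (unique-↭ (lvF-≈ p) u) (≈sym p) a
    ext-rem {x} u (pend {t} {R} p) a = af-≈ (unique-↭ (lvF-≈ p) u) (≈sym p) (af-cut↑ (lf x) t R (unique-↭ (lvF-≈ p) u) a)

    rem-perm : ∀ {x F F' F₂ F₂'} → lvF F ↭ lvF F' → Rem x F F₂ → Rem x F' F₂' → lvF F₂ ↭ lvF F₂'
    rem-perm p r r' = drop-∷ (↭-trans (↭-sym (rem-lv r)) (↭-trans p (rem-lv r')))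

    sound-isolated : ∀ {x F F' F₂ F₂' R w n} → Unique (lvF F) → lvF F ↭ lvF F' → F ≈ one x ∷ R → Rem x F F₂ → Rem x F' F₂' →
      Sound F₂ F₂' w n → Sound F F' w (suc n)
    sound-isolated {x} {F} {F'} {F₂} {F₂'} {R} {w} u p iso r r' (sound {col} {C} {I} a c d i b st) =
      sound (af-sym (ext-rem (unique-↭ p u) r' (af-sym (ext-rem u r (af-one u₂ p₂ (λ j e → proj₂ (fresh C) (subst (_∈ C) e (c j))) a)))))
        (λ {y} j → covv y (∈-resp-↭ (rem-lv r) j))
        (cons (inj₁ (All.tabulate (λ {y} j m → unique-head u₂ (subst (_∈ lvF F₂) (alone m) (i j)))))
          (indep-map (λ j l m → same↓ rs (i j) (i l) m) (λ j l m → same↓ rs' (∈-resp-↭ p₂ (i j)) (∈-resp-↭ p₂ (i l)) m) d))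
        (λ { (here refl) → ∈-resp-↭ (↭-sym (rem-lv r)) (here refl) ; (there j) → lv⊆ rs (i j) })
        (≤-trans (s≤s b) (≤-reflexive (sym (+-suc w (length I)))))
        (≤-trans (≤-reflexive (↭-length (rem-lv r))) (s≤s st))
      where
      k = proj₁ (fresh C)
      u₂ : Unique (lvF (one x ∷ F₂))
      u₂ = unique-↭ (rem-lv r) u
      p₂ : lvF F₂ ↭ lvF F₂'
      p₂ = rem-perm p r r'
      rs : Restr F F₂
      rs = rem-restr u r
      rs' : Restr F' F₂'
      rs' = rem-restr (unique-↭ p u) r'
      alone : ∀ {y} → Same F x y → y ≡ x
      alone m with same-head (unique-↭ (lvF-≈ iso) u) (here refl) (same-≈ iso m)
      ... | here e = e
      covv : ∀ y → y ∈ x ∷ lvF F₂ → upd col x k y ∈ k ∷ C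
      covv y (here refl) = here (upd-≡ col x k)
      covv y (there j) = there (subst (_∈ C) (sym (upd-≢ col (λ { refl → unique-head u₂ j }))) (c j))

    sound-cherry : ∀ {x y F F' F₂ F₂' w n} → Unique (lvF F) → lvF F ↭ lvF F' → Ch F x y → Ch F' x y → Rem x F F₂ → Rem x F' F₂' →
      Sound F₂ F₂' w n → Sound F F' w (suc n)
    sound-cherry {x} {y} {F} {F'} {F₂} {F₂'} u p (t , R , q , ct) (t' , R' , q' , ct') r r' (sound {col} {C} {I} a c d i b st) =
      sound (af-≈ uq (≈sym q) (af-≈ʳ (unique-↭ (lvF-≈ q') u') (≈sym q') (af-cherry ct ct' uq (↭-trans (↭-sym (lvF-≈ q)) (↭-trans p (lvF-≈ q'))) a₁)))
        (λ {z} j → covv z (∈-resp-↭ (rem-lv r) j) (∈-resp-↭ (↭-sym m) (∈-++⁺ˡ (∈-unr⁻ t (chtop-∈ ct)))))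
        (indep-map (λ j l k → same↓ rs (i j) (i l) k) (λ j l k → same↓ rs' (∈-resp-↭ p₂ (i j)) (∈-resp-↭ p₂ (i l)) k) d)
        (λ j → lv⊆ rs (i j)) b (≤-trans (≤-reflexive (↭-length (rem-lv r))) (s≤s st))
      where
      u' : Unique (lvF F')
      u' = unique-↭ p u
      uq : Unique (lvF (edge (lf x) t ∷ R))
      uq = unique-↭ (lvF-≈ q) u
      p₂ : lvF F₂ ↭ lvF F₂'
      p₂ = rem-perm p r r'
      rs : Restr F F₂
      rs = rem-restr u r
      rs' : Restr F' F₂'
      rs' = rem-restr u' r'
      m : lvF F₂ ↭ lvF (unr t ∷ R)
      m = rem-perm ↭-refl r (pend q)
      m' : lvF F₂' ↭ lvF (unr t' ∷ R')
      m' = rem-perm ↭-refl r' (pend q')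
      a₁ : AF (unr t ∷ R) (unr t' ∷ R') col
      a₁ = af-restr (restr-compare rs (rem-restr u (pend q)) m) (restr-compare rs' (rem-restr u' (pend q')) m') (rem-perm p (pend q) (pend q')) a
      covv : ∀ z → z ∈ x ∷ lvF F₂ → y ∈ lvF F₂ → upd col x (col y) z ∈ C
      covv z j y∈ with z ≟ x
      ... | yes _ = c y∈
      covv z (here e) y∈ | no n = ⊥-elim (n e)
      covv z (there j) y∈ | no n = c j

    sep-irrefl : ∀ {F a b d} → ¬ SepF F a b a d
    sep-irrefl z with find z
    ... | edge s t , _ , _ , (u , _ , inj₁ ((i , _) , (n , _))) = n i
    ... | edge s t , _ , _ , (u , _ , inj₂ ((i , _) , (n , _))) = n i

    single-phylo : ∀ (a : A) → PhyloForest (single a)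
    single-phylo a = ([] ∷ [] , []) , (λ { [] e E₂ () ; (_ ∷ _) e E₂ () }) , v
      where
      leaf0' : IsLeaf (single a) (inj₁ a)
      leaf0' = inj₁ ([] , [] , ↭-refl , refl , [] , [])
      v : ∀ v → v ∈ inj₁ a ∷ [] → (IsLeaf (single a) v → Labelled v) × (Labelled v → IsLeaf (single a) v) × (¬ IsLeaf (single a) v → Deg (single a) v 3)
      v _ (here refl) = (λ _ → a , refl) , (λ _ → leaf0') , λ n → ⊥-elim (n leaf0')

    cps-phylo : ∀ {G G' σ w} → CPS G G' σ w → PhyloForest G × PhyloForest G'
    cps-phylo (last x) = single-phylo x , single-phylo x
    cps-phylo (step p q _ _) = p , q

    sound-last : ∀ {F F' a} → Rep F (single a) → Rep F' (single a) → lvF F ↭ lvF F' → Sound F F' 0 1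
    sound-last {F} {F'} {a} r r' p = fin (label-verts r (here refl))
      where
      only : ∀ {H x b} → Rep H (single a) → ι x ≡ a → b ∈ lvF H → b ≡ x
      only rH refl j with lv-verts rH j
      ... | here e = leaf-injective e
      short : ∀ {x} (xs : List L) → Unique xs → (∀ {b} → b ∈ xs → b ≡ x) → length xs ≤ 1
      short [] u f = z≤n
      short (b ∷ []) u f = s≤s z≤n
      short (b ∷ c ∷ xs) u f = ⊥-elim (unique-head u (subst (_∈ c ∷ xs) (Eq.trans (f (there (here refl))) (sym (f (here refl)))) (here refl)))
      fin : (∃ λ x → ι x ≡ a × x ∈ lvF F) → Sound F F' 0 1
      fin (x , e , x∈) = sound {col = λ _ → 0} {C = 0 ∷ []} {I = x ∷ []}
        (record { okˡ = ok r ; okʳ = ok r' ; agr = λ _ _ _ z → ⊥-elim (nosep r z) ; agr' = λ _ _ _ z → ⊥-elim (nosep r' z) })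
        (λ _ → here refl) (cons (inj₁ []) []) (λ { (here refl) → x∈ }) ≤-refl (short {x} (lvF F) (rep-unique r) (only r e))
        where
        ok : ∀ {H} → Rep H (single a) → Ok H (λ _ → 0)
        ok {H} rH = record { blk = λ i j _ → subst (Same H _) (Eq.trans (only rH e i) (sym (only rH e j))) (same-refl H i) ; dis = λ _ _ _ _ _ n → ⊥-elim (n refl) }
        nosep : ∀ {H a' b c d} → Rep H (single a) → ¬ SepF H a' b c d
        nosep {H} {a'} {b} {c} {d} rH z = case sepF-∈ z of λ { ((i , _) , (k , _)) →
          sep-irrefl (subst (λ y → SepF H a' b y d) (Eq.trans (only rH e k) (sym (only rH e i))) z) }

    Cuts : Graph A → Graph A → Set
    Cuts G H = MinusEdge G (λ _ _ _ _ → ⊤) H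

    forget : ∀ {G P H} → MinusEdge G P H → Cuts G H
    forget (E₁ , e , E₂ , K , c , _ , i) = E₁ , e , E₂ , K , c , tt , i

    c2-cuts : ∀ {G G' a G₂ G₂'} → C2 G G' a G₂ G₂' → (G₂' ≡ G' × Cuts G G₂) ⊎ (G₂ ≡ G × Cuts G' G₂')
    c2-cuts (_ , _ , inj₁ (_ , e , inj₁ m)) = inj₁ (e , forget m)
    c2-cuts (_ , _ , inj₁ (_ , e , inj₂ (inj₁ (_ , _ , _ , _ , inj₁ m)))) = inj₁ (e , forget m)
    c2-cuts (_ , _ , inj₁ (_ , e , inj₂ (inj₁ (_ , _ , _ , _ , inj₂ m)))) = inj₁ (e , forget m)
    c2-cuts (_ , _ , inj₁ (_ , e , inj₂ (inj₂ (_ , _ , _ , _ , _ , _ , _ , _ , inj₁ m)))) = inj₁ (e , forget m)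
    c2-cuts (_ , _ , inj₁ (_ , e , inj₂ (inj₂ (_ , _ , _ , _ , _ , _ , _ , _ , inj₂ (inj₁ m))))) = inj₁ (e , forget m)
    c2-cuts (_ , _ , inj₁ (_ , e , inj₂ (inj₂ (_ , _ , _ , _ , _ , _ , _ , _ , inj₂ (inj₂ m))))) = inj₁ (e , forget m)
    c2-cuts (_ , _ , inj₂ (inj₁ (_ , _ , _ , inj₁ (e , m)))) = inj₁ (e , forget m)
    c2-cuts (_ , _ , inj₂ (inj₁ (_ , _ , _ , inj₂ (e , m)))) = inj₂ (e , forget m)
    c2-cuts (_ , _ , inj₂ (inj₂ (_ , _ , _ , _ , _ , _ , _ , e , m))) = inj₁ (e , forget m)

    SoundFor : Graph A → Graph A → ℕ → ℕ → Set
    SoundFor G G' w n = ∀ {F F'} → Rep F G → Rep F' G' → lvF F ↭ lvF F' → Sound F F' w n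

    soundFor-sym : ∀ {G G' w n} → SoundFor G G' w n → SoundFor G' G w n
    soundFor-sym f r r' p = sound-sym (↭-sym p) (f r' r (↭-sym p))

    step-c2 : ∀ {G G' a G₂ G₂' w n} → PhyloForest G₂ → PhyloForest G₂' → C2 G G' a G₂ G₂' → SoundFor G₂ G₂' w n → SoundFor G G' (suc w) (suc n)
    step-c2 {G} {G'} ph ph' c f {F} {F'} r r' p = go (c2-cuts c) ph ph' f
      where
      go : ∀ {G₂ G₂' w n} → (G₂' ≡ G' × Cuts G G₂) ⊎ (G₂ ≡ G × Cuts G' G₂') → PhyloForest G₂ → PhyloForest G₂' → SoundFor G₂ G₂' w n → Sound F F' (suc w) (suc n)
      go (inj₁ (refl , m)) ph ph' f = case minusEdge-view r m ph of λ { (s , t , R , q , r₂) →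
        sound-cut (rep-unique r) q (f r₂ r' (↭-trans (↭-reflexive (lvF-cut s t R)) (↭-trans (lvF-≈ (≈sym q)) p))) }
      go (inj₂ (refl , m)) ph ph' f = case minusEdge-view r' m ph' of λ { (s , t , R , q , r₂) →
        let p₂ = ↭-trans p (↭-trans (lvF-≈ q) (↭-reflexive (sym (lvF-cut s t R))))
        in sound-sym (↭-sym p) (sound-cut (rep-unique r') q (sound-sym p₂ (f r r₂ p₂))) }

    step-c3 : ∀ {G G' a G₂ G₂' w n} → PhyloForest G₂ → PhyloForest G₂' → C3 G G' a G₂ G₂' → SoundFor G₂ G₂' w n → SoundFor G G' w (suc n)
    step-c3 {G} {G'} ph ph' (iso , m , m') f {F} {F'} r r' p with isolated-view r iso | minus-view r m ph | minus-view r' m' ph'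
    ... | x , R , refl , q | x₁ , F₂ , e₁ , rm , r₂ | x₂ , F₂' , e₂ , rm' , r₂' with ι-injective e₁ | ι-injective e₂
    ... | refl | refl = sound-isolated (rep-unique r) p q rm rm' (f r₂ r₂' (rem-perm p rm rm'))

    step-c1 : ∀ {G G' a G₂ G₂' w n} → PhyloForest G₂ → PhyloForest G₂' → C1 G G' a G₂ G₂' → SoundFor G₂ G₂' w n → SoundFor G G' w (suc n)
    step-c1 {G} {G'} ph ph' (b , c , c' , m , m') f {F} {F'} r r' p with cherry-view r c | cherry-view r' c' | minus-view r m ph | minus-view r' m' ph'
    ... | x , y , refl , refl , ch | x' , y' , ex , ey , ch' | x₁ , F₂ , e₁ , rm , r₂ | x₂ , F₂' , e₂ , rm' , r₂' with ι-injective e₁ | ι-injective e₂ | ι-injective ex | ι-injective ey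
    ... | refl | refl | refl | refl = sound-cherry (rep-unique r) p ch ch' rm rm' (f r₂ r₂' (rem-perm p rm rm'))

    cps-sound : ∀ {G G' σ w} → CPS G G' σ w → SoundFor G G' w (length σ)
    cps-sound (last x) r r' p = sound-last r r' p
    cps-sound (step _ _ (c1 c) k) = case cps-phylo k of λ { (ph , ph') →
      step-c1 ph ph' c (cps-sound k) }
    cps-sound (step _ _ (c2 c) k) = case cps-phylo k of λ { (ph , ph') →
      step-c2 ph ph' c (cps-sound k) }
    cps-sound (step _ _ (c2ʳ c) k) = case cps-phylo k of λ { (ph , ph') →
      soundFor-sym (step-c2 ph' ph c (soundFor-sym (cps-sound k))) }
    cps-sound (step _ _ (c3 c) k) = case cps-phylo k of λ { (ph , ph') →
      step-c3 ph ph' c (cps-sound k) }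
    cps-sound (step _ _ (c3ʳ c) k) = case cps-phylo k of λ { (ph , ph') →
      soundFor-sym (step-c3 ph' ph c (soundFor-sym (cps-sound k))) }

    indep-trees : ∀ {T T' I} → Indep (T ∷ []) (T' ∷ []) I → (∀ {x} → x ∈ I → x ∈ lvU T) → (∀ {x} → x ∈ I → x ∈ lvU T') → length I ≤ 1
    indep-trees [] f g = z≤n
    indep-trees (cons _ []) f g = s≤s z≤n
    indep-trees (cons (inj₁ (n ∷ _)) (cons _ _)) f g = ⊥-elim (n (here (f (here refl) , f (there (here refl)))))
    indep-trees (cons (inj₂ (n ∷ _)) (cons _ _)) f g = ⊥-elim (n (here (g (here refl) , g (there (here refl)))))

    AFBound : Ut → Ut → ℕ → Set
    AFBound T T' k = ∃ λ col → ∃ λ C → AF (T ∷ []) (T' ∷ []) col × Cover (T ∷ []) col C × length C ≤ suc k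

    cps-bound : ∀ {T T' G G' σ w} → CPS G G' σ w → Rep (T ∷ []) G → Rep (T' ∷ []) G' → lvF (T ∷ []) ↭ lvF (T' ∷ []) →
      AFBound T T' w × length (lvF (T ∷ [])) ≤ length σ
    cps-bound {T} {T'} {w = w} k r r' p with cps-sound k r r' p
    ... | sound a c d i b st = (_ , _ , a , c , ≤-trans b (≤-trans (+-mono-≤ (≤-refl {w}) (indep-trees d (λ j → inT T (i j)) (λ j → inT T' (∈-resp-↭ p (i j))))) (≤-reflexive (+-comm w 1)))) , st
      where
      inT : ∀ U {x} → x ∈ lvF (U ∷ []) → x ∈ lvU U
      inT U = subst (_ ∈_) (List.++-identityʳ (lvU U))

    tbr-lv : ∀ {T H} → TBR₁ T H → lvF (T ∷ []) ↭ lvF (H ∷ [])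
    tbr-lv {T} {H} (a , b , p , q , T~ , ap , bq , H~) = ↭-trans (lvF-≈ e₁) (↭-trans (↭-reflexive (sym (lvF-cut a b []))) (↭-trans (lvF-≈ e₂)
      (↭-trans (↭-reflexive (lvF-cut p q [])) (lvF-≈ (≈sym e₃)))))
      where
      e₁ : T ∷ [] ≈ edge a b ∷ []
      e₁ = ≈head T~
      e₂ : cutF a b [] ≈ cutF p q []
      e₂ = ≈head ap ◅◅ ≈cons (≈head bq)
      e₃ : H ∷ [] ≈ edge p q ∷ []
      e₃ = ≈head H~

    afBound-tbr : ∀ {T H T' k} → Unique (lvF (T ∷ [])) → TBR₁ T H → lvF (H ∷ []) ↭ lvF (T' ∷ []) → AFBound H T' k → AFBound T T' (suc k)
    afBound-tbr {T} {H} {T'} {k} uT m@(a , b , p , q , T~ , ap , bq , H~) pH (col , C , x , c , le) =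
      rejoin (af-split uE (af-≈ uH e₁ x) (λ i → c (∈-resp-↭ (lvF-≈ (≈sym e₁)) i)) (↭-trans (↭-sym pH) (lvF-≈ e₁)))
      where
      e₁ : H ∷ [] ≈ edge p q ∷ []
      e₁ = ≈head H~
      e₂ : cutF a b [] ≈ cutF p q []
      e₂ = ≈head ap ◅◅ ≈cons (≈head bq)
      e₃ : T ∷ [] ≈ edge a b ∷ []
      e₃ = ≈head T~
      uH : Unique (lvF (H ∷ []))
      uH = unique-↭ (tbr-lv m) uT
      uE : Unique (lvF (edge p q ∷ []))
      uE = unique-↭ (lvF-≈ e₁) uH
      uA : Unique (lvF (edge a b ∷ []))
      uA = unique-↭ (lvF-≈ e₃) uT
      rejoin : (∃ λ col' → ∃ λ C' → AF (cutF p q []) (T' ∷ []) col' × Cover (cutF p q []) col' C' × length C' ≤ suc (length C)) → AFBound T T' (suc k)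
      rejoin (col' , C' , x' , c' , le') = col' , C' ,
        af-≈ uA (≈sym e₃) (af-cut↑ a b [] uA (af-≈ (subst Unique (sym (lvF-cut p q [])) uE) (≈sym e₂) x')) ,
        (λ i → c' (∈-resp-↭ (lvF-≈ e₂) (subst (_ ∈_) (sym (lvF-cut a b [])) (∈-resp-↭ (lvF-≈ e₃) i)))) , ≤-trans le' (s≤s le)

    tbr-bound : ∀ {T T' G G' k} → TBRSeq G G' k → Rep (T ∷ []) G → Rep (T' ∷ []) G' → lvF (T ∷ []) ↭ lvF (T' ∷ []) → AFBound T T' k
    tbr-bound {T} {T'} (done iso) r r' p =
      let r₁ = rep-iso r iso (rep-phylo r') in
      (λ _ → 0) , 0 ∷ [] , record { okˡ = ok T ; okʳ = ok T' ; agr = λ _ _ _ → rep-sep r₁ r' ; agr' = λ _ _ _ → rep-sep r' r₁ } , (λ _ → here refl) , ≤-refl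
      where
      ok : ∀ U → Ok (U ∷ []) (λ _ → 0)
      ok U = record { blk = λ i j _ → here (subst (_ ∈_) (List.++-identityʳ (lvU U)) i , subst (_ ∈_) (List.++-identityʳ (lvU U)) j) ; dis = λ _ _ _ _ _ n → ⊥-elim (n refl) }
    tbr-bound {T} {T'} (move m k) r r' p = moved (tbr-view r m)
      where
      moved : (∃ λ H → TBR₁ T H × Rep (H ∷ []) _) → AFBound T T' _
      moved (H , t , r₁) = afBound-tbr (rep-unique r) t pH (tbr-bound k r₁ r' pH)
        where
        pH : lvF (H ∷ []) ↭ lvF (T' ∷ [])
        pH = ↭-trans (↭-sym (tbr-lv t)) p

    ACPS : Forest → Forest → ℕ → Set
    ACPS F F' d = ∀ {G G'} → Rep F G → Rep F' G' → ∃ λ σ → CPS G G' σ d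

    cps-sym : ∀ {G G' : Graph A} {σ w} → CPS G G' σ w → CPS G' G σ w
    cps-sym (last x) = last x
    cps-sym (step p q (c1 (y , c , c' , m , m')) k) = step q p (c1 (y , c' , c , m' , m)) (cps-sym k)
    cps-sym (step p q (c2 c) k) = step q p (c2ʳ c) (cps-sym k)
    cps-sym (step p q (c2ʳ c) k) = step q p (c2 c) (cps-sym k)
    cps-sym (step p q (c3 c) k) = step q p (c3ʳ c) (cps-sym k)
    cps-sym (step p q (c3ʳ c) k) = step q p (c3 c) (cps-sym k)

    acps-sym : ∀ {F F' d} → ACPS F F' d → ACPS F' F d
    acps-sym f r r' = case f r' r of λ { (σ , k) →
      σ , cps-sym k }

    acps-≈ : ∀ {F F' F₂ F₂' d} → F ≈ F₂ → F' ≈ F₂' → ACPS F₂ F₂' d → ACPS F F' d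
    acps-≈ p q f r r' = f (rep-≈ p r) (rep-≈ q r')

    acps-last : ∀ {x} → ACPS (one x ∷ []) (one x ∷ []) 0
    acps-last {x} {mkG V E} {mkG V' E'} (one .x ∷ [] , h) (one .x ∷ [] , h')
      with ↭-singleton-inv (↭-sym (proj₁ (cont h))) | ↭-singleton-inv (↭-sym (proj₁ (cont h'))) | noEdges (proj₂ (cont h)) | noEdges (proj₂ (cont h'))
      where
      noEdges : ∀ {E} → [] ≋ E → E ≡ []
      noEdges p with _ , [] , q ← ≋⇒edgesEq p = ↭-empty-inv (↭-sym q)
    ... | refl | refl | refl | refl = _ , last (ι x)

    acps-c1 : ∀ {F F' F₂ F₂' x y d} → Ch F x y → Ch F' x y → Rem x F F₂ → Rem x F' F₂' → ACPS F₂ F₂' d → ACPS F F' d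
    acps-c1 ch ch' m m' f r r' =
      case minus-make m r of λ { (_ , k , r₂) →
      case minus-make m' r' of λ { (_ , k' , r₂') →
      case f r₂ r₂' of λ { (σ , cps) →
      _ , step (rep-phylo r) (rep-phylo r') (c1 (_ , cherry-make r ch , cherry-make r' ch' , k , k')) cps }}}

    acps-c3 : ∀ {F F' F₂ F₂' R x d} → F ≈ one x ∷ R → Rem x F F₂ → Rem x F' F₂' → ACPS F₂ F₂' d → ACPS F F' d
    acps-c3 p m m' f r r' =
      case minus-make m r of λ { (_ , k , r₂) →
      case minus-make m' r' of λ { (_ , k' , r₂') →
      case f r₂ r₂' of λ { (σ , cps) →
      _ , step (rep-phylo r) (rep-phylo r') (c3 (isolated-make r p , k , k')) cps }}}

    C2Step : Forest → Forest → L → Forest → Forest → Set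
    C2Step F F' x F₂ F₂' = ∀ {G G'} → Rep F G → Rep F' G' → ∃ λ G₂ → ∃ λ G₂' → C2 G G' (ι x) G₂ G₂' × Rep F₂ G₂ × Rep F₂' G₂'

    acps-c2 : ∀ {F F' F₂ F₂' x d} → C2Step F F' x F₂ F₂' → ACPS F₂ F₂' d → ACPS F F' (suc d)
    acps-c2 s f r r' = case s r r' of λ { (_ , _ , c , r₂ , r₂') →
      case f r₂ r₂' of λ { (_ , cps) →
      _ , step (rep-phylo r) (rep-phylo r') (c2 c) cps }}

    EdgeInfo : ∀ {s t} → Graph A → Named s → Named t → Forest → EdgeProp {A} → Set
    EdgeInfo {s} {t} G α β R P = ∀ {E₁ e E₂ K} → SameE (rt α , rt β) e → Rep (cutF s t R) K → P E₁ e E₂ K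

    minusEdge-make : ∀ {s t R G} (P : EdgeProp {A}) (α : Named s) (β : Named t) (ρ : All NamedU R) → Holds G (cU (edge α β) ⊹ cF ρ) →
      EdgeInfo G α β R P → ∃ λ H → MinusEdge G P H × Rep (cutF s t R) H
    minusEdge-make P α β ρ h info = case cut-make α β ρ h of λ { (E₁ , e , E₂ , K , c , s , r) →
      K , (E₁ , e , E₂ , K , c , info s r , iso-refl r) , r }

    hasPendant-make : ∀ {s t R G} (P : EdgeProp {A}) (α : Named s) (β : Named t) (ρ : All NamedU R) → Holds G (cU (edge α β) ⊹ cF ρ) →
      EdgeInfo G α β R P → HasPendant G P
    hasPendant-make P α β ρ h info = case cut-make α β ρ h of λ { (E₁ , e , E₂ , K , c , s , r) →
      E₁ , e , E₂ , K , c , info s r }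

    edge-named : ∀ {s t R G} → Rep (edge s t ∷ R) G → Σ (Named s) λ α → Σ (Named t) λ β → Σ (All NamedU R) λ ρ → Holds G (cU (edge α β) ⊹ cF ρ)
    edge-named (edge α β ∷ ρ , h) = α , β , ρ , h

    cut-at : ∀ {F s t R G} (P : EdgeProp {A}) → F ≈ edge s t ∷ R → Rep F G →
      (∀ (α : Named s) (β : Named t) (ρ : All NamedU R) → Holds G (cU (edge α β) ⊹ cF ρ) → EdgeInfo G α β R P) → ∃ λ H → MinusEdge G P H × Rep (cutF s t R) H
    cut-at P p r info = case edge-named (rep-≈ p r) of λ { (α , β , ρ , h) →
      minusEdge-make P α β ρ h (info α β ρ h) }

    pendant-at : ∀ {F s t R G} (P : EdgeProp {A}) → F ≈ edge s t ∷ R → Rep F G →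
      (∀ (α : Named s) (β : Named t) (ρ : All NamedU R) → Holds G (cU (edge α β) ⊹ cF ρ) → EdgeInfo G α β R P) → HasPendant G P
    pendant-at P p r info = case edge-named (rep-≈ p r) of λ { (α , β , ρ , h) →
      hasPendant-make P α β ρ h (info α β ρ h) }

    leafEdge : ∀ {w t R G} (α : Named (lf w)) (β : Named t) → EdgeInfo G α β R (IsEdgeOf (ι w))
    leafEdge (lf w) β s _ = inc-resp s (inj₁ refl)

    cut-leaf : ∀ {F w t R G} → F ≈ edge (lf w) t ∷ R → Rep F G → ∃ λ H → MinusEdge G (IsEdgeOf (ι w)) H × Rep (cutF (lf w) t R) H
    cut-leaf {R = R} {G} p r = cut-at (IsEdgeOf (ι _)) p r (λ α β ρ h {E₁} {e} {E₂} {K} → leafEdge {R = R} {G} α β {E₁} {e} {E₂} {K})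

    EitherEdge : L → L → EdgeProp {A}
    EitherEdge x y E₁ e E₂ K = IsEdgeOf (ι x) E₁ e E₂ K ⊎ IsEdgeOf (ι y) E₁ e E₂ K

    cut-either : ∀ {F x y w t R G} → w ≡ x ⊎ w ≡ y → F ≈ edge (lf w) t ∷ R → Rep F G → ∃ λ H → MinusEdge G (EitherEdge x y) H × Rep (cutF (lf w) t R) H
    cut-either {x = x} {y} o p r = case cut-leaf p r of λ { (H , (E₁ , e , E₂ , K , c , i , iso) , r₂) →
      H , (E₁ , e , E₂ , K , c , side o i , iso) , r₂ }
      where
      side : ∀ {w e} → w ≡ x ⊎ w ≡ y → Inc (leaf w) e → Inc (leaf x) e ⊎ Inc (leaf y) e
      side (inj₁ refl) i = inj₁ i
      side (inj₂ refl) i = inj₂ i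

    pendantCut : ∀ {s t R G x} → x ∈ lv s → (α : Named s) (β : Named t) (ρ : All NamedU R) → Holds G (cU (edge α β) ⊹ cF ρ) → EdgeInfo G α β R (PendantCut G (ι x) (map ι (lv s)))
    pendantCut {s} {t} {R} {G} {x} i α β ρ h {e = e} {K = K} se r = (lv-verts (edge α β ∷ ρ , h) (∈-++⁺ˡ (∈-++⁺ˡ i)) , reach se) , λ a → into a , outof a
      where
      go : ∀ {v} → v ∈ vs α ++ vs β → Star (Adj G) (leaf x) v
      go = star-U G (edge α β) (λ k → holds-adj h (∈-++⁺ˡ k)) (∈-++⁺ˡ (lv-vs α i))
      reach : ∀ {e} → SameE (rt α , rt β) e → Star (Adj G) (leaf x) (proj₁ e)
      reach (inj₁ refl) = go (∈-++⁺ˡ (rt∈ α))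
      reach (inj₂ refl) = go (∈-++⁺ʳ (vs α) (rt∈ β))
      into : ∀ a → Conn K (leaf x) (inj₁ a) → a ∈ map ι (lv s)
      into a (j , st) = fin (comp-closed r (∈-unr⁻ s i) st)
        where
        fin : Σ (NamedU (unr s)) (λ ν → inj₁ a ∈ proj₁ (cU ν)) → a ∈ map ι (lv s)
        fin (ν , k) = case label-∈ (ν ∷ []) (∈-++⁺ˡ k) of λ { (y , e , l) →
          subst (_∈ map ι (lv s)) e (∈-map⁺ ι (∈-unr s (subst (y ∈_) (List.++-identityʳ (lvU (unr s))) l))) }
      outof : ∀ a → a ∈ map ι (lv s) → Conn K (leaf x) (inj₁ a)
      outof a k with y , l , refl ← ∈-map⁻ ι k = conn-make r (here (∈-unr⁻ s i , ∈-unr⁻ s l))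

    Conflict : Forest → Forest → L → L → L → Set
    Conflict F F' x y z = Ch F x y × Ch F' x z × z ≢ y

    c2-a1 : ∀ {F F' x y z w t R} → Conflict F F' x y z → w ≡ x ⊎ w ≡ y → F ≈ edge (lf w) t ∷ R → C2Step F F' x (cutF (lf w) t R) F'
    c2-a1 (ch , ch' , n) o p r r' = case cut-either o p r of λ { (H , m , r₂) →
      H , _ , (_ , cherry-make r ch , inj₁ ((_ , cherry-make r' ch' , n ∘ ι-injective) , refl , inj₁ m)) , r₂ , r' }

    S₃ : L → L → L → Tr
    S₃ x y p = nd (nd (lf x) (lf y)) (lf p)

    S₄ : L → L → L → L → Tr
    S₄ x y p q = nd (nd (lf x) (lf y)) (nd (lf p) (lf q))

    pend3-info : ∀ {x y p t R G} (α : Named (S₃ x y p)) (β : Named t) (ρ : All NamedU R) → Holds G (cU (edge α β) ⊹ cF ρ) → EdgeInfo G α β R (Pend3 G (ι x) (ι y) (ι p))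
    pend3-info α β ρ h {E₁} {e} {E₂} {K} s r = pendantCut (here refl) α β ρ h {E₁} {e} {E₂} {K} s r , cherry-make r (_ , _ , ≈head ~rot , more)

    pend4-info : ∀ {x y p q t R G} (α : Named (S₄ x y p q)) (β : Named t) (ρ : All NamedU R) → Holds G (cU (edge α β) ⊹ cF ρ) → EdgeInfo G α β R (Pend4 G (ι x) (ι y) (ι p) (ι q))
    pend4-info α β ρ h {E₁} {e} {E₂} {K} s r = pendantCut (here refl) α β ρ h {E₁} {e} {E₂} {K} s r ,
      cherry-make r (_ , _ , ≈head ~rot , more) , cherry-make r (_ , _ , ≈head (~swp ◅◅ ~rot) , more)

    pend2-info : ∀ {p q t R G} (α : Named (nd (lf p) (lf q))) (β : Named t) (ρ : All NamedU R) → Holds G (cU (edge α β) ⊹ cF ρ) → EdgeInfo G α β R (Pend2 G (ι p) (ι q))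
    pend2-info α β ρ h {E₁} {e} {E₂} {K} s r = pendantCut (here refl) α β ρ h {E₁} {e} {E₂} {K} s r , cherry-make r (_ , _ , ε , two)

    distinct : ∀ {F s t R} → Unique (lvF F) → F ≈ edge s t ∷ R → Unique (lv s)
    distinct {s = s} {t} u p = unique-++ˡ (lv s) (unique-++ˡ (lv s ++ lv t) (unique-↭ (lvF-≈ p) u))

    third-≢ : ∀ {x y p : L} → Unique (x ∷ y ∷ p ∷ []) → p ≢ x × p ≢ y
    third-≢ ((_ ∷ xp ∷ []) ∷ (yp ∷ []) ∷ _) = xp ∘ sym , yp ∘ sym

    c2-a2 : ∀ {F F' x y z p t R G G' H} → Unique (lvF F) → Conflict F F' x y z → F ≈ edge (S₃ x y p) t ∷ R → Rep F G → Rep F' G' →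
      MinusEdge G (IsEdgeOf (ι p)) H ⊎ MinusEdge G (Pend3 G (ι x) (ι y) (ι p)) H → C2 G G' (ι x) H G'
    c2-a2 {p = p} {G = G} u (ch , ch' , n) e r r' m =
      _ , cherry-make r ch , inj₁ ((_ , cherry-make r' ch' , n ∘ ι-injective) , refl , inj₂ (inj₁ (ι p ,
        proj₁ (third-≢ (distinct u e)) ∘ ι-injective , proj₂ (third-≢ (distinct u e)) ∘ ι-injective ,
        pendant-at (Pend3 G _ _ _) e r (λ α β ρ h {E₁} {e} {E₂} {K} → pend3-info α β ρ h {E₁} {e} {E₂} {K}) , m)))

    c2-a2-leaf : ∀ {F F' x y z p t R t' R'} → Unique (lvF F) → Conflict F F' x y z → F ≈ edge (S₃ x y p) t ∷ R → F ≈ edge (lf p) t' ∷ R' →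
      C2Step F F' x (cutF (lf p) t' R') F'
    c2-a2-leaf u c e e' r r' = case cut-leaf e' r of λ { (H , m , r₂) →
      H , _ , c2-a2 u c e r r' (inj₁ m) , r₂ , r' }

    c2-a2-whole : ∀ {F F' x y z p t R} → Unique (lvF F) → Conflict F F' x y z → F ≈ edge (S₃ x y p) t ∷ R → C2Step F F' x (cutF (S₃ x y p) t R) F'
    c2-a2-whole u c e {G} r r' =
      case cut-at (Pend3 G _ _ _) e r (λ α β ρ h {E₁} {e} {E₂} {K} → pend3-info α β ρ h {E₁} {e} {E₂} {K}) of λ { (H , m , r₂) →
      H , _ , c2-a2 u c e r r' (inj₂ m) , r₂ , r' }

    c2-a3 : ∀ {F F' x y z p q t R G G' H} → Unique (lvF F) → Conflict F F' x y z → F ≈ edge (S₄ x y p q) t ∷ R → Rep F G → Rep F' G' →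
      MinusEdge G (IsEdgeOf (ι p)) H ⊎ MinusEdge G (IsEdgeOf (ι q)) H ⊎ MinusEdge G (Pend2 G (ι p) (ι q)) H → C2 G G' (ι x) H G'
    c2-a3 {p = p} {q} {G = G} u (ch , ch' , n) e r r' m =
      _ , cherry-make r ch , inj₁ ((_ , cherry-make r' ch' , n ∘ ι-injective) , refl , inj₂ (inj₂ (ι p , ι q ,
        (λ f → unique-head (unique-++ʳ (_ ∷ _ ∷ []) d) (here (ι-injective f))) ,
        proj₁ (third-≢ (unique-++ˡ (_ ∷ _ ∷ p ∷ []) d)) ∘ ι-injective , proj₂ (third-≢ (unique-++ˡ (_ ∷ _ ∷ p ∷ []) d)) ∘ ι-injective ,
        proj₁ (third-≢ d') ∘ ι-injective , proj₂ (third-≢ d') ∘ ι-injective ,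
        pendant-at (Pend4 G _ _ _ _) e r (λ α β ρ h {E₁} {e} {E₂} {K} → pend4-info α β ρ h {E₁} {e} {E₂} {K}) , m)))
      where
      d = distinct u e
      d' = unique-++ˡ (_ ∷ _ ∷ q ∷ []) (unique-↭ (prep _ (prep _ (swap p q ↭-refl))) d)

    c2-a3-leaf : ∀ {F F' x y z p q w t R t' R'} → Unique (lvF F) → Conflict F F' x y z → F ≈ edge (S₄ x y p q) t ∷ R → w ≡ p ⊎ w ≡ q → F ≈ edge (lf w) t' ∷ R' →
      C2Step F F' x (cutF (lf w) t' R') F'
    c2-a3-leaf u c e (inj₁ refl) e' r r' = case cut-leaf e' r of λ { (H , m , r₂) →
      H , _ , c2-a3 u c e r r' (inj₁ m) , r₂ , r' }
    c2-a3-leaf u c e (inj₂ refl) e' r r' = case cut-leaf e' r of λ { (H , m , r₂) →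
      H , _ , c2-a3 u c e r r' (inj₂ (inj₁ m)) , r₂ , r' }

    c2-a3-pair : ∀ {F F' x y z p q t R t' R'} → Unique (lvF F) → Conflict F F' x y z → F ≈ edge (S₄ x y p q) t ∷ R → F ≈ edge (nd (lf p) (lf q)) t' ∷ R' →
      C2Step F F' x (cutF (nd (lf p) (lf q)) t' R') F'
    c2-a3-pair u c e e' {G} r r' =
      case cut-at (Pend2 G _ _) e' r (λ α β ρ h {E₁} {e} {E₂} {K} → pend2-info α β ρ h {E₁} {e} {E₂} {K}) of λ { (H , m , r₂) →
      H , _ , c2-a3 u c e r r' (inj₂ (inj₂ m)) , r₂ , r' }

    NoCh : Forest → L → Set
    NoCh F x = ∀ {y} → ¬ Ch F x y

    ¬inCherry : ∀ {F G x} → Rep F G → NoCh F x → ¬ InCherry G (ι x)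
    ¬inCherry {F} r n (b , c) = case cherry-view r c of λ { (x' , y , e , _ , ch) →
      n (subst (λ z → Ch F z y) (ι-injective e) ch) }

    c2-b1 : ∀ {F F' x y w t R} → Ch F x y → Same F' x y → NoCh F' x → NoCh F' y → w ≡ x ⊎ w ≡ y → F ≈ edge (lf w) t ∷ R → C2Step F F' x (cutF (lf w) t R) F'
    c2-b1 ch k nx ny o p r r' = case cut-either o p r of λ { (H , m , r₂) →
      H , _ , (_ , cherry-make r ch , inj₂ (inj₁ (conn-make r' k , ¬inCherry r' nx , ¬inCherry r' ny , inj₁ (refl , m)))) , r₂ , r' }

    c2-c : ∀ {F F' x y w t R} → Ch F x y → x ∈ lvF F' → y ∈ lvF F' → ¬ Same F' x y → (∀ {z R} → ¬ (F' ≈ one z ∷ R)) → NoCh F' x → NoCh F' y →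
      w ≡ x ⊎ w ≡ y → F ≈ edge (lf w) t ∷ R → C2Step F F' x (cutF (lf w) t R) F'
    c2-c ch x∈ y∈ k ni nx ny o p r r' = case cut-either o p r of λ { (H , m , r₂) →
      H , _ , (_ , cherry-make r ch , inj₂ (inj₂ (lv-verts r' x∈ , lv-verts r' y∈ , k ∘ conn-view r' , notIso r' , notIso r' , ¬inCherry r' nx , ¬inCherry r' ny , refl , m))) , r₂ , r' }
      where
      notIso : ∀ {G a} → Rep _ G → ¬ Isolated G a
      notIso r' i = case isolated-view r' i of λ { (_ , _ , _ , p) →
        ni p }

    walk-to : ∀ {s y} (G : Graph A) (α : Named s) → (∀ {v} → v ∈ vs α → v ∈ verts G) → (∀ {a b} → (a , b) ∈ es α → Adj G a b) → Unique (vs α) → y ∈ lv s →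
      ∃ λ ps → Walk G (rt α) (leaf y) ps × Unique ps × All (_∈ vs α) ps
    walk-to G (lf x) vsub esub u (here refl) = _ , stop (vsub (here refl)) , [] ∷ [] , here refl ∷ []
    walk-to {nd s t} G (nd n α β) vsub esub u@(_ ∷ u') i with ∈-++⁻ (lv s) i
    ... | inj₁ j = case walk-to G α (λ k → vsub (there (∈-++⁺ˡ k))) (λ k → esub (there (there (∈-++⁺ˡ k)))) (unique-++ˡ (vs α) u') j of λ { (ps , w , up , inn) →
      _ , next (esub (here refl)) w , All.map (λ k e → unique-head u (∈-++⁺ˡ (subst (_∈ vs α) (sym e) k))) inn ∷ up , here refl ∷ All.map (λ k → there (∈-++⁺ˡ k)) inn }
    ... | inj₂ j = case walk-to G β (λ k → vsub (there (∈-++⁺ʳ (vs α) k))) (λ k → esub (there (there (∈-++⁺ʳ (es α) k)))) (unique-++ʳ (vs α) u') j of λ { (ps , w , up , inn) →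
      _ , next (esub (there (here refl))) w , All.map (λ k e → unique-head u (∈-++⁺ʳ (vs α) (subst (_∈ vs β) (sym e) k))) inn ∷ up , here refl ∷ All.map (λ k → there (∈-++⁺ʳ (vs α) k)) inn }

    consec-∈ : ∀ {a b : Vx A} {ps} → Consec a b ps → a ∈ ps × b ∈ ps
    consec-∈ here = here refl , there (here refl)
    consec-∈ (there c) = case consec-∈ c of λ { (i , j) →
      there i , there j }

    thirdEdge-info : ∀ {B x r y R G} → y ∈ lv r → (α : Named B) (β : Named (nd (lf x) r)) (ρ : All NamedU R) → Holds G (cU (edge α β) ⊹ cF ρ) →
      EdgeInfo G α β R (ThirdEdge G (ι x) (ι y))
    thirdEdge-info {G = G} i α (nd n (lf x) β) ρ h {e = e} se _ =
      inj₂ n , adj-x , inc-resp se (inj₂ refl) , _ , next adj-x (next adj-r (proj₁ (proj₂ w))) , uniq , off se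
      where
      esub : ∀ {a b} → (a , b) ∈ es (nd n (lf x) β) → Adj G a b
      esub k = holds-adj h (∈-++⁺ˡ (there (∈-++⁺ʳ (es α) k)))
      vsub : ∀ {v} → v ∈ vs (nd n (lf x) β) → v ∈ verts G
      vsub k = ∈-resp-↭ (proj₁ (cont h)) (∈-++⁺ˡ (∈-++⁺ʳ (vs α) k))
      uv : Unique (vs α ++ vs (nd n (lf x) β))
      uv = unique-++ˡ (vs α ++ vs (nd n (lf x) β)) (uniqueV h)
      un : Unique (inj₂ n ∷ leaf x ∷ vs β)
      un = unique-++ʳ (vs α) uv
      w = walk-to G β (λ k → vsub (there (there k))) (λ k → esub (there (there k))) (unique-++ʳ (inj₂ n ∷ leaf x ∷ []) un) i
      adj-x : Adj G (leaf x) (inj₂ n)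
      adj-x = adj-sym {G} (esub (here refl))
      adj-r : Adj G (inj₂ n) (rt β)
      adj-r = esub (there (here refl))
      inn : All (_∈ vs β) (proj₁ w)
      inn = proj₂ (proj₂ (proj₂ w))
      uniq : Unique (leaf x ∷ inj₂ n ∷ proj₁ w)
      uniq = ((λ e → unique-head un (here (sym e))) ∷ All.map (λ k e → unique-head (unique-++ʳ (inj₂ n ∷ []) un) (subst (_∈ vs β) (sym e) k)) inn) ∷
             (All.map (λ k e → unique-head un (there (subst (_∈ vs β) (sym e) k))) inn ∷ proj₁ (proj₂ (proj₂ w)))
      path : All (_∈ vs (nd n (lf x) β)) (leaf x ∷ inj₂ n ∷ proj₁ w)
      path = there (here refl) ∷ here refl ∷ All.map (λ k → there (there k)) inn
      notα : rt α ∉ vs (nd n (lf x) β)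
      notα k = unique-disjoint (vs α) uv (rt∈ α) k
      off : ∀ {e} → SameE (rt α , inj₂ n) e → ¬ (Σ (Vx A) λ a → Σ (Vx A) λ b → Consec a b (leaf x ∷ inj₂ n ∷ proj₁ w) × Joins e a b)
      off s (a , b , c , j) = case consec-∈ c of λ { (p , q) →
        side s j (All.lookup path p) (All.lookup path q) }
        where
        side : ∀ {e a b} → SameE (rt α , inj₂ n) e → Joins e a b → a ∈ vs (nd n (lf x) β) → b ∈ vs (nd n (lf x) β) → ⊥
        side (inj₁ refl) (inj₁ refl) p q = notα p
        side (inj₁ refl) (inj₂ refl) p q = notα q
        side (inj₂ refl) (inj₁ refl) p q = notα q
        side (inj₂ refl) (inj₂ refl) p q = notα p

    c2-b2 : ∀ {F F' x y B r R} → Ch F x y → Same F' x y → NoCh F' x → NoCh F' y → F' ≈ edge B (nd (lf x) r) ∷ R → y ∈ lv r →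
      C2Step F F' x F (cutF B (nd (lf x) r) R)
    c2-b2 ch k nx ny p i {G} {G'} r r' =
      case cut-at (ThirdEdge G' _ _) p r' (λ α β ρ h {E₁} {e} {E₂} {K} → thirdEdge-info i α β ρ h {E₁} {e} {E₂} {K}) of λ { (H , m , r₂) →
      _ , H , (_ , cherry-make r ch , inj₂ (inj₁ (conn-make r' k , ¬inCherry r' nx , ¬inCherry r' ny , inj₂ (refl , m)))) , r , r₂ }

    record Inv (F F' : Forest) : Set where
      constructor mkInv
      field
        unq : Unique (lvF F)
        prm : lvF F ↭ lvF F'
    open Inv public

    -- F has k + 1 trees in all uses, so the bound says: weight + |F| + |F'| − 1 ≤ number of blocks, for agreement forests
    -- satisfying Q. The case distinctions of the search are cases of Q.
    record Best (k : ℕ) (F F' : Forest) (Q : Colouring → Set) : Set where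
      constructor best
      field
        weight  : ℕ
        picking : ACPS F F' weight
        minimal : ∀ {col C} → AF F F' col → Cover F col C → Q col → k + (weight + length F') ≤ length C

    infixr 4 _orBest_

    _orBest_ : ∀ {k F F' P Q} → Best k F F' P → Best k F F' Q → Best k F F' (λ c → P c ⊎ Q c)
    _orBest_ {k} {F} {F'} (best d f b) (best d' f' b') with ≤-total d d'
    ... | inj₁ le = best d f λ { x c (inj₁ p) → b x c p ; x c (inj₂ q) → ≤-trans (+-monoʳ-≤ k (+-monoˡ-≤ (length F') le)) (b' x c q) }
    ... | inj₂ le = best d' f' λ { x c (inj₁ p) → ≤-trans (+-monoʳ-≤ k (+-monoˡ-≤ (length F') le)) (b x c p) ; x c (inj₂ q) → b' x c q }

    refine : ∀ {k F F' P Q} → (∀ {col} → AF F F' col → Q col → P col) → Best k F F' P → Best k F F' Q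
    refine g (best d f b) = best d f (λ x c q → b x c (g x q))

    Single : Forest → L → Colouring → Set
    Single F x col = ∀ {a} → a ∈ lvF F → col a ≡ col x → a ≡ x

    single? : ∀ F x col → Single F x col ⊎ (∃ λ a → a ∈ lvF F × a ≢ x × col a ≡ col x)
    single? F x col with any? (λ a → ¬? (a ≟ x) ×-dec (col a ℕ.≟ col x)) (lvF F)
    ... | yes p = case find p of λ { (a , i , n , e) →
      inj₂ (a , i , n , e) }
    ... | no n  = inj₁ λ {a} i e → stable i e
      where
      stable : ∀ {a} → a ∈ lvF F → col a ≡ col x → a ≡ x
      stable {a} i e with a ≟ x
      ... | yes f = f
      ... | no m  = ⊥-elim (n (lose i (m , e)))

    inv-rem : ∀ {x F F' F₂ F₂'} → Inv F F' → Rem x F F₂ → Rem x F' F₂' → Inv F₂ F₂'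
    inv-rem (mkInv u p) r r' = mkInv (unique-++ʳ (_ ∷ []) (unique-↭ (rem-lv r) u)) (rem-perm p r r')

    best-single : ∀ {k e x F F' F₂ F₂'} → Inv F F' → Rem x F F₂ → Rem x F' F₂' → e + length F' ≤ suc (length F₂') →
      (∀ {d} → ACPS F₂ F₂' d → ACPS F F' (e + d)) → Best k F₂ F₂' (λ _ → ⊤) → Best k F F' (Single F x)
    best-single {k} {e} {x} {F} {F'} {F₂} {F₂'} (mkInv u p) r r' le rule (best d f b) = best (e + d) (rule f) bnd
      where
      arith : ∀ {m} → k + (d + length F₂') ≤ m → k + (e + d + length F') ≤ suc m
      arith {m} h = ≤-trans (+-monoʳ-≤ k (≤-trans (≤-reflexive (Eq.trans (cong (_+ length F') (+-comm e d)) (+-assoc d e (length F')))) (≤-trans (+-monoʳ-≤ d le) (≤-reflexive (+-suc d (length F₂'))))))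
        (≤-trans (≤-reflexive (+-suc k (d + length F₂'))) (s≤s h))
      bnd : ∀ {col C} → AF F F' col → Cover F col C → Single F x col → k + (e + d + length F') ≤ length C
      bnd {col} {C} a c s =
        case ∈-↭ (c (∈-resp-↭ (↭-sym (rem-lv r)) (here refl))) of λ { (C' , q) →
        let up : ∀ {z} → z ∈ lvF F₂ → z ∈ lvF F
            up = lv⊆ (rem-restr u r)
        in ≤-trans (arith (b (af-rem u p r r' a) (λ {z} i → ∈-strip (∈-resp-↭ q (c (up i))) (λ eq → unique-head (unique-↭ (rem-lv r) u) (subst (_∈ lvF F₂) (s (up i) eq) i))) tt))
             (≤-reflexive (sym (↭-length q))) }

    best-cherry : ∀ {k x y F F' t R t' R' P Q} → Inv F F' → F ≈ edge (lf x) t ∷ R → F' ≈ edge (lf x) t' ∷ R' → Ch F x y → Ch F' x y →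
      (∀ {col} → Q col → P col) → Best k (unr t ∷ R) (unr t' ∷ R') P → Best k F F' Q
    best-cherry {k} (mkInv u p) e e' ch ch' g (best d f b) = best d (acps-c1 ch ch' (pend e) (pend e') f)
      λ a c q → ≤-trans (≤-reflexive (cong (λ n → k + (d + n)) (length-≈ e'))) (b (af-rem u p (pend e) (pend e') a) (λ i → c (lv⊆ (rem-restr u (pend e)) i)) (g q))

    Apart : Tr → Tr → Colouring → Set
    Apart s t col = ∀ {a b} → a ∈ lv s → b ∈ lv t → col a ≢ col b

    best-cutʳ : ∀ {k F F' s t R' Q} → Inv F F' → F' ≈ edge s t ∷ R' → (∀ {d} → ACPS F (cutF s t R') d → ACPS F F' (suc d)) →
      Best k F (cutF s t R') Q → Best k F F' (λ col → Apart s t col × Q col)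
    best-cutʳ {k} {s = s} {t} {R'} (mkInv u p) e rule (best d f b) = best (suc d) (rule f)
      λ { a c (un , q) → ≤-trans (≤-reflexive (cong (k +_) (Eq.trans (cong (suc d +_) (length-≈ e)) (sym (+-suc d (suc (length R')))))))
        (b (af-sym (af-cut↓ s t R' (unique-↭ (lvF-≈ e) (unique-↭ p u)) un (af-sym (af-≈ʳ (unique-↭ p u) e a)))) c q) }

    best-cutˡ : ∀ {F F' s t R Q} → Inv F F' → F ≈ edge s t ∷ R → (∀ {d} → ACPS (cutF s t R) F' d → ACPS F F' (suc d)) →
      Best 1 (cutF s t R) F' Q → Best 0 F F' (λ col → Apart s t col × Q col)
    best-cutˡ {s = s} {t} {R} (mkInv u p) e rule (best d f b) = best (suc d) (rule f)
      λ { a c (un , q) → b (af-cut↓ s t R (unique-↭ (lvF-≈ e) u) un (af-≈ u e a)) (λ i → c (∈-resp-↭ (lvF-≈ (≈sym e)) (subst (_ ∈_) (lvF-cut s t R) i))) q }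

    pend-sz : ∀ {F x t R} → F ≈ edge (lf x) t ∷ R → suc (szF (unr t ∷ R)) ≤ szF F
    pend-sz {t = t} {R} p = ≤-trans (s≤s (+-monoˡ-≤ (szF R) (sz-unr t))) (≤-reflexive (sym (szF-≈ p)))

    cut-sz : ∀ {F s t R} → F ≈ edge s t ∷ R → suc (szF (cutF s t R)) ≤ szF F
    cut-sz {s = s} {t} {R} p = ≤-trans (s≤s (≤-trans (+-mono-≤ (sz-unr s) (+-monoˡ-≤ (szF R) (sz-unr t))) (≤-reflexive (sym (+-assoc (sz s) (sz t) (szF R)))))) (≤-reflexive (sym (szF-≈ p)))

    ch-same : ∀ {F x y} → Ch F x y → Same F x y
    ch-same (t , R , p , ct) = same-≈ (≈sym p) (here (here refl , there (chtop-∈ ct)))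

    ch-≢ : ∀ {F x y} → Unique (lvF F) → Ch F x y → x ≢ y
    ch-≢ u (t , R , p , ct) refl = unique-head (unique-↭ (lvF-≈ p) u) (∈-++⁺ˡ (chtop-∈ ct))

    ch-rest : ∀ {x y t c} → ChTop y t → c ∈ x ∷ lv t → c ≢ x → c ≢ y → ∃ λ r → t ≡ nd (lf y) r × c ∈ lv r
    ch-rest ct (here e) n m = ⊥-elim (n e)
    ch-rest two (there (here e)) n m = ⊥-elim (m e)
    ch-rest more (there (here e)) n m = ⊥-elim (m e)
    ch-rest more (there (there i)) n m = _ , refl , i

    ch-sep : ∀ {F x y c d} → Unique (lvF F) → Ch F x y → Same F x c → Same F x d → c ≢ x → c ≢ y → d ≢ x → d ≢ y → SepF F x y c d
    ch-sep {F} {x} {y} {c} {d} u (t , R , p , ct) k l cx cy dx dy =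
      go (ch-rest ct (same-head u' (here refl) (same-≈ p k)) cx cy) (ch-rest ct (same-head u' (here refl) (same-≈ p l)) dx dy)
      where
      u' : Unique (lvF (edge (lf x) t ∷ R))
      u' = unique-↭ (lvF-≈ p) u
      go : (∃ λ r → t ≡ nd (lf y) r × c ∈ lv r) → (∃ λ r → t ≡ nd (lf y) r × d ∈ lv r) → SepF F x y c d
      go (r , refl , i) (_ , refl , j) = sepF-≈ (≈sym q) (unique-↭ (lvF-≈ q) u) (sep-root (unique-↭ (lvF-≈ q) u) (here refl) (there (here refl)) i j)
        where
        q : F ≈ edge (nd (lf x) (lf y)) r ∷ R
        q = p ◅◅ ≈head ~rot⁻

    ch-sym : ∀ {F x y} → Ch F x y → Ch F y x
    ch-sym (_ , R , p , two)  = _ , R , p ◅◅ ≈head ~swp , two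
    ch-sym (_ , R , p , more) = _ , R , p ◅◅ ≈head (~rot⁻ ◅◅ ~flip ◅◅ ~rot) , more

    cherry-single : ∀ {F x y col} → Unique (lvF F) → Ch F x y → Ok F col → col x ≢ col y → Single F x col ⊎ Single F y col
    cherry-single {F} {x} {y} {col} u ch o n with single? F x col | single? F y col
    ... | inj₁ s | _ = inj₁ s
    ... | inj₂ _ | inj₁ s = inj₂ s
    ... | inj₂ (a , i , ax , ea) | inj₂ (b , j , by , eb) =
      ⊥-elim (sepF-compat u (ch-sep u ch xa (same-trans u xy yb) ax (λ { refl → n (sym ea) }) (λ { refl → n eb }) by) (dis o xa yb xy (sym ea) (sym eb) n))
      where
      xy = ch-same ch
      xa : Same F x a
      xa = blk o (same-∈ xy) i (sym ea)
      yb : Same F y b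
      yb = blk o (same-∈ (same-sym xy)) j (sym eb)

    -- A block passing through the pendant subtree P meets the path between y and z, hence is their block.
    pendant-colour : ∀ {F y z P Q R col a b} → Unique (lvF F) → F ≈ edge (nd (lf y) P) Q ∷ R → z ∈ lv Q → Ok F col → col y ≡ col z →
      a ∈ lv P → b ∈ y ∷ lv Q → col a ≡ col b → col a ≡ col y
    pendant-colour {F} {y} {z} {P} {Q} {R} {col} {a} {b} u p z∈ o e a∈ (here refl) f = f
    pendant-colour {F} {y} {z} {P} {Q} {R} {col} {a} {b} u p z∈ o e a∈ (there b∈) f with col a ℕ.≟ col y
    ... | yes g = g
    ... | no n  = ⊥-elim (sepF-compat u' (sep-root u' (here refl) (there a∈) z∈ b∈)
            (dis o' (here (here refl , ∈-++⁺ʳ (y ∷ lv P) z∈)) (here (there (∈-++⁺ˡ a∈) , ∈-++⁺ʳ (y ∷ lv P) b∈)) (here (here refl , there (∈-++⁺ˡ a∈))) e f (n ∘ sym)))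
      where
      u' = unique-↭ (lvF-≈ p) u
      o' = ok-≈ u p o

    other-leaf : ∀ a b {w} → Unique (lv a ++ lv b) → w ∈ lv a ++ lv b → ∃ λ w' → w' ∈ lv a ++ lv b × w' ≢ w
    other-leaf a b u i with ∈-++⁻ (lv a) i
    ... | inj₁ j = case lv-nonempty b of λ { (w' , k) →
      w' , ∈-++⁺ʳ (lv a) k , λ { refl → unique-disjoint (lv a) u j k } }
    ... | inj₂ j = case lv-nonempty a of λ { (w' , k) →
      w' , ∈-++⁺ˡ k , λ { refl → unique-disjoint (lv a) u k j } }

    no-cherry : ∀ {F x a b c d R} → Unique (lvF F) → F ≈ edge (lf x) (nd (nd a b) (nd c d)) ∷ R → NoCh F x
    no-cherry {F} {x} {a} {b} {c} {d} {R} u p {w} ch = go (same-head u₀ (here refl) (same-≈ p (ch-same ch)))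
      where
      u₀ = unique-↭ (lvF-≈ p) u
      side : ∀ a b c d → F ≈ edge (lf x) (nd (nd a b) (nd c d)) ∷ R → w ∈ lv a ++ lv b → ⊥
      side a b c d p i = sepF-compat u (ch-sep u ch (inn (there (∈-++⁺ʳ (lv a ++ lv b) v∈))) (inn (there (∈-++⁺ˡ w'∈))) v≢x (λ e → v≢P (subst (_∈ lv a ++ lv b) (sym e) i)) (≢x (∈-++⁺ˡ w'∈)) w'≢)
          (sepF-≈ (≈sym q) u₂ (sepF-swap (sep-root u₂ i w'∈ (here refl) (there v∈))))
        where
        u₁ = unique-↭ (lvF-≈ p) u
        uP : Unique (lv (nd (nd a b) (nd c d)))
        uP = unique-++ˡ (lv (nd (nd a b) (nd c d))) (unique-++ʳ (x ∷ []) u₁)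
        q : F ≈ edge (nd a b) (nd (lf x) (nd c d)) ∷ R
        q = p ◅◅ ≈head (~rot⁻ ◅◅ ~flip ◅◅ ~rot)
        u₂ = unique-↭ (lvF-≈ q) u
        ow = other-leaf a b (unique-++ˡ (lv a ++ lv b) uP) i
        w' = proj₁ ow
        w'∈ : w' ∈ lv a ++ lv b
        w'∈ = proj₁ (proj₂ ow)
        w'≢ : w' ≢ w
        w'≢ = proj₂ (proj₂ ow)
        v = proj₁ (lv-nonempty (nd c d))
        v∈ : v ∈ lv c ++ lv d
        v∈ = proj₂ (lv-nonempty (nd c d))
        inn : ∀ {z} → z ∈ x ∷ lv (nd (nd a b) (nd c d)) → Same F x z
        inn k = same-≈ (≈sym p) (here (here refl , k))
        ≢x : ∀ {z} → z ∈ lv (nd (nd a b) (nd c d)) → z ≢ x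
        ≢x k refl = unique-head u₁ (∈-++⁺ˡ k)
        v≢x : v ≢ x
        v≢x = ≢x (∈-++⁺ʳ (lv a ++ lv b) v∈)
        v≢P : v ∉ lv a ++ lv b
        v≢P k = unique-disjoint (lv a ++ lv b) uP k v∈
      go : w ∈ x ∷ lv (nd (nd a b) (nd c d)) → ⊥
      go (here e) = ch-≢ u ch (sym e)
      go (there k) with ∈-++⁻ (lv a ++ lv b) k
      ... | inj₁ i = side a b c d p i
      ... | inj₂ i = side c d a b (p ◅◅ ≈head (swp ◅ flip ◅ swp ◅ ε)) i

    Block₂ : Forest → L → L → Colouring → Set
    Block₂ F y z col = col y ≡ col z × (∀ {a} → a ∈ lvF F → col a ≡ col y → a ≡ y ⊎ a ≡ z)

    pendant-apart : ∀ {F F' y z P Q R col} → Inv F F' → F' ≈ edge (nd (lf y) P) Q ∷ R → z ∈ lv Q → AF F F' col → Block₂ F y z col → Apart P (nd (lf y) Q) col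
    pendant-apart {F} {F'} {y} {z} {P} {Q} {R} {col} (mkInv u q) p z∈ a (e , f) {c} {b} c∈ b∈ g = bad (f (∈-resp-↭ (↭-sym q) (∈-resp-↭ (lvF-≈ (≈sym p)) (there (∈-++⁺ˡ (∈-++⁺ˡ c∈)))))
        (pendant-colour (unique-↭ q u) p z∈ (okʳ a) e c∈ b∈ g))
      where
      u' : Unique (lvF (edge (nd (lf y) P) Q ∷ R))
      u' = unique-↭ (lvF-≈ p) (unique-↭ q u)
      bad : c ≡ y ⊎ c ≡ z → ⊥
      bad (inj₁ refl) = unique-head u' (∈-++⁺ˡ (∈-++⁺ˡ c∈))
      bad (inj₂ refl) = unique-disjoint (y ∷ lv P) (unique-++ˡ (y ∷ lv P ++ lv Q) u') (there c∈) z∈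

    inv-cutʳ : ∀ {F F' s t R} → Inv F F' → F' ≈ edge s t ∷ R → Inv F (cutF s t R)
    inv-cutʳ {s = s} {t} {R} (mkInv u p) e = mkInv u (↭-trans p (↭-trans (lvF-≈ e) (↭-reflexive (sym (lvF-cut s t R)))))

    inv-≈ʳ : ∀ {F F' F₂'} → Inv F F' → F' ≈ F₂' → Inv F F₂'
    inv-≈ʳ (mkInv u p) e = mkInv u (↭-trans p (lvF-≈ e))

    inv-≈ˡ : ∀ {F F' F₂} → Inv F F' → F ≈ F₂ → Inv F₂ F'
    inv-≈ˡ (mkInv u p) e = mkInv (unique-↭ (lvF-≈ e) u) (↭-trans (↭-sym (lvF-≈ e)) p)

    best-≈ʳ : ∀ {k F F' F₂' Q} → Inv F F' → F' ≈ F₂' → Best k F F₂' Q → Best k F F' Q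
    best-≈ʳ {k} (mkInv u p) e (best d f b) = best d (acps-≈ ε e f) λ a c q → ≤-trans (≤-reflexive (cong (λ n → k + (d + n)) (length-≈ e))) (b (af-≈ʳ (unique-↭ p u) e a) c q)

    best-≈ˡ : ∀ {k F F' F₂ Q} → Inv F F' → F ≈ F₂ → Best k F₂ F' Q → Best k F F' Q
    best-≈ˡ (mkInv u p) e (best d f b) = best d (acps-≈ e ε f) λ a c q → b (af-≈ u e a) (λ i → c (∈-resp-↭ (lvF-≈ (≈sym e)) i)) q

    -- The situation after a pendant cherry (y,z) of F has been cut off while {y,z} is a block: pendant subtrees of F'
    -- between y and z are cut, by (b)(ii), until (y,z) is a cherry of F' as well.
    module StateB (N : ℕ) (ihA : ∀ T F' → szF (T ∷ []) + szF F' ≤ N → Inv (T ∷ []) F' → Best 0 (T ∷ []) F' (λ _ → ⊤)) where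

      pairF : L → L → Ut → Forest
      pairF y z T = edge (lf y) (lf z) ∷ T ∷ []

      chPair : ∀ {y z T} → Ch (pairF y z T) y z
      chPair = _ , _ , ε , two

      finish : ∀ {y z T t₂ R} → szF (T ∷ []) + szF (unr t₂ ∷ R) ≤ N → Inv (pairF y z T) (edge (lf y) (nd (lf z) t₂) ∷ R) →
        Best 1 (pairF y z T) (edge (lf y) (nd (lf z) t₂) ∷ R) (Block₂ (pairF y z T) y z)
      finish {y} {z} {T} {t₂} {R} le inv =
        let r₁ : Rem y (pairF y z T) (one z ∷ T ∷ [])
            r₁ = pend ε
            r₁' : Rem y (edge (lf y) (nd (lf z) t₂) ∷ R) (edge (lf z) t₂ ∷ R)
            r₁' = pend ε
            r₂ : Rem z (one z ∷ T ∷ []) (T ∷ [])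
            r₂ = isol ε
            r₂' : Rem z (edge (lf z) t₂ ∷ R) (unr t₂ ∷ R)
            r₂' = pend ε
            inv₁ = inv-rem inv r₁ r₁'
            inv₂ = inv-rem inv₁ r₂ r₂'
        in case ihA T (unr t₂ ∷ R) le inv₂ of λ { (best d f b) →
        best d (acps-c1 chPair (_ , _ , ε , more) r₁ r₁' (acps-c3 ε r₂ r₂' f))
           λ {col} {C} a c (e , g) →
             case ∈-↭ (c (here refl)) of λ { (C' , q) →
             ≤-trans (s≤s (b (af-rem (unq inv₁) (prm inv₁) r₂ r₂' (af-rem (unq inv) (prm inv) r₁ r₁' a))
               (λ i → ∈-strip (∈-resp-↭ q (c (there (there i)))) (λ eq → out inv i (g (there (there i)) eq))) tt)) (≤-reflexive (sym (↭-length q))) }}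
        where
        out : Inv (pairF y z T) (edge (lf y) (nd (lf z) t₂) ∷ R) → ∀ {w} → w ∈ lvF (T ∷ []) → w ≡ y ⊎ w ≡ z → ⊥
        out (mkInv u _) i (inj₁ refl) = unique-head u (there i)
        out (mkInv u _) i (inj₂ refl) = unique-head (unique-++ʳ (y ∷ []) u) i

      block-swap : ∀ {y z T col} → Block₂ (pairF y z T) y z col → Block₂ (pairF z y T) z y col
      block-swap {y} {z} {T} (e , f) = sym e , λ i g → Sum.swap (f (swap₂ i) (Eq.trans g (sym e)))
        where
        swap₂ : ∀ {a} → a ∈ z ∷ y ∷ lvF (T ∷ []) → a ∈ y ∷ z ∷ lvF (T ∷ [])
        swap₂ (here e) = there (here e)
        swap₂ (there (here e)) = here e
        swap₂ (there (there i)) = there (there i)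

      cutPendant : ∀ {y z T P Q R} → Inv (pairF y z T) (edge (lf y) (nd Q P) ∷ R) → z ∈ lv Q →
        (∀ {d} → ACPS (pairF y z T) (cutF P (nd (lf y) Q) R) d → ACPS (pairF y z T) (edge (lf y) (nd Q P) ∷ R) (suc d)) →
        Best 1 (pairF y z T) (edge (lf y) Q ∷ unr P ∷ R) (Block₂ (pairF y z T) y z) →
        Best 1 (pairF y z T) (edge (lf y) (nd Q P) ∷ R) (Block₂ (pairF y z T) y z)
      cutPendant {y} {z} {T} {P} {Q} {R} inv z∈ rule b =
        refine {P = λ col → Apart P (nd (lf y) Q) col × Block₂ (pairF y z T) y z col} (λ a q → pendant-apart inv e₁ z∈ a q , q)
           (best-cutʳ inv e₂ rule (best-≈ʳ (inv-cutʳ inv e₂) (≈perm (swap (unr P) (edge (lf y) Q) ↭-refl)) b))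
        where
        e₁ : edge (lf y) (nd Q P) ∷ R ≈ edge (nd (lf y) P) Q ∷ R
        e₁ = ≈head (swp ◅ flip ◅ swp ◅ ε) ◅◅ ≈head ~rot⁻
        e₂ : edge (lf y) (nd Q P) ∷ R ≈ edge P (nd (lf y) Q) ∷ R
        e₂ = e₁ ◅◅ ≈head (~flip ◅◅ ~rot)

      stateB  : ∀ m {y z T} t R → szF (edge (lf y) t ∷ R) ≤ m → szF (T ∷ []) + szF (edge (lf y) t ∷ R) ≤ N → Inv (pairF y z T) (edge (lf y) t ∷ R) →
        z ∈ lv t → t ≢ lf z → Best 1 (pairF y z T) (edge (lf y) t ∷ R) (Block₂ (pairF y z T) y z)
      stateB₁ : ∀ m {y z T} t₁ t₂ R → szF (edge (lf y) (nd t₁ t₂) ∷ R) ≤ m → szF (T ∷ []) + szF (edge (lf y) (nd t₁ t₂) ∷ R) ≤ N →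
        Inv (pairF y z T) (edge (lf y) (nd t₁ t₂) ∷ R) → z ∈ lv t₁ → Best 1 (pairF y z T) (edge (lf y) (nd t₁ t₂) ∷ R) (Block₂ (pairF y z T) y z)
      stateB m (lf x) R le leN inv (here refl) n = ⊥-elim (n refl)
      stateB m {y} {z} {T} (nd t₁ t₂) R le leN inv i n = go (∈-++⁻ (lv t₁) i)
        where
        e : edge (lf y) (nd t₁ t₂) ∷ R ≈ edge (lf y) (nd t₂ t₁) ∷ R
        e = ≈head (swp ◅ flip ◅ swp ◅ ε)
        go : z ∈ lv t₁ ⊎ z ∈ lv t₂ → Best 1 (pairF y z T) (edge (lf y) (nd t₁ t₂) ∷ R) (Block₂ (pairF y z T) y z)
        go (inj₁ j) = stateB₁ m t₁ t₂ R le leN inv j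
        go (inj₂ j) = best-≈ʳ inv e (stateB₁ m t₂ t₁ R (≤-trans (≤-reflexive (sym (szF-≈ e))) le) (≤-trans (≤-reflexive (cong (szF (T ∷ []) +_) (sym (szF-≈ e)))) leN) (inv-≈ʳ inv e) j)
      stateB₁ zero t₁ t₂ R () leN inv i
      stateB₁ (suc m) {y} {z} {T} (lf _) t₂ R le leN inv (here refl) =
        finish (≤-trans (+-monoʳ-≤ (szF (T ∷ [])) (≤-trans (+-monoˡ-≤ (szF R) (≤-trans (sz-unr t₂) (≤-trans (n≤1+n _) (≤-trans (n≤1+n _) (n≤1+n _))))) ≤-refl)) leN) inv
      stateB₁ (suc m) {y} {z} {T} (nd p q) t₂ R le leN inv@(mkInv u pm) i =
        byPendant t₂ refl (locate-pendant p q (nd (lf y) t₂) i)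
        where
        t₁ = nd p q
        F = pairF y z T
        F' = edge (lf y) (nd t₁ t₂) ∷ R
        u' : Unique (lvF F')
        u' = unique-↭ pm u
        eP : F' ≈ edge t₂ (nd (lf y) t₁) ∷ R
        eP = ≈head (swp ◅ flip ◅ swp ◅ ε) ◅◅ ≈head (~rot⁻ ◅◅ ~flip ◅◅ ~rot)
        small : ∀ {G s t R} → F' ≈ edge s t ∷ R → cutF s t R ≈ G → szF G ≤ m
        small e g = s≤s⁻¹ (≤-trans (s≤s (≤-reflexive (sym (szF-≈ g)))) (≤-trans (cut-sz e) le))
        smallN : ∀ {G s t R} → F' ≈ edge s t ∷ R → cutF s t R ≈ G → szF (T ∷ []) + szF G ≤ N
        smallN e g = ≤-trans (+-monoʳ-≤ (szF (T ∷ [])) (≤-trans (≤-reflexive (sym (szF-≈ g))) (≤-trans (n≤1+n _) (cut-sz e)))) leN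
        gP : cutF t₂ (nd (lf y) t₁) R ≈ edge (lf y) t₁ ∷ unr t₂ ∷ R
        gP = ≈perm (swap (unr t₂) (edge (lf y) t₁) ↭-refl)
        atY : (∀ {d} → ACPS F (cutF t₂ (nd (lf y) t₁) R) d → ACPS F F' (suc d)) → Best 1 F F' (Block₂ F y z)
        atY rule = cutPendant inv i rule (stateB m t₁ (unr t₂ ∷ R) (small eP gP) (smallN eP gP) (inv-≈ʳ (inv-cutʳ inv eP) gP) i λ ())
        module AtZ {v w : Tr} (e : edge t₁ (nd (lf y) t₂) ~ edge (nd (lf z) v) w) (sub : ∀ {a} → a ∈ lv v → a ∈ lv t₁) (sup : ∀ {a} → a ∈ y ∷ lv t₂ → a ∈ lv w) where
          F'' = edge (lf z) (nd w v) ∷ R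
          eF : F' ≈ edge (nd (lf z) v) w ∷ R
          eF = ≈head (swp ◅ rot ◅ ε) ◅◅ ≈head (flipIn ◅◅ e)
            where
            flipIn : edge t₁ (nd t₂ (lf y)) ~ edge t₁ (nd (lf y) t₂)
            flipIn = swp ◅ flip ◅ swp ◅ ε
          e'' : F' ≈ F''
          e'' = eF ◅◅ ≈head (rot ◅ swp ◅ flip ◅ swp ◅ ε)
          w≢ : w ≢ lf y
          w≢ refl with sup (here refl) | sup (there (proj₂ (lv-nonempty t₂)))
          ... | here _ | here e₂ = unique-head u' (∈-++⁺ˡ (∈-++⁺ʳ (lv t₁) (subst (_∈ lv t₂) e₂ (proj₂ (lv-nonempty t₂)))))
          eQ : F'' ≈ edge v (nd (lf z) w) ∷ R
          eQ = ≈head (swp ◅ flip ◅ swp ◅ ε) ◅◅ ≈head (~rot⁻ ◅◅ ~flip ◅◅ ~rot)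
          gQ : cutF v (nd (lf z) w) R ≈ edge (lf z) w ∷ unr v ∷ R
          gQ = ≈perm (swap (unr v) (edge (lf z) w) ↭-refl)
          invZ : Inv (pairF z y T) F''
          invZ = inv-≈ʳ (inv-≈ˡ inv (≈head ~swp)) e''
          atZ : (∀ {d} → ACPS (pairF z y T) (cutF v (nd (lf z) w) R) d → ACPS (pairF z y T) F'' (suc d)) → Best 1 F F' (Block₂ F y z)
          atZ rule = refine (λ _ → block-swap {y} {z} {T}) (best-≈ˡ inv (≈head ~swp) (best-≈ʳ (inv-≈ˡ inv (≈head ~swp)) e''
            (cutPendant invZ (sup (here refl)) rule (stateB m w (unr v ∷ R) (small (e'' ◅◅ eQ) gQ) (smallN (e'' ◅◅ eQ) gQ) (inv-≈ʳ (inv-cutʳ invZ eQ) gQ) (sup (here refl)) w≢))))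
        byPendant : ∀ t → t ≡ t₂ → (∃ λ v → ∃ λ w → edge t₁ (nd (lf y) t₂) ~ edge (nd (lf z) v) w × (∀ {a} → a ∈ lv v → a ∈ lv t₁) × (∀ {a} → a ∈ y ∷ lv t₂ → a ∈ lv w)) → Best 1 F F' (Block₂ F y z)
        byPendant (lf x) refl _ = atY (λ f → acps-sym (acps-c2 (c2-a1 conflict (inj₂ refl) eP) (acps-sym f)))
          where
          conflict : Conflict F' F y x z
          conflict = (_ , _ , ≈head (swp ◅ flip ◅ swp ◅ ε) , more) , chPair , λ { refl → unique-disjoint (lv t₁) (unique-++ˡ (lv t₁ ++ x ∷ []) (unique-++ʳ (y ∷ []) u')) i (here refl) }
        byPendant (nd c d) refl (lf x , w , e , sub , sup) = atZ (λ f → acps-sym (acps-c2 (c2-a1 conflict (inj₂ refl) eQ) (acps-sym f)))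
          where
          open AtZ e sub sup
          conflict : Conflict F'' (pairF z y T) z x y
          conflict = (_ , _ , ≈head (swp ◅ flip ◅ swp ◅ ε) , more) , chPair , λ { refl → unique-head u' (∈-++⁺ˡ (∈-++⁺ˡ (sub (here refl)))) }
        byPendant (nd c d) refl (nd g h , lf x , e , sub , sup) = ⊥-elim (two-in (sup (here refl)) (sup (there (proj₂ (lv-nonempty (nd c d))))))
          where
          two-in : ∀ {a} → y ∈ x ∷ [] → a ∈ x ∷ [] → ⊥
          two-in (here refl) _ = AtZ.w≢ e sub sup refl
        byPendant (nd c d) refl (nd g h , nd k l , e , sub , sup) = atY (λ f → acps-c2 (c2-b2 chPair yz ny nz eP i) f)
          where
          open AtZ e sub sup
          yz : Same F' y z
          yz = here (here refl , there (∈-++⁺ˡ i))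
          ny : NoCh F' y
          ny = no-cherry u' ε
          nz : NoCh F' z
          nz = no-cherry u' e''

    data Deep (T : Ut) (x y : L) : Set where
      two   : T ~ edge (lf x) (lf y) → Deep T x y
      three : ∀ p → T ~ edge (nd (lf x) (lf y)) (lf p) → Deep T x y
      deep₃ : ∀ p t → T ~ edge (S₃ x y p) t → Deep T x y
      deep₄ : ∀ p q t → T ~ edge (S₄ x y p q) t → Deep T x y

    deep-~ : ∀ {T T' x y} → T ~ T' → Deep T' x y → Deep T x y
    deep-~ e (two f)         = two (e ◅◅ f)
    deep-~ e (three p f)     = three p (e ◅◅ f)
    deep-~ e (deep₃ p t f)   = deep₃ p t (e ◅◅ f)
    deep-~ e (deep₄ p q t f) = deep₄ p q t (e ◅◅ f)

    deep-flip : ∀ {T x y} → Deep T x y → Deep T y x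
    deep-flip (two f)         = two (f ◅◅ ~swp)
    deep-flip (three p f)     = three p (f ◅◅ ~flip)
    deep-flip (deep₃ p t f)   = deep₃ p t (f ◅◅ ~rot ◅◅ ~flip ◅◅ ~rot⁻)
    deep-flip (deep₄ p q t f) = deep₄ p q t (f ◅◅ ~rot ◅◅ ~flip ◅◅ ~rot⁻)

    deep-ch : ∀ {T x y} → Deep T x y → Ch (T ∷ []) x y
    deep-ch (two f)         = _ , _ , ≈head f , two
    deep-ch (three p f)     = _ , _ , ≈head (f ◅◅ ~rot) , more
    deep-ch (deep₃ p t f)   = _ , _ , ≈head (f ◅◅ ~rot ◅◅ ~rot) , more
    deep-ch (deep₄ p q t f) = _ , _ , ≈head (f ◅◅ ~rot ◅◅ ~rot) , more

    deepN : ∀ a b t → (∃ λ x → ∃ λ y → a ≡ lf x × b ≡ lf y) ⊎ (∃ λ x → ∃ λ y → Deep (edge (nd a b) t) x y)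
    deepN (lf x) (lf y) t = inj₁ (x , y , refl , refl)
    deepN (lf p) (nd c d) t with deepN c d (nd (lf p) t)
    ... | inj₁ (x , y , refl , refl) = inj₂ (x , y , deep₃ p t ~flip)
    ... | inj₂ (x , y , D) = inj₂ (x , y , deep-~ (~flip ◅◅ ~rot) D)
    deepN (nd a b) (lf p) t with deepN a b (nd (lf p) t)
    ... | inj₁ (x , y , refl , refl) = inj₂ (x , y , deep₃ p t ε)
    ... | inj₂ (x , y , D) = inj₂ (x , y , deep-~ ~rot D)
    deepN (nd a b) (nd c d) t with deepN a b (nd (nd c d) t) | deepN c d (nd (nd a b) t)
    ... | inj₂ (x , y , D) | _ = inj₂ (x , y , deep-~ ~rot D)
    ... | inj₁ _ | inj₂ (x , y , D) = inj₂ (x , y , deep-~ (~flip ◅◅ ~rot) D)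
    ... | inj₁ (x , y , refl , refl) | inj₁ (p , q , refl , refl) = inj₂ (x , y , deep₄ p q t ε)

    deepU : ∀ s t → ∃ λ x → ∃ λ y → Deep (edge s t) x y
    deepU (lf x) (lf y) = x , y , two ε
    deepU (nd a b) (lf p) with deepN a b (lf p)
    ... | inj₁ (x , y , refl , refl) = x , y , three p ε
    ... | inj₂ D = D
    deepU (lf p) (nd a b) with deepN a b (lf p)
    ... | inj₁ (x , y , refl , refl) = x , y , three p ~swp
    ... | inj₂ (x , y , D) = x , y , deep-~ ~swp D
    deepU (nd a b) (nd c d) with deepN a b (nd c d) | deepN c d (nd a b)
    ... | inj₂ D | _ = D
    ... | inj₁ _ | inj₂ (x , y , D) = x , y , deep-~ ~swp D
    ... | inj₁ (x , y , refl , refl) | inj₁ (p , q , refl , refl) = x , y , deep₃ p (lf q) ~rot⁻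

    data Partner (F' : Forest) (x y z : L) : Set where
      pair : ∀ {R} → F' ≈ edge (lf x) (lf z) ∷ R → Partner F' x y z
      trio : ∀ {r R} → F' ≈ edge (lf x) (nd (lf z) r) ∷ R → r ≢ lf y → Partner F' x y z

    partner-ch : ∀ {F' x y z} → Partner F' x y z → Ch F' x z
    partner-ch (pair e)   = _ , _ , e , two
    partner-ch (trio e _) = _ , _ , e , more

    data Shape (F' : Forest) (x y : L) : Set where
      common : Ch F' x y → Shape F' x y
      clash  : ∀ z → z ≢ y → Partner F' x y z → Shape F' x y
      free   : ∀ {a b c d R} → F' ≈ edge (lf x) (nd (nd a b) (nd c d)) ∷ R → Shape F' x y

    flipʳ : ∀ {x a b R} → edge (lf x) (nd a b) ∷ R ≈ edge (lf x) (nd b a) ∷ R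
    flipʳ = ≈head (swp ◅ flip ◅ swp ◅ ε)

    shape : ∀ {F' x R} y t → F' ≈ edge (lf x) t ∷ R → Shape F' x y
    shape y (lf z) e with z ≟ y
    ... | yes refl = common (_ , _ , e , two)
    ... | no n     = clash z n (pair e)
    shape y (nd (nd a b) (nd c d)) e = free e
    shape y (nd (nd a b) (lf z)) e with z ≟ y
    ... | yes refl = common (_ , _ , e ◅◅ flipʳ , more)
    ... | no n     = clash z n (trio (e ◅◅ flipʳ) λ ())
    shape y (nd (lf z) (nd c d)) e with z ≟ y
    ... | yes refl = common (_ , _ , e , more)
    ... | no n     = clash z n (trio e λ ())
    shape y (nd (lf z) (lf w)) e with z ≟ y | w ≟ y
    ... | yes refl | _        = common (_ , _ , e , more)
    ... | no _     | yes refl = common (_ , _ , e ◅◅ flipʳ , more)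
    ... | no n     | no m     = clash z n (trio e λ { refl → m refl })

    Block₃ : Forest → L → L → L → Colouring → Set
    Block₃ F x y z col = col x ≡ col y × col x ≡ col z × (∀ {a} → a ∈ lvF F → col a ≡ col x → a ≡ x ⊎ a ≡ y ⊎ a ≡ z)

    conflict-total : ∀ {F F' x y z col} → Inv F F' → Conflict F F' x y z → AF F F' col → Single F x col ⊎ Single F y col ⊎ Single F z col ⊎ Block₃ F x y z col
    conflict-total {F} {F'} {x} {y} {z} {col} (mkInv u p) (ch , ch' , n) a with col x ℕ.≟ col y | col x ℕ.≟ col z
    ... | no m | _ = Sum.map id inj₁ (cherry-single u ch (okˡ a) m)
    ... | yes _ | no m = go (cherry-single (unique-↭ p u) ch' (okʳ a) m)
      where
      back : ∀ {w} → Single F' w col → Single F w col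
      back s i e = s (∈-resp-↭ p i) e
      go : Single F' x col ⊎ Single F' z col → Single F x col ⊎ Single F y col ⊎ Single F z col ⊎ Block₃ F x y z col
      go (inj₁ s) = inj₁ (back s)
      go (inj₂ s) = inj₂ (inj₂ (inj₁ (back s)))
    ... | yes e | yes f = inj₂ (inj₂ (inj₂ (e , f , blk₃)))
      where
      u' = unique-↭ p u
      o = okˡ a
      o' = okʳ a
      x∈ : x ∈ lvF F
      x∈ = same-∈ (ch-same ch)
      x∈' : x ∈ lvF F'
      x∈' = same-∈ (ch-same ch')
      z∈ : z ∈ lvF F
      z∈ = ∈-resp-↭ (↭-sym p) (same-∈ (same-sym (ch-same ch')))
      blk₃ : ∀ {c} → c ∈ lvF F → col c ≡ col x → c ≡ x ⊎ c ≡ y ⊎ c ≡ z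
      blk₃ {c} i g with c ≟ x | c ≟ y | c ≟ z
      ... | yes h | _ | _ = inj₁ h
      ... | no _ | yes h | _ = inj₂ (inj₁ h)
      ... | no _ | no _ | yes h = inj₂ (inj₂ h)
      ... | no cx | no cy | no cz = ⊥-elim (sepF-compat u'
            (agr a e f (sym g) (ch-sep u ch (blk o x∈ z∈ f) (blk o x∈ i (sym g)) (ch-≢ u' ch' ∘ sym) n cx cy))
            (ch-sep u' ch' (blk o' x∈' (∈-resp-↭ p (same-∈ (same-sym (ch-same ch)))) e) (blk o' x∈' (∈-resp-↭ p i) (sym g)) (ch-≢ u ch ∘ sym) (n ∘ sym) cx cz))

    cross : ∀ {F s t R col x p z a} → Unique (lvF F) → F ≈ edge s t ∷ R → Ok F col → x ∈ lv s → p ∈ lv s → z ∈ lv t → a ∈ lv t →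
      col x ≡ col z → col p ≡ col a → col x ≡ col p
    cross {s = s} {col = col} {x} {p} u e o x∈ p∈ z∈ a∈ f g with col x ℕ.≟ col p
    ... | yes h = h
    ... | no n  = ⊥-elim (sepF-compat u' (sep-root u' x∈ p∈ z∈ a∈)
            (dis (ok-≈ u e o) (here (∈-++⁺ˡ x∈ , ∈-++⁺ʳ (lv s) z∈)) (here (∈-++⁺ˡ p∈ , ∈-++⁺ʳ (lv s) a∈)) (here (∈-++⁺ˡ x∈ , ∈-++⁺ˡ p∈)) f g n))
      where u' = unique-↭ (lvF-≈ e) u

    block-out : ∀ F {x y z col p} → Block₃ F x y z col → p ∈ lvF F → p ≢ x → p ≢ y → p ≢ z → col x ≢ col p
    block-out F (_ , _ , b) i nx ny nz e with b i (sym e)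
    ... | inj₁ f = nx f
    ... | inj₂ (inj₁ f) = ny f
    ... | inj₂ (inj₂ f) = nz f

    single-p : ∀ {T F' x y z p t col} → Inv (T ∷ []) F' → T ~ edge (S₃ x y p) t → z ∈ lvF (T ∷ []) → z ≢ x → z ≢ y → z ≢ p →
      AF (T ∷ []) F' col → Block₃ (T ∷ []) x y z col → Single (T ∷ []) p col
    single-p {T} {F'} {x} {y} {z} {p} {t} {col} (mkInv u _) e z∈ zx zy zp a b@(exy , exz , _) {c} i f with c ≟ p
    ... | yes g = g
    ... | no cp = ⊥-elim (cxp (cross u e' (okˡ a) (here refl) (there (there (here refl))) (inT z∈ zx zy zp) (inT i cx cy cp) exz (sym f)))
      where
      e' : T ∷ [] ≈ edge (S₃ x y p) t ∷ []
      e' = ≈head e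
      u' = unique-↭ (lvF-≈ e') u
      p∈ : p ∈ lvF (T ∷ [])
      p∈ = ∈-resp-↭ (lvF-≈ (≈sym e')) (there (there (here refl)))
      cxp : col x ≢ col p
      cxp = block-out (T ∷ []) b p∈ (λ { refl → unique-head u' (there (here refl)) }) (λ { refl → unique-head (unique-++ʳ (x ∷ []) u') (here refl) }) (zp ∘ sym)
      cx : c ≢ x
      cx refl = cxp f
      cy : c ≢ y
      cy refl = cxp (Eq.trans exy f)
      inT : ∀ {w} → w ∈ lvF (T ∷ []) → w ≢ x → w ≢ y → w ≢ p → w ∈ lv t
      inT i n₁ n₂ n₃ = subst (_ ∈_) (List.++-identityʳ (lv t)) (∈-strip (∈-strip (∈-strip (∈-resp-↭ (lvF-≈ e') i) n₁) n₂) n₃)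

    deep₄-total : ∀ {T F' x y z p q t col} → Inv (T ∷ []) F' → T ~ edge (S₄ x y p q) t → z ∈ lvF (T ∷ []) → z ≢ x → z ≢ y →
      AF (T ∷ []) F' col → Block₃ (T ∷ []) x y z col → Single (T ∷ []) p col ⊎ Single (T ∷ []) q col ⊎ Block₂ (T ∷ []) p q col
    deep₄-total {T} {F'} {x} {y} {z} {p} {q} {t} {col} (mkInv u _) e z∈ zx zy a b@(exy , exz , _) = go (z ≟ q) (z ≟ p)
      where
      F = T ∷ []
      o = okˡ a
      e' : F ≈ edge (S₄ x y p q) t ∷ []
      e' = ≈head e
      u' = unique-↭ (lvF-≈ e') u
      allSame : ∀ {v w} → v ∈ lvF F → w ∈ lvF F → Same F v w
      allSame i j = here (subst (_ ∈_) (List.++-identityʳ (lvU T)) i , subst (_ ∈_) (List.++-identityʳ (lvU T)) j)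
      back : ∀ {w} → w ∈ lvF (edge (S₄ x y p q) t ∷ []) → w ∈ lvF F
      back = ∈-resp-↭ (lvF-≈ (≈sym e'))
      x∈ : x ∈ lvF F
      x∈ = back (here refl)
      p∈ : p ∈ lvF F
      p∈ = back (there (there (here refl)))
      q∈ : q ∈ lvF F
      q∈ = back (there (there (there (here refl))))
      px : p ≢ x
      px refl = unique-head u' (there (here refl))
      py : p ≢ y
      py refl = unique-head (unique-++ʳ (x ∷ []) u') (here refl)
      qx : q ≢ x
      qx refl = unique-head u' (there (there (here refl)))
      qy : q ≢ y
      qy refl = unique-head (unique-++ʳ (x ∷ []) u') (there (here refl))
      chpq : Ch F p q
      chpq = _ , _ , e' ◅◅ ≈head (~flip ◅◅ ~rot ◅◅ ~rot) , more
      inT : ∀ {w} → w ∈ lvF F → w ≢ x → w ≢ y → w ≢ p → w ≢ q → w ∈ lv t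
      inT i n₁ n₂ n₃ n₄ = subst (_ ∈_) (List.++-identityʳ (lv t)) (∈-strip (∈-strip (∈-strip (∈-strip (∈-resp-↭ (lvF-≈ e') i) n₁) n₂) n₃) n₄)
      -- Here z is q, so the path from x to z passes the attachment point of p.
      sib : ∀ {p q} → Ch F p q → p ∈ lvF F → q ∈ lvF F → col x ≢ col p → p ≢ x → q ≢ x → col x ≡ col q → Single F p col
      sib {p} {q} ch p∈ q∈ n px qx eq {c} i f with c ≟ p
      ... | yes g = g
      ... | no cp = ⊥-elim (sepF-compat u
            (sepF-flipʳ (ch-sep u ch (allSame p∈ x∈) (allSame p∈ i) (px ∘ sym) (qx ∘ sym) cp (λ { refl → n (Eq.trans eq f) })))
            (sepF-flipʳ (dis o (allSame p∈ i) (allSame x∈ q∈) (allSame p∈ x∈) (sym f) eq (n ∘ sym))))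
      go : Dec (z ≡ q) → Dec (z ≡ p) → Single F p col ⊎ Single F q col ⊎ Block₂ F p q col
      go (yes refl) _ = inj₁ (sib chpq p∈ q∈ (block-out F b p∈ px py (ch-≢ u chpq)) px qx exz)
      go (no _) (yes refl) = inj₂ (inj₁ (sib (ch-sym chpq) q∈ p∈ (block-out F b q∈ qx qy (ch-≢ u chpq ∘ sym)) qx px exz))
      go (no zq) (no zp) = byCol (col p ℕ.≟ col q)
        where
        nxp : col x ≢ col p
        nxp = block-out F b p∈ px py (zp ∘ sym)
        byCol : Dec (col p ≡ col q) → Single F p col ⊎ Single F q col ⊎ Block₂ F p q col
        byCol (no n) with cherry-single u chpq o n
        ... | inj₁ s = inj₁ s
        ... | inj₂ s = inj₂ (inj₁ s)
        byCol (yes f) = inj₂ (inj₂ (f , only))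
          where
          only : ∀ {c} → c ∈ lvF F → col c ≡ col p → c ≡ p ⊎ c ≡ q
          only {c} i g with c ≟ p | c ≟ q
          ... | yes h | _ = inj₁ h
          ... | no _ | yes h = inj₂ h
          ... | no cp | no cq = ⊥-elim (nxp (cross u e' o (here refl) (there (there (here refl))) (inT z∈ zx zy zp zq)
                  (inT i (λ { refl → nxp g }) (λ { refl → nxp (Eq.trans exy g) }) cp cq) exz (sym g)))

    module StateA (N : ℕ) (ih : ∀ T F' → szF (T ∷ []) + szF F' ≤ N → Inv (T ∷ []) F' → Best 0 (T ∷ []) F' (λ _ → ⊤))
      (s₀ t₀ : Tr) (F' : Forest) (le : szF (edge s₀ t₀ ∷ []) + szF F' ≤ suc N) (inv : Inv (edge s₀ t₀ ∷ []) F') (noOne : ∀ {z R} → ¬ (F' ≈ one z ∷ R)) where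

      open StateB N ih

      T : Ut
      T = edge s₀ t₀

      F : Forest
      F = T ∷ []

      u : Unique (lvF F)
      u = unq inv

      u' : Unique (lvF F')
      u' = unique-↭ (prm inv) u

      to : ∀ {w} → w ∈ lvF F → w ∈ lvF F'
      to = ∈-resp-↭ (prm inv)

      from : ∀ {w} → w ∈ lvF F' → w ∈ lvF F
      from = ∈-resp-↭ (↭-sym (prm inv))

      inTree : ∀ {w} → w ∈ lvF F → w ∈ lv s₀ ++ lv t₀
      inTree = subst (_ ∈_) (List.++-identityʳ (lv s₀ ++ lv t₀))

      locˡ : ∀ {w} → w ∈ lvF F → ∃ λ t → F ≈ edge (lf w) t ∷ []
      locˡ i = case locateU s₀ t₀ (inTree i) of λ { (t , e) →
        t , ≈head e }

      locʳ : ∀ {w} → w ∈ lvF F' → ∃ λ t → ∃ λ R → F' ≈ edge (lf w) t ∷ R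
      locʳ i with locateF F' i
      ... | inj₁ (_ , e) = ⊥-elim (noOne e)
      ... | inj₂ x = x

      smaller : ∀ {a b} → suc a ≤ szF F → b ≤ szF F' → a + b ≤ N
      smaller p q = s≤s⁻¹ (≤-trans (+-mono-≤ p q) le)

      smaller' : ∀ {a b} → a ≤ szF F → suc b ≤ szF F' → a + b ≤ N
      smaller' {a} {b} p q = s≤s⁻¹ (≤-trans (≤-reflexive (sym (+-suc a b))) (≤-trans (+-mono-≤ p q) le))

      removal : ∀ {w} → w ∈ lvF F → (∀ {t R t' R' d} → F ≈ edge (lf w) t ∷ R → F' ≈ edge (lf w) t' ∷ R' → ACPS (unr t ∷ R) (unr t' ∷ R') d → ACPS F F' (suc d)) →
        Best 0 F F' (Single F w)
      removal i rule =
        case locˡ i of λ { (t , e) →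
        case locʳ (to i) of λ { (t' , R' , e') →
        best-single {0} {1} inv (pend e) (pend e') (s≤s (≤-reflexive (length-≈ e'))) (rule e e')
          (ih (unr t) (unr t' ∷ R') (smaller (pend-sz e) (≤-trans (n≤1+n _) (pend-sz e'))) (inv-rem inv (pend e) (pend e'))) }}

      removeˡ : ∀ {v w} → w ∈ lvF F → (∀ {t R} → F ≈ edge (lf w) t ∷ R → C2Step F F' v (cutF (lf w) t R) F') → Best 0 F F' (Single F w)
      removeˡ i allowed = removal i (λ e e' f → acps-c2 (allowed e) (acps-c3 ε (isol ε) (pend e') f))

      removeʳ : ∀ {v w} → w ∈ lvF F → (∀ {t R} → F' ≈ edge (lf w) t ∷ R → C2Step F' F v (cutF (lf w) t R) F) → Best 0 F F' (Single F w)
      removeʳ i allowed = removal i (λ e e' f → acps-sym (acps-c2 (allowed e') (acps-c3 ε (isol ε) (pend e) (acps-sym f))))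

      commonCherry : ∀ {x y} → Ch F x y → Ch F' x y → Best 0 F F' (λ _ → ⊤)
      commonCherry ch ch' =
        case locˡ (same-∈ (ch-same ch)) of λ { (t , e) →
        case locʳ (same-∈ (ch-same ch')) of λ { (t' , R' , e') →
        best-cherry inv e e' ch ch' (λ _ → tt) (ih (unr t) (unr t' ∷ R') (smaller (pend-sz e) (≤-trans (n≤1+n _) (pend-sz e'))) (inv-rem inv (pend e) (pend e'))) }}

      wholeTriple : ∀ {x y z t r R} → Conflict F F' x y z → T ~ edge (S₃ x y z) t → F' ≈ edge (lf x) (nd (lf z) r) ∷ R → y ∈ lv r → r ≢ lf y → Best 0 F F' (Block₃ F x y z)
      wholeTriple {x} {y} {z} {t} {r} {R} conf e e' y∈ ny =
        refine {P = λ col → Apart (S₃ x y z) t col × Block₃ F x y z col} (λ _ b → apart b , b) (best-cutˡ inv eF (acps-c2 (c2-a2-whole u conf eF))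
          (best-cherry inv₂ e₂ e' (_ , _ , e₂ , more) (partner-ch {y = y} (trio e' ny)) toPair
            (stateB (szF (edge (lf z) r ∷ R)) r R ≤-refl (smaller (≤-trans (s≤s (≤-trans (≤-reflexive (+-comm (szU (unr t)) 0)) (m≤n+m _ 3))) tsz) (≤-trans (n≤1+n _) (pend-sz e'))) inv₃ y∈ ny)))
        where
        eF : F ≈ edge (S₃ x y z) t ∷ []
        eF = ≈head e
        tsz : suc (3 + szU (unr t)) ≤ szF F
        tsz = ≤-trans (s≤s (s≤s (s≤s (s≤s (≤-trans (sz-unr t) (≤-trans (n≤1+n _) (≤-reflexive (sym (+-identityʳ _)))))))))
                (≤-reflexive (sym (szF-≈ eF)))
        uF = unique-↭ (lvF-≈ eF) u
        inv₂ : Inv (cutF (S₃ x y z) t []) F'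
        inv₂ = mkInv (subst Unique (sym (lvF-cut (S₃ x y z) t [])) uF) (↭-trans (↭-reflexive (lvF-cut (S₃ x y z) t [])) (↭-trans (lvF-≈ (≈sym eF)) (prm inv)))
        e₂ : cutF (S₃ x y z) t [] ≈ edge (lf x) (nd (lf z) (lf y)) ∷ unr t ∷ []
        e₂ = ≈head ~rot ◅◅ flipʳ
        inv₃ : Inv (pairF z y (unr t)) (edge (lf z) r ∷ R)
        inv₃ = inv-rem inv₂ (pend e₂) (pend e')
        apart : ∀ {col} → Block₃ F x y z col → Apart (S₃ x y z) t col
        apart {col} (f , g , b) {a} {c} a∈ c∈ h = bad (b (∈-resp-↭ (lvF-≈ (≈sym eF)) (∈-++⁺ˡ (∈-++⁺ʳ (lv (S₃ x y z)) c∈))) (Eq.trans (sym h) (colx a∈)))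
          where
          colx : ∀ {a} → a ∈ lv (S₃ x y z) → col a ≡ col x
          colx (here refl) = refl
          colx (there (here refl)) = sym f
          colx (there (there (here refl))) = sym g
          bad : c ≡ x ⊎ c ≡ y ⊎ c ≡ z → ⊥
          bad (inj₁ refl) = unique-head uF (there (there (∈-++⁺ˡ c∈)))
          bad (inj₂ (inj₁ refl)) = unique-head (unique-++ʳ (x ∷ []) uF) (there (∈-++⁺ˡ c∈))
          bad (inj₂ (inj₂ refl)) = unique-head (unique-++ʳ (x ∷ y ∷ []) uF) (∈-++⁺ˡ c∈)
        rs = rem-restr (unq inv₂) (pend e₂)
        toPair : ∀ {col} → Block₃ F x y z col → Block₂ (pairF z y (unr t)) z y col
        toPair {col} (f , g , b) = Eq.trans (sym g) f , λ {a} i h → fin i (b (∈-resp-↭ (lvF-≈ (≈sym eF)) (subst (a ∈_) (lvF-cut (S₃ x y z) t []) (lv⊆ rs i))) (Eq.trans h (sym g)))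
          where
          fin : ∀ {a} → a ∈ lvF (pairF z y (unr t)) → a ≡ x ⊎ a ≡ y ⊎ a ≡ z → a ≡ z ⊎ a ≡ y
          fin i (inj₁ refl) = ⊥-elim (unique-head (unique-↭ (rem-lv (pend e₂)) (unq inv₂)) i)
          fin i (inj₂ (inj₁ h)) = inj₂ h
          fin i (inj₂ (inj₂ h)) = inj₁ h

      pairBlock : ∀ {x y z p q t tp R} → Conflict F F' x y z → T ~ edge (S₄ x y p q) t → F' ≈ edge (lf p) tp ∷ R → q ∈ lv tp → tp ≢ lf q → Best 0 F F' (Block₂ F p q)
      pairBlock {x} {y} {z} {p} {q} {t} {tp} {R} conf e e' q∈ nq =
        refine {P = λ col → Apart (nd (lf p) (lf q)) t' col × Block₂ F p q col} (λ _ b → apart b , b) (best-cutˡ inv e₂ (acps-c2 (c2-a3-pair u conf (≈head e) e₂))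
          (refine (λ _ → toPair) (best-≈ʳ inv₂ e' (stateB (szF (edge (lf p) tp ∷ R)) tp R ≤-refl
            (smaller tsz (≤-reflexive (sym (szF-≈ e')))) (inv-≈ʳ inv₂ e') q∈ nq))))
        where
        t' : Tr
        t' = nd (nd (lf x) (lf y)) t
        e₂ : F ≈ edge (nd (lf p) (lf q)) t' ∷ []
        e₂ = ≈head (e ◅◅ ~flip ◅◅ ~rot)
        tsz : suc (szF (unr t' ∷ [])) ≤ szF F
        tsz = ≤-trans (s≤s (+-monoˡ-≤ 0 (≤-trans (sz-unr t') (m≤n+m (sz t') (sz (nd (lf p) (lf q))))))) (≤-reflexive (sym (szF-≈ e₂)))
        uF = unique-↭ (lvF-≈ e₂) u
        back : ∀ {w} → w ∈ lvF (edge (nd (lf p) (lf q)) t' ∷ []) → w ∈ lvF F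
        back = ∈-resp-↭ (lvF-≈ (≈sym e₂))
        inv₂ : Inv (pairF p q (unr t')) F'
        inv₂ = mkInv (subst Unique (sym (lvF-cut (nd (lf p) (lf q)) t' [])) uF) (↭-trans (↭-reflexive (lvF-cut (nd (lf p) (lf q)) t' [])) (↭-trans (lvF-≈ (≈sym e₂)) (prm inv)))
        apart : ∀ {col} → Block₂ F p q col → Apart (nd (lf p) (lf q)) t' col
        apart {col} (f , b) {a} {c} a∈ c∈ h = bad (b (back (∈-++⁺ˡ (there (there c∈)))) (Eq.trans (sym h) (colp a∈)))
          where
          colp : ∀ {a} → a ∈ p ∷ q ∷ [] → col a ≡ col p
          colp (here refl) = refl
          colp (there (here refl)) = sym f
          bad : c ≡ p ⊎ c ≡ q → ⊥
          bad (inj₁ refl) = unique-head uF (there (∈-++⁺ˡ c∈))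
          bad (inj₂ refl) = unique-head (unique-++ʳ (p ∷ []) uF) (∈-++⁺ˡ c∈)
        toPair : ∀ {col} → Block₂ F p q col → Block₂ (pairF p q (unr t')) p q col
        toPair (f , b) = f , λ {a} i h → b (back (subst (a ∈_) (lvF-cut (nd (lf p) (lf q)) t' []) i)) h

      clashing : ∀ {x y z} → Deep T x y → z ≢ y → Partner F' x y z → Best 0 F F' (λ _ → ⊤)
      clashing {x} {y} {z} D zy pt = byDeep D
        where
        ch = deep-ch D
        ch' = partner-ch pt
        conf : Conflict F F' x y z
        conf = ch , ch' , zy
        x∈ : x ∈ lvF F
        x∈ = same-∈ (ch-same ch)
        y∈ : y ∈ lvF F
        y∈ = same-∈ (same-sym (ch-same ch))
        z∈ : z ∈ lvF F
        z∈ = from (same-∈ (same-sym (ch-same ch')))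
        zx : z ≢ x
        zx = ch-≢ u' ch' ∘ sym
        Bx = removeˡ x∈ (c2-a1 conf (inj₁ refl))
        By = removeˡ y∈ (c2-a1 conf (inj₂ refl))
        Bz = removeʳ z∈ (c2-a1 {F = F'} {F' = F} (ch' , ch , zy ∘ sym) (inj₂ refl))
        with₃ : Best 0 F F' (Block₃ F x y z) → Best 0 F F' (λ _ → ⊤)
        with₃ b = refine (λ a _ → conflict-total inv conf a) (Bx orBest By orBest Bz orBest b)
        impossible : (∀ {col} → AF F F' col → Block₃ F x y z col → ⊥) → Best 0 F F' (Block₃ F x y z)
        impossible f = refine (λ a b → ⊥-elim (f a b)) Bx
        apart-xy : ¬ Same F' x y → Best 0 F F' (Block₃ F x y z)
        apart-xy n = impossible (λ a b → n (blk (okʳ a) (to x∈) (to y∈) (proj₁ b)))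
        triple : ∀ {t} → T ~ edge (S₃ x y z) t → Partner F' x y z → Best 0 F F' (Block₃ F x y z)
        triple e (pair e') = apart-xy (λ k → out (same-head (unique-↭ (lvF-≈ e') u') (here refl) (same-≈ e' k)))
          where
          out : y ∈ x ∷ z ∷ [] → ⊥
          out (here g) = ch-≢ u ch (sym g)
          out (there (here g)) = zy (sym g)
        triple e (trio {r} e' ny) with y ∈? lv r
        ... | yes i = wholeTriple conf e e' i ny
        ... | no n = apart-xy (λ k → out (same-head (unique-↭ (lvF-≈ e') u') (here refl) (same-≈ e' k)))
          where
          out : y ∈ x ∷ z ∷ lv r → ⊥
          out (here g) = ch-≢ u ch (sym g)
          out (there (here g)) = zy (sym g)
          out (there (there i)) = n i
        byDeep : Deep T x y → Best 0 F F' (λ _ → ⊤)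
        byDeep (two e) = ⊥-elim (out (∈-resp-↭ (lvF-≈ (≈head {F = []} e)) z∈))
          where
          out : z ∈ x ∷ y ∷ [] → ⊥
          out (here g) = zx g
          out (there (here g)) = zy g
        byDeep (three p e) = commonCherry (_ , _ , ≈head (third (∈-resp-↭ (lvF-≈ (≈head {F = []} e)) z∈)) , more) ch'
          where
          third : z ∈ x ∷ y ∷ p ∷ [] → T ~ edge (lf x) (nd (lf z) (lf y))
          third (here g) = ⊥-elim (zx g)
          third (there (here g)) = ⊥-elim (zy g)
          third (there (there (here refl))) = e ◅◅ rot ◅ swp ◅ flip ◅ swp ◅ ε
        byDeep (deep₃ p t e) with z ≟ p
        ... | yes refl = with₃ (triple e pt)
        ... | no zp = with₃ (refine {P = Single F p} (λ a b {c} → single-p inv e z∈ zx zy zp a b {c}) (removeˡ p∈ (c2-a2-leaf u conf (≈head e))))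
          where
          p∈ : p ∈ lvF F
          p∈ = ∈-resp-↭ (lvF-≈ (≈sym (≈head {F = []} e))) (there (there (here refl)))
        byDeep (deep₄ p q t e) = byPQ (locʳ (to p∈))
          where
          p∈ : p ∈ lvF F
          p∈ = ∈-resp-↭ (lvF-≈ (≈sym (≈head {F = []} e))) (there (there (here refl)))
          q∈ : q ∈ lvF F
          q∈ = ∈-resp-↭ (lvF-≈ (≈sym (≈head {F = []} e))) (there (there (there (here refl))))
          Bp = removeˡ p∈ (c2-a3-leaf u conf (≈head e) (inj₁ refl))
          Bq = removeˡ q∈ (c2-a3-leaf u conf (≈head e) (inj₂ refl))
          chpq : Ch F p q
          chpq = _ , _ , ≈head (e ◅◅ ~flip ◅◅ ~rot ◅◅ ~rot) , more
          with₂ : Best 0 F F' (Block₂ F p q) → Best 0 F F' (λ _ → ⊤)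
          with₂ b = with₃ (refine (deep₄-total inv e z∈ zx zy) (Bp orBest Bq orBest b))
          byPQ : (∃ λ tp → ∃ λ R → F' ≈ edge (lf p) tp ∷ R) → Best 0 F F' (λ _ → ⊤)
          byPQ (tp , R , e') with q ∈? lv tp
          byPQ (tp , R , e') | no n = with₂ (refine (λ a b → ⊥-elim (out (same-head (unique-↭ (lvF-≈ e') u') (here refl) (same-≈ e' (blk (okʳ a) (to p∈) (to q∈) (proj₁ b)))))) Bp)
            where
            out : q ∈ p ∷ lv tp → ⊥
            out (here g) = ch-≢ u chpq (sym g)
            out (there i) = n i
          byPQ (lf w , R , e') | yes (here refl) = commonCherry chpq (_ , _ , e' , two)
          byPQ (nd c d , R , e') | yes i = with₂ (pairBlock conf e e' i λ ())

      separate : ∀ {x y} → Ch F x y → NoCh F' x → NoCh F' y → ¬ Same F' x y → Best 0 F F' (λ _ → ⊤)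
      separate {x} {y} ch nx ny n = refine (λ a _ → cherry-single u ch (okˡ a) (λ f → n (blk (okʳ a) (to x∈) (to y∈) f)))
        (removeˡ x∈ (c2-c ch (to x∈) (to y∈) n noOne nx ny (inj₁ refl)) orBest removeˡ y∈ (c2-c ch (to x∈) (to y∈) n noOne nx ny (inj₂ refl)))
        where
        x∈ = same-∈ (ch-same ch)
        y∈ = same-∈ (same-sym (ch-same ch))

      cutThird : ∀ {x y B r R} → Ch F x y → NoCh F' x → NoCh F' y → Same F' x y → F' ≈ edge B (nd (lf x) r) ∷ R → y ∈ lv r →
        Best 0 F F' (Apart B (nd (lf x) r))
      cutThird {x} {y} {B} {r} {R} ch nx ny k e i = refine {P = λ col → Apart B (nd (lf x) r) col × ⊤} (λ _ q → q , tt) (best-cutʳ inv e (acps-c2 (c2-b2 ch k nx ny e i))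
        (ih T (cutF B (nd (lf x) r) R) (smaller' ≤-refl (cut-sz e)) (inv-cutʳ inv e)))

      together : ∀ {x y p q t₂ R} → Ch F x y → NoCh F' x → NoCh F' y → F' ≈ edge (lf x) (nd (nd p q) t₂) ∷ R → y ∈ lv (nd p q) → Best 0 F F' (λ _ → ⊤)
      together {x} {y} {p} {q} {t₂} {R} ch nx ny e y∈t = go (locate-pendant p q (nd (lf x) t₂) y∈t)
        where
        t₁ = nd p q
        x∈ = same-∈ (ch-same ch)
        y∈ = same-∈ (same-sym (ch-same ch))
        xy : Same F' x y
        xy = same-≈ (≈sym e) (here (here refl , there (∈-++⁺ˡ y∈t)))
        e₁ : F' ≈ edge (nd (lf x) t₂) t₁ ∷ R
        e₁ = e ◅◅ flipʳ ◅◅ ≈head ~rot⁻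
        e₂ : F' ≈ edge t₂ (nd (lf x) t₁) ∷ R
        e₂ = e₁ ◅◅ ≈head (~flip ◅◅ ~rot)
        go : (∃ λ v → ∃ λ w → edge t₁ (nd (lf x) t₂) ~ edge (nd (lf y) v) w × (∀ {a} → a ∈ lv v → a ∈ lv t₁) × (∀ {a} → a ∈ x ∷ lv t₂ → a ∈ lv w)) → Best 0 F F' (λ _ → ⊤)
        go (v , w , f , sub , sup) = refine total (removeˡ x∈ (c2-b1 ch xy nx ny (inj₁ refl)) orBest removeˡ y∈ (c2-b1 ch xy nx ny (inj₂ refl))
            orBest cutThird ch nx ny xy e₂ y∈t orBest cutThird (ch-sym ch) ny nx (same-sym xy) g₂ (sup (here refl)))
          where
          g₁ : F' ≈ edge (nd (lf y) v) w ∷ R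
          g₁ = e₁ ◅◅ ≈head (swp ◅ f)
          g₂ : F' ≈ edge v (nd (lf y) w) ∷ R
          g₂ = g₁ ◅◅ ≈head (~flip ◅◅ ~rot)
          total : ∀ {col} → AF F F' col → ⊤ → Single F x col ⊎ Single F y col ⊎ Apart t₂ (nd (lf x) t₁) col ⊎ Apart v (nd (lf y) w) col
          total {col} a _ with col x ℕ.≟ col y
          ... | no n = Sum.map id inj₁ (cherry-single u ch (okˡ a) n)
          ... | yes h with crossing? t₂ (nd (lf x) t₁) col | crossing? v (nd (lf y) w) col
          ...   | inj₂ n | _ = inj₂ (inj₂ (inj₁ n))
          ...   | inj₁ _ | inj₂ n = inj₂ (inj₂ (inj₂ n))
          ...   | inj₁ (c , c' , c∈ , c'∈ , ce) | inj₁ (d , d' , d∈ , d'∈ , de) =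
              ⊥-elim (sepF-compat u (sepF-flipˡ (sepF-flipʳ (ch-sep u ch (all c∈F) (all d∈F) cx cy dx dy)))
                (agr' a (sym dy') (sym h) (Eq.trans (sym h) (sym cx')) quartet))
            where
            cx' : col c ≡ col x
            cx' = pendant-colour u' e₁ y∈t (okʳ a) h c∈ c'∈ ce
            dy' : col d ≡ col y
            dy' = pendant-colour u' g₁ (sup (here refl)) (okʳ a) (sym h) d∈ d'∈ de
            ug = unique-↭ (lvF-≈ g₁) u'
            quartet : SepF F' y d x c
            quartet = sepF-≈ (≈sym g₁) ug (sep-root ug (here refl) (there d∈) (sup (here refl)) (sup (there c∈)))
            c∈F : c ∈ lvF F
            c∈F = from (proj₂ (proj₂ (sepF-∈ quartet)))
            d∈F : d ∈ lvF F
            d∈F = from (proj₂ (proj₁ (sepF-∈ quartet)))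
            all : ∀ {b} → b ∈ lvF F → Same F x b
            all i = here (inTree x∈ , inTree i)
            ue = unique-↭ (lvF-≈ e₁) u'
            cx : c ≢ x
            cx refl = unique-head ue (∈-++⁺ˡ (∈-++⁺ˡ c∈))
            cy : c ≢ y
            cy refl = unique-disjoint (x ∷ lv t₂) (unique-++ˡ (x ∷ lv t₂ ++ lv t₁) ue) (there c∈) y∈t
            dx : d ≢ x
            dx refl = unique-disjoint (x ∷ lv t₂) (unique-++ˡ (x ∷ lv t₂ ++ lv t₁) ue) (here refl) (sub d∈)
            dy : d ≢ y
            dy refl = unique-head ug (∈-++⁺ˡ (∈-++⁺ˡ d∈))

      free-both : ∀ {x y a b c d R} → Ch F x y → F' ≈ edge (lf x) (nd (nd a b) (nd c d)) ∷ R → NoCh F' y → Best 0 F F' (λ _ → ⊤)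
      free-both {x} {y} {a} {b} {c} {d} {R} ch e ny with y ∈? (lv (nd a b) ++ lv (nd c d))
      ... | no n = separate ch (no-cherry u' e) ny (λ k → out (same-head (unique-↭ (lvF-≈ e) u') (here refl) (same-≈ e k)))
        where
        out : y ∈ x ∷ lv (nd a b) ++ lv (nd c d) → ⊥
        out (here g) = ch-≢ u ch (sym g)
        out (there i) = n i
      ... | yes i with ∈-++⁻ (lv (nd a b)) i
      ...   | inj₁ j = together ch (no-cherry u' e) ny e j
      ...   | inj₂ j = together ch (no-cherry u' e) ny (e ◅◅ flipʳ) j

      search-tree : Best 0 F F' (λ _ → ⊤)
      search-tree = case deepU s₀ t₀ of λ { (x , y , D) →
        byX D }
        where
        byY : ∀ {x y a b c d R} → Deep T x y → F' ≈ edge (lf x) (nd (nd a b) (nd c d)) ∷ R → Shape F' y x → Best 0 F F' (λ _ → ⊤)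
        byY D e (common ch') = commonCherry (deep-ch (deep-flip D)) ch'
        byY D e (clash z n pt) = clashing (deep-flip D) n pt
        byY D e (free e') = free-both (deep-ch D) e (no-cherry u' e')
        byX' : ∀ {x y} → Deep T x y → Shape F' x y → Best 0 F F' (λ _ → ⊤)
        byX' D (common ch') = commonCherry (deep-ch D) ch'
        byX' D (clash z n pt) = clashing D n pt
        byX' {x} D (free e) = case locʳ (to (same-∈ (same-sym (ch-same (deep-ch D))))) of λ { (t , R , e') →
          byY D e (shape x t e') }
        byX : ∀ {x y} → Deep T x y → Best 0 F F' (λ _ → ⊤)
        byX {x} {y} D = case locʳ (to (same-∈ (ch-same (deep-ch D)))) of λ { (t , R , e') →
          byX' D (shape y t e') }

    data IsEdge : Ut → Set where
      isEdge : ∀ {s t} → IsEdge (edge s t)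

    isEdge-~ : ∀ {U V} → U ⟶ V → IsEdge V
    isEdge-~ rot  = isEdge
    isEdge-~ swp  = isEdge
    isEdge-~ flip = isEdge

    allEdges-≈ : ∀ {F F'} → F ≈ F' → All IsEdge F → All IsEdge F'
    allEdges-≈ ε q = q
    allEdges-≈ (tree r ◅ p) (_ ∷ q) = allEdges-≈ p (isEdge-~ r ∷ q)
    allEdges-≈ (perm r ◅ p) q = allEdges-≈ p (All-resp-↭ r q)

    find-isolated : ∀ F → (∃ λ w → ∃ λ R → F ↭ one w ∷ R) ⊎ All IsEdge F
    find-isolated [] = inj₂ []
    find-isolated (one w ∷ F) = inj₁ (w , F , ↭-refl)
    find-isolated (edge s t ∷ F) with find-isolated F
    ... | inj₁ (w , R , p) = inj₁ (w , edge s t ∷ R , ↭-trans (prep _ p) (swap _ _ ↭-refl))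
    ... | inj₂ q = inj₂ (isEdge ∷ q)

    single-forest : ∀ {x} F → Unique (lvF F) → lvF F ≡ x ∷ [] → F ≡ one x ∷ []
    single-forest (one y ∷ []) u refl = refl
    single-forest (one y ∷ U ∷ F) u e with () ← subst (_ ∈_) (List.∷-injectiveʳ e) (∈-++⁺ˡ {ys = lvF F} (proj₂ (lvU-nonempty U)))
    single-forest {x} (edge s t ∷ F) u e = ⊥-elim (unique-disjoint (lv s) (unique-++ˡ (lv s ++ lv t) u) (proj₂ a)
        (subst (_∈ lv t) (Eq.trans (only (∈-++⁺ˡ (∈-++⁺ʳ (lv s) (proj₂ b)))) (sym (only (∈-++⁺ˡ (∈-++⁺ˡ (proj₂ a)))))) (proj₂ b)))
      where
      a = lv-nonempty s
      b = lv-nonempty t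
      only : ∀ {c} → c ∈ lvF (edge s t ∷ F) → c ≡ x
      only i with subst (_ ∈_) e i
      ... | here f = f

    solve : ∀ n T F' → szF (T ∷ []) + szF F' ≤ n → Inv (T ∷ []) F' → Best 0 (T ∷ []) F' (λ _ → ⊤)
    solve n (one x) F' le (mkInv u p) with single-forest F' (unique-↭ p u) (↭-singleton-inv (↭-sym p))
    ... | refl = best 0 acps-last (λ _ c _ → nonempty (c (here refl)))
      where
      nonempty : ∀ {k} {C : List ℕ} → k ∈ C → 1 ≤ length C
      nonempty (here _)  = s≤s z≤n
      nonempty (there _) = s≤s z≤n
    solve (suc n) (edge s t) F' le inv with find-isolated F'
    ... | inj₂ q = StateA.search-tree n (solve n) s t F' le inv (λ e → absurd (allEdges-≈ e q))
      where
      absurd : ∀ {z R} → ¬ All IsEdge (one z ∷ R)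
      absurd (() ∷ _)
    ... | inj₁ (w , R , p) = refine {P = Single F w} (λ a _ {b} → alone a {b})
        (best-single {0} {0} inv (pend eF) (isol e') (≤-reflexive (↭-length p)) (λ f → acps-sym (acps-c3 e' (isol e') (pend eF) (acps-sym f)))
          (solve n (unr t') R (s≤s⁻¹ (≤-trans (+-mono-≤ (pend-sz eF) (≤-reflexive (sym (szF-≈ e')))) le)) (inv-rem inv (pend eF) (isol e'))))
      where
      F = edge s t ∷ []
      e' : F' ≈ one w ∷ R
      e' = ≈perm p
      w∈ : w ∈ lvF F
      w∈ = ∈-resp-↭ (↭-sym (prm inv)) (∈-resp-↭ (lvF-≈ (≈sym e')) (here refl))
      at = locateU s t (subst (w ∈_) (List.++-identityʳ (lv s ++ lv t)) w∈)
      t' = proj₁ at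
      eF : F ≈ edge (lf w) t' ∷ []
      eF = ≈head (proj₂ at)
      u' = unique-↭ (prm inv) (unq inv)
      alone : ∀ {col} → AF F F' col → Single F w col
      alone a {b} i f with same-head (unique-↭ (lvF-≈ e') u') (here refl) (same-≈ e' (blk (okʳ a) (∈-resp-↭ (prm inv) w∈) (∈-resp-↭ (prm inv) i) (sym f)))
      ... | here g = g

    connected-single : ∀ {F G} → Rep F G → (∀ u v → u ∈ verts G → v ∈ verts G → Conn G u v) → F ≢ [] → ∃ λ U → F ≡ U ∷ []
    connected-single {[]} r c n = ⊥-elim (n refl)
    connected-single {U ∷ []} r c n = U , refl
    connected-single {U ∷ V ∷ F} r c n =
      case lvU-nonempty U of λ { (x , i) →
      case lvU-nonempty V of λ { (y , j) →
      let u = rep-unique r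
          k : y ∈ lvF (V ∷ F)
          k = ∈-++⁺ˡ j
      in ⊥-elim (unique-disjoint (lvU U) u (same-head u i (conn-view r (c _ _ (lv-verts r (∈-++⁺ˡ i)) (lv-verts r (∈-++⁺ʳ (lvU U) k))))) k) }}

    Answer : Ut → Graph A → Graph A → ℕ → Set
    Answer U T T' d = IsTBRDist T T' d × (∃ λ σ → CPS T T' σ d) × (∀ σ w → CPS T T' σ w → d ≤ w × length (lvF (U ∷ [])) ≤ length σ)

    module _ {U U' : Ut} {T T' : Graph A} (r : Rep (U ∷ []) T) (r' : Rep (U' ∷ []) T') (p : lvF (U ∷ []) ↭ lvF (U' ∷ [])) where

      af-tbrseq : ∀ {d} → AFBound U U' d → ∃ λ m → TBRSeq T T' m × m ≤ d
      af-tbrseq (col , C , x , c , le) = realise (af-tbrs (rep-unique r) p x (λ i → c (∈-resp-↭ (↭-sym p) i)))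
        where
        realise : (∃ λ m → TBRs U U' m × suc m ≤ length C) → ∃ λ m → TBRSeq T T' m × m ≤ _
        realise (m , tb , le') = m , tbrs-make tb r r' , s≤s⁻¹ (≤-trans le' le)

      conclude : ∀ {d σ} → CPS T T' σ d → (∀ {m} → AFBound U U' m → d ≤ m) → (∃ λ m → TBRSeq T T' m × m ≤ d) → Answer U T T' d
      conclude {d} k below (m , tbr , le) =
        (subst (TBRSeq T T') (≤-antisym le (below (tbr-bound tbr r r' p))) tbr , λ j q → below (tbr-bound q r r' p)) , (_ , k) ,
        λ σ' w q → below (proj₁ (cps-bound q r r' p)) , proj₂ (cps-bound q r r' p)

      answer : Best 0 (U ∷ []) (U' ∷ []) (λ _ → ⊤) → ∃ (Answer U T T')
      answer (best d f b) = d , conclude (proj₂ (f r r')) below (af-tbrseq (proj₁ (cps-bound (proj₂ (f r r')) r r' p)))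
        where
        below : ∀ {m} → AFBound U U' m → d ≤ m
        below (col , C , x , c , le) = s≤s⁻¹ (≤-trans (≤-reflexive (+-comm 1 d)) (≤-trans (b x c tt) le))

      combine : ∃ (Answer U T T')
      combine = answer (solve _ U (U' ∷ []) ≤-refl (mkInv (rep-unique r) p))

    module _ (X : List A) (Ls : List L) (uL : Unique Ls) (index-of : ∀ {a} → a ∈ X → ∃ λ i → ι i ≡ a) (ι∈ : ∀ i → ι i ∈ X) (all∈ : ∀ i → i ∈ Ls) (i₀ : L) where

      rep-tree : ∀ {G} → PhyloTreeOn X G → ∃ λ U → Rep (U ∷ []) G
      rep-tree {G} ((ph , on) , c) = single-tree (connected-single r c nonempty) r
        where
        rep = rep-exists ph (λ a i → index-of (proj₁ (on a) i))
        F = proj₁ rep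
        r : Rep F G
        r = proj₂ rep
        none : ∀ {F i} → F ≡ [] → ¬ (i ∈ lvF F)
        none refl ()
        nonempty : F ≢ []
        nonempty e = none e (verts-lv r (proj₂ (on _) (ι∈ i₀)))
        single-tree : ∀ {F} → (∃ λ U → F ≡ U ∷ []) → Rep F G → ∃ λ U → Rep (U ∷ []) G
        single-tree (U , refl) r = U , r

      leaves : ∀ {U G} → PhyloTreeOn X G → Rep (U ∷ []) G → lvF (U ∷ []) ↭ Ls
      leaves ((_ , on) , _) r = unique-set (rep-unique r) uL (λ _ → all∈ _) (λ {i} _ → verts-lv r (proj₂ (on _) (ι∈ i)))

      tbr-distance : ∀ {T T'} → length X ≡ length Ls → PhyloTreeOn X T → PhyloTreeOn X T' → Σ ℕ (λ d → IsTBRDist T T' d × IsMinCPSWeight X T T' d)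
      tbr-distance {T} {T'} size tT tT' = finish (rep-tree tT) (rep-tree tT')
        where
        finish : (∃ λ U → Rep (U ∷ []) T) → (∃ λ U' → Rep (U' ∷ []) T') → Σ ℕ (λ d → IsTBRDist T T' d × IsMinCPSWeight X T T' d)
        finish (U , r) (U' , r') = package (combine r r' (↭-trans p (↭-sym (leaves tT' r'))))
          where
          p = leaves tT r
          package : ∃ (Answer U T T') → Σ ℕ (λ d → IsTBRDist T T' d × IsMinCPSWeight X T T' d)
          package (d , dist , (σ , k) , min) =
            d , dist , (σ , k , ≤-trans (≤-reflexive (Eq.trans size (sym (↭-length p)))) (proj₂ (min σ d k))) , λ σ' w q → proj₁ (min σ' w (proj₁ q))

lookup-injective : {A : Set} (X : List A) → Unique X → ∀ {i j} → lookup X i ≡ lookup X j → i ≡ j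
lookup-injective (x ∷ X) u {Fin.zero} {Fin.zero} e = refl
lookup-injective (x ∷ X) u {Fin.zero} {Fin.suc j} e = ⊥-elim (unique-head u (subst (_∈ X) (sym e) (∈-lookup j)))
lookup-injective (x ∷ X) u {Fin.suc i} {Fin.zero} e = ⊥-elim (unique-head u (subst (_∈ X) e (∈-lookup i)))
lookup-injective (x ∷ X) (_ ∷ u) {Fin.suc i} {Fin.suc j} e = cong Fin.suc (lookup-injective X u e)

theorem4p2 : {A : Set} (X : List A) → Unique X → X ≢ [] →
    (T T' : Graph A) → PhyloTreeOn X T → PhyloTreeOn X T' →
    Σ ℕ (λ d → IsTBRDist T T' d × IsMinCPSWeight X T T' d)
theorem4p2 [] uX X≢ = ⊥-elim (X≢ refl)
theorem4p2 X@(_ ∷ _) uX _ T T' =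
  Forests.Realise.tbr-distance Fin._≟_ (lookup X) (lookup-injective X uX) X (allFin (length X)) (Unique.allFin⁺ (length X))
    (λ i → Any.index i , sym (lookup-index i)) ∈-lookup ∈-allFin Fin.zero (sym (List.length-tabulate id))
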